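{- Let $G$ be an arbitrary (not necessarily finite index) subgroup of $\Gamma=\mathrm{PSL}_2(\mathbb{Z})$, let $Y'$ be a tree obtained by cutting $Y_{\mathrm{comb}}(G)$ at some of its vertices of valency 2, and let $\jmath:Y'\to\mathbf{T}$ be a lift of $Y'$. Let $P$ be the corresponding polygon, $\sigma$ the corresponding involution on the set of edges of $P$, and $g_s\in G$ ($s$ an edge of $P$) the corresponding elements, all as defined in the context. 1. The couple $(P,\sigma)$ is a special polygon. 2. Let $S$ be a subset of the set of edges of $P$ which intersects every $\sigma$-orbit exactly once. Then $\{g_s\mid s\in S\}$ is an independent set of generators of $G$.
   Context: **Graphs.** $\mathbb{H}$ is the hyperbolic upper half-plane with the action of $\Gamma=\mathrm{PSL}_2(\mathbb{Z})$. Put $\rho=e^{\pi i/3}$ and let $\triangle\subset\mathbb{H}$ be the (closed) hyperbolic triangle with vertices $\rho,0,\infty$. Let $G_0,G_1\subset\Gamma$ be the subgroups of order 2 and 3 generated by the classes of $\left(\begin{smallmatrix}0&-1\\1&0\end{smallmatrix}\right)$ and $\left(\begin{smallmatrix}0&1\\-1&1\end{smallmatrix}\right)$ (fixing $i$ and $\rho$ respectively). The graph $Y_{\mathrm{comb}}(G)$ (multiple edges allowed) has vertex set $(G\backslash\Gamma/G_0)\sqcup(G\backslash\Gamma/G_1)$ (vertices of type (0), of valency 1 or 2, and of type (1), of valency 1 or 3) and edge set $G\backslash\Gamma$; an edge $x\in G\backslash\Gamma$ joins the $G_0$-orbit of $x$ with the $G_1$-orbit of $x$. $\mathbf{T}=Y_{\mathrm{comb}}(\{\mathrm{Id}\})$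 is a tree with edge set $\Gamma$, on which $\Gamma$ acts on the left, and $G\backslash\mathbf{T}=Y_{\mathrm{comb}}(G)$. Cutting at a vertex of valency 2 means replacing it by two univalent vertices, each incident to one of the two edges. A lift $\jmath:Y'\to\mathbf{T}$ is a map of graphs whose composite with $\mathbf{T}\to Y_{\mathrm{comb}}(G)$ is the natural map $Y'\to Y_{\mathrm{comb}}(G)$; we identify $Y'$ with $\jmath(Y')$, so that edges of $Y'$ are elements of $\Gamma$. **The polygon.** $P=\bigcup_g g\cdot\triangle$ over all edges $g\in\Gamma$ of $\jmath(Y')$; it is a convex hyperbolic polygon and a fundamental domain for $G$. The edges of $P$ are obtained from the univalent vertices $V$ of $Y'$ as follows; let $g\in\Gamma$ be the edge of $\jmath(Y')$ incident to $V$. - If $V$ is of type (0) and arises from cutting a bivalent vertex of $Y_{\mathrm{comb}}(G)$, then $V$ gives one edge $g\cdot(0,\infty)$ of $P$. - If $V$ is of type (0) and comes from a univalent vertex of $Y_{\mathrm{comb}}(G)$, then $V$ gives two edges $g\cdot[i,0)$ and $g\cdot[i,\infty)$ of $P$. - If $V$ is of type (1), then $V$ gives two edges $g\cdot[\rho,0)$ and $g\cdot[\rho,\infty)$ of $P$. (Intervals are geodesic.) **The involution $\sigma$ and elements $g_s$.** - If $s$ corresponds to a vertex $V$ obtained by cutting a bivalent vertex $W$, and $\bar s$ is the edge corresponding to the other vertex $\bar V$ obtained from $W$, then $\sigma(s)=\bar s$, $\sigma(\bar s)=s$, and $g_s\in\Gamma$ is the unique element taking $s$ to $\bar s$ and reversing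 the orientations of $s,\bar s$ induced from $P$. - If $s',s''$ correspond to a univalent vertex of type (0) coming from a univalent vertex of $Y_{\mathrm{comb}}(G)$, then $\sigma(s')=s''$, $\sigma(s'')=s'$, and $g_{s'}=g_{s''}$ is the unique element of $\Gamma$ that swaps $s'$ and $s''$. - If $s',s''$ correspond to a univalent vertex of type (1), then $\sigma(s')=s''$, $\sigma(s'')=s'$; $g_{s'}$ is the unique element of $\Gamma$ taking $s'$ to $s''$, and $g_{s''}=g_{s'}^{ -1}$. In all cases $g_s\in G$ and $g_s$ takes $s$ to $\sigma(s)$. **Special polygon.** A special polygon is a convex hyperbolic polygon $P\subset\mathbb{H}$ (possibly with infinitely many edges) with an involution $\sigma$ on the set of its edges such that: 1. every edge is a $\Gamma$-copy of the geodesic interval joining $\infty$ with $0$, $i$ or $\rho$; 2. every edge which is a $\Gamma$-copy of $(0,\infty)$ is paired under $\sigma$ with another such edge; 3. every edge $s$ which is a $\Gamma$-copy of $[i,\infty)$ is adjacent to another such edge $s'$, $\sigma$ interchanges $s$ and $s'$, and the angle between them is $\pi$; 4. every edge $s$ which is a $\Gamma$-copy of $[\rho,\infty)$ is adjacent to another such edge $s'$, $\sigma$ interchanges $s$ and $s'$, and the internal angle between them is $2\pi/3$. **Independent generators.** A (possibly infinite) subset of a group $H$ is an independent set of generators if $H$ is the free product of the cyclic subgroups generated by the elements of the subset. -}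

module Defs where

open import Level using (0ℓ; suc)
open import Algebra.Bundles using (Group; CommutativeRing)
open import Data.Empty using (⊥)
open import Data.Integer.Base as ℤ using (ℤ; +_; -[1+_]; 0ℤ; 1ℤ)
open import Data.Integer.Tactic.RingSolver using (solve-∀)
open import Data.List.Base using (List; []; _∷_; _++_; foldr)
open import Data.List.Relation.Unary.Any using (Any)
open import Data.List.Relation.Unary.Linked using (Linked)
import Data.Nat.Base as ℕ
open import Data.Product.Base using (Σ; ∃; ∃₂; _×_; _,_; proj₁; proj₂)
open import Data.Sum.Base using (_⊎_; inj₁; inj₂; [_,_]′)
open import Function.Bundles using (Func; _⇔_)
open import Relation.Binary.Bundles using (Setoid)
open import Relation.Binary.Construct.Closure.Equivalence using (EqClosure)
open import Relation.Binary.Core using (Rel)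
open import Relation.Binary.PropositionalEquality.Core as ≡ using (_≡_; refl; cong₂)
open import Relation.Binary.Structures using (IsTotalOrder)
open import Relation.Nullary.Negation.Core using (¬_)
open import Relation.Unary using (Pred; _⊆_; _≐_)
import Algebra.Definitions.RawMonoid as Multiples
import Algebra.Properties.Group as GroupProperties
import Relation.Binary.Reasoning.Setoid as SetoidReasoning

record Mat : Set where
  constructor mat
  field a b c d : ℤ

det : Mat → ℤ
det (mat a b c d) = a ℤ.* d ℤ.- b ℤ.* c

mul : Mat → Mat → Mat
mul (mat a b c d) (mat a′ b′ c′ d′) =
  mat (a ℤ.* a′ ℤ.+ b ℤ.* c′) (a ℤ.* b′ ℤ.+ b ℤ.* d′)
      (c ℤ.* a′ ℤ.+ d ℤ.* c′) (c ℤ.* b′ ℤ.+ d ℤ.* d′)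

adj : Mat → Mat
adj (mat a b c d) = mat d (ℤ.- b) (ℤ.- c) a

neg : Mat → Mat
neg (mat a b c d) = mat (ℤ.- a) (ℤ.- b) (ℤ.- c) (ℤ.- d)

scalar : ℤ → Mat
scalar x = mat x 0ℤ 0ℤ x

private
  abstract
    mat-cong : ∀ {a b c d a′ b′ c′ d′} →
               a ≡ a′ → b ≡ b′ → c ≡ c′ → d ≡ d′ → mat a b c d ≡ mat a′ b′ c′ d′
    mat-cong refl refl refl refl = refl

    det-mul : ∀ M N → det (mul M N) ≡ det M ℤ.* det N
    det-mul (mat a b c d) (mat a′ b′ c′ d′) = lemma a b c d a′ b′ c′ d′
      where
      lemma : ∀ a b c d a′ b′ c′ d′ →
        (a ℤ.* a′ ℤ.+ b ℤ.* c′) ℤ.* (c ℤ.* b′ ℤ.+ d ℤ.* d′)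
          ℤ.- (a ℤ.* b′ ℤ.+ b ℤ.* d′) ℤ.* (c ℤ.* a′ ℤ.+ d ℤ.* c′)
        ≡ (a ℤ.* d ℤ.- b ℤ.* c) ℤ.* (a′ ℤ.* d′ ℤ.- b′ ℤ.* c′)
      lemma = solve-∀

    det-adj : ∀ M → det (adj M) ≡ det M
    det-adj (mat a b c d) = lemma a b c d
      where
      lemma : ∀ a b c d → d ℤ.* a ℤ.- (ℤ.- b) ℤ.* (ℤ.- c) ≡ a ℤ.* d ℤ.- b ℤ.* c
      lemma = solve-∀

    mul-assoc : ∀ M N K → mul (mul M N) K ≡ mul M (mul N K)
    mul-assoc (mat a b c d) (mat a′ b′ c′ d′) (mat a″ b″ c″ d″) = mat-cong
      (lemma a b a′ b′ c′ d′ a″ c″) (lemma a b a′ b′ c′ d′ b″ d″)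
      (lemma c d a′ b′ c′ d′ a″ c″) (lemma c d a′ b′ c′ d′ b″ d″)
      where
      lemma : ∀ x y p q r s u v →
        (x ℤ.* p ℤ.+ y ℤ.* r) ℤ.* u ℤ.+ (x ℤ.* q ℤ.+ y ℤ.* s) ℤ.* v
        ≡ x ℤ.* (p ℤ.* u ℤ.+ q ℤ.* v) ℤ.+ y ℤ.* (r ℤ.* u ℤ.+ s ℤ.* v)
      lemma = solve-∀

    mul-identityˡ : ∀ M → mul (scalar 1ℤ) M ≡ M
    mul-identityˡ (mat a b c d) = mat-cong (one a c) (one b d) (two a c) (two b d)
      where
      one : ∀ x y → 1ℤ ℤ.* x ℤ.+ 0ℤ ℤ.* y ≡ x
      one = solve-∀
      two : ∀ x y → 0ℤ ℤ.* x ℤ.+ 1ℤ ℤ.* y ≡ y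
      two = solve-∀

    mul-identityʳ : ∀ M → mul M (scalar 1ℤ) ≡ M
    mul-identityʳ (mat a b c d) = mat-cong (one a b) (two a b) (one c d) (two c d)
      where
      one : ∀ x y → x ℤ.* 1ℤ ℤ.+ y ℤ.* 0ℤ ≡ x
      one = solve-∀
      two : ∀ x y → x ℤ.* 0ℤ ℤ.+ y ℤ.* 1ℤ ≡ y
      two = solve-∀

    mul-adjʳ : ∀ M → mul M (adj M) ≡ scalar (det M)
    mul-adjʳ (mat a b c d) = mat-cong (l₁ a b c d) (l₂ a b) (l₃ c d) (l₄ a b c d)
      where
      l₁ : ∀ a b c d → a ℤ.* d ℤ.+ b ℤ.* (ℤ.- c) ≡ a ℤ.* d ℤ.- b ℤ.* c
      l₁ = solve-∀
      l₂ : ∀ a b → a ℤ.* (ℤ.- b) ℤ.+ b ℤ.* a ≡ 0ℤ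
      l₂ = solve-∀
      l₃ : ∀ c d → c ℤ.* d ℤ.+ d ℤ.* (ℤ.- c) ≡ 0ℤ
      l₃ = solve-∀
      l₄ : ∀ a b c d → c ℤ.* (ℤ.- b) ℤ.+ d ℤ.* a ≡ a ℤ.* d ℤ.- b ℤ.* c
      l₄ = solve-∀

    mul-adjˡ : ∀ M → mul (adj M) M ≡ scalar (det M)
    mul-adjˡ (mat a b c d) = mat-cong (l₁ a b c d) (l₂ b d) (l₃ a c) (l₄ a b c d)
      where
      l₁ : ∀ a b c d → d ℤ.* a ℤ.+ (ℤ.- b) ℤ.* c ≡ a ℤ.* d ℤ.- b ℤ.* c
      l₁ = solve-∀
      l₂ : ∀ b d → d ℤ.* b ℤ.+ (ℤ.- b) ℤ.* d ≡ 0ℤ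
      l₂ = solve-∀
      l₃ : ∀ a c → (ℤ.- c) ℤ.* a ℤ.+ a ℤ.* c ≡ 0ℤ
      l₃ = solve-∀
      l₄ : ∀ a b c d → (ℤ.- c) ℤ.* b ℤ.+ a ℤ.* d ≡ a ℤ.* d ℤ.- b ℤ.* c
      l₄ = solve-∀

    neg-neg : ∀ M → neg (neg M) ≡ M
    neg-neg (mat a b c d) = mat-cong (l a) (l b) (l c) (l d)
      where
      l : ∀ x → ℤ.- (ℤ.- x) ≡ x
      l = solve-∀

    mul-negˡ : ∀ M N → mul (neg M) N ≡ neg (mul M N)
    mul-negˡ (mat a b c d) (mat a′ b′ c′ d′) =
      mat-cong (l a b a′ c′) (l a b b′ d′) (l c d a′ c′) (l c d b′ d′)
      where
      l : ∀ x y u v → (ℤ.- x) ℤ.* u ℤ.+ (ℤ.- y) ℤ.* v ≡ ℤ.- (x ℤ.* u ℤ.+ y ℤ.* v)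
      l = solve-∀

    mul-negʳ : ∀ M N → mul M (neg N) ≡ neg (mul M N)
    mul-negʳ (mat a b c d) (mat a′ b′ c′ d′) =
      mat-cong (l a b a′ c′) (l a b b′ d′) (l c d a′ c′) (l c d b′ d′)
      where
      l : ∀ x y u v → x ℤ.* (ℤ.- u) ℤ.+ y ℤ.* (ℤ.- v) ≡ ℤ.- (x ℤ.* u ℤ.+ y ℤ.* v)
      l = solve-∀

record SL₂ℤ : Set where
  constructor sl
  field
    matrix : Mat
    det≡1  : det matrix ≡ 1ℤ

open SL₂ℤ public

infix 4 _≈±_

data _≈±_ (M N : SL₂ℤ) : Set where
  plus  : matrix M ≡ matrix N → M ≈± N
  minus : matrix M ≡ neg (matrix N) → M ≈± N

private
  swap-neg : ∀ {M N} → M ≡ neg N → N ≡ neg M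
  swap-neg {N = N} refl = ≡.sym (neg-neg N)

  ≈±-sym : ∀ {M N} → M ≈± N → N ≈± M
  ≈±-sym (plus p)  = plus (≡.sym p)
  ≈±-sym (minus p) = minus (swap-neg p)

  ≈±-trans : ∀ {M N K} → M ≈± N → N ≈± K → M ≈± K
  ≈±-trans (plus p)  (plus q)  = plus (≡.trans p q)
  ≈±-trans (plus p)  (minus q) = minus (≡.trans p q)
  ≈±-trans (minus p) (plus q)  = minus (≡.trans p (≡.cong neg q))
  ≈±-trans {K = K} (minus p) (minus q) =
    plus (≡.trans p (≡.trans (≡.cong neg q) (neg-neg (matrix K))))

infixl 7 _·_

_·_ : SL₂ℤ → SL₂ℤ → SL₂ℤ
M · N = sl (mul (matrix M) (matrix N))
           (≡.trans (det-mul (matrix M) (matrix N)) (cong₂ ℤ._*_ (det≡1 M) (det≡1 N)))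

one : SL₂ℤ
one = sl (scalar 1ℤ) refl

inverseMatrix : SL₂ℤ → SL₂ℤ
inverseMatrix M = sl (adj (matrix M)) (≡.trans (det-adj (matrix M)) (det≡1 M))

private
  ·-cong : ∀ {M M′ N N′} → M ≈± M′ → N ≈± N′ → (M · N) ≈± (M′ · N′)
  ·-cong (plus p) (plus q) = plus (cong₂ mul p q)
  ·-cong {M′ = M′} {N′ = N′} (plus p) (minus q) =
    minus (≡.trans (cong₂ mul p q) (mul-negʳ (matrix M′) (matrix N′)))
  ·-cong {M′ = M′} {N′ = N′} (minus p) (plus q) =
    minus (≡.trans (cong₂ mul p q) (mul-negˡ (matrix M′) (matrix N′)))
  ·-cong {M′ = M′} {N′ = N′} (minus p) (minus q) =
    plus (≡.trans (cong₂ mul p q)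
      (≡.trans (mul-negˡ (matrix M′) (neg (matrix N′)))
        (≡.trans (≡.cong neg (mul-negʳ (matrix M′) (matrix N′)))
          (neg-neg (mul (matrix M′) (matrix N′))))))

PSL₂ℤ : Group 0ℓ 0ℓ
PSL₂ℤ = record
  { Carrier = SL₂ℤ
  ; _≈_     = _≈±_
  ; _∙_     = _·_
  ; ε       = one
  ; _⁻¹     = inverseMatrix
  ; isGroup = record
    { isMonoid = record
      { isSemigroup = record
        { isMagma = record
          { isEquivalence = record { refl = plus refl ; sym = ≈±-sym ; trans = ≈±-trans }
          ; ∙-cong = ·-cong
          }
        ; assoc = λ M N K → plus (mul-assoc (matrix M) (matrix N) (matrix K))
        }
      ; identity = (λ M → plus (mul-identityˡ (matrix M)))
                 , (λ M → plus (mul-identityʳ (matrix M)))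
      }
    ; inverse = (λ M → plus (≡.trans (mul-adjˡ (matrix M)) (≡.cong scalar (det≡1 M))))
              , (λ M → plus (≡.trans (mul-adjʳ (matrix M)) (≡.cong scalar (det≡1 M))))
    ; ⁻¹-cong = λ where
        (plus p) → plus (≡.cong adj p)
        (minus p) → minus (≡.cong adj p)
    }
  }

module GroupTheory (𝒢 : Group 0ℓ 0ℓ) where

  private
    module 𝒢 = Group 𝒢
  open 𝒢 using (Carrier; _∙_; ε; _⁻¹; _≈_)

  record Subgroup : Set₁ where
    field
      Mem       : Pred Carrier 0ℓ
      resp      : ∀ {x y} → x ≈ y → Mem x → Mem y
      ε-closed  : Mem ε
      ∙-closed  : ∀ {x y} → Mem x → Mem y → Mem (x ∙ y)
      ⁻¹-closed : ∀ {x} → Mem x → Mem (x ⁻¹)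

  open Subgroup public

  data ⟨_⟩ (x : Carrier) : Pred Carrier 0ℓ where
    gen    : ⟨ x ⟩ x
    unit   : ⟨ x ⟩ ε
    prod   : ∀ {y z} → ⟨ x ⟩ y → ⟨ x ⟩ z → ⟨ x ⟩ (y ∙ z)
    inv    : ∀ {y} → ⟨ x ⟩ y → ⟨ x ⟩ (y ⁻¹)
    ⟨⟩-resp : ∀ {y z} → y ≈ z → ⟨ x ⟩ y → ⟨ x ⟩ z

  cyclic : Carrier → Subgroup
  cyclic x = record
    { Mem = ⟨ x ⟩ ; resp = ⟨⟩-resp ; ε-closed = unit ; ∙-closed = prod ; ⁻¹-closed = inv }

  trivial : Subgroup
  trivial = record
    { Mem       = λ x → x ≈ ε
    ; resp      = λ x≈y x≈ε → 𝒢.trans (𝒢.sym x≈y) x≈ε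
    ; ε-closed  = 𝒢.refl
    ; ∙-closed  = λ x≈ε y≈ε → 𝒢.trans (𝒢.∙-cong x≈ε y≈ε) (𝒢.identityˡ ε)
    ; ⁻¹-closed = λ x≈ε → 𝒢.trans (𝒢.⁻¹-cong x≈ε) (GroupProperties.ε⁻¹≈ε 𝒢)
    }

  doubleCosets : Subgroup → Subgroup → Setoid 0ℓ 0ℓ
  doubleCosets H K = record
    { Carrier = Carrier
    ; _≈_ = λ x y → ∃₂ λ h k → Mem H h × Mem K k × y ≈ (h ∙ x) ∙ k
    ; isEquivalence = record
      { refl = λ {x} → ε , ε , ε-closed H , ε-closed K ,
          𝒢.sym (𝒢.trans (𝒢.identityʳ _) (𝒢.identityˡ x))
      ; sym = λ {x} {y} (h , k , h∈ , k∈ , y≈) →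
          h ⁻¹ , k ⁻¹ , ⁻¹-closed H h∈ , ⁻¹-closed K k∈ , symm x y h k y≈
      ; trans = λ {x} {y} {z} (h , k , h∈ , k∈ , y≈) (h′ , k′ , h′∈ , k′∈ , z≈) →
          h′ ∙ h , k ∙ k′ , ∙-closed H h′∈ h∈ , ∙-closed K k∈ k′∈ , transi x y z h k h′ k′ y≈ z≈
      }
    }
    where
    open SetoidReasoning 𝒢.setoid
    symm : ∀ x y h k → y ≈ (h ∙ x) ∙ k → x ≈ (h ⁻¹ ∙ y) ∙ k ⁻¹
    symm x y h k y≈ = begin
      x                                   ≈⟨ GroupProperties.\\-leftDividesʳ 𝒢 h x ⟨
      h ⁻¹ ∙ (h ∙ x)                      ≈⟨ 𝒢.∙-congˡ (GroupProperties.//-rightDividesʳ 𝒢 k (h ∙ x)) ⟨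
      h ⁻¹ ∙ (((h ∙ x) ∙ k) ∙ k ⁻¹)       ≈⟨ 𝒢.∙-congˡ (𝒢.∙-congʳ y≈) ⟨
      h ⁻¹ ∙ (y ∙ k ⁻¹)                   ≈⟨ 𝒢.assoc _ _ _ ⟨
      (h ⁻¹ ∙ y) ∙ k ⁻¹                   ∎
    transi : ∀ x y z h k h′ k′ → y ≈ (h ∙ x) ∙ k → z ≈ (h′ ∙ y) ∙ k′ →
             z ≈ ((h′ ∙ h) ∙ x) ∙ (k ∙ k′)
    transi x y z h k h′ k′ y≈ z≈ = begin
      z                                   ≈⟨ z≈ ⟩
      (h′ ∙ y) ∙ k′                       ≈⟨ 𝒢.∙-congʳ (𝒢.∙-congˡ y≈) ⟩
      (h′ ∙ ((h ∙ x) ∙ k)) ∙ k′           ≈⟨ 𝒢.∙-congʳ (𝒢.assoc _ _ _) ⟨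
      ((h′ ∙ (h ∙ x)) ∙ k) ∙ k′           ≈⟨ 𝒢.assoc _ _ _ ⟩
      (h′ ∙ (h ∙ x)) ∙ (k ∙ k′)           ≈⟨ 𝒢.∙-congʳ (𝒢.assoc _ _ _) ⟨
      ((h′ ∙ h) ∙ x) ∙ (k ∙ k′)           ∎

  cosets : Subgroup → Setoid 0ℓ 0ℓ
  cosets H = record
    { Carrier = Carrier
    ; _≈_ = λ x y → ∃ λ h → Mem H h × y ≈ h ∙ x
    ; isEquivalence = record
      { refl = ε , ε-closed H , 𝒢.sym (𝒢.identityˡ _)
      ; sym = λ {x} {y} (h , h∈ , y≈) → h ⁻¹ , ⁻¹-closed H h∈ ,
          𝒢.trans (𝒢.sym (GroupProperties.\\-leftDividesʳ 𝒢 h x)) (𝒢.∙-congˡ (𝒢.sym y≈))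
      ; trans = λ {x} (h , h∈ , y≈) (h′ , h′∈ , z≈) → h′ ∙ h , ∙-closed H h′∈ h∈ ,
          𝒢.trans z≈ (𝒢.trans (𝒢.∙-congˡ y≈) (𝒢.sym (𝒢.assoc h′ h x)))
      }
    }

  -- The free product of the cyclic groups ⟨ x ⟩ for x in X: words in letters
  -- taken from these groups, modulo the congruence generated by deleting
  -- identity letters and multiplying adjacent letters of the same factor.
  -- (Replacing a letter by an equal one is a consequence of the second rule.)

  module _ (X : Pred Carrier 0ℓ) where

    record Letter : Set where
      field
        factor : Carrier
        inX    : X factor
        value  : Carrier
        value∈ : ⟨ factor ⟩ value

    open Letter

    Word : Set
    Word = List Letter

    data Reduction : Rel Word 0ℓ where
      delete : ∀ u {k} v → value k ≈ ε → Reduction (u ++ k ∷ v) (u ++ v)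
      merge  : ∀ u {k l m} v → factor k ≈ factor m → factor l ≈ factor m →
               value k ∙ value l ≈ value m → Reduction (u ++ k ∷ l ∷ v) (u ++ m ∷ v)

    evaluate : Word → Carrier
    evaluate = foldr (λ l y → value l ∙ y) ε

    record IndependentGenerators (H : Subgroup) : Set where
      field
        contained  : X ⊆ Mem H
        surjective : ∀ {h} → Mem H h → ∃ λ w → evaluate w ≈ h
        injective  : ∀ {w w′} → evaluate w ≈ evaluate w′ → EqClosure Reduction w w′

-- Multigraphs given by an incidence relation; in all the graphs constructed below
-- an edge is incident to exactly two vertices, one of each type.

record Graph : Set₁ where
  field
    vertices : Setoid 0ℓ 0ℓ
    edges    : Setoid 0ℓ 0ℓ
  module V = Setoid vertices
  module E = Setoid edges
  Vertex = V.Carrier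
  Edge   = E.Carrier
  field
    Inc      : Edge → Vertex → Set
    Inc-resp : ∀ {e e′ v v′} → e E.≈ e′ → v V.≈ v′ → Inc e v → Inc e′ v′

  Univalent : Pred Vertex 0ℓ
  Univalent v = ∃ λ e → Inc e v × (∀ f → Inc f v → f E.≈ e)

  Bivalent : Pred Vertex 0ℓ
  Bivalent v = ∃₂ λ e₁ e₂ → Inc e₁ v × Inc e₂ v × ¬ (e₁ E.≈ e₂) ×
                            (∀ f → Inc f v → f E.≈ e₁ ⊎ f E.≈ e₂)

  data Walk (u v : Vertex) : Set where
    stay : u V.≈ v → Walk u v
    -- There are no loops, so u ≉ w makes w the other end of e.
    step : ∀ e w → Inc e u → Inc e w → ¬ (u V.≈ w) → Walk w v → Walk u v

  trace : ∀ {u v} → Walk u v → List Edge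
  trace (stay _)             = []
  trace (step e _ _ _ _ rest) = e ∷ trace rest

  record IsTree : Set where
    field
      inhabited : Vertex
      connected : ∀ u v → Walk u v
      acyclic   : ∀ {u} (w : Walk u u) → Linked (λ e f → ¬ (e E.≈ f)) (trace w) →
                  trace w ≡ []

record GraphMap (Y Z : Graph) : Set where
  private
    module Y = Graph Y
    module Z = Graph Z
  field
    onV      : Func Y.vertices Z.vertices
    onE      : Func Y.edges Z.edges
    inc      : ∀ {e v} → Y.Inc e v → Z.Inc (Func.to onE e) (Func.to onV v)
  vertex = Func.to onV
  edge   = Func.to onE

record CutSet (Y : Graph) : Set₁ where
  open Graph Y
  field
    Cut      : Pred Vertex 0ℓ
    cut-resp : ∀ {v w} → v V.≈ w → Cut v → Cut w
    bivalent : ∀ {v} → Cut v → Bivalent v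

module Cutting (Y : Graph) (C : CutSet Y) where
  open Graph Y
  open CutSet C

  Uncut : Set
  Uncut = Σ Vertex λ v → ¬ Cut v

  -- A univalent vertex of the cut graph which arises from the bivalent vertex W
  -- and is incident to the edge e.

  record CutEnd : Set where
    constructor cutEnd
    field
      W    : Vertex
      W∈   : Cut W
      e    : Edge
      e∋W  : Inc e W

  open CutEnd public

  infix 4 _≈ᵉ_

  _≈ᵉ_ : Rel CutEnd 0ℓ
  V₁ ≈ᵉ V₂ = W V₁ V.≈ W V₂ × e V₁ E.≈ e V₂

  opposite : CutEnd → CutEnd
  opposite (cutEnd W W∈ e e∋W) with bivalent W∈
  ... | e₁ , e₂ , e₁∋W , e₂∋W , _ , all =
    [ (λ _ → cutEnd W W∈ e₂ e₂∋W) , (λ _ → cutEnd W W∈ e₁ e₁∋W) ]′ (all e e∋W)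

  CutVertex : Set
  CutVertex = Uncut ⊎ CutEnd

  infix 4 _≈ᶜ_

  _≈ᶜ_ : Rel CutVertex 0ℓ
  inj₁ (v , _) ≈ᶜ inj₁ (w , _) = v V.≈ w
  inj₂ V₁      ≈ᶜ inj₂ V₂      = V₁ ≈ᵉ V₂
  _            ≈ᶜ _            = ⊥

  IncCut : Edge → CutVertex → Set
  IncCut f (inj₁ (v , _)) = Inc f v
  IncCut f (inj₂ V)       = f E.≈ e V

  cutGraph : Graph
  cutGraph = record
    { vertices = record
      { Carrier = CutVertex
      ; _≈_ = _≈ᶜ_
      ; isEquivalence = record
        { refl  = λ { {inj₁ _} → V.refl ; {inj₂ _} → V.refl , E.refl }
        ; sym   = λ { {inj₁ _} {inj₁ _} p → V.sym p
                    ; {inj₂ _} {inj₂ _} (p , q) → V.sym p , E.sym q }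
        ; trans = λ { {inj₁ _} {inj₁ _} {inj₁ _} p q → V.trans p q
                    ; {inj₂ _} {inj₂ _} {inj₂ _} (p , q) (p′ , q′) → V.trans p p′ , E.trans q q′ }
        }
      }
    ; edges    = edges
    ; Inc      = IncCut
    ; Inc-resp = λ { {v = inj₁ _} {v′ = inj₁ _} p q → Inc-resp p q
                   ; {v = inj₂ _} {v′ = inj₂ _} p (_ , q) r → E.trans (E.sym p) (E.trans r q) }
    }

  glueVertex : CutVertex → Vertex
  glueVertex (inj₁ (v , _)) = v
  glueVertex (inj₂ V)       = W V

  glue : GraphMap cutGraph Y
  glue = record
    { onV = record { to = glueVertex
                   ; cong = λ { {inj₁ _} {inj₁ _} p → p ; {inj₂ _} {inj₂ _} (p , _) → p } }
    ; onE = record { to = λ f → f ; cong = λ p → p }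
    ; inc = λ { {v = inj₁ _} p → p ; {v = inj₂ V} p → Inc-resp (E.sym p) V.refl (e∋W V) }
    }

data Kind : Set where
  type0 type1 : Kind

module CosetGraph (𝒢 : Group 0ℓ 0ℓ) (generator : Kind → Group.Carrier 𝒢) where

  private
    module 𝒢 = Group 𝒢
  open 𝒢 using (Carrier; ε)
  open GroupTheory 𝒢

  stabilizer : Kind → Subgroup
  stabilizer κ = cyclic (generator κ)

  module _ (G : Subgroup) where

    private
      module D κ = Setoid (doubleCosets G (stabilizer κ))

    infix 4 _≈ᵛ_

    data _≈ᵛ_ : Rel (Kind × Carrier) 0ℓ where
      same : ∀ {κ x y} → Setoid._≈_ (doubleCosets G (stabilizer κ)) x y → (κ , x) ≈ᵛ (κ , y)

    private
      coset⇒double : ∀ κ {x y} → Setoid._≈_ (cosets G) x y → D._≈_ κ x y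
      coset⇒double κ (h , h∈ , p) =
        h , ε , h∈ , ε-closed (stabilizer κ) , 𝒢.trans p (𝒢.sym (𝒢.identityʳ _))

    Y-comb : Graph
    Y-comb = record
      { vertices = record
        { Carrier = Kind × Carrier
        ; _≈_ = _≈ᵛ_
        ; isEquivalence = record
          { refl  = λ { {κ , _} → same (D.refl κ) }
          ; sym   = λ { {κ , _} (same p) → same (D.sym κ p) }
          ; trans = λ { {κ , _} (same p) (same q) → same (D.trans κ p q) }
          }
        }
      ; edges    = cosets G
      ; Inc      = λ x (κ , y) → D._≈_ κ x y
      ; Inc-resp = λ { p (same {κ} q) r →
                       D.trans κ (D.sym κ (coset⇒double κ p)) (D.trans κ r q) }
      }

  quotientMap : ∀ G → GraphMap (Y-comb trivial) (Y-comb G)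
  quotientMap G = record
    { onV = record { to = λ v → v ; cong = λ { (same p) → same (weaken p) } }
    ; onE = record { to = λ e → e
                   ; cong = λ (h , h≈ε , p) → h , resp G (𝒢.sym h≈ε) (ε-closed G) , p }
    ; inc = weaken
    }
    where
    weaken : ∀ {κ x y} → Setoid._≈_ (doubleCosets trivial (stabilizer κ)) x y →
             Setoid._≈_ (doubleCosets G (stabilizer κ)) x y
    weaken (h , k , h≈ε , k∈ , p) = h , k , resp G (𝒢.sym h≈ε) (ε-closed G) , k∈ , p

Γ : Set
Γ = Group.Carrier PSL₂ℤ

open Group PSL₂ℤ using (_⁻¹)
open GroupTheory PSL₂ℤ public

generator : Kind → Γ
generator type0 = sl (mat 0ℤ (ℤ.- 1ℤ) 1ℤ 0ℤ) refl
generator type1 = sl (mat 0ℤ 1ℤ (ℤ.- 1ℤ) 1ℤ) refl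

open CosetGraph PSL₂ℤ generator public

𝐓 : Graph
𝐓 = Y-comb trivial

record Lift (G : Subgroup) (C : CutSet (Y-comb G)) : Set where
  private
    module Y = Graph (Y-comb G)
  open Cutting (Y-comb G) C using (cutGraph; glueVertex)
  field
    toTree : GraphMap cutGraph 𝐓
  open GraphMap toTree public
  field
    overV : ∀ v → GraphMap.vertex (quotientMap G) (vertex v) Y.V.≈ glueVertex v
    overE : ∀ e → GraphMap.edge (quotientMap G) (edge e) Y.E.≈ e

-- The ideal endpoint, before translation by g, of an edge g[i,0), g[i,∞), g[ρ,0)
-- or g[ρ,∞).

data Half : Set where
  to0 to∞ : Half

flip : Half → Half
flip to0 = to∞
flip to∞ = to0

module PolygonSides (G : Subgroup) (C : CutSet (Y-comb G)) where

  private
    module Y = Graph (Y-comb G)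
  open Cutting (Y-comb G) C public

  -- `Univalent (Y-comb G) v` and `Univalent cutGraph (inj₁ (v , _))` unfold to
  -- the same type, so `half` covers the univalent vertices of Y′ of either type.

  data Side : Set where
    full : (V : CutEnd) → proj₁ (W V) ≡ type0 → Side
    half : (V : Uncut) → Y.Univalent (proj₁ V) → Half → Side

  infix 4 _≈ˢ_

  _≈ˢ_ : Rel Side 0ℓ
  full V _   ≈ˢ full V′ _    = V ≈ᵉ V′
  half V _ h ≈ˢ half V′ _ h′ = proj₁ V Y.V.≈ proj₁ V′ × h ≡ h′
  _          ≈ˢ _            = ⊥

  sides : Setoid 0ℓ 0ℓ
  sides = record
    { Carrier = Side
    ; _≈_ = _≈ˢ_
    ; isEquivalence = record
      { refl  = λ { {full _ _} → Y.V.refl , Y.E.refl ; {half _ _ _} → Y.V.refl , refl }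
      ; sym   = λ { {full _ _} {full _ _} (p , q) → Y.V.sym p , Y.E.sym q
                  ; {half _ _ _} {half _ _ _} (p , q) → Y.V.sym p , ≡.sym q }
      ; trans = λ { {full _ _} {full _ _} {full _ _} (p , q) (p′ , q′) →
                      Y.V.trans p p′ , Y.E.trans q q′
                  ; {half _ _ _} {half _ _ _} {half _ _ _} (p , q) (p′ , q′) →
                      Y.V.trans p p′ , ≡.trans q q′ }
      }
    }

  opposite-kind : ∀ V → W (opposite V) ≡ W V
  opposite-kind (cutEnd W W∈ e e∋W) with CutSet.bivalent C W∈
  ... | _ , _ , _ , _ , _ , all with all e e∋W
  ...   | inj₁ _ = refl
  ...   | inj₂ _ = refl

  σ : Side → Side
  σ (full V is0)   = full (opposite V) (≡.trans (≡.cong proj₁ (opposite-kind V)) is0)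
  σ (half V uni h) = half V uni (flip h)

  -- The edge of Y′ incident to the univalent vertex giving rise to the side.

  edgeAt : Side → Y.Edge
  edgeAt (full V _)     = e V
  edgeAt (half _ uni _) = proj₁ uni

  record IsTransversal (S : Pred Side 0ℓ) : Set where
    field
      S-resp : ∀ {s t} → s ≈ˢ t → S s → S t
      meets  : ∀ s → S s ⊎ S (σ s)
      once   : ∀ {s t} → S s → S t → t ≈ˢ s ⊎ t ≈ˢ σ s → t ≈ˢ s

-- Complete ordered fields, classically all isomorphic to ℝ. The carrier is a
-- setoid so that constructions of ℝ by sequences of rationals are instances.

record CompleteOrderedField : Set₁ where
  field
    commutativeRing : CommutativeRing 0ℓ 0ℓ
  open CommutativeRing commutativeRing public
    renaming (Carrier to Scalar; _≈_ to _≋_; refl to ≋-refl; sym to ≋-sym; trans to ≋-trans)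
  infix 4 _≤_ _<_
  field
    _≤_          : Rel Scalar 0ℓ
    isTotalOrder : IsTotalOrder _≋_ _≤_
    +-monoˡ-≤    : ∀ {x y} z → x ≤ y → x + z ≤ y + z
    *-nonneg     : ∀ {x y} → 0# ≤ x → 0# ≤ y → 0# ≤ x * y
    0≉1          : ¬ (0# ≋ 1#)
    inverse      : ∀ x → ¬ (x ≋ 0#) → ∃ λ y → x * y ≋ 1#

  UpperBound : Pred Scalar 0ℓ → Pred Scalar 0ℓ
  UpperBound A b = ∀ x → A x → x ≤ b

  field
    supremum : (A : Pred Scalar 0ℓ) → ∃ A → ∃ (UpperBound A) →
               ∃ λ s → UpperBound A s × (∀ b → UpperBound A b → s ≤ b)

  _<_ : Rel Scalar 0ℓ
  x < y = ¬ (y ≤ x)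

  fromℤ : ℤ → Scalar
  fromℤ (+ n)    = Multiples._×_ +-rawMonoid n 1#
  fromℤ -[1+ n ] = - Multiples._×_ +-rawMonoid (ℕ.suc n) 1#

module UpperHalfPlane (ℝ : CompleteOrderedField) where
  open CompleteOrderedField ℝ

  record ℍ : Set where
    constructor _+i_⟨_⟩
    field
      x y : Scalar
      y>0 : 0# < y

  open ℍ public

  infix 4 _≈ʰ_

  _≈ʰ_ : Rel ℍ 0ℓ
  z ≈ʰ w = x z ≋ x w × y z ≋ y w

  Region : Set₁
  Region = Pred ℍ 0ℓ

  sq : Scalar → Scalar
  sq t = t * t

  normSq : ℍ → Scalar
  normSq z = sq (x z) + sq (y z)

  -- w = (az + b)/(cz + d), written as w(cz + d) = az + b in real and imaginary
  -- parts; note that cz + d never vanishes.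

  Maps : Γ → ℍ → ℍ → Set
  Maps g z w =
    let mat a b c d = matrix g
        re = fromℤ c * x z + fromℤ d
        im = fromℤ c * y z
    in x w * re - y w * im ≋ fromℤ a * x z + fromℤ b
     × x w * im + y w * re ≋ fromℤ a * y z

  infixr 7 _⊙_

  _⊙_ : Γ → Region → Region
  (g ⊙ A) w = ∃ λ z → A z × Maps g z w

  -- Geodesics are the sets α + β Re z + γ |z|² = 0, so the geodesic segment from
  -- p to q is the set of z at which (Re z , |z|²) is a convex combination of its
  -- values at p and q.

  Between : ℍ → ℍ → Pred ℍ 0ℓ
  Between p q z = ∃ λ t → 0# ≤ t × t ≤ 1# ×
    x z ≋ (1# - t) * x p + t * x q × normSq z ≋ (1# - t) * normSq p + t * normSq q

  -- Zero iff the three points lie on a geodesic; for p ≠ q, positive iff z lies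
  -- strictly to the left of the geodesic directed from p to q.

  orient : ℍ → ℍ → ℍ → Scalar
  orient p q z = (x q - x p) * (normSq z - normSq p) - (normSq q - normSq p) * (x z - x p)

  Convex : Region → Set
  Convex A = ∀ {p q z} → A p → A q → Between p q z → A z

  -- The hyperbolic and the Euclidean metric define the same topology on ℍ.

  Ball : ℍ → Scalar → Region
  Ball z ε w = sq (x w - x z) + sq (y w - y z) < ε

  Meets : Region → Region → Set
  Meets A B = ∃ λ z → A z × B z

  Interior Closure Boundary Complement : Region → Region
  Interior A z   = ∃ λ ε → 0# < ε × (Ball z ε ⊆ A)
  Closure A z    = ∀ ε → 0# < ε → Meets (Ball z ε) A
  Complement A z = ¬ A z
  Boundary A z   = Closure A z × Closure (Complement A) z

  Closed : Region → Set
  Closed A = Closure A ⊆ A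

  -- Segments, half-lines and lines, containing all their endpoints in ℍ.

  record IsGeodesicInterval (s : Region) : Set where
    field
      closed        : Closed s
      convex        : Convex s
      collinear     : ∀ {p q z} → s p → s q → s z → orient p q z ≋ 0#
      nondegenerate : ∃₂ λ p q → s p × s q × ¬ (p ≈ʰ q)

  Endpoint : Region → Region
  Endpoint s z = s z × (∀ {p q} → s p → s q → Between p q z → z ≈ʰ p ⊎ z ≈ʰ q)

  -- The initial direction at p of the geodesic from p to q, up to a positive
  -- factor: differentiate the parametrisation in `Between` at t = 0.

  direction : ℍ → ℍ → Scalar × Scalar
  direction p q = let δ = x q - x p; two = 1# + 1# in
    two * y p * δ , (normSq q - normSq p) - two * x p * δ

  infix 7 _∙∙_

  _∙∙_ : Scalar × Scalar → Scalar × Scalar → Scalar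
  (u₁ , u₂) ∙∙ (v₁ , v₂) = u₁ * v₁ + u₂ * v₂

  -- The angle at p between the geodesics towards q and r has cosine c.

  CosAngle : ℍ → ℍ → ℍ → Scalar → Set
  CosAngle p q r c = let u = direction p q; v = direction p r in
    ∃₂ λ ∣u∣ ∣v∣ → 0# ≤ ∣u∣ × 0# ≤ ∣v∣ × sq ∣u∣ ≋ u ∙∙ u × sq ∣v∣ ≋ v ∙∙ v ×
                   u ∙∙ v ≋ c * (∣u∣ * ∣v∣)

  -- In a convex polygon the internal angle at a vertex is at most π, hence it is
  -- the unoriented angle between the two edges, determined by its cosine.

  Adjacent-at-angle-with-cosine : Pred Scalar 0ℓ → Region → Region → Set
  Adjacent-at-angle-with-cosine κ s t = ∃ λ p → Endpoint s p × Endpoint t p ×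
    (∀ {q r} → s q → t r → ¬ (q ≈ʰ p) → ¬ (r ≈ʰ p) → ∃ λ c → κ c × CosAngle p q r c)

  cosπ cos2π/3 : Pred Scalar 0ℓ
  cosπ    c = c ≋ - 1#
  cos2π/3 c = c + c ≋ - 1#

  -- The sides of △ lie on x = 0, x = 1/2 and |z − 1| = 1, i.e. |z|² = 2x.

  △ : Region
  △ z = 0# ≤ x z × x z + x z ≤ 1# × x z + x z ≤ normSq z

  ⟨0,∞⟩ : Region
  ⟨0,∞⟩ z = x z ≋ 0#

  -- [i,0), [i,∞) for type0 and [ρ,0), [ρ,∞) for type1.

  halfLine : Kind → Half → Region
  halfLine type0 to0 z = x z ≋ 0# × normSq z ≤ 1#
  halfLine type0 to∞ z = x z ≋ 0# × 1# ≤ normSq z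
  halfLine type1 to0 z = normSq z ≋ x z + x z × x z + x z ≤ 1#
  halfLine type1 to∞ z = x z + x z ≋ 1# × 1# ≤ normSq z

  module _ (P : Region) (E : Setoid 0ℓ 0ℓ) (edge : Setoid.Carrier E → Region) where
    private
      module E = Setoid E

    -- The edges are part of the data, since two of them may meet at angle π, and
    -- there may be infinitely many. `boundary` concerns the boundary in ℍ only.

    record IsConvexPolygon : Set where
      field
        convex        : Convex P
        closed        : Closed P
        hasInterior   : ∃ (Interior P)
        edge-resp     : ∀ {s t} → s E.≈ t → edge s ≐ edge t
        edge-geodesic : ∀ s → IsGeodesicInterval (edge s)
        boundary      : ∀ z → Boundary P z ⇔ (∃ λ s → edge s z)
        edges-meet    : ∀ {s t z} → ¬ (s E.≈ t) → edge s z → edge t z →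
                        Endpoint (edge s) z × Endpoint (edge t) z
        locallyFinite : ∀ z → ∃ λ ε → 0# < ε × ∃ λ (l : List E.Carrier) →
                        ∀ s → Meets (Ball z ε) (edge s) → Any (s E.≈_) l

    Copy : Region → Pred E.Carrier 0ℓ
    Copy A s = ∃ λ g → edge s ≐ g ⊙ A

    record IsSpecialPolygon (σ : E.Carrier → E.Carrier) : Set where
      field
        isConvexPolygon : IsConvexPolygon
        σ-cong          : ∀ {s t} → s E.≈ t → σ s E.≈ σ t
        σ-involutive    : ∀ s → σ (σ s) E.≈ s
        edge-kinds      : ∀ s → Copy ⟨0,∞⟩ s ⊎ Copy (halfLine type0 to∞) s ⊎
                                Copy (halfLine type1 to∞) s
        full-edges      : ∀ s → Copy ⟨0,∞⟩ s →
                          ¬ (σ s E.≈ s) × Copy ⟨0,∞⟩ (σ s)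
        i-edges         : ∀ s → Copy (halfLine type0 to∞) s →
                          ¬ (σ s E.≈ s) × Copy (halfLine type0 to∞) (σ s) ×
                          Adjacent-at-angle-with-cosine cosπ (edge s) (edge (σ s))
        ρ-edges         : ∀ s → Copy (halfLine type1 to∞) s →
                          ¬ (σ s E.≈ s) × Copy (halfLine type1 to∞) (σ s) ×
                          Adjacent-at-angle-with-cosine cos2π/3 (edge s) (edge (σ s))

  module LiftedPolygon (G : Subgroup) (C : CutSet (Y-comb G)) (ȷ : Lift G C) where
    private
      module Y = Graph (Y-comb G)
      module ȷ = Lift ȷ
    open PolygonSides G C public

    P : Region
    P z = ∃ λ (e : Y.Edge) → (ȷ.edge e ⊙ △) z

    side : Side → Region
    side s@(full _ _)   = ȷ.edge (edgeAt s) ⊙ ⟨0,∞⟩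
    side s@(half V _ h) = ȷ.edge (edgeAt s) ⊙ halfLine (proj₁ (proj₁ V)) h

    -- A boundary edge is oriented so that P lies to its left.

    Directed : ℍ → ℍ → Set
    Directed p q = ∀ {z} → P z → 0# ≤ orient p q z

    ReversesOrientation : Γ → Region → Set
    ReversesOrientation g s = ∀ {p q p′ q′} → s p → s q → Maps g p p′ → Maps g q q′ →
                              Directed p q → Directed q′ p′

    -- `IsPairing s g` holds iff g = g_s.

    IsPairing : Side → Γ → Set
    IsPairing s@(full _ _) g =
      (g ⊙ side s ≐ side (σ s)) × ReversesOrientation g (side s)
    IsPairing s@(half ((type0 , _) , _) _ _) g =
      (g ⊙ side s ≐ side (σ s)) × (g ⊙ side (σ s) ≐ side s)
    IsPairing s@(half ((type1 , _) , _) _ to0) g = g ⊙ side s ≐ side (σ s)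
    IsPairing s@(half ((type1 , _) , _) _ to∞) g = g ⁻¹ ⊙ side (σ s) ≐ side s

    pairings : Pred Side 0ℓ → Pred Γ 0ℓ
    pairings S g = ∃ λ s → S s × IsPairing s g

-- Write S and U for the generators of order 2 and 3, and r(e) ∈ Γ for the lift of an
-- edge e of Y′.  A tile γ△ lies in Re z ≥ 0 as soon as the reduced word of γ in S and U
-- does not begin with S.  A walk in Y′ cannot continue through a cut or univalent
-- vertex, so all tiles of P lie on one side of each of its sides; conversely a path of
-- tiles that leaves P crosses a side.  Hence P is the intersection of the half-planes
-- bounded by its sides.
--
-- For the generators (Reidemeister–Schreier): to the step from e to ea, where a is S or
-- U, attach r(e) a r(ea)⁻¹ ∈ G.  It is 1 unless the step crosses a side s, and then it is
-- g_s or its inverse.  Since Γ = ⟨S, U | S², U³⟩, the word obtained along a path depends,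
-- as an element of the free product, only on the ends of the path, and a path between
-- two tiles of P gives the empty word.  The word of a path from a tile x to gx defines
-- the inverse of the evaluation map from the free product to G.

module Submission where

open import Defs
open import Level using (0ℓ)
open import Axiom.ExcludedMiddle using (ExcludedMiddle)
open import Algebra.Bundles using (Group; CommutativeRing)
open import Data.Bool.Base using (Bool; true; false)
open import Data.Empty using (⊥; ⊥-elim)
open import Data.Integer.Base as ℤ using (ℤ; +_; -[1+_]; 0ℤ; 1ℤ)
open import Data.Integer.Tactic.RingSolver using (solve-∀)
open import Data.List.Base using (List; []; _∷_; _++_)
open import Data.List.Membership.Propositional using (_∈_)
open import Data.List.Properties using (++-assoc; ++-identityʳ)
open import Data.List.Relation.Unary.All as All using (All; []; _∷_)
open import Data.List.Relation.Unary.Any as Any using (Any; here; there)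
open import Data.Maybe.Base using (nothing)
open import Data.Nat.Base as ℕ using (ℕ; zero; suc)
open import Data.Nat.Induction using (<-wellFounded)
open import Data.Product.Base using (∃; ∃₂; _×_; _,_; proj₁; proj₂)
open import Data.Sum.Base using (_⊎_; inj₁; inj₂; [_,_]′)
open import Data.Vec.Base as Vec using (Vec; allFin)
open import Data.Vec.N-ary using (N-ary; _$ⁿ_; curryⁿ; Eq; curryⁿ-cong)
open import Function.Base using (_∘_; _$_)
open import Function.Bundles using (Func; mk⇔)
open import Induction.WellFounded using (Acc; acc)
open import Relation.Binary.Construct.Closure.Equivalence as Closure using (EqClosure)
open import Relation.Binary.Construct.Closure.ReflexiveTransitive using (_◅_; _◅◅_) renaming (ε to ε★)
open import Relation.Binary.Construct.Closure.Symmetric using (fwd)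
open import Relation.Binary.PropositionalEquality.Core as ≡ using (_≡_; refl)
open import Relation.Binary.Structures using (IsTotalOrder)
open import Relation.Nullary.Decidable.Core using (Dec; yes; no)
open import Relation.Nullary.Negation.Core using (¬_; contradiction)
open import Relation.Unary using (Pred; _⊆_; _≐_)
open import Tactic.RingSolver.Core.AlmostCommutativeRing using (fromCommutativeRing)
open import Tactic.RingSolver.Core.Expression using (Expr; Κ; Ι; _⊕_; _⊗_; _⊛_; ⊝_; module Eval)
open import Tactic.RingSolver.Core.Polynomial.Parameters using (Homomorphism)
import Algebra.Definitions.RawMonoid as Multiples
import Algebra.Properties.Group as GroupProperties
import Algebra.Properties.Ring as RingProperties
import Algebra.Properties.Semiring.Mult as SemiringMult
import Data.Integer.DivMod as ℤ
import Data.Integer.Properties as ℤ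
import Data.List.Relation.Unary.Any.Properties as Any
import Data.Nat.Properties as ℕ
import Relation.Binary.Reasoning.Setoid as SetoidReasoning
import Tactic.RingSolver.Core.Polynomial.Base as Polynomial
import Tactic.RingSolver.Core.Polynomial.Homomorphism as PolynomialHomomorphism
import Tactic.RingSolver.Core.Polynomial.Semantics as PolynomialSemantics

-- The half-plane statement about words is a ping-pong argument and serves twice: it places the
-- tiles, and it shows that a nonempty reduced word is not 1, from which the presentation of Γ
-- follows. That the half-planes cut out no more than P needs a tile through every point of ℍ. The
-- heights Im γz of an orbit have a supremum but no maximum at hand, so a point above half the
-- supremum is translated into the strip 0 ≤ Re z ≤ 1; below the ideal triangle 0, 1, ∞ a further
-- move would double its height. The elements g_s are characterised by their action on point sets,
-- whereas the rewriting uses explicit products. Stabilisers of the model edges in Γ, computed from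
-- integer matrix entries, connect the two; parity separates the edges at i from those at ρ. All
-- geometry is done in the coordinates (1, Re z, |z|²). Γ acts on them linearly up to the factor |cz
-- + d|², geodesics are their linear relations and segments their convex combinations. Claims thus
-- become polynomial identities modulo hypotheses, checked with explicit multipliers.

-- A ring solver with integer coefficients over any commutative ring.

module IntegerCoefficients (R : CommutativeRing 0ℓ 0ℓ) where
  open CommutativeRing R
  open RingProperties ring using (-0#≈0#; -‿+-comm; -‿involutive; -‿distribˡ-*; -‿distribʳ-*)
  open SemiringMult semiring using (×-homo-+; ×1-homo-*)
  open Multiples +-rawMonoid using () renaming (_×_ to _times_)
  open SetoidReasoning setoid

  embed : ℤ → Carrier
  embed (+ n)    = n times 1#
  embed -[1+ n ] = - (suc n times 1#)

  embed-⊖ : ∀ m n → embed (m ℤ.⊖ n) ≈ m times 1# + - (n times 1#)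
  embed-⊖ m zero = sym (trans (+-congˡ -0#≈0#) (+-identityʳ _))
  embed-⊖ zero (suc n) = sym (+-identityˡ _)
  embed-⊖ (suc m) (suc n) = begin
    embed (suc m ℤ.⊖ suc n)                       ≡⟨ ≡.cong embed (ℤ.[1+m]⊖[1+n]≡m⊖n m n) ⟩
    embed (m ℤ.⊖ n)                               ≈⟨ embed-⊖ m n ⟩
    M + - N                                       ≈⟨ +-identityʳ _ ⟨
    (M + - N) + 0#                                ≈⟨ +-congˡ (-‿inverseʳ 1#) ⟨
    (M + - N) + (1# + - 1#)                       ≈⟨ +-assoc _ _ _ ⟩
    M + (- N + (1# + - 1#))                       ≈⟨ +-congˡ (+-comm _ _) ⟩
    M + ((1# + - 1#) + - N)                       ≈⟨ +-congˡ (+-assoc _ _ _) ⟩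
    M + (1# + (- 1# + - N))                       ≈⟨ +-assoc _ _ _ ⟨
    (M + 1#) + (- 1# + - N)                       ≈⟨ +-cong (+-comm _ _) (-‿+-comm _ _) ⟩
    (1# + M) + - (1# + N)                         ∎
    where M = m times 1#
          N = n times 1#

  embed-+ : ∀ i j → embed (i ℤ.+ j) ≈ embed i + embed j
  embed-+ (+ m) (+ n) = ×-homo-+ 1# m n
  embed-+ (+ m) -[1+ n ] = embed-⊖ m (suc n)
  embed-+ -[1+ m ] (+ n) = trans (embed-⊖ n (suc m)) (+-comm _ _)
  embed-+ -[1+ m ] -[1+ n ] = begin
    - (suc (suc (m ℕ.+ n)) times 1#)              ≡⟨ ≡.cong (λ k → - (suc k times 1#)) (≡.sym (ℕ-+-suc m n)) ⟩
    - ((suc m ℕ.+ suc n) times 1#)                ≈⟨ -‿cong (×-homo-+ 1# (suc m) (suc n)) ⟩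
    - (suc m times 1# + suc n times 1#)           ≈⟨ -‿+-comm _ _ ⟨
    - (suc m times 1#) + - (suc n times 1#)       ∎
    where open import Data.Nat.Properties using () renaming (+-suc to ℕ-+-suc)

  embed-neg : ∀ i → embed (ℤ.- i) ≈ - embed i
  embed-neg (+ zero) = sym -0#≈0#
  embed-neg (+ suc n) = refl′ where refl′ = CommutativeRing.refl R
  embed-neg -[1+ n ] = sym (-‿involutive _)

  embed-+* : ∀ n j → embed (+ n ℤ.* j) ≈ embed (+ n) * embed j
  embed-+* zero j = trans (reflexive (≡.cong embed (ℤ.*-zeroˡ j))) (sym (zeroˡ _))
  embed-+* (suc n) j = begin
    embed (+ suc n ℤ.* j)            ≡⟨ ≡.cong embed (ℤ.suc-* (+ n) j) ⟩
    embed (j ℤ.+ + n ℤ.* j)          ≈⟨ embed-+ j (+ n ℤ.* j) ⟩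
    embed j + embed (+ n ℤ.* j)      ≈⟨ +-cong (sym (*-identityˡ _)) (embed-+* n j) ⟩
    1# * embed j + embed (+ n) * embed j ≈⟨ distribʳ _ _ _ ⟨
    (1# + embed (+ n)) * embed j     ∎

  embed-* : ∀ i j → embed (i ℤ.* j) ≈ embed i * embed j
  embed-* (+ n) j = embed-+* n j
  embed-* -[1+ n ] j = begin
    embed (-[1+ n ] ℤ.* j)           ≡⟨ ≡.cong embed (≡.sym (ℤ.neg-distribˡ-* (+ suc n) j)) ⟩
    embed (ℤ.- (+ suc n ℤ.* j))      ≈⟨ embed-neg (+ suc n ℤ.* j) ⟩
    - embed (+ suc n ℤ.* j)          ≈⟨ -‿cong (embed-+* (suc n) j) ⟩
    - (embed (+ suc n) * embed j)    ≈⟨ -‿distribˡ-* _ _ ⟩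
    - embed (+ suc n) * embed j      ∎

  -- `embed 1ℤ` is `1# + 0#`; coefficients are interpreted so that 1ℤ is `1#` on the nose.
  numeral : ℕ → Carrier
  numeral zero          = 0#
  numeral (suc zero)    = 1#
  numeral (suc (suc n)) = 1# + numeral (suc n)

  coefficient : ℤ → Carrier
  coefficient (+ n)    = numeral n
  coefficient -[1+ n ] = - numeral (suc n)

  numeral≈embed : ∀ n → numeral n ≈ embed (+ n)
  numeral≈embed zero          = CommutativeRing.refl R
  numeral≈embed (suc zero)    = sym (+-identityʳ 1#)
  numeral≈embed (suc (suc n)) = +-congˡ (numeral≈embed (suc n))

  coefficient≈embed : ∀ i → coefficient i ≈ embed i
  coefficient≈embed (+ n)    = numeral≈embed n
  coefficient≈embed -[1+ n ] = -‿cong (numeral≈embed (suc n))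

  private
    isZero : ℤ → Bool
    isZero (+ zero) = true
    isZero _        = false

    homomorphism : Homomorphism 0ℓ 0ℓ 0ℓ 0ℓ
    homomorphism = record
      { from = record { rawRing = CommutativeRing.rawRing ℤ.+-*-commutativeRing
                      ; isZero = isZero }
      -- The target ring never has to recognise zero: all cancellation takes place among the integer
      -- coefficients.
      ; to = fromCommutativeRing R (λ _ → nothing)
      ; morphism = record
        { ⟦_⟧ = coefficient
        ; +-homo = λ i j → trans (coefficient≈embed (i ℤ.+ j)) (trans (embed-+ i j)
                     (sym (+-cong (coefficient≈embed i) (coefficient≈embed j))))
        ; *-homo = λ i j → trans (coefficient≈embed (i ℤ.* j)) (trans (embed-* i j)
                     (sym (*-cong (coefficient≈embed i) (coefficient≈embed j))))
        ; -‿homo = λ i → trans (coefficient≈embed (ℤ.- i)) (trans (embed-neg i)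
                     (sym (-‿cong (coefficient≈embed i))))
        ; 0-homo = CommutativeRing.refl R
        ; 1-homo = CommutativeRing.refl R
        }
      ; Zero-C⟶Zero-R = λ { (+ zero) _ → CommutativeRing.refl R }
      }

  open Eval rawRing coefficient
  private
    module P = Polynomial (Homomorphism.from homomorphism)
    open P using (Poly; κ; ι; _⊞_; _⊠_; ⊟_; _⊡_; Zero)
    open PolynomialHomomorphism homomorphism
    open PolynomialSemantics homomorphism using () renaming (⟦_⟧ to ⟦_⟧ₚ)

  norm : ∀ {n} → Expr ℤ n → Poly n
  norm (Κ x)   = κ x
  norm (Ι x)   = ι x
  norm (x ⊕ y) = norm x ⊞ norm y
  norm (x ⊗ y) = norm x ⊠ norm y
  norm (⊝ x)   = ⊟ norm x
  norm (x ⊛ i) = norm x ⊡ i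

  private
    open import Algebra.Properties.Semiring.Exp.TCOptimised semiring using (^-congˡ)

    norm-correct : ∀ {n} (e : Expr ℤ n) ρ → ⟦ norm e ⟧ₚ ρ ≈ ⟦ e ⟧ ρ
    norm-correct (Κ x)   ρ = κ-hom x ρ
    norm-correct (Ι x)   ρ = ι-hom x ρ
    norm-correct (x ⊕ y) ρ = trans (⊞-hom (norm x) (norm y) ρ) (+-cong (norm-correct x ρ) (norm-correct y ρ))
    norm-correct (x ⊗ y) ρ = trans (⊠-hom (norm x) (norm y) ρ) (*-cong (norm-correct x ρ) (norm-correct y ρ))
    norm-correct (⊝ x)   ρ = trans (⊟-hom (norm x) ρ) (-‿cong (norm-correct x ρ))
    norm-correct (x ⊛ i) ρ = trans (⊡-hom (norm x) i ρ) (^-congˡ i (norm-correct x ρ))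

    -- A proper sum in Horner normal form is never `Zero`, so the constant 0 is the only case.
    zero-correct : ∀ {n} (p : Poly n) → Zero p → ∀ ρ → ⟦ p ⟧ₚ ρ ≈ 0#
    zero-correct (P.Κ (+ zero) P.⊐ _) _ ρ = CommutativeRing.refl R

  infixl 6 _:+_ _:-_
  infixl 7 _:*_
  infix 4 _:=_
  infix 8 :-_

  pattern _:+_ x y = x ⊕ y
  pattern _:*_ x y = x ⊗ y
  pattern :-_ x = ⊝ x
  pattern _:=_ x y = x , y

  _:-_ : ∀ {n} → Expr ℤ n → Expr ℤ n → Expr ℤ n
  x :- y = x ⊕ ⊝ y

  # : ∀ {n} → ℕ → Expr ℤ n
  # k = Κ (+ k)

  variables : ∀ {n} → Vec (Expr ℤ n) n
  variables {n} = Vec.map Ι (allFin n)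

  -- Both sides are compared through the normal form of their difference, which is a closed term.
  ring! : ∀ n (f : N-ary n (Expr ℤ n) (Expr ℤ n × Expr ℤ n)) →
         (let e = f $ⁿ variables) → {_ : Zero (norm (proj₁ e :- proj₂ e))} →
         Eq n _≈_ (curryⁿ ⟦ proj₁ e ⟧) (curryⁿ ⟦ proj₂ e ⟧)
  ring! n f {z} = curryⁿ-cong _≈_ ⟦ l ⟧ ⟦ r ⟧ λ ρ → begin
    ⟦ l ⟧ ρ                          ≈⟨ +-identityʳ _ ⟨
    ⟦ l ⟧ ρ + 0#                     ≈⟨ +-congˡ (-‿inverseˡ _) ⟨
    ⟦ l ⟧ ρ + (- ⟦ r ⟧ ρ + ⟦ r ⟧ ρ)    ≈⟨ +-assoc _ _ _ ⟨
    ⟦ l :- r ⟧ ρ + ⟦ r ⟧ ρ            ≈⟨ +-congʳ (norm-correct (l :- r) ρ) ⟨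
    ⟦ norm (l :- r) ⟧ₚ ρ + ⟦ r ⟧ ρ    ≈⟨ +-congʳ (zero-correct (norm (l :- r)) z ρ) ⟩
    0# + ⟦ r ⟧ ρ                     ≈⟨ +-identityˡ _ ⟩
    ⟦ r ⟧ ρ                          ∎
    where
    l = proj₁ (f $ⁿ variables)
    r = proj₂ (f $ⁿ variables)

-- Complete ordered fields: signs, square roots, integer parts.

module OrderedField (em : ExcludedMiddle 0ℓ) (ℝ : CompleteOrderedField) where
  open CompleteOrderedField ℝ public
  open IntegerCoefficients commutativeRing public
  open RingProperties (CommutativeRing.ring commutativeRing) public using (-0#≈0#; -‿involutive)
  open IsTotalOrder isTotalOrder public using (total)
    renaming (refl to ≤-refl; trans to ≤-trans; antisym to ≤-antisym; reflexive to ≤-reflexive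
             ; ≤-respˡ-≈ to ≤-respˡ; ≤-respʳ-≈ to ≤-respʳ)

  2# : Scalar
  2# = 1# + 1#

  stable : ∀ {A : Set} → ¬ ¬ A → A
  stable {A} ¬¬a with em {A}
  ... | yes a = a
  ... | no ¬a = ⊥-elim (¬¬a ¬a)

  _≋?_ : ∀ x y → Dec (x ≋ y)
  x ≋? y = em

  difference-zero : ∀ {x y} → x - y ≋ 0# → x ≋ y
  difference-zero {x} {y} p = ≋-trans (ring! 2 (λ x y → x := (x :- y) :+ y) x y)
    (≋-trans (+-congʳ p) (+-identityˡ y))

  zero-difference : ∀ {x y} → x ≋ y → x - y ≋ 0#
  zero-difference {x} {y} p = ≋-trans (+-congʳ p) (-‿inverseʳ y)

  -- Ideal membership with a certificate: the multiplier k is supplied by hand, and what remains is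
  -- an identity for `ring!`. Nearly all the algebra below has this shape.
  combine₁ : ∀ {x y l r} k → l ≋ r → x - y ≋ k * (l - r) → x ≋ y
  combine₁ k p e = difference-zero (≋-trans e (≋-trans (*-congˡ (zero-difference p)) (zeroʳ k)))

  combine₂ : ∀ {x y l r l′ r′} k k′ → l ≋ r → l′ ≋ r′ →
             x - y ≋ k * (l - r) + k′ * (l′ - r′) → x ≋ y
  combine₂ k k′ p p′ e = difference-zero (≋-trans e (≋-trans
    (+-cong (≋-trans (*-congˡ (zero-difference p)) (zeroʳ k))
            (≋-trans (*-congˡ (zero-difference p′)) (zeroʳ k′))) (+-identityˡ 0#)))

  combine₃ : ∀ {x y l r l′ r′ l″ r″} k k′ k″ → l ≋ r → l′ ≋ r′ → l″ ≋ r″ →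
             x - y ≋ k * (l - r) + k′ * (l′ - r′) + k″ * (l″ - r″) → x ≋ y
  combine₃ k k′ k″ p p′ p″ e = difference-zero (≋-trans e (≋-trans
    (+-cong (≋-trans (+-cong (≋-trans (*-congˡ (zero-difference p)) (zeroʳ k))
            (≋-trans (*-congˡ (zero-difference p′)) (zeroʳ k′))) (+-identityˡ 0#))
      (≋-trans (*-congˡ (zero-difference p″)) (zeroʳ k″))) (+-identityˡ 0#)))

  pos-resp : ∀ {x y} → x ≋ y → 0# < x → 0# < y
  pos-resp p h q = h (≤-respˡ (≋-sym p) q)

  nonneg-by : ∀ {x y} → 0# ≤ x → x ≋ y → 0# ≤ y
  nonneg-by p e = ≤-respʳ e p

  pos-by : ∀ {x y} → 0# < x → x ≋ y → 0# < y
  pos-by p e = pos-resp e p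

  ≤⇒nonneg : ∀ {x y} → x ≤ y → 0# ≤ y - x
  ≤⇒nonneg {x} {y} p = ≤-respˡ (-‿inverseʳ x) (+-monoˡ-≤ (- x) p)

  nonneg⇒≤ : ∀ {x y} → 0# ≤ y - x → x ≤ y
  nonneg⇒≤ {x} {y} p = ≤-respˡ (+-identityˡ x)
    (≤-respʳ (ring! 2 (λ x y → (y :- x) :+ x := y) x y) (+-monoˡ-≤ x p))

  <⇒pos : ∀ {x y} → x < y → 0# < y - x
  <⇒pos {x} {y} p q = p (nonneg⇒≤ (≤-respʳ (ring! 2 (λ x y → :- (y :- x) := x :- y) x y)
    (≤-respʳ (+-identityˡ _) (≤⇒nonneg q))))

  pos⇒< : ∀ {x y} → 0# < y - x → x < y
  pos⇒< {x} {y} p q = p (nonneg⇒≤ (nonneg-by (≤⇒nonneg q) (ring! 2 (λ x y → x :- y := # 0 :- (y :- x)) x y)))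

  +-nonneg : ∀ {x y} → 0# ≤ x → 0# ≤ y → 0# ≤ x + y
  +-nonneg {x} {y} p q = ≤-trans q (≤-respˡ (+-identityˡ y) (+-monoˡ-≤ y p))

  neg-nonneg : ∀ {x} → x ≤ 0# → 0# ≤ - x
  neg-nonneg p = nonneg-by (≤⇒nonneg p) (+-identityˡ _)

  nonneg-neg : ∀ {x} → 0# ≤ - x → x ≤ 0#
  nonneg-neg p = nonneg⇒≤ (nonneg-by p (≋-sym (+-identityˡ _)))

  nonneg⊎neg : ∀ x → 0# ≤ x ⊎ 0# < - x
  nonneg⊎neg x with em {0# ≤ x}
  ... | yes p = inj₁ p
  ... | no ¬p = inj₂ λ q → ¬p (nonneg-by (neg-nonneg q) (-‿involutive x))

  pos⊎nonpos : ∀ x → 0# < x ⊎ 0# ≤ - x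
  pos⊎nonpos x with em {x ≤ 0#}
  ... | yes p = inj₂ (neg-nonneg p)
  ... | no ¬p = inj₁ ¬p

  pos⇒nonneg : ∀ {x} → 0# < x → 0# ≤ x
  pos⇒nonneg {x} p = [ (λ q → q) , (λ q → contradiction q p) ]′ (total 0# x)

  pos⇒≉0 : ∀ {x} → 0# < x → ¬ (x ≋ 0#)
  pos⇒≉0 p q = p (≤-reflexive q)

  nonneg∧≉0⇒pos : ∀ {x} → 0# ≤ x → ¬ (x ≋ 0#) → 0# < x
  nonneg∧≉0⇒pos p q r = q (≤-antisym r p)

  pos-not-nonpos : ∀ {x} → 0# < x → 0# ≤ - x → ⊥
  pos-not-nonpos p q = p (nonneg-neg q)

  neg-not-nonneg : ∀ {x} → 0# < - x → 0# ≤ x → ⊥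
  neg-not-nonneg p q = p (nonneg-neg (nonneg-by q (≋-sym (-‿involutive _))))

  both-signs : ∀ {x} → 0# ≤ x → 0# ≤ - x → x ≋ 0#
  both-signs p q = ≤-antisym (nonneg-neg q) p

  *-≋0 : ∀ {x y} → ¬ (x ≋ 0#) → x * y ≋ 0# → y ≋ 0#
  *-≋0 {x} {y} x≉0 p with x⁻¹ , q ← inverse x x≉0 =
    combine₂ (- y) x⁻¹ q p
      (ring! 3 (λ x y z → y :- # 0 := (:- y) :* (x :* z :- # 1) :+ z :* (x :* y :- # 0)) x y x⁻¹)

  *-≉0 : ∀ {x y} → ¬ (x ≋ 0#) → ¬ (y ≋ 0#) → ¬ (x * y ≋ 0#)
  *-≉0 p q r = q (*-≋0 p r)

  *-pos : ∀ {x y} → 0# < x → 0# < y → 0# < x * y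
  *-pos p q = nonneg∧≉0⇒pos (*-nonneg (pos⇒nonneg p) (pos⇒nonneg q)) (*-≉0 (pos⇒≉0 p) (pos⇒≉0 q))

  +-pos : ∀ {x y} → 0# < x → 0# ≤ y → 0# < x + y
  +-pos {x} {y} p q r = p (≤-trans (nonneg⇒≤ (nonneg-by q (ring! 2 (λ x y → y := (x :+ y) :- x) x y))) r)

  square-nonneg : ∀ x → 0# ≤ x * x
  square-nonneg x with total 0# x
  ... | inj₁ p = *-nonneg p p
  ... | inj₂ p = nonneg-by (*-nonneg (neg-nonneg p) (neg-nonneg p)) (ring! 1 (λ x → (:- x) :* (:- x) := x :* x) x)

  0<1 : 0# < 1#
  0<1 = nonneg∧≉0⇒pos (nonneg-by (square-nonneg 1#) (*-identityˡ 1#)) (0≉1 ∘ ≋-sym)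

  0≤1 : 0# ≤ 1#
  0≤1 = pos⇒nonneg 0<1

  numeral-nonneg : ∀ n → 0# ≤ numeral n
  numeral-nonneg zero          = ≤-refl
  numeral-nonneg (suc zero)    = 0≤1
  numeral-nonneg (suc (suc n)) = +-nonneg 0≤1 (numeral-nonneg (suc n))

  numeral-pos : ∀ n → 0# < numeral (suc n)
  numeral-pos zero    = 0<1
  numeral-pos (suc n) = +-pos 0<1 (numeral-nonneg (suc n))

  0<2 : 0# < 2#
  0<2 = numeral-pos 1

  nonneg-cancel : ∀ {d x} → 0# < d → 0# ≤ d * x → 0# ≤ x
  nonneg-cancel {d} {x} p q with nonneg⊎neg x
  ... | inj₁ r = r
  ... | inj₂ r = ⊥-elim (neg-not-nonneg (pos-by (*-pos p r) (ring! 2 (λ d x → d :* (:- x) := :- (d :* x)) d x)) q)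

  pos-cancel : ∀ {d x} → 0# < d → 0# < d * x → 0# < x
  pos-cancel {d} {x} p q = nonneg∧≉0⇒pos (nonneg-cancel p (pos⇒nonneg q))
    λ r → pos⇒≉0 q (≋-trans (*-congˡ r) (zeroʳ d))

  *-cancel : ∀ {d x y} → 0# < d → d * x ≋ d * y → x ≋ y
  *-cancel {d} {x} {y} p q = difference-zero (*-≋0 (pos⇒≉0 p)
    (≋-trans (ring! 3 (λ d x y → d :* (x :- y) := d :* x :- d :* y) d x y) (zero-difference q)))

  sum-zeroˡ : ∀ {x y} → 0# ≤ x → 0# ≤ y → x + y ≋ 0# → x ≋ 0#
  sum-zeroˡ {x} {y} p q r = both-signs p
    (nonneg-by q (combine₁ 1# r (ring! 2 (λ x y → y :- (:- x) := # 1 :* ((x :+ y) :- # 0)) x y)))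

  sum-zeroʳ : ∀ {x y} → 0# ≤ x → 0# ≤ y → x + y ≋ 0# → y ≋ 0#
  sum-zeroʳ p q r = sum-zeroˡ q p (≋-trans (+-comm _ _) r)

  square-zero : ∀ {x} → x * x ≋ 0# → x ≋ 0#
  square-zero {x} p with x ≋? 0#
  ... | yes q = q
  ... | no q  = *-≋0 q p

  reciprocal : ∀ {x} → 0# < x → ∃ λ y → 0# < y × x * y ≋ 1#
  reciprocal {x} p with y , q ← inverse x (pos⇒≉0 p) = y , pos-cancel p (pos-by 0<1 (≋-sym q)) , q

  ½ : Scalar
  ½ = proj₁ (reciprocal 0<2)

  0<half : 0# < ½
  0<half = proj₁ (proj₂ (reciprocal 0<2))

  2*half : 2# * ½ ≋ 1#
  2*half = proj₂ (proj₂ (reciprocal 0<2))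

  square-injective : ∀ {x y} → 0# ≤ x → 0# ≤ y → x * x ≋ y * y → x ≋ y
  square-injective {x} {y} p q r with (x + y) ≋? 0#
  ... | yes s = ≋-trans (sum-zeroˡ p q s) (≋-sym (sum-zeroʳ p q s))
  ... | no s  = difference-zero (*-≋0 s
    (≋-trans (ring! 2 (λ x y → (x :+ y) :* (x :- y) := x :* x :- y :* y) x y) (zero-difference r)))

  square-monotone : ∀ {x y} → 0# ≤ x → 0# < y - x → 0# < y * y - x * x
  square-monotone {x} {y} p q = pos-by (*-pos q (+-pos q (*-nonneg (numeral-nonneg 2) p))) (ring! 2 (λ x y → (y :- x) :* ((y :- x) :+ (# 2 :* x)) := y :* y :- x :* x) x y)

  square-gap-identity : ∀ s d r → (d + (2# * s + 1#)) * r ≋ 1# → (d * r) * (1# + d * r * (2# * s + d)) ≋ (s * s + d) - (s + d * r) * (s + d * r)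
  square-gap-identity s d r mr = combine₁ (d + d * d * r) mr (ring! 3 (λ s d r → (d :* r) :* (# 1 :+ d :* r :* (# 2 :* s :+ d)) :- ((s :* s :+ d) :- (s :+ d :* r) :* (s :+ d :* r))
                    := (d :+ d :* d :* r) :* ((d :+ (# 2 :* s :+ # 1)) :* r :- # 1)) s d r)
  -- ε = d/(d+2s+1)
  square-gap : ∀ {s d} → 0# ≤ s → 0# < d → ∃ λ ε → 0# < ε × (s + ε) * (s + ε) ≤ s * s + d
  square-gap {s} {d} s≥0 d>0 = d * r , ε>0 , nonneg⇒≤ (nonneg-by (*-nonneg (pos⇒nonneg ε>0) (+-nonneg 0≤1 (*-nonneg (pos⇒nonneg ε>0)
      (+-nonneg (*-nonneg (numeral-nonneg 2) s≥0) (pos⇒nonneg d>0))))) (square-gap-identity s d r mr))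
    where
    rec = reciprocal (+-pos d>0 (+-nonneg (*-nonneg (numeral-nonneg 2) s≥0) 0≤1))
    r = proj₁ rec
    r>0 = proj₁ (proj₂ rec)
    mr = proj₂ (proj₂ rec)
    ε>0 = *-pos d>0 r>0

  <-≤-trans : ∀ {x y z} → x < y → y ≤ z → x < z
  <-≤-trans p q r = p (≤-trans q r)

  x<x+ε : ∀ {x ε} → 0# < ε → x < x + ε
  x<x+ε {x} {ε} p = pos⇒< (pos-by p (ring! 2 (λ x ε → ε := (x :+ ε) :- x) x ε))

  <-or-≥ : ∀ x y → x < y ⊎ y ≤ x
  <-or-≥ x y with em {y ≤ x}
  ... | yes p = inj₂ p
  ... | no p  = inj₁ p

  sqrt-identity₁ : ∀ s t → s ≋ 0# → t ≋ - (s * s - t)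
  sqrt-identity₁ s t z = combine₁ s z (ring! 2 (λ s t → t :- (:- (s :* s :- t)) := s :* (s :- # 0)) s t)

  sqrt-identity₂ : ∀ s t r → (2# * s) * r ≋ 1# → r * (s * s + t) ≋ s - (s * s - t) * r
  sqrt-identity₂ s t r p = combine₁ s p
    (ring! 3 (λ s t r → r :* (s :* s :+ t) :- (s :- (s :* s :- t) :* r) := s :* (# 2 :* s :* r :- # 1)) s t r)

  sqrt-identity₃ : ∀ s t r → (2# * s) * r ≋ 1# →
    ((s * s - t) * r) * ((s * s - t) * r) ≋ (s - (s * s - t) * r) * (s - (s * s - t) * r) - t
  sqrt-identity₃ s t r p = combine₁ (s * s - t) p
    (ring! 3 (λ s t r → ((s :* s :- t) :* r) :* ((s :* s :- t) :* r) :- ((s :- (s :* s :- t) :* r) :* (s :- (s :* s :- t) :* r) :- t)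
      := (s :* s :- t) :* (# 2 :* s :* r :- # 1)) s t r)

  <⇒≤ : ∀ {x y} → x < y → x ≤ y
  <⇒≤ p = nonneg⇒≤ (pos⇒nonneg (<⇒pos p))

  x-ε<x : ∀ {x ε} → 0# < ε → x - ε < x
  x-ε<x {x} {ε} p = pos⇒< (pos-by p (ring! 2 (λ x ε → ε := x :- (x :- ε)) x ε))

  IsSupremum : Pred Scalar 0ℓ → Scalar → Set
  IsSupremum A s = UpperBound A s × (∀ b → UpperBound A b → s ≤ b)

  module SquareRoot (t : Scalar) (t≥0 : 0# ≤ t) where
    A : Pred Scalar 0ℓ
    A u = 0# ≤ u × u * u ≤ t

    0∈A : A 0#
    0∈A = ≤-refl , ≤-respˡ (≋-sym (zeroˡ 0#)) t≥0

    upper : ∀ v → 0# ≤ v → t < v * v → UpperBound A v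
    upper v v≥0 t<v² u (u≥0 , u²≤t) with <-or-≥ v u
    ... | inj₂ u≤v = u≤v
    ... | inj₁ v<u = contradiction (≤-trans u²≤t (<⇒≤ t<v²)) (pos⇒< (square-monotone v≥0 (<⇒pos v<u)))

    bounded : UpperBound A (1# + t)
    -- (1 + t)² exceeds t whether t is below or above 1.
    bounded = upper (1# + t) (+-nonneg 0≤1 t≥0)
        (pos⇒< (pos-by (+-pos 0<1 (+-nonneg t≥0 (square-nonneg t)))
          (ring! 1 (λ t → # 1 :+ (t :+ t :* t) := (# 1 :+ t) :* (# 1 :+ t) :- t) t)))

    sup≥0 : ∀ s → IsSupremum A s → 0# ≤ s
    sup≥0 s sup = proj₁ sup 0# 0∈A

    t≤sup² : ∀ s → IsSupremum A s → t ≤ s * s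
    t≤sup² s sup with <-or-≥ (s * s) t
    ... | inj₂ p = p
    ... | inj₁ p = let ε , ε>0 , q = square-gap (sup≥0 s sup) (<⇒pos p) in
      contradiction (proj₁ sup (s + ε) (+-nonneg (sup≥0 s sup) (pos⇒nonneg ε>0) ,
        ≤-respʳ (ring! 2 (λ s t → s :* s :+ (t :- s :* s) := t) s t) q)) (x<x+ε ε>0)

    -- ε = (s² - t)/2s
    overshoot : ∀ s r → 0# ≤ s → 0# < s * s - t → 0# < r → (2# * s) * r ≋ 1# → IsSupremum A s → ⊥
    overshoot s r s≥0 d>0 r>0 2sr sup =
      contradiction (proj₂ sup (s - (s * s - t) * r) (upper (s - (s * s - t) * r)
        (nonneg-by (*-nonneg (pos⇒nonneg r>0) (+-nonneg (square-nonneg s) t≥0)) (sqrt-identity₂ s t r 2sr))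
        (pos⇒< (pos-by (*-pos (*-pos d>0 r>0) (*-pos d>0 r>0)) (sqrt-identity₃ s t r 2sr)))))
        (x-ε<x (*-pos d>0 r>0))

    sup²≤t : ∀ s → IsSupremum A s → s * s ≤ t
    sup²≤t s sup with <-or-≥ t (s * s)
    ... | inj₂ p = p
    ... | inj₁ p = let r , r>0 , 2sr = reciprocal (*-pos 0<2 s>0) in
      ⊥-elim (overshoot s r (sup≥0 s sup) (<⇒pos p) r>0 2sr sup)
      where
      s>0 : 0# < s
      s>0 = nonneg∧≉0⇒pos (sup≥0 s sup) λ z → pos-not-nonpos (<⇒pos p) (nonneg-by t≥0 (sqrt-identity₁ s t z))

  -- The root is the supremum of all u ≥ 0 with u² ≤ t. If its square were too small, `square-gap`
  -- would give a larger member; if too large, a Newton step would give a smaller upper bound.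
  sqrt : ∀ {t} → 0# ≤ t → ∃ λ s → 0# ≤ s × s * s ≋ t
  sqrt {t} t≥0 = let s , sup = supremum A (0# , 0∈A) (1# + t , bounded) in
    s , sup≥0 s sup , ≤-antisym (sup²≤t s sup) (t≤sup² s sup)
    where open SquareRoot t t≥0

  fromℤ≡embed : ∀ i → fromℤ i ≡ embed i
  fromℤ≡embed (+ n)    = refl
  fromℤ≡embed -[1+ n ] = refl

  fromℤ≋coefficient : ∀ i → fromℤ i ≋ coefficient i
  fromℤ≋coefficient i = ≋-trans (reflexive (fromℤ≡embed i)) (≋-sym (coefficient≈embed i))

  fromℤ-+ : ∀ i j → fromℤ (i ℤ.+ j) ≋ fromℤ i + fromℤ j
  fromℤ-+ i j rewrite fromℤ≡embed (i ℤ.+ j) | fromℤ≡embed i | fromℤ≡embed j = embed-+ i j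

  fromℤ-* : ∀ i j → fromℤ (i ℤ.* j) ≋ fromℤ i * fromℤ j
  fromℤ-* i j rewrite fromℤ≡embed (i ℤ.* j) | fromℤ≡embed i | fromℤ≡embed j = embed-* i j

  fromℤ-neg : ∀ i → fromℤ (ℤ.- i) ≋ - fromℤ i
  fromℤ-neg i rewrite fromℤ≡embed (ℤ.- i) | fromℤ≡embed i = embed-neg i

  fromℤ-suc-pos : ∀ n → 0# < fromℤ (+ suc n)
  fromℤ-suc-pos n = pos-by (numeral-pos n) (≋-sym (fromℤ≋coefficient (+ suc n)))

  fromℤ-zero : ∀ i → fromℤ i ≋ 0# → i ≡ 0ℤ
  fromℤ-zero (+ zero)  _ = refl
  fromℤ-zero (+ suc n) p = ⊥-elim (pos⇒≉0 (fromℤ-suc-pos n) p)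
  fromℤ-zero -[1+ n ]  p = ⊥-elim (pos⇒≉0 (fromℤ-suc-pos n)
    (≋-trans (≋-sym (-‿involutive _)) (≋-trans (-‿cong p) -0#≈0#)))

  -- The set is closed under adding 1, so s - 1 would bound it as well.
  no-integer-supremum : ∀ s → IsSupremum (λ u → ∃ λ n → u ≋ fromℤ (+ n)) s → ⊥
  no-integer-supremum s sup = contradiction (proj₂ sup (s - 1#) upper) (x-ε<x 0<1)
    where
    upper : UpperBound (λ u → ∃ λ n → u ≋ fromℤ (+ n)) (s - 1#)
    upper u (n , p) = nonneg⇒≤ (nonneg-by (≤⇒nonneg (proj₁ sup (1# + u) (suc n , +-congˡ p)))
      (ring! 2 (λ s u → s :- (# 1 :+ u) := (s :- # 1) :- u) s u))

  archimedean : ∀ x → ∃ λ n → x < fromℤ (+ n)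
  archimedean x with em {∃ λ n → x < fromℤ (+ n)}
  ... | yes p = p
  ... | no ¬p = let s , sup = supremum (λ u → ∃ λ n → u ≋ fromℤ (+ n)) (0# , 0 , ≋-refl)
                      (x , λ { u (n , p) → ≤-respˡ (≋-sym p) (stable (λ q → ¬p (n , q))) })
                in ⊥-elim (no-integer-supremum s sup)

  -- Counts n down from a value with n - m > x; the first n - m not above x is the floor. The
  -- hypothesis -m ≤ x stops the count before n = 0 can still be too large.
  floor-step : ∀ x m → 0# ≤ x + fromℤ m → ∀ n → 0# < (fromℤ (+ n) - fromℤ m) - x →
               ∃ λ k → 0# ≤ x - fromℤ k × 0# ≤ 1# - (x - fromℤ k)
  floor-step x m base zero p =
    ⊥-elim (pos-not-nonpos p (nonneg-by base (ring! 2 (λ x m → x :+ m := :- ((# 0 :- m) :- x)) x (fromℤ m))))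
  floor-step x m base (suc n) p with pos⊎nonpos ((fromℤ (+ n) - fromℤ m) - x)
  ... | inj₁ q = floor-step x m base n q
  ... | inj₂ q = + n ℤ.- m ,
      nonneg-by q (≋-trans (ring! 3 (λ x n m → :- ((n :- m) :- x) := x :- (n :- m)) x (fromℤ (+ n)) (fromℤ m))
        (+-congˡ (-‿cong (≋-sym k≋)))) ,
      nonneg-by (pos⇒nonneg p) (≋-trans (ring! 3 (λ x n m → ((# 1 :+ n) :- m) :- x := # 1 :- (x :- (n :- m))) x (fromℤ (+ n)) (fromℤ m))
            (+-congˡ (-‿cong (+-congˡ (-‿cong (≋-sym k≋))))))
      where
      k≋ : fromℤ (+ n ℤ.- m) ≋ fromℤ (+ n) - fromℤ m
      k≋ = ≋-trans (fromℤ-+ (+ n) (ℤ.- m)) (+-congˡ (fromℤ-neg m))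

  floor : ∀ x → ∃ λ k → 0# ≤ x - fromℤ k × 0# ≤ 1# - (x - fromℤ k)
  floor x = let N , x<N = archimedean x
                M , -x<M = archimedean (- x) in floor-step x (+ M)
      (nonneg-by (pos⇒nonneg (<⇒pos -x<M)) (ring! 2 (λ x m → m :- (:- x) := x :+ m) x (fromℤ (+ M))))
      (N ℕ.+ M)
      (pos-by (<⇒pos x<N) (≋-trans (ring! 3 (λ x n m → n :- x := ((n :+ m) :- m) :- x) x (fromℤ (+ N)) (fromℤ (+ M)))
        (+-congʳ (+-congʳ (≋-sym (fromℤ-+ (+ N) (+ M)))))))

-- The action of Γ on the upper half-plane.

module HalfPlane (em : ExcludedMiddle 0ℓ) (ℝ : CompleteOrderedField) where
  open OrderedField em ℝ public
  open UpperHalfPlane ℝ public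
  private module Γ = Group PSL₂ℤ
  open Γ using (_⁻¹)

  reA reB reC reD : Γ → Scalar
  reA g = fromℤ (Mat.a (matrix g))
  reB g = fromℤ (Mat.b (matrix g))
  reC g = fromℤ (Mat.c (matrix g))
  reD g = fromℤ (Mat.d (matrix g))

  det-real : ∀ g → reA g * reD g - reB g * reC g ≋ 1#
  det-real (sl (mat a b c d) p) = ≋-sym (≋-trans (≋-trans (≋-sym (+-identityʳ 1#)) (reflexive (≡.cong fromℤ (≡.sym p))))
    (≋-trans (fromℤ-+ (a ℤ.* d) (ℤ.- (b ℤ.* c)))
      (+-cong (fromℤ-* a d) (≋-trans (fromℤ-neg (b ℤ.* c)) (-‿cong (fromℤ-* b c))))))

  -- |cz + d|², the factor by which Re gz, Im gz and |gz|² become polynomials in the coordinates of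
  -- z.
  den : Γ → ℍ → Scalar
  den g z = sq (reC g * x z + reD g) + sq (reC g * y z)

  -- The real part of (az + b) times the conjugate of cz + d, and |az + b|². Both are linear in Re z
  -- and |z|²; the action on forms rests on this.
  numX numN : Γ → ℍ → Scalar
  numX g z = reA g * reC g * normSq z + (reA g * reD g + reB g * reC g) * x z + reB g * reD g
  numN g z = sq (reA g) * normSq z + 2# * (reA g * reB g) * x z + sq (reB g)

  den-expand : ∀ g z → den g z ≋ sq (reC g) * normSq z + 2# * (reC g * reD g) * x z + sq (reD g)
  den-expand g z = ring! 4 (λ c d x y → (c :* x :+ d) :* (c :* x :+ d) :+ (c :* y) :* (c :* y)
      := c :* c :* (x :* x :+ y :* y) :+ # 2 :* (c :* d) :* x :+ d :* d) (reC g) (reD g) (x z) (y z)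

  -- If cz + d vanished, its imaginary part c Im z would give c = 0, and then d = 0, against
  -- determinant 1.
  den-pos : ∀ g z → 0# < den g z
  den-pos g z = nonneg∧≉0⇒pos (+-nonneg (square-nonneg _) (square-nonneg _)) impossible
    where
    impossible : ¬ (den g z ≋ 0#)
    impossible p = pos⇒≉0 0<1 (≋-trans (≋-sym (det-real g)) vanish)
      where
      cy≋0 : reC g * y z ≋ 0#
      cy≋0 = square-zero (sum-zeroʳ (square-nonneg _) (square-nonneg _) p)
      c≋0 : reC g ≋ 0#
      c≋0 = *-≋0 (pos⇒≉0 (y>0 z)) (≋-trans (*-comm _ _) cy≋0)
      cxd≋0 : reC g * x z + reD g ≋ 0#
      cxd≋0 = square-zero (sum-zeroˡ (square-nonneg _) (square-nonneg _) p)
      identity : ∀ a b c d x → c ≋ 0# → c * x + d ≋ 0# → a * d - b * c ≋ 0#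
      identity a b c d x p q = combine₂ (- (a * x + b)) a p q (ring! 5 (λ a b c d x →
        (a :* d :- b :* c) :- # 0 := (:- (a :* x :+ b)) :* (c :- # 0) :+ a :* (c :* x :+ d :- # 0)) a b c d x)
      vanish = identity (reA g) (reB g) (reC g) (reD g) (x z) c≋0 cxd≋0

  module ImageIdentities (a b c d x y : Scalar) (det : a * d - b * c ≋ 1#) where
    re im D n X N : Scalar
    re = c * x + d
    im = c * y
    D  = re * re + im * im
    n  = x * x + y * y
    X  = a * c * n + (a * d + b * c) * x + b * d
    N  = (a * a) * n + 2# * (a * b) * x + b * b

    module _ (u v : Scalar) (p : u * re - v * im ≋ a * x + b) (q : u * im + v * re ≋ a * y) where
      image-x : D * u ≋ X
      image-x = combine₂ re im p q (ring! 8 (λ a b c d x y u v →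
        let re = c :* x :+ d; im = c :* y; n = x :* x :+ y :* y in
        (re :* re :+ im :* im) :* u :- (a :* c :* n :+ (a :* d :+ b :* c) :* x :+ b :* d)
        := re :* (u :* re :- v :* im :- (a :* x :+ b)) :+ im :* (u :* im :+ v :* re :- a :* y)) a b c d x y u v)

      image-y : D * v ≋ y
      image-y = combine₃ (- im) re y p q det (ring! 8 (λ a b c d x y u v →
        let re = c :* x :+ d; im = c :* y in
        (re :* re :+ im :* im) :* v :- y
        := (:- im) :* (u :* re :- v :* im :- (a :* x :+ b)) :+ re :* (u :* im :+ v :* re :- a :* y)
           :+ y :* (a :* d :- b :* c :- # 1)) a b c d x y u v)

      image-n : D * (u * u + v * v) ≋ N
      image-n = ≋-trans
        (ring! 4 (λ r i u v → (r :* r :+ i :* i) :* (u :* u :+ v :* v)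
          := (u :* r :- v :* i) :* (u :* r :- v :* i) :+ (u :* i :+ v :* r) :* (u :* i :+ v :* r)) re im u v)
        (≋-trans (+-cong (*-cong p p) (*-cong q q))
          (ring! 4 (λ a b x y → (a :* x :+ b) :* (a :* x :+ b) :+ a :* y :* (a :* y)
            := (a :* a) :* (x :* x :+ y :* y) :+ # 2 :* (a :* b) :* x :+ b :* b) a b x y))

    module _ (r : Scalar) (p : D * r ≋ 1#) where
      preimage-re : (X * r) * re - (y * r) * im ≋ a * x + b
      preimage-re = combine₂ (a * x + b) (r * y * im) p det (ring! 7 (λ a b c d x y r →
        let re = c :* x :+ d; im = c :* y; n = x :* x :+ y :* y in
        ((a :* c :* n :+ (a :* d :+ b :* c) :* x :+ b :* d) :* r) :* re :- (y :* r) :* im :- (a :* x :+ b)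
        := (a :* x :+ b) :* ((re :* re :+ im :* im) :* r :- # 1) :+ (r :* y :* im) :* (a :* d :- b :* c :- # 1)) a b c d x y r)

      preimage-im : (X * r) * im + (y * r) * re ≋ a * y
      preimage-im = combine₂ (a * y) (- (r * y * re)) p det (ring! 7 (λ a b c d x y r →
        let re = c :* x :+ d; im = c :* y; n = x :* x :+ y :* y in
        ((a :* c :* n :+ (a :* d :+ b :* c) :* x :+ b :* d) :* r) :* im :+ (y :* r) :* re :- (a :* y)
        := (a :* y) :* ((re :* re :+ im :* im) :* r :- # 1) :+ (:- (r :* y :* re)) :* (a :* d :- b :* c :- # 1)) a b c d x y r)

  module I (g : Γ) (z : ℍ) = ImageIdentities (reA g) (reB g) (reC g) (reD g) (x z) (y z) (det-real g)

  Maps-x : ∀ g {z w} → Maps g z w → den g z * x w ≋ numX g z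
  Maps-x g {z} {w} (p , q) = I.image-x g z (x w) (y w) p q

  Maps-y : ∀ g {z w} → Maps g z w → den g z * y w ≋ y z
  Maps-y g {z} {w} (p , q) = I.image-y g z (x w) (y w) p q

  Maps-n : ∀ g {z w} → Maps g z w → den g z * normSq w ≋ numN g z
  Maps-n g {z} {w} (p , q) = I.image-n g z (x w) (y w) p q

  abstract
    infixr 6 _▸_

    -- A value for the relation `Maps`. It is sealed: `Maps-▸` and the uniqueness of images carry
    -- all later reasoning, and the chosen reciprocal never unfolds.
    _▸_ : Γ → ℍ → ℍ
    g ▸ z = (numX g z * r) +i (y z * r) ⟨ *-pos (y>0 z) (proj₁ (proj₂ (reciprocal (den-pos g z)))) ⟩
      where
      r : Scalar
      r = proj₁ (reciprocal (den-pos g z))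

    Maps-▸ : ∀ g z → Maps g z (g ▸ z)
    Maps-▸ g z = let r , _ , p = reciprocal (den-pos g z) in I.preimage-re g z r p , I.preimage-im g z r p

  infix 4 _≃_

  -- `_≈ʰ_` as a record, so that z and w can be inferred.
  record _≃_ (z w : ℍ) : Set where
    constructor by
    field coordinates : z ≈ʰ w
  open _≃_ public

  ≃-refl : ∀ {z} → z ≃ z
  ≃-refl = by (≋-refl , ≋-refl)

  ≃-sym : ∀ {z w} → z ≃ w → w ≃ z
  ≃-sym (by (p , q)) = by (≋-sym p , ≋-sym q)

  ≃-trans : ∀ {z w v} → z ≃ w → w ≃ v → z ≃ v
  ≃-trans (by (p , q)) (by (p′ , q′)) = by (≋-trans p p′ , ≋-trans q q′)

  normSq-cong : ∀ {z w} → z ≃ w → normSq z ≋ normSq w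
  normSq-cong (by (p , q)) = +-cong (*-cong p p) (*-cong q q)

  -- Since y > 0, it is determined by y² = |z|² - x².
  ≃-from-normSq : ∀ {z w} → x z ≋ x w → normSq z ≋ normSq w → z ≃ w
  ≃-from-normSq {z} {w} p q = by $ p , square-injective (pos⇒nonneg (y>0 z)) (pos⇒nonneg (y>0 w))
    (identity (x z) (y z) (x w) (y w) p q)
    where
    identity : ∀ x y x′ y′ → x ≋ x′ → x * x + y * y ≋ x′ * x′ + y′ * y′ → y * y ≋ y′ * y′
    identity x y x′ y′ p q = combine₂ (- (x + x′)) 1# p q (ring! 4 (λ x y x′ y′ →
      y :* y :- y′ :* y′ := (:- (x :+ x′)) :* (x :- x′) :+ # 1 :* (x :* x :+ y :* y :- (x′ :* x′ :+ y′ :* y′))) x y x′ y′)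

  Maps-unique : ∀ g {z w w′} → Maps g z w → Maps g z w′ → w ≃ w′
  Maps-unique g {z} {w} {w′} m m′ = by $
    *-cancel (den-pos g z) (≋-trans (Maps-x g {z} {w} m) (≋-sym (Maps-x g {z} {w′} m′))) ,
    *-cancel (den-pos g z) (≋-trans (Maps-y g {z} {w} m) (≋-sym (Maps-y g {z} {w′} m′)))

  Maps⇒≈ : ∀ g {z w} → Maps g z w → w ≃ g ▸ z
  Maps⇒≈ g {z} {w} m = Maps-unique g {z} {w} {g ▸ z} m (Maps-▸ g z)

  Maps-resp : ∀ g {z z′ w w′} → z ≃ z′ → w ≃ w′ → Maps g z w → Maps g z′ w′
  Maps-resp g (by (zx , zy)) (by (wx , wy)) (p , q) =
    ≋-trans (≋-sym (+-cong (*-cong wx (+-congʳ (*-congˡ zx))) (-‿cong (*-cong wy (*-congˡ zy)))))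
      (≋-trans p (+-congʳ (*-congˡ zx))) ,
    ≋-trans (≋-sym (+-cong (*-cong wx (*-congˡ zy)) (*-cong wy (+-congʳ (*-congˡ zx)))))
      (≋-trans q (*-congˡ zy))

  Maps-neg : ∀ {a b c d x y u v} →
    u * (c * x + d) - v * (c * y) ≋ a * x + b × u * (c * y) + v * (c * x + d) ≋ a * y →
    u * ((- c) * x + - d) - v * ((- c) * y) ≋ (- a) * x + - b × u * ((- c) * y) + v * ((- c) * x + - d) ≋ (- a) * y
  Maps-neg {a} {b} {c} {d} {x} {y} {u} {v} (p , q) =
    combine₁ (- 1#) p (ring! 8 (λ a b c d x y u v →
      u :* ((:- c) :* x :+ (:- d)) :- v :* ((:- c) :* y) :- ((:- a) :* x :+ (:- b))
      := (:- # 1) :* (u :* (c :* x :+ d) :- v :* (c :* y) :- (a :* x :+ b))) a b c d x y u v) ,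
    combine₁ (- 1#) q (ring! 8 (λ a b c d x y u v →
      u :* ((:- c) :* y) :+ v :* ((:- c) :* x :+ (:- d)) :- (:- a) :* y
      := (:- # 1) :* (u :* (c :* y) :+ v :* (c :* x :+ d) :- a :* y)) a b c d x y u v)

  Maps-coefficients : ∀ {a b c d a′ b′ c′ d′ x y u v} → a ≋ a′ → b ≋ b′ → c ≋ c′ → d ≋ d′ →
    u * (c * x + d) - v * (c * y) ≋ a * x + b × u * (c * y) + v * (c * x + d) ≋ a * y →
    u * (c′ * x + d′) - v * (c′ * y) ≋ a′ * x + b′ × u * (c′ * y) + v * (c′ * x + d′) ≋ a′ * y
  Maps-coefficients a b c d (p , q) =
    ≋-trans (≋-sym (+-cong (*-congˡ (+-cong (*-congʳ c) d)) (-‿cong (*-congˡ (*-congʳ c)))))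
      (≋-trans p (+-cong (*-congʳ a) b)) ,
    ≋-trans (≋-sym (+-cong (*-congˡ (*-congʳ c)) (*-congˡ (+-cong (*-congʳ c) d))))
      (≋-trans q (*-congʳ a))

  Maps-cong : ∀ {g h} z w → g Γ.≈ h → Maps g z w → Maps h z w
  Maps-cong _ _ (plus refl) m = m
  Maps-cong {g} {sl (mat a b c d) _} z w (minus refl) m =
    Maps-coefficients {x = x z} {y = y z} {u = x w} {v = y w} (flip-sign a) (flip-sign b) (flip-sign c) (flip-sign d)
      (Maps-neg {x = x z} {y = y z} {u = x w} {v = y w} m)
    where
    flip-sign : ∀ i → - fromℤ (ℤ.- i) ≋ fromℤ i
    flip-sign i = ≋-trans (-‿cong (fromℤ-neg i)) (-‿involutive (fromℤ i))

  Maps-∘ : ∀ g h z v w → Maps h z v → Maps g v w → Maps (g · h) z w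
  Maps-∘ g@(sl (mat a b c d) _) h@(sl (mat a′ b′ c′ d′) _) z v w (p , q) (p′ , q′) =
    Maps-coefficients {x = x z} {y = y z} {u = x w} {v = y w} (entry a a′ b c′) (entry a b′ b d′) (entry c a′ d c′) (entry c b′ d d′)
     (compose (reA g) (reB g) (reC g) (reD g) (reA h) (reB h) (reC h) (reD h) (x z) (y z) (x v) (y v) (x w) (y w) p q p′ q′)
    where
    entry : ∀ i j k l → fromℤ i * fromℤ j + fromℤ k * fromℤ l ≋ fromℤ (i ℤ.* j ℤ.+ k ℤ.* l)
    entry i j k l = ≋-sym (≋-trans (fromℤ-+ (i ℤ.* j) (k ℤ.* l)) (+-cong (fromℤ-* i j) (fromℤ-* k l)))
    combine₄ : ∀ {x y l r l′ r′ l″ r″ l‴ r‴} k k′ k″ k‴ → l ≋ r → l′ ≋ r′ → l″ ≋ r″ → l‴ ≋ r‴ →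
      x - y ≋ (k * (l - r) + k′ * (l′ - r′)) + (k″ * (l″ - r″) + k‴ * (l‴ - r‴)) → x ≋ y
    combine₄ k k′ k″ k‴ p q r s e = difference-zero (≋-trans e (≋-trans (+-cong (vanish k k′ p q) (vanish k″ k‴ r s)) (+-identityˡ 0#)))
      where
      vanish : ∀ {l r l′ r′} k k′ → l ≋ r → l′ ≋ r′ → k * (l - r) + k′ * (l′ - r′) ≋ 0#
      vanish k k′ p q = ≋-trans (+-cong (≋-trans (*-congˡ (zero-difference p)) (zeroʳ k))
                                        (≋-trans (*-congˡ (zero-difference q)) (zeroʳ k′))) (+-identityˡ 0#)
    compose : ∀ a b c d a′ b′ c′ d′ x y s t u v →
      s * (c′ * x + d′) - t * (c′ * y) ≋ a′ * x + b′ → s * (c′ * y) + t * (c′ * x + d′) ≋ a′ * y →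
      u * (c * s + d) - v * (c * t) ≋ a * s + b → u * (c * t) + v * (c * s + d) ≋ a * t →
      let A = a * a′ + b * c′; B = a * b′ + b * d′; C = c * a′ + d * c′; D = c * b′ + d * d′ in
      u * (C * x + D) - v * (C * y) ≋ A * x + B × u * (C * y) + v * (C * x + D) ≋ A * y
    compose a b c d a′ b′ c′ d′ x y s t u v p q p′ q′ =
      -- In complex terms the equation of the composite is (a - wc) times the equation of the inner
      -- map plus (c′z + d′) times that of the outer one, where w is the final image; the four
      -- multipliers come from the real and imaginary parts of these factors.
      combine₄ (a - u * c) (v * c) (c′ * x + d′) (- (c′ * y)) p q p′ q′
        (ring! 14 (λ a b c d a′ b′ c′ d′ x y s t u v →
          let A = a :* a′ :+ b :* c′; B = a :* b′ :+ b :* d′; C = c :* a′ :+ d :* c′; D = c :* b′ :+ d :* d′ in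
          u :* (C :* x :+ D) :- v :* (C :* y) :- (A :* x :+ B)
          := ((a :- u :* c) :* (s :* (c′ :* x :+ d′) :- t :* (c′ :* y) :- (a′ :* x :+ b′))
              :+ (v :* c) :* (s :* (c′ :* y) :+ t :* (c′ :* x :+ d′) :- a′ :* y))
            :+ ((c′ :* x :+ d′) :* (u :* (c :* s :+ d) :- v :* (c :* t) :- (a :* s :+ b))
              :+ (:- (c′ :* y)) :* (u :* (c :* t) :+ v :* (c :* s :+ d) :- a :* t))) a b c d a′ b′ c′ d′ x y s t u v) ,
      combine₄ (- (v * c)) (a - u * c) (c′ * y) (c′ * x + d′) p q p′ q′
        (ring! 14 (λ a b c d a′ b′ c′ d′ x y s t u v →
          let A = a :* a′ :+ b :* c′; B = a :* b′ :+ b :* d′; C = c :* a′ :+ d :* c′; D = c :* b′ :+ d :* d′ in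
          u :* (C :* y) :+ v :* (C :* x :+ D) :- A :* y
          := ((:- (v :* c)) :* (s :* (c′ :* x :+ d′) :- t :* (c′ :* y) :- (a′ :* x :+ b′))
              :+ (a :- u :* c) :* (s :* (c′ :* y) :+ t :* (c′ :* x :+ d′) :- a′ :* y))
            :+ ((c′ :* y) :* (u :* (c :* s :+ d) :- v :* (c :* t) :- (a :* s :+ b))
              :+ (c′ :* x :+ d′) :* (u :* (c :* t) :+ v :* (c :* s :+ d) :- a :* t))) a b c d a′ b′ c′ d′ x y s t u v)

  Maps-one : ∀ z → Maps one z z
  Maps-one z = ring! 2 (λ x y → x :* (# 0 :* x :+ (# 1 :+ # 0)) :- y :* (# 0 :* y) := (# 1 :+ # 0) :* x :+ # 0) (x z) (y z) ,
    ring! 2 (λ x y → x :* (# 0 :* y) :+ y :* (# 0 :* x :+ (# 1 :+ # 0)) := (# 1 :+ # 0) :* y) (x z) (y z)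

  ▸-cong : ∀ {g h z w} → g Γ.≈ h → z ≃ w → g ▸ z ≃ h ▸ w
  ▸-cong {g} {h} {z} {w} p q = Maps⇒≈ h {w} {g ▸ z} (Maps-resp h {z} {w} {g ▸ z} {g ▸ z} q ≃-refl (Maps-cong {g} {h} z (g ▸ z) p (Maps-▸ g z)))

  ▸-congʳ : ∀ g {z w} → z ≃ w → g ▸ z ≃ g ▸ w
  ▸-congʳ g = ▸-cong {g} {g} Γ.refl

  ▸-congˡ : ∀ {g h} z → g Γ.≈ h → g ▸ z ≃ h ▸ z
  ▸-congˡ {g} {h} z p = ▸-cong {g} {h} p ≃-refl

  ▸-one : ∀ z → one ▸ z ≃ z
  ▸-one z = ≃-sym (Maps⇒≈ one {z} {z} (Maps-one z))

  ▸-· : ∀ g h z → (g · h) ▸ z ≃ g ▸ h ▸ z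
  ▸-· g h z = ≃-sym (Maps⇒≈ (g · h) {z} {g ▸ h ▸ z} (Maps-∘ g h z (h ▸ z) (g ▸ (h ▸ z)) (Maps-▸ h z) (Maps-▸ g (h ▸ z))))

  ▸-inverseˡ : ∀ g z → g ⁻¹ ▸ g ▸ z ≃ z
  ▸-inverseˡ g z = ≃-trans (≃-sym (▸-· (g ⁻¹) g z))
    (≃-trans (▸-congˡ {g ⁻¹ · g} {one} z (Γ.inverseˡ g)) (▸-one z))

  ▸-inverseʳ : ∀ g z → g ▸ g ⁻¹ ▸ z ≃ z
  ▸-inverseʳ g z = ≃-trans (≃-sym (▸-· g (g ⁻¹) z))
    (≃-trans (▸-congˡ {g · g ⁻¹} {one} z (Γ.inverseʳ g)) (▸-one z))

-- Forms α + β Re z + γ|z|² and the half-planes they bound.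

module Forms (em : ExcludedMiddle 0ℓ) (ℝ : CompleteOrderedField) where
  open HalfPlane em ℝ public
  private module Γ = Group PSL₂ℤ
  open Γ using (_⁻¹)

  -- Every closed half-plane is given by an inequality `value ℓ z` ≥ 0, so convexity, closedness and
  -- the side of a geodesic become questions about signs.
  record Form : Set where
    constructor form
    field α β γ : Scalar

  value : Form → ℍ → Scalar
  value (form α β γ) z = α + β * x z + γ * normSq z

  negate : Form → Form
  negate (form α β γ) = form (- α) (- β) (- γ)

  -- The composite of the form with g after clearing |cz + d|². On (1, Re z, |z|²) the matrix g acts
  -- through its symmetric square, and this is the transposed action.
  pull : Γ → Form → Form
  pull g (form α β γ) = let a = reA g; b = reB g; c = reC g; d = reD g in form
    (α * sq d + β * (b * d) + γ * sq b)
    (α * (2# * (c * d)) + β * (a * d + b * c) + γ * (2# * (a * b)))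
    (α * sq c + β * (a * c) + γ * sq a)

  value-pull : ∀ g ℓ z → den g z * value ℓ (g ▸ z) ≋ value (pull g ℓ) z
  value-pull g (form α β γ) z =
    identity (reA g) (reB g) (reC g) (reD g) (x z) (normSq z) α β γ (den g z) (x (g ▸ z)) (normSq (g ▸ z))
      (Maps-x g {z} {g ▸ z} (Maps-▸ g z)) (Maps-n g {z} {g ▸ z} (Maps-▸ g z)) (den-expand g z)
    where
    identity : ∀ a b c d x n α β γ D u m →
      D * u ≋ a * c * n + (a * d + b * c) * x + b * d →
      D * m ≋ (a * a) * n + 2# * (a * b) * x + b * b →
      D ≋ (c * c) * n + 2# * (c * d) * x + d * d →
      D * (α + β * u + γ * m) ≋ (α * (d * d) + β * (b * d) + γ * (b * b))
        + (α * (2# * (c * d)) + β * (a * d + b * c) + γ * (2# * (a * b))) * x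
        + (α * (c * c) + β * (a * c) + γ * (a * a)) * n
    identity a b c d x n α β γ D u m p q r = combine₃ β γ α p q r (ring! 12 (λ a b c d x n α β γ D u m →
      D :* (α :+ β :* u :+ γ :* m) :- ((α :* (d :* d) :+ β :* (b :* d) :+ γ :* (b :* b))
        :+ (α :* (# 2 :* (c :* d)) :+ β :* (a :* d :+ b :* c) :+ γ :* (# 2 :* (a :* b))) :* x
        :+ (α :* (c :* c) :+ β :* (a :* c) :+ γ :* (a :* a)) :* n)
      := β :* (D :* u :- (a :* c :* n :+ (a :* d :+ b :* c) :* x :+ b :* d))
        :+ γ :* (D :* m :- ((a :* a) :* n :+ # 2 :* (a :* b) :* x :+ b :* b))
        :+ α :* (D :- ((c :* c) :* n :+ # 2 :* (c :* d) :* x :+ d :* d))) a b c d x n α β γ D u m)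

  value-cong : ∀ ℓ {z w} → z ≃ w → value ℓ z ≋ value ℓ w
  value-cong _ p = +-cong (+-congˡ (*-congˡ (proj₁ (coordinates p)))) (*-congˡ (normSq-cong p))

  value-negate : ∀ ℓ z → value (negate ℓ) z ≋ - value ℓ z
  value-negate (form α β γ) z = ring! 5 (λ α β γ x n → (:- α) :+ (:- β) :* x :+ (:- γ) :* n
    := :- (α :+ β :* x :+ γ :* n)) α β γ (x z) (normSq z)

  pull-pos : ∀ g ℓ z → 0# < value ℓ (g ▸ z) → 0# < value (pull g ℓ) z
  pull-pos g ℓ z p = pos-by (*-pos (den-pos g z) p) (value-pull g ℓ z)

  pos-pull : ∀ g ℓ z → 0# < value (pull g ℓ) z → 0# < value ℓ (g ▸ z)
  pos-pull g ℓ z p = pos-cancel (den-pos g z) (pos-by p (≋-sym (value-pull g ℓ z)))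

  pull-nonneg : ∀ g ℓ z → 0# ≤ value ℓ (g ▸ z) → 0# ≤ value (pull g ℓ) z
  pull-nonneg g ℓ z p = nonneg-by (*-nonneg (pos⇒nonneg (den-pos g z)) p) (value-pull g ℓ z)

  nonneg-pull : ∀ g ℓ z → 0# ≤ value (pull g ℓ) z → 0# ≤ value ℓ (g ▸ z)
  nonneg-pull g ℓ z p = nonneg-cancel (den-pos g z) (nonneg-by p (≋-sym (value-pull g ℓ z)))

  Interior-⊆ : ∀ {A B : Region} {z} → A ⊆ B → Interior A z → Interior B z
  Interior-⊆ A⊆B (ε , ε>0 , ball) = ε , ε>0 , λ w∈ → A⊆B (ball w∈)

  Interior-∩ : ∀ {A B : Region} {z} → Interior A z → Interior B z → Interior (λ w → A w × B w) z
  Interior-∩ (ε , ε>0 , ball) (ε′ , ε′>0 , ball′) with total ε ε′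
  ... | inj₁ ε≤ε′ = ε , ε>0 , λ w∈ → ball w∈ , ball′ (<-≤-trans w∈ ε≤ε′)
  ... | inj₂ ε′≤ε = ε′ , ε′>0 , λ w∈ → ball (<-≤-trans w∈ ε′≤ε) , ball′ w∈

  Ball-centre : ∀ z {ε} → 0# < ε → Ball z ε z
  Ball-centre z p q = p (≤-respʳ (ring! 2 (λ x y → (x :- x) :* (x :- x) :+ (y :- y) :* (y :- y) := # 0) (x z) (y z)) q)

  -- 4m(m + Bu + Cv + γs) is a sum of squares plus 2m² - 4Ks, where s = u² + v².
  module Openness (m B C γ : Scalar) where
    K : Scalar
    K = 2# * 2# * (B * B + C * C + γ * γ + m * m)

    K-pos : 0# < m → 0# < K
    K-pos p = *-pos (*-pos 0<2 0<2) (pos-by (+-pos (*-pos p p)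
      (+-nonneg (+-nonneg (square-nonneg B) (square-nonneg C)) (square-nonneg γ))) (+-comm _ _))

    identity : ∀ u v ε → K * ε ≋ m * m →
      m * m + K * (ε - (u * u + v * v))
      + (((m + 2# * B * u) * (m + 2# * B * u) + (m + 2# * C * v) * (m + 2# * C * v)
          + ((2# * B * v) * (2# * B * v) + (2# * C * u) * (2# * C * u)))
         + (u * u + v * v) * (2# * ((m + γ) * (m + γ) + (m * m + γ * γ))))
      ≋ 2# * 2# * m * (m + B * u + C * v + γ * (u * u + v * v))
    identity u v ε p = combine₁ 1# p (ring! 7 (λ m B C γ u v ε →
      let K = # 2 :* # 2 :* (B :* B :+ C :* C :+ γ :* γ :+ m :* m) in
      m :* m :+ K :* (ε :- (u :* u :+ v :* v))
      :+ (((m :+ # 2 :* B :* u) :* (m :+ # 2 :* B :* u) :+ (m :+ # 2 :* C :* v) :* (m :+ # 2 :* C :* v)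
          :+ ((# 2 :* B :* v) :* (# 2 :* B :* v) :+ (# 2 :* C :* u) :* (# 2 :* C :* u)))
         :+ (u :* u :+ v :* v) :* (# 2 :* ((m :+ γ) :* (m :+ γ) :+ (m :* m :+ γ :* γ))))
      :- # 2 :* # 2 :* m :* (m :+ B :* u :+ C :* v :+ γ :* (u :* u :+ v :* v))
      := # 1 :* (K :* ε :- m :* m)) m B C γ u v ε)

    lower : ∀ u v ε → 0# < m → K * ε ≋ m * m → u * u + v * v < ε →
            0# < m + B * u + C * v + γ * (u * u + v * v)
    lower u v ε m>0 p q = pos-cancel (*-pos (*-pos 0<2 0<2) m>0) (pos-by
      (+-pos (+-pos (*-pos m>0 m>0) (*-nonneg (pos⇒nonneg (K-pos m>0)) (pos⇒nonneg (<⇒pos q))))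
        (+-nonneg (+-nonneg (+-nonneg (square-nonneg (m + 2# * B * u)) (square-nonneg (m + 2# * C * v)))
                            (+-nonneg (square-nonneg (2# * B * v)) (square-nonneg (2# * C * u))))
          (*-nonneg (+-nonneg (square-nonneg u) (square-nonneg v))
            (*-nonneg (pos⇒nonneg 0<2) (+-nonneg (square-nonneg (m + γ)) (+-nonneg (square-nonneg m) (square-nonneg γ)))))))
      (identity u v ε p))

    radius : 0# < m → ∃ λ ε → 0# < ε × K * ε ≋ m * m
    radius m>0 = let r , r>0 , p = reciprocal (K-pos m>0) in
      m * m * r , *-pos (*-pos m>0 m>0) r>0 ,
      combine₁ (m * m) p (ring! 3 (λ K m r → K :* (m :* m :* r) :- m :* m := m :* m :* (K :* r :- # 1)) K m r)

  -- The second-order term is γ times the squared Euclidean distance, which is the shape that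
  -- `Openness` bounds from below.
  taylor : ∀ α β γ x y x′ y′ →
    (α + β * x + γ * (x * x + y * y)) + (β + 2# * γ * x) * (x′ - x) + (2# * γ * y) * (y′ - y)
      + γ * ((x′ - x) * (x′ - x) + (y′ - y) * (y′ - y))
    ≋ α + β * x′ + γ * (x′ * x′ + y′ * y′)
  taylor = ring! 7 λ α β γ x y x′ y′ →
    (α :+ β :* x :+ γ :* (x :* x :+ y :* y)) :+ (β :+ # 2 :* γ :* x) :* (x′ :- x) :+ (# 2 :* γ :* y) :* (y′ :- y)
      :+ γ :* ((x′ :- x) :* (x′ :- x) :+ (y′ :- y) :* (y′ :- y))
    := α :+ β :* x′ :+ γ :* (x′ :* x′ :+ y′ :* y′)

  value-open : ∀ ℓ z → 0# < value ℓ z → Interior (λ w → 0# < value ℓ w) z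
  value-open ℓ@(form α β γ) z p = let ε , ε>0 , q = O.radius p in
    ε , ε>0 , λ {w} w∈ → pos-by (O.lower (x w - x z) (y w - y z) ε p q w∈) (taylor α β γ (x z) (y z) (x w) (y w))
    where module O = Openness (value ℓ z) (β + 2# * γ * x z) (2# * γ * y z) γ

  value-▸-open : ∀ g ℓ z → 0# < value ℓ (g ▸ z) → Interior (λ w → 0# < value ℓ (g ▸ w)) z
  value-▸-open g ℓ z p = Interior-⊆ {z = z} (λ {w} → pos-pull g ℓ w) (value-open (pull g ℓ) z (pull-pos g ℓ z p))

  closure-nonneg : ∀ {A : Region} g ℓ {z} → (∀ {w} → A w → 0# ≤ value ℓ (g ▸ w)) → Closure A z → 0# ≤ value ℓ (g ▸ z)
  closure-nonneg {A} g ℓ {z} A≥0 z∈ with nonneg⊎neg (value ℓ (g ▸ z))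
  ... | inj₁ p = p
  ... | inj₂ p = ⊥-elim (absurd (value-▸-open g (negate ℓ) z (pos-by p (≋-sym (value-negate ℓ (g ▸ z))))))
    where
    absurd : Interior (λ w → 0# < value (negate ℓ) (g ▸ w)) z → ⊥
    absurd (ε , ε>0 , ball) = let w , w∈ball , w∈A = z∈ ε ε>0 in
      neg-not-nonneg (pos-by (ball w∈ball) (value-negate ℓ (g ▸ w))) (A≥0 w∈A)

  -- `Between` is a convex combination in exactly the coordinates in which forms are affine.
  Between-value : ∀ α β γ {p q z} (b : Between p q z) → let t = proj₁ b in
    value (form α β γ) z ≋ (1# - t) * value (form α β γ) p + t * value (form α β γ) q
  Between-value α β γ {p} {q} {z} (t , _ , _ , e , e′) =
    identity α β γ t (x p) (normSq p) (x q) (normSq q) (x z) (normSq z) e e′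
    where
    identity : ∀ α β γ t x n x′ n′ u m → u ≋ (1# - t) * x + t * x′ → m ≋ (1# - t) * n + t * n′ →
      α + β * u + γ * m ≋ (1# - t) * (α + β * x + γ * n) + t * (α + β * x′ + γ * n′)
    identity α β γ t x n x′ n′ u m p q = combine₂ β γ p q (ring! 10 (λ α β γ t x n x′ n′ u m →
      α :+ β :* u :+ γ :* m :- ((# 1 :- t) :* (α :+ β :* x :+ γ :* n) :+ t :* (α :+ β :* x′ :+ γ :* n′))
      := β :* (u :- ((# 1 :- t) :* x :+ t :* x′)) :+ γ :* (m :- ((# 1 :- t) :* n :+ t :* n′))) α β γ t x n x′ n′ u m)

  Between-nonneg : ∀ ℓ {p q z} → 0# ≤ value ℓ p → 0# ≤ value ℓ q → Between p q z → 0# ≤ value ℓ z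
  Between-nonneg (form α β γ) {p} {q} {z} p≥0 q≥0 b@(t , t≥0 , t≤1 , _) =
    nonneg-by (+-nonneg (*-nonneg (≤⇒nonneg t≤1) p≥0) (*-nonneg t≥0 q≥0)) (≋-sym (Between-value α β γ {p} {q} {z} b))

  Between-▸-nonneg : ∀ g ℓ {p q z} → 0# ≤ value ℓ (g ▸ p) → 0# ≤ value ℓ (g ▸ q) → Between p q z → 0# ≤ value ℓ (g ▸ z)
  Between-▸-nonneg g ℓ {p} {q} {z} p≥0 q≥0 b =
    nonneg-pull g ℓ z (Between-nonneg (pull g ℓ) {p} {q} {z} (pull-nonneg g ℓ p p≥0) (pull-nonneg g ℓ q q≥0) b)

  -- τ = b / (b + 1 + a²) works, because b - τa = τ(b + 1 - a + a²) and 1 - a + a² is positive.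
  small : ∀ a b → 0# < b → ∃ λ τ → 0# < τ × 0# < 1# - τ × 0# < b - τ * a
  small a b b>0 = let r , r>0 , p = reciprocal N>0 in b * r , *-pos b>0 r>0 ,
      pos-by (*-pos r>0 (+-pos 0<1 (square-nonneg a))) (identity₁ r p) ,
      pos-by (*-pos (*-pos b>0 r>0) (+-pos b>0 quadratic-nonneg)) (identity₂ r p)
    where
    N>0 : 0# < b + (1# + a * a)
    N>0 = +-pos b>0 (+-nonneg 0≤1 (square-nonneg a))
    quadratic-nonneg : 0# ≤ 1# - a + a * a
    quadratic-nonneg = nonneg-cancel (*-pos 0<2 0<2) (nonneg-by (+-nonneg (square-nonneg (2# * a - 1#)) (numeral-nonneg 3))
      (ring! 1 (λ a → (# 2 :* a :- # 1) :* (# 2 :* a :- # 1) :+ # 3 := # 2 :* # 2 :* (# 1 :- a :+ a :* a)) a))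
    identity₁ : ∀ r → (b + (1# + a * a)) * r ≋ 1# → r * (1# + a * a) ≋ 1# - b * r
    identity₁ r p = combine₁ 1# p (ring! 3 (λ a b r → r :* (# 1 :+ a :* a) :- (# 1 :- b :* r)
      := # 1 :* ((b :+ (# 1 :+ a :* a)) :* r :- # 1)) a b r)
    identity₂ : ∀ r → (b + (1# + a * a)) * r ≋ 1# → b * r * (b + (1# - a + a * a)) ≋ b - (b * r) * a
    identity₂ r p = combine₁ b p (ring! 3 (λ a b r → b :* r :* (b :+ (# 1 :- a :+ a :* a)) :- (b :- (b :* r) :* a)
      := b :* ((b :+ (# 1 :+ a :* a)) :* r :- # 1)) a b r)

  -- The new difference is the convex combination of b - τa and b with weights s and 1 - s.
  shrink : ∀ {a b τ s} → 0# < b → 0# < s → 0# < 1# - s → 0# < b - τ * a → 0# < b - (τ * s) * a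
  shrink {a} {b} {τ} {s} b>0 s>0 s<1 p = pos-by (+-pos (*-pos s>0 p) (*-nonneg (pos⇒nonneg s<1) (pos⇒nonneg b>0)))
    (ring! 4 (λ a b τ s → s :* (b :- τ :* a) :+ (# 1 :- s) :* b := b :- (τ :* s) :* a) a b τ s)

  product<1 : ∀ {σ τ} → 0# < τ → 0# < 1# - σ → 0# < 1# - τ → 0# < 1# - σ * τ
  product<1 {σ} {τ} τ>0 σ<1 τ<1 = pos-by (+-pos τ<1 (*-nonneg (pos⇒nonneg τ>0) (pos⇒nonneg σ<1)))
    (ring! 2 (λ σ τ → (# 1 :- τ) :+ τ :* (# 1 :- σ) := # 1 :- σ :* τ) σ τ)

  -- The product of three separate choices satisfies all three bounds, by `shrink`.
  small₃ : ∀ {a b a′ b′ a″ b″} → 0# < b → 0# < b′ → 0# < b″ →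
           ∃ λ τ → 0# < τ × 0# < 1# - τ × 0# < b - τ * a × 0# < b′ - τ * a′ × 0# < b″ - τ * a″
  small₃ {a} {b} {a′} {b′} {a″} {b″} b>0 b′>0 b″>0 =
    let σ , σ>0 , σ<1 , p = small a b b>0
        τ , τ>0 , τ<1 , p′ = small a′ b′ b′>0
        υ , υ>0 , υ<1 , p″ = small a″ b″ b″>0
    in σ * τ * υ , *-pos (*-pos σ>0 τ>0) υ>0 , product<1 υ>0 (product<1 τ>0 σ<1 τ<1) υ<1 ,
       shrink {a} {b} {σ * τ} b>0 υ>0 υ<1 (shrink {a} {b} {σ} b>0 τ>0 τ<1 p) ,
       shrink {a′} {b′} {σ * τ} b′>0 υ>0 υ<1 (pos-by (shrink {a′} {b′} {τ} b′>0 σ>0 σ<1 p′) (+-congˡ (-‿cong (*-congʳ (*-comm τ σ))))) ,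
       pos-by (shrink {a″} {b″} {υ} b″>0 (*-pos σ>0 τ>0) (product<1 τ>0 σ<1 τ<1) p″) (+-congˡ (-‿cong (*-congʳ (*-comm υ _))))

  -- A step along -∇ℓ.
  module Descent (α β γ x y : Scalar) where
    B C M : Scalar
    B = β + 2# * γ * x
    C = 2# * γ * y
    M = B * B + C * C

    step-value : ∀ τ → (α + β * x + γ * (x * x + y * y)) ≋ 0# → τ * M * (1# - τ * γ) ≋
      - (α + β * (x - τ * B) + γ * ((x - τ * B) * (x - τ * B) + (y - τ * C) * (y - τ * C)))
    step-value τ p = combine₁ 1# p (ring! 6 (λ α β γ x y τ →
      let B = β :+ # 2 :* γ :* x; C = # 2 :* γ :* y in
      τ :* (B :* B :+ C :* C) :* (# 1 :- τ :* γ)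
      :- (:- (α :+ β :* (x :- τ :* B) :+ γ :* ((x :- τ :* B) :* (x :- τ :* B) :+ (y :- τ :* C) :* (y :- τ :* C))))
      := # 1 :* (α :+ β :* x :+ γ :* (x :* x :+ y :* y) :- # 0)) α β γ x y τ)

    gradient-zero : M ≋ 0# → 0# < y → γ ≋ 0# × β ≋ 0#
    gradient-zero p y>0 = γ≋0 , β≋0
      where
      γ≋0 : γ ≋ 0#
      γ≋0 = *-≋0 (pos⇒≉0 (*-pos 0<2 y>0)) (≋-trans (ring! 2 (λ γ y → # 2 :* y :* γ := # 2 :* γ :* y) γ y)
        (square-zero (sum-zeroʳ (square-nonneg B) (square-nonneg C) p)))
      β≋0 : β ≋ 0#
      β≋0 = combine₂ 1# (- (2# * x)) (square-zero {B} (sum-zeroˡ (square-nonneg B) (square-nonneg C) p)) γ≋0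
        (ring! 3 (λ β γ x → β :- # 0 := # 1 :* (β :+ # 2 :* γ :* x :- # 0) :+ (:- (# 2 :* x)) :* (γ :- # 0)) β γ x)

  -- A short step against the gradient makes the form negative inside any given ball. The point o
  -- excludes a vanishing gradient: since y > 0, that would give β = γ = 0, and the form would be
  -- constantly 0.
  zero-not-interior : ∀ ℓ {z o} → value ℓ z ≋ 0# → 0# < value ℓ o → ¬ Interior (λ w → 0# ≤ value ℓ w) z
  -- The three bounds on the step length τ make the new value -τM(1 - τγ) negative, keep the point
  -- in ℍ, and keep it in the ball, its squared distance being τ²M.
  zero-not-interior ℓ@(form α β γ) {z} {o} ℓz ℓo (ε , ε>0 , ball) = absurd (small₃ {γ} {1#} {C} {y z} {M} {ε} 0<1 (y>0 z) ε>0)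
    where
    open Descent α β γ (x z) (y z)
    constant : ∀ α β γ x n x′ n′ → γ ≋ 0# → β ≋ 0# → α + β * x + γ * n ≋ 0# → α + β * x′ + γ * n′ ≋ 0#
    constant α β γ x n x′ n′ p q r = combine₃ (n′ - n) (x′ - x) 1# p q r (ring! 7 (λ α β γ x n x′ n′ →
      (α :+ β :* x′ :+ γ :* n′) :- # 0 := (n′ :- n) :* (γ :- # 0) :+ (x′ :- x) :* (β :- # 0)
        :+ # 1 :* (α :+ β :* x :+ γ :* n :- # 0)) α β γ x n x′ n′)
    M>0 : 0# < M
    M>0 = nonneg∧≉0⇒pos (+-nonneg (square-nonneg B) (square-nonneg C)) λ M≋0 →
      let γ≋0 , β≋0 = gradient-zero M≋0 (y>0 z) in
      pos⇒≉0 ℓo (constant α β γ (x z) (normSq z) (x o) (normSq o) γ≋0 β≋0 ℓz)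
    distance : ∀ ε M τ x y B C → M ≋ B * B + C * C → (ε - τ * M) + τ * M * (1# - τ) ≋
      ε - (((x - τ * B) - x) * ((x - τ * B) - x) + ((y - τ * C) - y) * ((y - τ * C) - y))
    distance ε M τ x y B C p = combine₁ (- (τ * τ)) p (ring! 7 (λ ε M τ x y B C →
      (ε :- τ :* M) :+ τ :* M :* (# 1 :- τ) :- (ε :- (((x :- τ :* B) :- x) :* ((x :- τ :* B) :- x) :+ ((y :- τ :* C) :- y) :* ((y :- τ :* C) :- y)))
      := (:- (τ :* τ)) :* (M :- (B :* B :+ C :* C))) ε M τ x y B C)
    absurd : ¬ (∃ λ τ → 0# < τ × 0# < 1# - τ × 0# < 1# - τ * γ × 0# < y z - τ * C × 0# < ε - τ * M)
    absurd (τ , τ>0 , τ<1 , p , q , r) = neg-not-nonneg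
      (pos-by (*-pos (*-pos τ>0 M>0) p) (step-value τ ℓz))
      (ball {(x z - τ * B) +i (y z - τ * C) ⟨ q ⟩} (pos⇒< (pos-by (+-pos r (*-nonneg (*-nonneg (pos⇒nonneg τ>0) (pos⇒nonneg M>0)) (pos⇒nonneg τ<1)))
        (distance ε M τ (x z) (y z) B C ≋-refl))))

  zero-▸-not-interior : ∀ g ℓ {z o} → value ℓ (g ▸ z) ≋ 0# → 0# < value ℓ (g ▸ o) →
                        ¬ Interior (λ w → 0# ≤ value ℓ (g ▸ w)) z
  zero-▸-not-interior g ℓ {z} {o} p q r = zero-not-interior (pull g ℓ) {z} {o}
    (≋-trans (≋-sym (value-pull g ℓ z)) (≋-trans (*-congˡ p) (zeroʳ _)))
    (pull-pos g ℓ o q) (Interior-⊆ {z = z} (λ {w} → pull-nonneg g ℓ w) r)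

-- Words in two elements S and U of a group with S² = U³ = 1.

module TwoGenerators (𝒢 : Group 0ℓ 0ℓ) (generator : Kind → Group.Carrier 𝒢)
    (S² : Group._≈_ 𝒢 (Group._∙_ 𝒢 (generator type0) (generator type0)) (Group.ε 𝒢))
    (U³ : Group._≈_ 𝒢 (Group._∙_ 𝒢 (generator type1) (Group._∙_ 𝒢 (generator type1) (generator type1))) (Group.ε 𝒢)) where
  open Group 𝒢 public using (Carrier; _∙_; ε; _⁻¹; _≈_; identityˡ; identityʳ; inverseˡ; inverseʳ; ⁻¹-cong)
    renaming (refl to ≈-refl; sym to ≈-sym; trans to ≈-trans; assoc to ∙-assoc)
  open Group 𝒢 public using (∙-cong; ∙-congˡ; ∙-congʳ)
  open GroupProperties 𝒢 public using (⁻¹-involutive; ⁻¹-anti-homo-∙; \\-leftDividesʳ; \\-leftDividesˡ; //-rightDividesʳ; //-rightDividesˡ; ∙-cancelˡ; inverseˡ-unique; inverseʳ-unique; ε⁻¹≈ε)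
  open SetoidReasoning (Group.setoid 𝒢) public

  S U : Carrier
  S = generator type0
  U = generator type1

  S∙S : S ∙ S ≈ ε
  S∙S = S²

  S⁻¹ : S ⁻¹ ≈ S
  S⁻¹ = ≈-sym (inverseˡ-unique S S S²)

  data Turn : Set where
    left right : Turn

  spin : Turn → Carrier
  spin left  = U
  spin right = U ∙ U

  opp : Turn → Turn
  opp left  = right
  opp right = left

  spin-opp : ∀ t → spin t ∙ spin (opp t) ≈ ε
  spin-opp left  = U³
  spin-opp right = ≈-trans (∙-assoc U U U) U³

  opp-spin : ∀ t → spin (opp t) ∙ spin t ≈ ε
  opp-spin left  = spin-opp right
  opp-spin right = spin-opp left

  cancelˡ : ∀ {g h} k → g ∙ h ≈ ε → g ∙ (h ∙ k) ≈ k
  cancelˡ {g} {h} k p = ≈-trans (≈-sym (∙-assoc g h k)) (≈-trans (∙-congʳ p) (identityˡ k))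

  data Rotation : Set where
    still : Rotation
    turn  : Turn → Rotation

  rotate : Rotation → Carrier
  rotate still    = ε
  rotate (turn t) = spin t

  -- The elements whose reduced word in S and U does not begin with S.
  data Pos : Carrier → Set where
    pos-rotate : ∀ {γ} j → γ ≈ rotate j → Pos γ
    pos-turn   : ∀ {γ δ} t → Pos δ → γ ≈ spin t ∙ (S ∙ δ) → Pos γ

  Pos-resp : ∀ {γ δ} → γ ≈ δ → Pos γ → Pos δ
  Pos-resp p (pos-rotate j q) = pos-rotate j (≈-trans (≈-sym p) q)
  Pos-resp p (pos-turn t δ q) = pos-turn t δ (≈-trans (≈-sym p) q)

  rotate-spin : ∀ j t → ∃ λ k → rotate j ∙ spin t ≈ rotate k
  rotate-spin still t              = turn t , identityˡ (spin t)
  rotate-spin (turn left) left     = turn right , ≈-refl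
  rotate-spin (turn left) right    = still , U³
  rotate-spin (turn right) left    = still , spin-opp right
  rotate-spin (turn right) right   = turn left , (begin
    U ∙ U ∙ (U ∙ U)   ≈⟨ ∙-assoc U U (U ∙ U) ⟩
    U ∙ (U ∙ (U ∙ U)) ≈⟨ ∙-congˡ U³ ⟩
    U ∙ ε             ≈⟨ identityʳ U ⟩
    U                 ∎)

  Pos-∙spin : ∀ {γ} t → Pos γ → Pos (γ ∙ spin t)
  Pos-∙spin t (pos-rotate j p) = let k , q = rotate-spin j t in pos-rotate k (≈-trans (∙-congʳ p) q)
  Pos-∙spin {γ} t (pos-turn {δ = δ} u δ∈ p) = pos-turn u (Pos-∙spin t δ∈) (begin
    γ ∙ spin t                     ≈⟨ ∙-congʳ p ⟩
    spin u ∙ (S ∙ δ) ∙ spin t      ≈⟨ ∙-assoc _ _ _ ⟩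
    spin u ∙ (S ∙ δ ∙ spin t)      ≈⟨ ∙-congˡ {spin u} (∙-assoc _ _ _) ⟩
    spin u ∙ (S ∙ (δ ∙ spin t))    ∎)

  -- Right multiplication alters the end of the reduced word; it can reach the leading letter only
  -- if the word is empty.
  Pos-∙S : ∀ {γ} → Pos γ → γ ≈ ε ⊎ Pos (γ ∙ S)
  Pos-∙S (pos-rotate still p) = inj₁ p
  Pos-∙S (pos-rotate (turn t) p) = inj₂ (pos-turn t (pos-rotate still ≈-refl)
    (≈-trans (∙-congʳ p) (∙-congˡ {spin t} (≈-sym (identityʳ S)))))
  Pos-∙S {γ} (pos-turn {δ = δ} t δ∈ p) with Pos-∙S δ∈
  ... | inj₁ q = inj₂ (pos-rotate (turn t) (begin
    γ ∙ S                     ≈⟨ ∙-congʳ p ⟩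
    spin t ∙ (S ∙ δ) ∙ S      ≈⟨ ∙-congʳ (∙-congˡ {spin t} (≈-trans (∙-congˡ {S} q) (identityʳ S))) ⟩
    spin t ∙ S ∙ S            ≈⟨ ∙-assoc (spin t) S S ⟩
    spin t ∙ (S ∙ S)          ≈⟨ ∙-congˡ {spin t} S∙S ⟩
    spin t ∙ ε              ≈⟨ identityʳ _ ⟩
    spin t                    ∎))
  ... | inj₂ q = inj₂ (pos-turn t q (begin
    γ ∙ S                     ≈⟨ ∙-congʳ p ⟩
    spin t ∙ (S ∙ δ) ∙ S      ≈⟨ ∙-assoc (spin t) _ _ ⟩
    spin t ∙ (S ∙ δ ∙ S)      ≈⟨ ∙-congˡ {spin t} (∙-assoc _ _ _) ⟩
    spin t ∙ (S ∙ (δ ∙ S))    ∎))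

  data Gen : Set where
    s u : Gen

  ⟦_⟧ : Gen → Carrier
  ⟦ s ⟧ = S
  ⟦ u ⟧ = U

  eval : List Gen → Carrier
  eval []      = ε
  eval (a ∷ w) = ⟦ a ⟧ ∙ eval w

  eval-++ : ∀ v w → eval (v ++ w) ≈ eval v ∙ eval w
  eval-++ []      w = ≈-sym (identityˡ (eval w))
  eval-++ (a ∷ v) w = ≈-trans (∙-congˡ {⟦ a ⟧} (eval-++ v w)) (≈-sym (∙-assoc ⟦ a ⟧ (eval v) (eval w)))

  Generated : Carrier → Set
  Generated γ = ∃ λ w → eval w ≈ γ

  generated-∙ : ∀ {g h} → Generated g → Generated h → Generated (g ∙ h)
  generated-∙ (v , p) (w , q) = v ++ w , ≈-trans (eval-++ v w) (∙-cong p q)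

  generated-resp : ∀ {g h} → g ≈ h → Generated g → Generated h
  generated-resp p (w , q) = w , ≈-trans q p

  generated-S : Generated S
  generated-S = s ∷ [] , identityʳ S

  generated-U : Generated U
  generated-U = u ∷ [] , identityʳ U

  generated-⁻¹ : ∀ {g} → Generated g → Generated (g ⁻¹)
  generated-⁻¹ {g} (w , p) = generated-resp (⁻¹-cong p) (go w)
    where
    letter : ∀ a → Generated (⟦ a ⟧ ⁻¹)
    letter s = generated-resp {S} (≈-sym S⁻¹) generated-S
    letter u = generated-resp {U ∙ U} (inverseˡ-unique (U ∙ U) U (spin-opp right)) (generated-∙ generated-U generated-U)
    go : ∀ w → Generated (eval w ⁻¹)
    go []      = [] , ≈-sym ε⁻¹≈ε
    go (a ∷ w) = generated-resp (≈-sym (⁻¹-anti-homo-∙ ⟦ a ⟧ (eval w))) (generated-∙ (go w) (letter a))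

  infix 4 _↠_

  -- Words contain no formal inverses, as S⁻¹ = S and U⁻¹ = U². Rewriting only deletes relators, and
  -- that alone reaches a normal form.
  data _↠_ : List Gen → List Gen → Set where
    ↠-refl  : ∀ {w} → w ↠ w
    ↠-trans : ∀ {v w x} → v ↠ w → w ↠ x → v ↠ x
    ↠-cons  : ∀ a {v w} → v ↠ w → a ∷ v ↠ a ∷ w
    ss      : ∀ {w} → s ∷ s ∷ w ↠ w
    uuu     : ∀ {w} → u ∷ u ∷ u ∷ w ↠ w

  eval-↠ : ∀ {v w} → v ↠ w → eval v ≈ eval w
  eval-↠ ↠-refl        = ≈-refl
  eval-↠ (↠-trans p q) = ≈-trans (eval-↠ p) (eval-↠ q)
  eval-↠ (↠-cons a p)  = ∙-congˡ {⟦ a ⟧} (eval-↠ p)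
  eval-↠ (ss {w})      = cancelˡ (eval w) S∙S
  eval-↠ (uuu {w})     = ≈-trans (∙-congˡ {U} (≈-sym (∙-assoc U U (eval w)))) (cancelˡ (eval w) (spin-opp left))

  spins : Turn → List Gen
  spins left  = u ∷ []
  spins right = u ∷ u ∷ []

  data Reduced : List Gen → Set where
    done : Reduced []
    last : ∀ t → Reduced (spins t)
    next : ∀ t {w} → Reduced w → Reduced (spins t ++ s ∷ w)

  eval-spins : ∀ t w → eval (spins t ++ w) ≈ spin t ∙ eval w
  eval-spins left  w = ≈-refl
  eval-spins right w = ≈-sym (∙-assoc U U (eval w))

  Reduced⇒Pos : ∀ {w} → Reduced w → Pos (eval w)
  Reduced⇒Pos done         = pos-rotate still ≈-refl
  Reduced⇒Pos (last left)  = pos-rotate (turn left) (identityʳ U)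
  Reduced⇒Pos (last right) = pos-rotate (turn right) (∙-congˡ {U} (identityʳ U))
  Reduced⇒Pos (next t {w} r) = pos-turn t (Reduced⇒Pos r) (eval-spins t (s ∷ w))

  data Normal : List Gen → Set where
    positive : ∀ {w} → Reduced w → Normal w
    negative : ∀ {w} → Reduced w → Normal (s ∷ w)

  cons-normal : ∀ a {w} → Normal w → ∃ λ v → a ∷ w ↠ v × Normal v
  cons-normal s (positive r)              = _ , ↠-refl , negative r
  cons-normal s (negative r)              = _ , ss , positive r
  cons-normal u (negative r)              = _ , ↠-refl , positive (next left r)
  cons-normal u (positive done)           = _ , ↠-refl , positive (last left)
  cons-normal u (positive (last left))    = _ , ↠-refl , positive (last right)
  cons-normal u (positive (last right))   = _ , uuu , positive done
  cons-normal u (positive (next left r))  = _ , ↠-refl , positive (next right r)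
  cons-normal u (positive (next right r)) = _ , uuu , negative r

  normalise : ∀ w → ∃ λ v → w ↠ v × Normal v
  normalise []      = [] , ↠-refl , positive done
  normalise (a ∷ w) = let v , p , n  = normalise w
                          v′ , q , n′ = cons-normal a n
                      in v′ , ↠-trans (↠-cons a p) q , n′

  -- The hypotheses are the ping-pong input. For PSL₂(ℤ), `disjoint` is read off from the position
  -- of the translates of a point of △.
  module Presentation (disjoint : ∀ {γ} → Pos γ → ¬ Pos (S ∙ γ)) (spin≉ε : ∀ t → ¬ (spin t ≈ ε)) where

    -- The relations S² = U³ = 1 suffice, since a nonempty reduced word is not 1.
    trivial-word : ∀ w → eval w ≈ ε → w ↠ []
    trivial-word w p = let v , q , n = normalise w in
      cases q n (≈-trans (≈-sym (eval-↠ q)) p)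
      where
      not-S∙ : ∀ {γ} → Pos γ → ∀ t → ¬ (S ∙ γ ≈ spin t)
      not-S∙ γ∈ t p = disjoint γ∈ (pos-rotate (turn t) p)
      cases : ∀ {v} → w ↠ v → Normal v → eval v ≈ ε → w ↠ []
      cases q (positive done)      p = q
      cases q (positive (last left))  p = ⊥-elim (spin≉ε left (≈-trans (≈-sym (identityʳ U)) p))
      cases q (positive (last right)) p = ⊥-elim (spin≉ε right (≈-trans (∙-congˡ (≈-sym (identityʳ U))) p))
      -- If the word is a turn followed by S and w, its triviality makes S ∙ `eval w` the opposite
      -- turn, which lies in `Pos`; so does `eval w`.
      cases q (positive (next t {w} r)) p = ⊥-elim (not-S∙ (Reduced⇒Pos r) (opp t) (begin
        S ∙ eval w                             ≈⟨ cancelˡ (S ∙ eval w) (opp-spin t) ⟨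
        spin (opp t) ∙ (spin t ∙ (S ∙ eval w)) ≈⟨ ∙-congˡ {spin (opp t)} (≈-trans (≈-sym (eval-spins t (s ∷ w))) p) ⟩
        spin (opp t) ∙ ε                     ≈⟨ identityʳ (spin (opp t)) ⟩
        spin (opp t)                           ∎))
      cases q (negative {w} r) p = ⊥-elim (disjoint (Reduced⇒Pos r) (pos-rotate still p))

-- Generation of PSL₂(ℤ) by S and U.

module ModularGroup where
  module Γ = Group PSL₂ℤ
  open TwoGenerators PSL₂ℤ generator (minus refl) (minus refl) public
    hiding (Carrier; _∙_; ε; ∙-assoc; ∙-congˡ; ∙-congʳ; identityˡ; identityʳ; inverseˡ; inverseʳ; ⁻¹-cong)
    renaming (S∙S to S·S; Pos-∙S to Pos-·S; Pos-∙spin to Pos-·spin; generated-∙ to generated-·)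
  open Group PSL₂ℤ using () renaming (assoc to ·-assoc; ∙-congˡ to ·-congˡ; ∙-congʳ to ·-congʳ; ∙-cong to ·-cong) public

  shift : ℤ → Γ
  shift k = sl (mat 1ℤ k 0ℤ 1ℤ) (identity k)
    where
    identity : ∀ k → 1ℤ ℤ.* 1ℤ ℤ.- k ℤ.* 0ℤ ≡ 1ℤ
    identity = solve-∀

  mat-≡ : ∀ {a b c d a′ b′ c′ d′} → a ≡ a′ → b ≡ b′ → c ≡ c′ → d ≡ d′ → mat a b c d ≡ mat a′ b′ c′ d′
  mat-≡ refl refl refl refl = refl

  shift-· : ∀ j k → shift j · shift k ≈ shift (j ℤ.+ k)
  shift-· j k = plus (mat-≡ (id₁ j) (id₂ j k) refl (id₃ k))
    where
    id₁ : ∀ j → 1ℤ ℤ.* 1ℤ ℤ.+ j ℤ.* 0ℤ ≡ 1ℤ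
    id₁ = solve-∀
    id₂ : ∀ j k → 1ℤ ℤ.* k ℤ.+ j ℤ.* 1ℤ ≡ j ℤ.+ k
    id₂ = solve-∀
    id₃ : ∀ k → 0ℤ ℤ.* k ℤ.+ 1ℤ ℤ.* 1ℤ ≡ 1ℤ
    id₃ = solve-∀

  shift-1 : U · U · S ≈ shift 1ℤ
  shift-1 = plus refl

  generated-shift : ∀ k → Generated (shift k)
  generated-shift (+ zero) = [] , plus refl
  generated-shift (+ suc n) = generated-resp (shift-· 1ℤ (+ n))
    (generated-· (generated-resp shift-1 (generated-· (generated-· generated-U generated-U) generated-S)) (generated-shift (+ n)))
  generated-shift -[1+ n ] = generated-resp
    (≈-sym (inverseˡ-unique _ _ (≈-trans (shift-· -[1+ n ] (+ suc n)) (plus (≡.cong (λ k → mat 1ℤ k 0ℤ 1ℤ) (ℤ.+-inverseˡ (+ suc n)))))))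
    (generated-⁻¹ (natural n))
    where
    natural : ∀ n → Generated (shift (+ suc n))
    natural zero = generated-resp shift-1 (generated-· (generated-· generated-U generated-U) generated-S)
    natural (suc n) = generated-resp (shift-· 1ℤ (+ suc n)) (generated-· (natural zero) (natural n))

  unit-product : ∀ a d → a ℤ.* d ≡ 1ℤ → (a ≡ 1ℤ × d ≡ 1ℤ) ⊎ (a ≡ ℤ.- 1ℤ × d ≡ ℤ.- 1ℤ)
  unit-product (+ n) d p with refl ← ℕ.m*n≡1⇒m≡1 n ℤ.∣ d ∣ (≡.trans (≡.sym (ℤ.abs-* (+ n) d)) (≡.cong ℤ.∣_∣ p)) =
    inj₁ (refl , ≡.trans (≡.sym (ℤ.*-identityˡ d)) p)
  unit-product -[1+ n ] d p with refl ← ℕ.m*n≡1⇒m≡1 (suc n) ℤ.∣ d ∣ (≡.trans (≡.sym (ℤ.abs-* -[1+ n ] d)) (≡.cong ℤ.∣_∣ p)) =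
    inj₂ (refl , ≡.trans (≡.trans (≡.sym (ℤ.neg-involutive d)) (≡.cong ℤ.-_ (≡.sym (ℤ.-1*i≡-i d)))) (≡.cong ℤ.-_ p))

  quotient-step : ∀ q g → shift q · S ⁻¹ · (S · (shift (ℤ.- q) · g)) ≈ g
  quotient-step q g = begin
    shift q · S ⁻¹ · (S · (shift (ℤ.- q) · g))     ≈⟨ ·-assoc (shift q) (S ⁻¹) _ ⟩
    shift q · (S ⁻¹ · (S · (shift (ℤ.- q) · g)))   ≈⟨ ·-congˡ {shift q} (cancelˡ _ (Γ.inverseˡ S)) ⟩
    shift q · (shift (ℤ.- q) · g)                  ≈⟨ cancelˡ g (≈-trans (shift-· q (ℤ.- q))
                                                        (plus (≡.cong (λ k → mat 1ℤ k 0ℤ 1ℤ) (ℤ.+-inverseʳ q)))) ⟩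
    g                                              ∎

  -- The Euclidean algorithm on the first column.
  generated : ∀ g → Generated g
  generated g = go g (<-wellFounded _)
    where
    det-c≡0 : ∀ a b d → a ℤ.* d ℤ.- b ℤ.* 0ℤ ≡ a ℤ.* d
    det-c≡0 = solve-∀

    remainder : ∀ a c r q → a ≡ r ℤ.+ q ℤ.* c → 1ℤ ℤ.* (1ℤ ℤ.* a ℤ.+ ℤ.- q ℤ.* c) ℤ.+ 0ℤ ℤ.* (0ℤ ℤ.* a ℤ.+ 1ℤ ℤ.* c) ≡ r
    remainder _ c r q refl = identity c r q
      where
      identity : ∀ c r q → 1ℤ ℤ.* (1ℤ ℤ.* (r ℤ.+ q ℤ.* c) ℤ.+ ℤ.- q ℤ.* c) ℤ.+ 0ℤ ℤ.* (0ℤ ℤ.* (r ℤ.+ q ℤ.* c) ℤ.+ 1ℤ ℤ.* c) ≡ r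
      identity = solve-∀

    -- After translating by -q and applying S, the lower left entry is a - qc, the remainder of a
    -- modulo c.
    smaller : ∀ g .{{_ : ℤ.NonZero (Mat.c (matrix g))}} → let c = Mat.c (matrix g); q = Mat.a (matrix g) ℤ./ c in
              ℤ.∣ Mat.c (matrix (S · (shift (ℤ.- q) · g))) ∣ ℕ.< ℤ.∣ c ∣
    smaller (sl (mat a b c d) _) = ≡.subst (λ r → ℤ.∣ r ∣ ℕ.< ℤ.∣ c ∣)
      (≡.sym (remainder a c (+ (a ℤ.% c)) (a ℤ./ c) (ℤ.a≡a%n+[a/n]*n a c))) (ℤ.n%d<d a c)

    descend : ∀ q g → Generated (S · (shift (ℤ.- q) · g)) → Generated g
    descend q g p = generated-resp (quotient-step q g)
      (generated-· (generated-· (generated-shift q) (generated-⁻¹ generated-S)) p)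

    go : ∀ g → Acc ℕ._<_ ℤ.∣ Mat.c (matrix g) ∣ → Generated g
    -- With c = 0 the determinant forces a = d = ±1, so g is a translation up to sign.
    go (sl (mat a b (+ zero) d) det) _ with unit-product a d (≡.trans (≡.sym (det-c≡0 a b d)) det)
    ... | inj₁ (refl , refl) = generated-resp (plus refl) (generated-shift b)
    ... | inj₂ (refl , refl) = generated-resp {shift (ℤ.- b)} (minus (mat-≡ refl refl refl refl)) (generated-shift (ℤ.- b))
    go g@(sl (mat a b (+ suc n) d) _) (acc rec) = descend (a ℤ./ (+ suc n)) g (go _ (rec (smaller g)))
    go g@(sl (mat a b -[1+ n ] d) _) (acc rec) = descend (a ℤ./ -[1+ n ]) g (go _ (rec (smaller g)))

  -- The normal form of any word for γ records whether it begins with S.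
  Pos-or-S·Pos : ∀ γ → Pos γ ⊎ ∃ λ δ → Pos δ × γ ≈ S · δ
  Pos-or-S·Pos γ = let w , p = generated γ
                       v , q , n = normalise w
                   in cases (≈-trans (≈-sym p) (eval-↠ q)) n
    where
    cases : ∀ {v} → γ ≈ eval v → Normal v → Pos γ ⊎ ∃ λ δ → Pos δ × γ ≈ S · δ
    cases p (positive r) = inj₁ (Pos-resp (≈-sym p) (Reduced⇒Pos r))
    cases p (negative {w} r) = inj₂ (eval w , Reduced⇒Pos r , p)

  spin≉one : ∀ t → ¬ (spin t ≈ one)
  spin≉one left  (plus ())
  spin≉one left  (minus ())
  spin≉one right (plus ())
  spin≉one right (minus ())

-- Ping-pong on tiles, and the tessellation of ℍ by the translates of △.

module Tiles (em : ExcludedMiddle 0ℓ) (ℝ : CompleteOrderedField) where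
  open Forms em ℝ public
  open ModularGroup hiding (_⁻¹; module Γ; s; u)
  private module Γ = Group PSL₂ℤ
  open Γ using (_⁻¹)

  n>0 : ∀ z → 0# < normSq z
  n>0 z = pos-by (+-pos (*-pos (y>0 z) (y>0 z)) (square-nonneg (x z))) (+-comm _ _)

  S-den : ∀ z → den S z ≋ normSq z
  S-den z = ring! 2 (λ x y → let l = # 1 :+ # 0 in (l :* x :+ # 0) :* (l :* x :+ # 0) :+ (l :* y) :* (l :* y)
    := x :* x :+ y :* y) (x z) (y z)

  S-x : ∀ z → normSq z * x (S ▸ z) ≋ - x z
  S-x z = ≋-trans (*-congʳ (≋-sym (S-den z))) (≋-trans (Maps-x S {z} {S ▸ z} (Maps-▸ S z))
    (ring! 2 (λ n x → let l = # 1 :+ # 0 in # 0 :* l :* n :+ (# 0 :* # 0 :+ (:- l) :* l) :* x :+ (:- l) :* # 0 := :- x) (normSq z) (x z)))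

  S-n : ∀ z → normSq z * normSq (S ▸ z) ≋ 1#
  S-n z = ≋-trans (*-congʳ (≋-sym (S-den z))) (≋-trans (Maps-n S {z} {S ▸ z} (Maps-▸ S z))
    (ring! 2 (λ n x → let l = # 1 :+ # 0 in # 0 :* # 0 :* n :+ # 2 :* (# 0 :* (:- l)) :* x :+ (:- l) :* (:- l) := # 1) (normSq z) (x z)))

  S-y : ∀ z → normSq z * y (S ▸ z) ≋ y z
  S-y z = ≋-trans (*-congʳ (≋-sym (S-den z))) (Maps-y S {z} {S ▸ z} (Maps-▸ S z))

  -- |z - 1|²
  distance² : ℍ → Scalar
  distance² z = normSq z - 2# * x z + 1#

  U-den : ∀ z → den U z ≋ distance² z
  U-den z = ring! 2 (λ x y → let l = # 1 :+ # 0 in ((:- l) :* x :+ l) :* ((:- l) :* x :+ l) :+ ((:- l) :* y) :* ((:- l) :* y)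
    := (x :* x :+ y :* y) :- # 2 :* x :+ # 1) (x z) (y z)

  distance²>0 : ∀ z → 0# < distance² z
  distance²>0 z = pos-by (den-pos U z) (U-den z)

  U-x : ∀ z → distance² z * x (U ▸ z) ≋ 1# - x z
  U-x z = ≋-trans (*-congʳ (≋-sym (U-den z))) (≋-trans (Maps-x U {z} {U ▸ z} (Maps-▸ U z))
    (ring! 2 (λ n x → let l = # 1 :+ # 0 in # 0 :* (:- l) :* n :+ (# 0 :* l :+ l :* (:- l)) :* x :+ l :* l := # 1 :- x) (normSq z) (x z)))

  U-n : ∀ z → distance² z * normSq (U ▸ z) ≋ 1#
  U-n z = ≋-trans (*-congʳ (≋-sym (U-den z))) (≋-trans (Maps-n U {z} {U ▸ z} (Maps-▸ U z))
    (ring! 2 (λ n x → let l = # 1 :+ # 0 in # 0 :* # 0 :* n :+ # 2 :* (# 0 :* l) :* x :+ l :* l := # 1) (normSq z) (x z)))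

  U-y : ∀ z → distance² z * y (U ▸ z) ≋ y z
  U-y z = ≋-trans (*-congʳ (≋-sym (U-den z))) (Maps-y U {z} {U ▸ z} (Maps-▸ U z))

  UU-den : ∀ z → den (U · U) z ≋ normSq z
  UU-den z = ring! 2 (λ x y → let l = # 1 :+ # 0 in ((:- l) :* x :+ # 0) :* ((:- l) :* x :+ # 0) :+ ((:- l) :* y) :* ((:- l) :* y)
    := (x :* x :+ y :* y)) (x z) (y z)

  UU-x : ∀ z → normSq z * x (U · U ▸ z) ≋ normSq z - x z
  UU-x z = ≋-trans (*-congʳ (≋-sym (UU-den z))) (≋-trans (Maps-x (U · U) {z} {U · U ▸ z} (Maps-▸ (U · U) z))
    (ring! 2 (λ n x → let l = # 1 :+ # 0 in (:- l) :* (:- l) :* n :+ ((:- l) :* # 0 :+ l :* (:- l)) :* x :+ l :* # 0 := n :- x) (normSq z) (x z)))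

  UU-n : ∀ z → normSq z * normSq (U · U ▸ z) ≋ distance² z
  UU-n z = ≋-trans (*-congʳ (≋-sym (UU-den z))) (≋-trans (Maps-n (U · U) {z} {U · U ▸ z} (Maps-▸ (U · U) z))
    (ring! 2 (λ n x → let l = # 1 :+ # 0 in (:- l) :* (:- l) :* n :+ # 2 :* ((:- l) :* l) :* x :+ l :* l := n :- # 2 :* x :+ # 1) (normSq z) (x z)))

  0<1-x : ∀ {z} → x z + x z ≤ 1# → 0# < 1# - x z
  0<1-x {z} p = pos-cancel 0<2 (pos-by (+-pos 0<1 (≤⇒nonneg p))
    (ring! 1 (λ x → # 1 :+ (# 1 :- (x :+ x)) := # 2 :* (# 1 :- x)) (x z)))

  0<n-x : ∀ {z} → x z + x z ≤ normSq z → 0# < normSq z - x z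
  0<n-x {z} p = pos-cancel 0<2 (pos-by (+-pos (n>0 z) (≤⇒nonneg p))
    (ring! 2 (λ x n → n :+ (n :- (x :+ x)) := # 2 :* (n :- x)) (x z) (normSq z)))

  -- Re z < 1 and |z|² > Re z describe the preimages of the half-plane Re > 0 under U and U². Both
  -- contain △ and the half-plane Re z ≤ 0.
  spin-x>0 : ∀ t z → 0# < 1# - x z → 0# < normSq z - x z → 0# < x (spin t ▸ z)
  spin-x>0 left  z p _ = pos-cancel (distance²>0 z) (pos-by p (≋-sym (U-x z)))
  spin-x>0 right z _ q = pos-cancel (n>0 z) (pos-by q (≋-sym (UU-x z)))

  S-x≤0 : ∀ z → 0# ≤ x z → 0# ≤ - x (S ▸ z)
  S-x≤0 z p = nonneg-cancel (n>0 z) (nonneg-by p (≋-trans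
    (≋-trans (≋-sym (-‿involutive (x z))) (-‿cong (≋-sym (S-x z))))
    (ring! 2 (λ n u → :- (n :* u) := n :* (:- u)) (normSq z) (x (S ▸ z)))))

  S-x<0 : ∀ z → 0# < x z → 0# < - x (S ▸ z)
  S-x<0 z p = pos-cancel (n>0 z) (pos-by p (≋-trans
    (≋-trans (≋-sym (-‿involutive (x z))) (-‿cong (≋-sym (S-x z))))
    (ring! 2 (λ n u → :- (n :* u) := n :* (:- u)) (normSq z) (x (S ▸ z)))))

  nonpos⇒0<1-x : ∀ z → 0# ≤ - x z → 0# < 1# - x z
  nonpos⇒0<1-x z p = +-pos 0<1 p

  nonpos⇒0<n-x : ∀ z → 0# ≤ - x z → 0# < normSq z - x z
  nonpos⇒0<n-x z p = +-pos (n>0 z) p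

  mutual
    -- Ping-pong along the word: the shorter word leaves △ in Re ≥ 0, S takes it to Re ≤ 0, and a
    -- nontrivial turn takes that into Re > 0. Only the empty word escapes the strict inequality.
    Pos-x>0 : ∀ {γ z} → Pos γ → △ z → 0# < x (γ ▸ z) ⊎ γ Γ.≈ one
    Pos-x>0 (pos-rotate still p) _ = inj₂ p
    Pos-x>0 {γ} {z} (pos-rotate (turn t) p) (_ , q , r) =
      inj₁ (pos-by (spin-x>0 t z (0<1-x {z} q) (0<n-x {z} r)) (≋-sym (proj₁ (coordinates (▸-congˡ {γ} {spin t} z p)))))
    Pos-x>0 {γ} {z} (pos-turn {δ = δ} t δ∈ p) z∈ =
      inj₁ (pos-by (spin-x>0 t v (nonpos⇒0<1-x v v≤0) (nonpos⇒0<n-x v v≤0)) (≋-sym (proj₁ (coordinates γz≃))))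
      where
      v : ℍ
      v = S ▸ (δ ▸ z)
      v≤0 : 0# ≤ - x v
      v≤0 = S-x≤0 (δ ▸ z) (Pos-x≥0 δ∈ z∈)
      γz≃ : γ ▸ z ≃ spin t ▸ v
      γz≃ = ≃-trans (▸-congˡ {γ} {spin t · (S · δ)} z p) (≃-trans (▸-· (spin t) (S · δ) z) (▸-congʳ (spin t) (▸-· S δ z)))

    Pos-x≥0 : ∀ {γ z} → Pos γ → △ z → 0# ≤ x (γ ▸ z)
    Pos-x≥0 {γ} {z} γ∈ z∈@(x≥0 , _) with Pos-x>0 γ∈ z∈
    ... | inj₁ p = pos⇒nonneg p
    ... | inj₂ p = nonneg-by x≥0 (≋-sym (proj₁ (coordinates (≃-trans (▸-congˡ {γ} {one} z p) (▸-one z)))))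

  Pos-interior : ∀ {γ z} → Pos γ → △ z → 0# < x z → 0# < x (γ ▸ z)
  Pos-interior {γ} {z} γ∈ z∈ x>0 with Pos-x>0 γ∈ z∈
  ... | inj₁ p = p
  ... | inj₂ p = pos-by x>0 (≋-sym (proj₁ (coordinates (≃-trans (▸-congˡ {γ} {one} z p) (▸-one z)))))

  -- 1/4 + i
  centre : ℍ
  centre = (½ * ½) +i 1# ⟨ 0<1 ⟩

  quarter : 2# * 2# * (½ * ½) ≋ 1#
  quarter = ≋-trans (ring! 1 (λ h → # 2 :* # 2 :* (h :* h) := # 2 :* h :* (# 2 :* h)) ½)
    (≋-trans (*-cong 2*half 2*half) (*-identityˡ 1#))

  centre-x>0 : 0# < x centre
  centre-x>0 = *-pos 0<half 0<half

  centre-2x<1 : 0# < 1# - (x centre + x centre)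
  centre-2x<1 = pos-cancel 0<2 (pos-by 0<1 (identity (x centre) quarter))
    where
    identity : ∀ q → 2# * 2# * q ≋ 1# → 1# ≋ 2# * (1# - (q + q))
    identity q p = combine₁ 1# p (ring! 1 (λ q → # 1 :- # 2 :* (# 1 :- (q :+ q)) := # 1 :* (# 2 :* # 2 :* q :- # 1)) q)

  centre-2x<n : 0# < normSq centre - (x centre + x centre)
  centre-2x<n = pos-by (+-pos centre-2x<1 (square-nonneg (x centre)))
    (ring! 1 (λ q → (# 1 :- (q :+ q)) :+ q :* q := (q :* q :+ # 1 :* # 1) :- (q :+ q)) (x centre))

  centre∈△ : △ centre
  centre∈△ = pos⇒nonneg centre-x>0 , nonneg⇒≤ (pos⇒nonneg centre-2x<1) , nonneg⇒≤ (pos⇒nonneg centre-2x<n)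

  -- Tested on `centre`: both γ and Sγ would send it into Re > 0, but S reverses the sign of the
  -- real part.
  disjoint : ∀ {γ} → Pos γ → ¬ Pos (S · γ)
  disjoint {γ} γ∈ Sγ∈ = pos-not-nonpos
    (pos-by (Pos-interior Sγ∈ centre∈△ centre-x>0) (proj₁ (coordinates (▸-· S γ centre))))
    (pos⇒nonneg (S-x<0 (γ ▸ centre) (Pos-interior γ∈ centre∈△ centre-x>0)))

  open Presentation disjoint spin≉one public using (trivial-word)

  △-resp : ∀ {z w} → z ≃ w → △ z → △ w
  △-resp e@(by (ex , _)) (p , q , r) =
    nonneg-by p ex , ≤-respˡ (+-cong ex ex) q , ≤-respˡ (+-cong ex ex) (≤-respʳ (normSq-cong e) r)

  U∈△ : ∀ z → 0# ≤ 1# - x z → 1# ≤ x z + x z → 1# ≤ normSq z → △ (U ▸ z)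
  U∈△ z p q r = nonneg-cancel D>0 (nonneg-by p (≋-sym (U-x z))) ,
    nonneg⇒≤ (nonneg-cancel D>0 (nonneg-by (≤⇒nonneg r) (identity₁ (x z) (normSq z) (x (U ▸ z)) (U-x z)))) ,
    nonneg⇒≤ (nonneg-cancel D>0 (nonneg-by (≤⇒nonneg q) (identity₂ (x z) (distance² z) (x (U ▸ z)) (normSq (U ▸ z)) (U-x z) (U-n z))))
    where
    D>0 = distance²>0 z
    identity₁ : ∀ x n u → (n - 2# * x + 1#) * u ≋ 1# - x → n - 1# ≋ (n - 2# * x + 1#) * (1# - (u + u))
    identity₁ x n u p = combine₁ 2# p (ring! 3 (λ x n u → let D = n :- # 2 :* x :+ # 1 in
      n :- # 1 :- D :* (# 1 :- (u :+ u)) := # 2 :* (D :* u :- (# 1 :- x))) x n u)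
    identity₂ : ∀ x D u m → D * u ≋ 1# - x → D * m ≋ 1# → (x + x) - 1# ≋ D * (m - (u + u))
    identity₂ x D u m p q = combine₂ 2# (- 1#) p q (ring! 4 (λ x D u m →
      (x :+ x) :- # 1 :- D :* (m :- (u :+ u)) := # 2 :* (D :* u :- (# 1 :- x)) :+ (:- # 1) :* (D :* m :- # 1)) x D u m)

  UU∈△ : ∀ z → 0# ≤ normSq z - x z → normSq z ≤ x z + x z → normSq z ≤ 1# → △ (U · U ▸ z)
  UU∈△ z p q r = nonneg-cancel (n>0 z) (nonneg-by p (≋-sym (UU-x z))) ,
    nonneg⇒≤ (nonneg-cancel (n>0 z) (nonneg-by (≤⇒nonneg q) (identity₁ (x z) (normSq z) (x (U · U ▸ z)) (UU-x z)))) ,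
    nonneg⇒≤ (nonneg-cancel (n>0 z) (nonneg-by (≤⇒nonneg r)
      (identity₂ (x z) (normSq z) (x (U · U ▸ z)) (normSq (U · U ▸ z)) (UU-x z) (UU-n z))))
    where
    identity₁ : ∀ x n u → n * u ≋ n - x → (x + x) - n ≋ n * (1# - (u + u))
    identity₁ x n u p = combine₁ 2# p (ring! 3 (λ x n u →
      (x :+ x) :- n :- n :* (# 1 :- (u :+ u)) := # 2 :* (n :* u :- (n :- x))) x n u)
    identity₂ : ∀ x n u m → n * u ≋ n - x → n * m ≋ n - 2# * x + 1# → 1# - n ≋ n * (m - (u + u))
    identity₂ x n u m p q = combine₂ 2# (- 1#) p q (ring! 4 (λ x n u m →
      # 1 :- n :- n :* (m :- (u :+ u)) := # 2 :* (n :* u :- (n :- x)) :+ (:- # 1) :* (n :* m :- (n :- # 2 :* x :+ # 1))) x n u m)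

  -- The ideal triangle 0, 1, ∞ is △ ∪ U△ ∪ U²△.
  ideal-covered : ∀ z → 0# ≤ x z → 0# ≤ 1# - x z → 0# ≤ normSq z - x z → ∃ λ j → △ (rotate j ▸ z)
  ideal-covered z p q r with total (x z + x z) 1#
  ... | inj₁ a with total (x z + x z) (normSq z)
  ...   | inj₁ b = still , △-resp (≃-sym (▸-one z)) (p , a , b)
  ...   | inj₂ b = turn right , UU∈△ z r b (≤-trans b a)
  ideal-covered z p q r | inj₂ a with total 1# (normSq z)
  ...   | inj₁ b = turn left , U∈△ z q a b
  ...   | inj₂ b = turn right , UU∈△ z r (≤-trans b a) b

  ▸▸ : ∀ g h z → g ▸ h ▸ z ≃ (g · h) ▸ z
  ▸▸ g h z = ≃-sym (▸-· g h z)

  integer-square : ∀ i → ¬ (i ≡ 0ℤ) → 0# ≤ sq (fromℤ i) - 1#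
  integer-square (+ zero)  i≢0 = ⊥-elim (i≢0 refl)
  integer-square (+ suc n) _   = at-least-one _ (nonneg-by (numeral-nonneg n) (≋-sym (fromℤ≋coefficient (+ n))))
    where
    at-least-one : ∀ k → 0# ≤ k → 0# ≤ sq (1# + k) - 1#
    at-least-one k p = nonneg-by (*-nonneg p (+-nonneg 0≤1 (+-nonneg 0≤1 p))) (ring! 1 (λ k → k :* (# 1 :+ (# 1 :+ k)) := (# 1 :+ k) :* (# 1 :+ k) :- # 1) k)
  integer-square -[1+ n ] _    = nonneg-by (integer-square (+ suc n) λ ())
    (ring! 1 (λ k → k :* k :- # 1 := (:- k) :* (:- k) :- # 1) (fromℤ (+ suc n)))

  -- Im γz ≤ Im z if c = 0, and Im z Im γz ≤ 1 otherwise.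
  height-bounded : ∀ z {r} → 0# < r → y z * r ≋ 1# → ∀ γ → 0# ≤ (y z + r) - y (γ ▸ z)
  height-bounded z {r} r>0 yr γ with em {Mat.c (matrix γ) ≡ 0ℤ}
  ... | no c≢0 = nonneg-by (+-nonneg (pos⇒nonneg (y>0 z)) (*-nonneg (pos⇒nonneg r>0) (nonneg-cancel (y>0 z)
        (nonneg-by (*-nonneg (+-nonneg (*-nonneg (integer-square _ c≢0) (square-nonneg (y z)))
                                       (square-nonneg (reC γ * x z + reD γ))) (pos⇒nonneg (y>0 (γ ▸ z))))
          (identity₁ (reC γ) (reD γ) (x z) (y z) (y (γ ▸ z)) (Maps-y γ {z} {γ ▸ z} (Maps-▸ γ z)))))))
        (identity₂ (y z) r (y (γ ▸ z)) yr)
    where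
    identity₁ : ∀ c d x y v → ((c * x + d) * (c * x + d) + (c * y) * (c * y)) * v ≋ y →
      ((c * c - 1#) * (y * y) + (c * x + d) * (c * x + d)) * v ≋ y * (1# - y * v)
    identity₁ c d x y v p = combine₁ 1# p (ring! 5 (λ c d x y v →
      ((c :* c :- # 1) :* (y :* y) :+ (c :* x :+ d) :* (c :* x :+ d)) :* v :- y :* (# 1 :- y :* v)
      := # 1 :* (((c :* x :+ d) :* (c :* x :+ d) :+ (c :* y) :* (c :* y)) :* v :- y)) c d x y v)
    identity₂ : ∀ y r v → y * r ≋ 1# → y + r * (1# - y * v) ≋ (y + r) - v
    identity₂ y r v p = combine₁ (- v) p (ring! 3 (λ y r v →
      y :+ r :* (# 1 :- y :* v) :- ((y :+ r) :- v) := (:- v) :* (y :* r :- # 1)) y r v)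
  ... | yes c≡0 = nonneg-by (+-nonneg (pos⇒nonneg r>0)
        (*-nonneg (integer-square (Mat.d (matrix γ)) d≢0) (pos⇒nonneg (y>0 (γ ▸ z)))))
        (identity (reC γ) (reD γ) (x z) (y z) (y (γ ▸ z)) r c≋0 (Maps-y γ {z} {γ ▸ z} (Maps-▸ γ z)))
    where
    c≋0 : reC γ ≋ 0#
    c≋0 = reflexive (≡.cong fromℤ c≡0)
    d≢0 : ¬ (Mat.d (matrix γ) ≡ 0ℤ)
    d≢0 d≡0 = pos⇒≉0 (den-pos γ z) (vanish (reC γ) (reD γ) (x z) (y z) c≋0 (reflexive (≡.cong fromℤ d≡0)))
      where
      vanish : ∀ c d x y → c ≋ 0# → d ≋ 0# → (c * x + d) * (c * x + d) + (c * y) * (c * y) ≋ 0#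
      vanish c d x y p q = combine₂ (c * x * x + 2# * x * d + c * y * y) d p q (ring! 4 (λ c d x y →
        (c :* x :+ d) :* (c :* x :+ d) :+ (c :* y) :* (c :* y) :- # 0
        := (c :* x :* x :+ # 2 :* x :* d :+ c :* y :* y) :* (c :- # 0) :+ d :* (d :- # 0)) c d x y)
    identity : ∀ c d x y v r → c ≋ 0# → ((c * x + d) * (c * x + d) + (c * y) * (c * y)) * v ≋ y →
      r + (d * d - 1#) * v ≋ (y + r) - v
    identity c d x y v r p q = combine₂ (- ((c * x * x + 2# * x * d + c * y * y) * v)) 1# p q (ring! 6 (λ c d x y v r →
      r :+ (d :* d :- # 1) :* v :- ((y :+ r) :- v)
      := (:- ((c :* x :* x :+ # 2 :* x :* d :+ c :* y :* y) :* v)) :* (c :- # 0)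
         :+ # 1 :* (((c :* x :+ d) :* (c :* x :+ d) :+ (c :* y) :* (c :* y)) :* v :- y)) c d x y v r)

  shift-den : ∀ k z → den (shift k) z ≋ 1#
  shift-den k z = ring! 2 (λ x y → (# 0 :* x :+ (# 1 :+ # 0)) :* (# 0 :* x :+ (# 1 :+ # 0)) :+ (# 0 :* y) :* (# 0 :* y) := # 1) (x z) (y z)

  shift-x : ∀ k z → x (shift k ▸ z) ≋ x z + fromℤ k
  shift-x k z = ≋-trans (≋-sym (*-identityˡ _)) (≋-trans (*-congʳ (≋-sym (shift-den k z)))
    (≋-trans (Maps-x (shift k) {z} {shift k ▸ z} (Maps-▸ (shift k) z))
      (ring! 3 (λ k n x → let l = # 1 :+ # 0 in l :* # 0 :* n :+ (l :* l :+ k :* # 0) :* x :+ k :* l := x :+ k) (fromℤ k) (normSq z) (x z))))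

  shift-y : ∀ k z → y (shift k ▸ z) ≋ y z
  shift-y k z = ≋-trans (≋-sym (*-identityˡ _)) (≋-trans (*-congʳ (≋-sym (shift-den k z))) (Maps-y (shift k) {z} {shift k ▸ z} (Maps-▸ (shift k) z)))

  module HeightReduction (z : ℍ) (s : Scalar) (s-sup : IsSupremum (λ t → ∃ λ γ → t ≋ y (γ ▸ z)) s) where

    bound : ∀ γ → 0# ≤ s - y (γ ▸ z)
    bound γ = ≤⇒nonneg (proj₁ s-sup _ (γ , ≋-refl))

    s>0 : 0# < s
    s>0 = pos-by (+-pos (y>0 (one ▸ z)) (bound one)) (ring! 2 (λ s y → y :+ (s :- y) := s) s (y (one ▸ z)))

    -- Replaces a point of maximal height: a move that doubles the height of such a point already
    -- contradicts the supremum s.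
    high : ∃ λ γ → 0# < 2# * y (γ ▸ z) - s
    high with em {∃ λ γ → 0# < 2# * y (γ ▸ z) - s}
    ... | yes p = p
    ... | no ¬p = ⊥-elim (pos-not-nonpos s>0 (nonneg-by
          (*-nonneg (pos⇒nonneg 0<2) (≤⇒nonneg (proj₂ s-sup (½ * s) half-bound)))
          (identity₂ ½ s 2*half)))
      where
      identity₁ : ∀ h s y → 2# * h ≋ 1# → - (2# * y - s) ≋ 2# * (h * s - y)
      identity₁ h s y p = combine₁ (- s) p (ring! 3 (λ h s y →
        :- (# 2 :* y :- s) :- # 2 :* (h :* s :- y) := (:- s) :* (# 2 :* h :- # 1)) h s y)
      identity₂ : ∀ h s → 2# * h ≋ 1# → 2# * (h * s - s) ≋ - s
      identity₂ h s p = combine₁ s p (ring! 2 (λ h s → # 2 :* (h :* s :- s) :- (:- s) := s :* (# 2 :* h :- # 1)) h s)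
      below : ∀ γ → 0# ≤ ½ * s - y (γ ▸ z)
      below γ with pos⊎nonpos (2# * y (γ ▸ z) - s)
      ... | inj₁ q = ⊥-elim (¬p (γ , q))
      ... | inj₂ q = nonneg-cancel 0<2 (nonneg-by q (identity₁ ½ s (y (γ ▸ z)) 2*half))
      half-bound : UpperBound (λ t → ∃ λ γ → t ≋ y (γ ▸ z)) (½ * s)
      half-bound t (γ , p) = ≤-respˡ (≋-sym p) (nonneg⇒≤ (below γ))

    -- D is the value |cw + d|² of the last move; D ≤ 1/2 means that the height has at least
    -- doubled.
    too-high : ∀ γ w {D} → 0# < 2# * y w - s → 0# ≤ 1# - 2# * D → D * y (γ ▸ z) ≋ y w → ⊥
    too-high γ w {D} p q e = pos⇒≉0
      (+-pos p (+-nonneg (*-nonneg q (pos⇒nonneg (y>0 (γ ▸ z)))) (bound γ)))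
      (identity (y w) s D (y (γ ▸ z)) e)
      where
      identity : ∀ y s D v → D * v ≋ y → (2# * y - s) + ((1# - 2# * D) * v + (s - v)) ≋ 0#
      identity y s D v p = combine₁ (- 2#) p (ring! 4 (λ y s D v →
        (# 2 :* y :- s) :+ ((# 1 :- # 2 :* D) :* v :+ (s :- v)) :- # 0 := (:- # 2) :* (D :* v :- y)) y s D v)

    -- In the strip 0 ≤ Re v ≤ 1 below the ideal triangle, S or U doubles the height.
    strip : ∀ δ → let v = δ ▸ z in 0# < 2# * y v - s → 0# ≤ x v → 0# ≤ 1# - x v → ∃ λ γ → △ (γ ▸ z)
    strip δ p q r with nonneg⊎neg (normSq (δ ▸ z) - x (δ ▸ z))
    ... | inj₁ t = let j , v∈ = ideal-covered (δ ▸ z) q r t in rotate j · δ , △-resp (▸▸ (rotate j) δ z) v∈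
    ... | inj₂ t with total (x (δ ▸ z) + x (δ ▸ z)) 1#
    ...   | inj₁ 2x≤1 = ⊥-elim (too-high (S · δ) (δ ▸ z) p
              (nonneg-by (+-nonneg (≤⇒nonneg 2x≤1) (*-nonneg (pos⇒nonneg 0<2) (pos⇒nonneg t)))
                (ring! 2 (λ x n → # 1 :- (x :+ x) :+ # 2 :* (:- (n :- x)) := # 1 :- # 2 :* n) (x (δ ▸ z)) (normSq (δ ▸ z))))
              (≋-trans (*-congˡ (proj₂ (coordinates (▸-· S δ z)))) (S-y (δ ▸ z))))
    ...   | inj₂ 1≤2x = ⊥-elim (too-high (U · δ) (δ ▸ z) p
              (nonneg-by (+-nonneg (≤⇒nonneg 1≤2x) (*-nonneg (pos⇒nonneg 0<2) (pos⇒nonneg t)))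
                (ring! 2 (λ x n → (x :+ x) :- # 1 :+ # 2 :* (:- (n :- x)) := # 1 :- # 2 :* (n :- # 2 :* x :+ # 1)) (x (δ ▸ z)) (normSq (δ ▸ z))))
              (≋-trans (*-congˡ (proj₂ (coordinates (▸-· U δ z)))) (U-y (δ ▸ z))))

    conclusion : ∃ λ γ → △ (γ ▸ z)
    conclusion = let γ , p = high
                     -- An integral translation brings the real part into [0 , 1] and preserves the
                     -- height.
                     k , q , r = floor (x (γ ▸ z))
                     e = coordinates (▸-· (shift (ℤ.- k)) γ z)
                     ex = ≋-trans (proj₁ e) (≋-trans (shift-x (ℤ.- k) (γ ▸ z)) (+-congˡ (fromℤ-neg k)))
                     ey = ≋-trans (proj₂ e) (shift-y (ℤ.- k) (γ ▸ z))
                 in strip (shift (ℤ.- k) · γ)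
                      (pos-by p (+-congʳ (*-congˡ (≋-sym ey))))
                      (nonneg-by q (≋-sym ex)) (nonneg-by r (+-congˡ (-‿cong (≋-sym ex))))

  tessellation : ∀ z → ∃ λ γ → △ (γ ▸ z)
  tessellation z =
    let r , r>0 , yr = reciprocal (y>0 z)
        s , s-sup = supremum (λ t → ∃ λ γ → t ≋ y (γ ▸ z)) (y (one ▸ z) , one , ≋-refl)
          (y z + r , λ { t (γ , p) → ≤-respˡ (≋-sym p) (nonneg⇒≤ (height-bounded z r>0 yr γ)) })
    in HeightReduction.conclusion z s s-sup

-- Translates of regions; invariance of orientation and angle.

module Regions (em : ExcludedMiddle 0ℓ) (ℝ : CompleteOrderedField) where
  open Tiles em ℝ public
  open ModularGroup hiding (_⁻¹; module Γ; s; u; left; right; last; next; done)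
  private module Γ = Group PSL₂ℤ
  open Γ using (_⁻¹)

  Resp : Region → Set
  Resp A = ∀ {z w} → z ≃ w → A z → A w

  ⊙-to : ∀ {A} → Resp A → ∀ g {w} → (g ⊙ A) w → A (g ⁻¹ ▸ w)
  ⊙-to A-resp g (z , z∈ , m) = A-resp (≃-sym (≃-trans (▸-congʳ (g ⁻¹) (Maps⇒≈ g m)) (▸-inverseˡ g z))) z∈

  ⊙-from : ∀ {A : Region} g {w} → A (g ⁻¹ ▸ w) → (g ⊙ A) w
  ⊙-from g {w} w∈ = g ⁻¹ ▸ w , w∈ , Maps-resp g {g ⁻¹ ▸ w} {g ⁻¹ ▸ w} {g ▸ g ⁻¹ ▸ w} {w} ≃-refl (▸-inverseʳ g w) (Maps-▸ g (g ⁻¹ ▸ w))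

  ⊙-in : ∀ {A : Region} g {z} → A z → (g ⊙ A) (g ▸ z)
  ⊙-in g {z} z∈ = z , z∈ , Maps-▸ g z

  ⊙-resp : ∀ {A : Region} g → Resp (g ⊙ A)
  ⊙-resp g {w} {w′} p (z , z∈ , m) = z , z∈ , Maps-resp g {z} {z} {w} {w′} ≃-refl p m

  infix 4 _⊑_ _≗_

  -- `_⊆_` and `_≐_` with an explicit point.
  _⊑_ _≗_ : Region → Region → Set
  A ⊑ B = ∀ z → A z → B z
  A ≗ B = A ⊑ B × B ⊑ A

  ≗⇒≐ : ∀ (A B : Region) → A ≗ B → A ≐ B
  ≗⇒≐ A B (p , q) = (λ {z} → p z) , (λ {z} → q z)

  ≐⇒≗ : ∀ (A B : Region) → A ≐ B → A ≗ B
  ≐⇒≗ A B (p , q) = (λ z → p {z}) , (λ z → q {z})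

  ⊙-cong : ∀ (A : Region) {g h} → g Γ.≈ h → g ⊙ A ⊑ h ⊙ A
  ⊙-cong A {g} {h} p w (z , z∈ , m) = z , z∈ , Maps-cong {g} {h} z w p m

  ⊙-∘ : ∀ (A : Region) g h → g ⊙ (h ⊙ A) ⊑ (g · h) ⊙ A
  ⊙-∘ A g h w (v , (z , z∈ , m) , m′) = z , z∈ , Maps-∘ g h z v w m m′

  ⊙-∘⁻ : ∀ (A : Region) g h → (g · h) ⊙ A ⊑ g ⊙ (h ⊙ A)
  ⊙-∘⁻ A g h w (z , z∈ , m) = h ▸ z , (z , z∈ , Maps-▸ h z) ,
    Maps-resp g {h ▸ z} {h ▸ z} {g ▸ h ▸ z} {w} ≃-refl (≃-trans (≃-sym (▸-· g h z)) (≃-sym (Maps⇒≈ (g · h) m))) (Maps-▸ g (h ▸ z))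

  ⊙-mono : ∀ (A B : Region) g → A ⊑ B → g ⊙ A ⊑ g ⊙ B
  ⊙-mono A B g A⊑B w (z , z∈ , m) = z , A⊑B z z∈ , m

  ⊙-▸ : ∀ (A B : Region) → Resp B → ∀ k → (∀ z → A z → B (k ▸ z)) → k ⊙ A ⊑ B
  ⊙-▸ A B B-resp k f w (z , z∈ , m) = B-resp (≃-sym (Maps⇒≈ k {z} {w} m)) (f z z∈)

  ⊑-⊙ : ∀ (A B : Region) k k′ → k · k′ Γ.≈ one → (∀ z → B z → A (k′ ▸ z)) → B ⊑ k ⊙ A
  ⊑-⊙ A B k k′ p f w w∈ = k′ ▸ w , f w w∈ ,
    Maps-resp k {k′ ▸ w} {k′ ▸ w} {k ▸ k′ ▸ w} {w} ≃-refl
      (≃-trans (▸▸ k k′ w) (≃-trans (▸-congˡ {k · k′} {one} w p) (▸-one w))) (Maps-▸ k (k′ ▸ w))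

  -- A finite intersection of closed half-planes; an equation enters as two opposite forms.
  -- Closedness and convexity of every translate come from this description.
  record Polyhedral (A : Region) : Set where
    field
      forms : List Form
      to    : ∀ {z} → A z → All (λ ℓ → 0# ≤ value ℓ z) forms
      from  : ∀ {z} → All (λ ℓ → 0# ≤ value ℓ z) forms → A z

    respects : Resp A
    respects p z∈ = from (All.map (λ {ℓ} → λ q → nonneg-by q (value-cong ℓ p)) (to z∈))

  module _ {A : Region} (poly : Polyhedral A) (g : Γ) where
    open Polyhedral poly

    value-⊙ : ∀ {ℓ} → ℓ ∈ forms → ∀ {w} → (g ⊙ A) w → 0# ≤ value ℓ (g ⁻¹ ▸ w)
    value-⊙ ℓ∈ w∈ = All.lookup (to (⊙-to respects g w∈)) ℓ∈

    ⊙-closed : Closed (g ⊙ A)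
    ⊙-closed {z} z∈ = ⊙-from g (from (All.tabulate λ {ℓ} ℓ∈ → closure-nonneg {g ⊙ A} (g ⁻¹) ℓ {z} (value-⊙ ℓ∈) z∈))

    ⊙-convex : Convex (g ⊙ A)
    ⊙-convex {p} {q} {z} p∈ q∈ b = ⊙-from g (from (All.tabulate λ {ℓ} ℓ∈ →
      Between-▸-nonneg (g ⁻¹) ℓ {p} {q} {z} (value-⊙ ℓ∈ p∈) (value-⊙ ℓ∈ q∈) b))

  -- The coordinates (1 , Re , |·|²) are transformed linearly, by a map of determinant 1, up to the factor `den`.
  orient-invariant : ∀ g p q z → den g p * den g q * den g z * orient (g ▸ p) (g ▸ q) (g ▸ z) ≋ orient p q z
  orient-invariant g p q z = ≋-trans (determinant (den g p) (x (g ▸ p)) (normSq (g ▸ p)) (den g q) (x (g ▸ q)) (normSq (g ▸ q)) (den g z) (x (g ▸ z)) (normSq (g ▸ z)))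
    (≋-trans (det-cong (den-expand g p) (mx p) (mn p) (den-expand g q) (mx q) (mn q) (den-expand g z) (mx z) (mn z))
      (≋-trans (linear (reA g) (reB g) (reC g) (reD g) (x p) (normSq p) (x q) (normSq q) (x z) (normSq z))
        (unimodular (reA g * reD g - reB g * reC g) _ (det-real g))))
    where
    mx = λ z → Maps-x g {z} {g ▸ z} (Maps-▸ g z)
    mn = λ z → Maps-n g {z} {g ▸ z} (Maps-▸ g z)
    det₃ : Scalar → Scalar → Scalar → Scalar → Scalar → Scalar → Scalar → Scalar → Scalar → Scalar
    det₃ D X N D′ X′ N′ D″ X″ N″ = D * (X′ * N″ - N′ * X″) - X * (D′ * N″ - N′ * D″) + N * (D′ * X″ - X′ * D″)
    det-cong : ∀ {D X N D′ X′ N′ D″ X″ N″ E Y M E′ Y′ M′ E″ Y″ M″} → D ≋ E → X ≋ Y → N ≋ M → D′ ≋ E′ → X′ ≋ Y′ → N′ ≋ M′ →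
      D″ ≋ E″ → X″ ≋ Y″ → N″ ≋ M″ → det₃ D X N D′ X′ N′ D″ X″ N″ ≋ det₃ E Y M E′ Y′ M′ E″ Y″ M″
    det-cong a b c d e f g h i = +-cong (+-cong (*-cong a (+-cong (*-cong e i) (-‿cong (*-cong f h))))
      (-‿cong (*-cong b (+-cong (*-cong d i) (-‿cong (*-cong f g)))))) (*-cong c (+-cong (*-cong d h) (-‿cong (*-cong e g))))
    determinant : ∀ D u m D′ u′ m′ D″ u″ m″ →
      D * D′ * D″ * ((u′ - u) * (m″ - m) - (m′ - m) * (u″ - u)) ≋ det₃ D (D * u) (D * m) D′ (D′ * u′) (D′ * m′) D″ (D″ * u″) (D″ * m″)
    determinant = ring! 9 λ D u m D′ u′ m′ D″ u″ m″ →
      D :* D′ :* D″ :* ((u′ :- u) :* (m″ :- m) :- (m′ :- m) :* (u″ :- u))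
      := D :* (D′ :* u′ :* (D″ :* m″) :- D′ :* m′ :* (D″ :* u″)) :- D :* u :* (D′ :* (D″ :* m″) :- D′ :* m′ :* D″)
         :+ D :* m :* (D′ :* (D″ :* u″) :- D′ :* u′ :* D″)
    unimodular : ∀ e o → e ≋ 1# → e * e * e * o ≋ o
    unimodular e o p = combine₁ ((e * e + e + 1#) * o) p (ring! 2 (λ e o → e :* e :* e :* o :- o := (e :* e :+ e :+ # 1) :* o :* (e :- # 1)) e o)
    linear : ∀ a b c d x n x′ n′ x″ n″ →
      let D = λ x n → (c * c) * n + 2# * (c * d) * x + d * d
          X = λ x n → a * c * n + (a * d + b * c) * x + b * d
          N = λ x n → (a * a) * n + 2# * (a * b) * x + b * b
      in det₃ (D x n) (X x n) (N x n) (D x′ n′) (X x′ n′) (N x′ n′) (D x″ n″) (X x″ n″) (N x″ n″)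
         ≋ (a * d - b * c) * (a * d - b * c) * (a * d - b * c) * ((x′ - x) * (n″ - n) - (n′ - n) * (x″ - x))
    linear = ring! 10 λ a b c d x n x′ n′ x″ n″ →
      let D = λ x n → (c :* c) :* n :+ # 2 :* (c :* d) :* x :+ d :* d
          X = λ x n → a :* c :* n :+ (a :* d :+ b :* c) :* x :+ b :* d
          N = λ x n → (a :* a) :* n :+ # 2 :* (a :* b) :* x :+ b :* b
      in D x n :* (X x′ n′ :* N x″ n″ :- N x′ n′ :* X x″ n″) :- X x n :* (D x′ n′ :* N x″ n″ :- N x′ n′ :* D x″ n″)
           :+ N x n :* (D x′ n′ :* X x″ n″ :- X x′ n′ :* D x″ n″)
         := (a :* d :- b :* c) :* (a :* d :- b :* c) :* (a :* d :- b :* c) :* ((x′ :- x) :* (n″ :- n) :- (n′ :- n) :* (x″ :- x))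

  -- 2 Im p Im q cosh d(p , q)
  polar : ℍ → ℍ → Scalar
  polar p q = normSq p + normSq q - 2# * (x p * x q)

  polar-invariant : ∀ g p q → den g p * den g q * polar (g ▸ p) (g ▸ q) ≋ polar p q
  polar-invariant g p q = ≋-trans
    (ring! 6 (λ D u m D′ u′ m′ → D :* D′ :* (m :+ m′ :- # 2 :* (u :* u′)) := (D :* m) :* D′ :+ (D′ :* m′) :* D :- # 2 :* ((D :* u) :* (D′ :* u′)))
      (den g p) (x (g ▸ p)) (normSq (g ▸ p)) (den g q) (x (g ▸ q)) (normSq (g ▸ q)))
    (≋-trans (+-cong (+-cong (*-cong (mn p) (den-expand g q)) (*-cong (mn q) (den-expand g p))) (-‿cong (*-congˡ (*-cong (mx p) (mx q)))))
      (≋-trans (linear (reA g) (reB g) (reC g) (reD g) (x p) (normSq p) (x q) (normSq q)) (unimodular _ _ (det-real g))))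
    where
    mx = λ z → Maps-x g {z} {g ▸ z} (Maps-▸ g z)
    mn = λ z → Maps-n g {z} {g ▸ z} (Maps-▸ g z)
    unimodular : ∀ e o → e ≋ 1# → e * e * o ≋ o
    unimodular e o p = combine₁ ((e + 1#) * o) p (ring! 2 (λ e o → e :* e :* o :- o := (e :+ # 1) :* o :* (e :- # 1)) e o)
    linear : ∀ a b c d x n x′ n′ →
      let D = λ x n → (c * c) * n + 2# * (c * d) * x + d * d
          X = λ x n → a * c * n + (a * d + b * c) * x + b * d
          N = λ x n → (a * a) * n + 2# * (a * b) * x + b * b
      in N x n * D x′ n′ + N x′ n′ * D x n - 2# * (X x n * X x′ n′)
         ≋ (a * d - b * c) * (a * d - b * c) * (n + n′ - 2# * (x * x′))
    linear = ring! 8 λ a b c d x n x′ n′ →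
      let D = λ x n → (c :* c) :* n :+ # 2 :* (c :* d) :* x :+ d :* d
          X = λ x n → a :* c :* n :+ (a :* d :+ b :* c) :* x :+ b :* d
          N = λ x n → (a :* a) :* n :+ # 2 :* (a :* b) :* x :+ b :* b
      in N x n :* D x′ n′ :+ N x′ n′ :* D x n :- # 2 :* (X x n :* X x′ n′)
         := (a :* d :- b :* c) :* (a :* d :- b :* c) :* (n :+ n′ :- # 2 :* (x :* x′))

  inner : ℍ → ℍ → ℍ → Scalar
  inner p q r = direction p q ∙∙ direction p r

  -- The hyperbolic law of cosines with denominators cleared: the angle at p is expressed by the
  -- three distances, so `inner` inherits its invariance from `polar`.
  inner-polar : ∀ p q r → inner p q r ≋ polar p q * polar p r - 2# * (y p * y p) * polar q r
  inner-polar p q r = ring! 6 (λ a b x n x′ n′ →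
    (# 2 :* b :* (x :- a)) :* (# 2 :* b :* (x′ :- a))
      :+ ((n :- (a :* a :+ b :* b)) :- # 2 :* a :* (x :- a)) :* ((n′ :- (a :* a :+ b :* b)) :- # 2 :* a :* (x′ :- a))
    := ((a :* a :+ b :* b) :+ n :- # 2 :* (a :* x)) :* ((a :* a :+ b :* b) :+ n′ :- # 2 :* (a :* x′))
       :- # 2 :* (b :* b) :* (n :+ n′ :- # 2 :* (x :* x′))) (x p) (y p) (x q) (normSq q) (x r) (normSq r)

  inner-invariant : ∀ g p q r → den g p * den g p * (den g q * den g r) * inner (g ▸ p) (g ▸ q) (g ▸ r) ≋ inner p q r
  inner-invariant g p q r = ≋-trans (*-congˡ (inner-polar (g ▸ p) (g ▸ q) (g ▸ r)))
    (≋-trans (ring! 7 (λ P Q R b c d v → P :* P :* (Q :* R) :* (b :* c :- # 2 :* (v :* v) :* d)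
        := (P :* Q :* b) :* (P :* R :* c) :- # 2 :* ((P :* v) :* (P :* v)) :* (Q :* R :* d))
        (den g p) (den g q) (den g r) (polar (g ▸ p) (g ▸ q)) (polar (g ▸ p) (g ▸ r)) (polar (g ▸ q) (g ▸ r)) (y (g ▸ p)))
      (≋-trans (+-cong (*-cong (polar-invariant g p q) (polar-invariant g p r))
          (-‿cong (*-cong (*-congˡ (*-cong my my)) (polar-invariant g q r))))
        (≋-sym (inner-polar p q r))))
    where my = Maps-y g {p} {g ▸ p} (Maps-▸ g p)

-- The model edges of △ and the elements exchanging them.

module Edges (em : ExcludedMiddle 0ℓ) (ℝ : CompleteOrderedField) where
  open Regions em ℝ public
  open ModularGroup hiding (_⁻¹; module Γ; s; u; left; right; last; next; done)
  private module Γ = Group PSL₂ℤ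
  open Γ using (_⁻¹)

  ℓ-x ℓ--x ℓ-1-2x ℓ-2x-1 ℓ-1-n ℓ-n-1 ℓ-n-2x ℓ-2x-n : Form
  ℓ-x    = form 0# 1# 0#
  ℓ--x   = form 0# (- 1#) 0#
  ℓ-1-2x = form 1# (- 2#) 0#
  ℓ-2x-1 = form (- 1#) 2# 0#
  ℓ-1-n  = form 1# 0# (- 1#)
  ℓ-n-1  = form (- 1#) 0# 1#
  ℓ-n-2x = form 0# (- 2#) 1#
  ℓ-2x-n = form 0# 2# (- 1#)

  value-x : ∀ z → value ℓ-x z ≋ x z
  value-x z = ring! 2 (λ x n → # 0 :+ # 1 :* x :+ # 0 :* n := x) (x z) (normSq z)
  value--x : ∀ z → value ℓ--x z ≋ - x z
  value--x z = ring! 2 (λ x n → # 0 :+ (:- # 1) :* x :+ # 0 :* n := :- x) (x z) (normSq z)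
  value-1-2x : ∀ z → value ℓ-1-2x z ≋ 1# - (x z + x z)
  value-1-2x z = ring! 2 (λ x n → # 1 :+ (:- # 2) :* x :+ # 0 :* n := # 1 :- (x :+ x)) (x z) (normSq z)
  value-2x-1 : ∀ z → value ℓ-2x-1 z ≋ (x z + x z) - 1#
  value-2x-1 z = ring! 2 (λ x n → (:- # 1) :+ # 2 :* x :+ # 0 :* n := (x :+ x) :- # 1) (x z) (normSq z)
  value-1-n : ∀ z → value ℓ-1-n z ≋ 1# - normSq z
  value-1-n z = ring! 2 (λ x n → # 1 :+ # 0 :* x :+ (:- # 1) :* n := # 1 :- n) (x z) (normSq z)
  value-n-1 : ∀ z → value ℓ-n-1 z ≋ normSq z - 1#
  value-n-1 z = ring! 2 (λ x n → (:- # 1) :+ # 0 :* x :+ # 1 :* n := n :- # 1) (x z) (normSq z)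
  value-n-2x : ∀ z → value ℓ-n-2x z ≋ normSq z - (x z + x z)
  value-n-2x z = ring! 2 (λ x n → # 0 :+ (:- # 2) :* x :+ # 1 :* n := n :- (x :+ x)) (x z) (normSq z)
  value-2x-n : ∀ z → value ℓ-2x-n z ≋ (x z + x z) - normSq z
  value-2x-n z = ring! 2 (λ x n → # 0 :+ # 2 :* x :+ (:- # 1) :* n := (x :+ x) :- n) (x z) (normSq z)

  ≋⇒nonneg : ∀ {x y} → x ≋ y → 0# ≤ x - y
  ≋⇒nonneg p = ≤⇒nonneg (≤-reflexive (≋-sym p))

  nonneg⇒≋ : ∀ {x y} → 0# ≤ x - y → 0# ≤ y - x → x ≋ y
  nonneg⇒≋ p q = ≤-antisym (nonneg⇒≤ q) (nonneg⇒≤ p)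

  by-value : ∀ {a b} → a ≋ b → 0# ≤ b → 0# ≤ a
  by-value p q = nonneg-by q (≋-sym p)

  line-polyhedral : Polyhedral ⟨0,∞⟩
  line-polyhedral = record
    { forms = ℓ-x ∷ ℓ--x ∷ []
    ; to = λ {z} p → by-value (value-x z) (≤-reflexive (≋-sym p)) ∷ by-value (value--x z) (neg-nonneg (≤-reflexive p)) ∷ []
    ; from = λ { {z} (p ∷ q ∷ []) → both-signs (nonneg-by p (value-x z)) (nonneg-by q (value--x z)) }
    }

  halfLine-polyhedral : ∀ κ h → Polyhedral (halfLine κ h)
  halfLine-polyhedral type0 to0 = record
    { forms = ℓ-x ∷ ℓ--x ∷ ℓ-1-n ∷ []
    ; to = λ {z} (p , q) → by-value (value-x z) (≤-reflexive (≋-sym p)) ∷ by-value (value--x z) (neg-nonneg (≤-reflexive p)) ∷ by-value (value-1-n z) (≤⇒nonneg q) ∷ []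
    ; from = λ { {z} (p ∷ q ∷ r ∷ []) → both-signs (nonneg-by p (value-x z)) (nonneg-by q (value--x z)) , nonneg⇒≤ (nonneg-by r (value-1-n z)) }
    }
  halfLine-polyhedral type0 to∞ = record
    { forms = ℓ-x ∷ ℓ--x ∷ ℓ-n-1 ∷ []
    ; to = λ {z} (p , q) → by-value (value-x z) (≤-reflexive (≋-sym p)) ∷ by-value (value--x z) (neg-nonneg (≤-reflexive p)) ∷ by-value (value-n-1 z) (≤⇒nonneg q) ∷ []
    ; from = λ { {z} (p ∷ q ∷ r ∷ []) → both-signs (nonneg-by p (value-x z)) (nonneg-by q (value--x z)) , nonneg⇒≤ (nonneg-by r (value-n-1 z)) }
    }
  halfLine-polyhedral type1 to0 = record
    { forms = ℓ-n-2x ∷ ℓ-2x-n ∷ ℓ-1-2x ∷ []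
    ; to = λ {z} (p , q) → by-value (value-n-2x z) (≋⇒nonneg p) ∷ by-value (value-2x-n z) (≋⇒nonneg (≋-sym p)) ∷ by-value (value-1-2x z) (≤⇒nonneg q) ∷ []
    ; from = λ { {z} (p ∷ q ∷ r ∷ []) → nonneg⇒≋ (nonneg-by p (value-n-2x z)) (nonneg-by q (value-2x-n z)) , nonneg⇒≤ (nonneg-by r (value-1-2x z)) }
    }
  halfLine-polyhedral type1 to∞ = record
    { forms = ℓ-2x-1 ∷ ℓ-1-2x ∷ ℓ-n-1 ∷ []
    ; to = λ {z} (p , q) → by-value (value-2x-1 z) (≋⇒nonneg p) ∷ by-value (value-1-2x z) (≋⇒nonneg (≋-sym p)) ∷ by-value (value-n-1 z) (≤⇒nonneg q) ∷ []
    ; from = λ { {z} (p ∷ q ∷ r ∷ []) → nonneg⇒≋ (nonneg-by p (value-2x-1 z)) (nonneg-by q (value-1-2x z)) , nonneg⇒≤ (nonneg-by r (value-n-1 z)) }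
    }

  line-resp : Resp ⟨0,∞⟩
  line-resp = Polyhedral.respects line-polyhedral

  halfLine-resp : ∀ κ h → Resp (halfLine κ h)
  halfLine-resp κ h = Polyhedral.respects (halfLine-polyhedral κ h)

  line-S : ∀ z → ⟨0,∞⟩ z → ⟨0,∞⟩ (S ▸ z)
  line-S z p = *-≋0 (pos⇒≉0 (n>0 z)) (≋-trans (S-x z) (≋-trans (-‿cong p) -0#≈0#))

  half0-S : ∀ h z → halfLine type0 h z → halfLine type0 (flip h) (S ▸ z)
  half0-S to0 z (p , q) = line-S z p , nonneg⇒≤ (nonneg-cancel (n>0 z) (nonneg-by (≤⇒nonneg q) (identity (normSq z) (normSq (S ▸ z)) (S-n z))))
    where
    identity : ∀ n m → n * m ≋ 1# → 1# - n ≋ n * (m - 1#)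
    identity n m p = combine₁ (- 1#) p (ring! 2 (λ n m → # 1 :- n :- n :* (m :- # 1) := (:- # 1) :* (n :* m :- # 1)) n m)
  half0-S to∞ z (p , q) = line-S z p , nonneg⇒≤ (nonneg-cancel (n>0 z) (nonneg-by (≤⇒nonneg q) (identity (normSq z) (normSq (S ▸ z)) (S-n z))))
    where
    identity : ∀ n m → n * m ≋ 1# → n - 1# ≋ n * (1# - m)
    identity n m p = combine₁ 1# p (ring! 2 (λ n m → n :- # 1 :- n :* (# 1 :- m) := # 1 :* (n :* m :- # 1)) n m)

  half1-U : ∀ z → halfLine type1 to∞ z → halfLine type1 to0 (U ▸ z)
  half1-U z (p , q) =
    *-cancel (distance²>0 z) (≋-trans (U-n z) (identity₁ (x z) (distance² z) (x (U ▸ z)) p (U-x z))) ,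
    nonneg⇒≤ (nonneg-cancel (distance²>0 z) (nonneg-by (≤⇒nonneg q) (identity₂ (x z) (normSq z) (x (U ▸ z)) p (U-x z))))
    where
    identity₁ : ∀ x D u → x + x ≋ 1# → D * u ≋ 1# - x → 1# ≋ D * (u + u)
    identity₁ x D u p q = combine₂ 1# (- 2#) p q (ring! 3 (λ x D u →
      # 1 :- D :* (u :+ u) := # 1 :* (x :+ x :- # 1) :+ (:- # 2) :* (D :* u :- (# 1 :- x))) x D u)
    identity₂ : ∀ x n u → x + x ≋ 1# → (n - 2# * x + 1#) * u ≋ 1# - x → n - 1# ≋ (n - 2# * x + 1#) * (1# - (u + u))
    identity₂ x n u p q = combine₁ 2# q (ring! 3 (λ x n u → let D = n :- # 2 :* x :+ # 1 in
      n :- # 1 :- D :* (# 1 :- (u :+ u)) := # 2 :* (D :* u :- (# 1 :- x))) x n u)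

  half1-UU : ∀ z → halfLine type1 to0 z → halfLine type1 to∞ (U · U ▸ z)
  half1-UU z (p , q) =
    *-cancel (n>0 z) (identity₁ (x z) (normSq z) (x (U · U ▸ z)) p (UU-x z)) ,
    nonneg⇒≤ (nonneg-cancel (n>0 z) (nonneg-by (≤⇒nonneg q) (identity₂ (x z) (normSq z) (normSq (U · U ▸ z)) p (UU-n z))))
    where
    identity₁ : ∀ x n u → n ≋ x + x → n * u ≋ n - x → n * (u + u) ≋ n * 1#
    identity₁ x n u p q = combine₂ 1# 2# p q (ring! 3 (λ x n u →
      n :* (u :+ u) :- n :* # 1 := # 1 :* (n :- (x :+ x)) :+ # 2 :* (n :* u :- (n :- x))) x n u)
    identity₂ : ∀ x n m → n ≋ x + x → n * m ≋ n - 2# * x + 1# → 1# - (x + x) ≋ n * (m - 1#)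
    identity₂ x n m p q = combine₂ 0# (- 1#) p q (ring! 3 (λ x n m →
      # 1 :- (x :+ x) :- n :* (m :- # 1) := # 0 :* (n :- (x :+ x)) :+ (:- # 1) :* (n :* m :- (n :- # 2 :* x :+ # 1))) x n m)

  S⊙line : S ⊙ ⟨0,∞⟩ ≗ ⟨0,∞⟩
  S⊙line = ⊙-▸ ⟨0,∞⟩ ⟨0,∞⟩ line-resp S line-S , ⊑-⊙ ⟨0,∞⟩ ⟨0,∞⟩ S S S·S line-S

  S⊙half0 : ∀ h → S ⊙ halfLine type0 h ≗ halfLine type0 (flip h)
  S⊙half0 h = ⊙-▸ (halfLine type0 h) (halfLine type0 (flip h)) (halfLine-resp type0 (flip h)) S (half0-S h) ,
    ⊑-⊙ (halfLine type0 h) (halfLine type0 (flip h)) S S S·S (back h)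
    where
    back : ∀ h z → halfLine type0 (flip h) z → halfLine type0 h (S ▸ z)
    back to0 = half0-S to∞
    back to∞ = half0-S to0

  U⊙half1 : U ⊙ halfLine type1 to∞ ≗ halfLine type1 to0
  U⊙half1 = ⊙-▸ (halfLine type1 to∞) (halfLine type1 to0) (halfLine-resp type1 to0) U half1-U ,
    ⊑-⊙ (halfLine type1 to∞) (halfLine type1 to0) U (U · U) (spin-opp ModularGroup.left) half1-UU

  UU⊙half1 : (U · U) ⊙ halfLine type1 to0 ≗ halfLine type1 to∞
  UU⊙half1 = ⊙-▸ (halfLine type1 to0) (halfLine type1 to∞) (halfLine-resp type1 to∞) (U · U) half1-UU ,
    ⊑-⊙ (halfLine type1 to0) (halfLine type1 to∞) (U · U) U (spin-opp ModularGroup.right) half1-U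

  ≗-trans : ∀ (A B C : Region) → A ≗ B → B ≗ C → A ≗ C
  ≗-trans A B C (p , p′) (q , q′) = (λ z z∈ → q z (p z z∈)) , (λ z z∈ → p′ z (q′ z z∈))

  ≗-sym : ∀ (A B : Region) → A ≗ B → B ≗ A
  ≗-sym A B (p , q) = q , p

  ⊙-≗ : ∀ (A B : Region) g → A ≗ B → g ⊙ A ≗ g ⊙ B
  ⊙-≗ A B g (p , q) = ⊙-mono A B g p , ⊙-mono B A g q

  ⊙-≈ : ∀ (A : Region) {g h} → g Γ.≈ h → g ⊙ A ≗ h ⊙ A
  ⊙-≈ A {g} {h} p = ⊙-cong A {g} {h} p , ⊙-cong A {h} {g} (Γ.sym p)

  ⊙-assoc : ∀ (A : Region) g h → g ⊙ (h ⊙ A) ≗ (g · h) ⊙ A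
  ⊙-assoc A g h = ⊙-∘ A g h , ⊙-∘⁻ A g h

  conjugate : ∀ (A B : Region) g f k → k ⊙ A ≗ B → (g · k · f ⁻¹) ⊙ (f ⊙ A) ≗ g ⊙ B
  conjugate A B g f k p =
    ≗-trans ((g · k · f ⁻¹) ⊙ (f ⊙ A)) ((g · k · f ⁻¹ · f) ⊙ A) (g ⊙ B) (⊙-assoc A (g · k · f ⁻¹) f)
      (≗-trans ((g · k · f ⁻¹ · f) ⊙ A) ((g · k) ⊙ A) (g ⊙ B) (⊙-≈ A {g · k · f ⁻¹ · f} {g · k} (//-rightDividesˡ f (g · k)))
        (≗-trans ((g · k) ⊙ A) (g ⊙ (k ⊙ A)) (g ⊙ B) (≗-sym (g ⊙ (k ⊙ A)) ((g · k) ⊙ A) (⊙-assoc A g k)) (⊙-≗ (k ⊙ A) B g p)))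

  line⊆△ : ⟨0,∞⟩ ⊑ △
  line⊆△ z p = ≤-reflexive (≋-sym p) , ≤-trans (≤-reflexive 2x≋0) 0≤1 , ≤-trans (≤-reflexive 2x≋0) (pos⇒nonneg (n>0 z))
    where
    2x≋0 : x z + x z ≋ 0#
    2x≋0 = ≋-trans (+-cong p p) (+-identityˡ 0#)

  half1-x>0 : ∀ h {z} → halfLine type1 h z → 0# < x z
  half1-x>0 to0 {z} (p , _) = pos-cancel 0<2 (pos-by (n>0 z) (≋-trans p (ring! 1 (λ x → x :+ x := # 2 :* x) (x z))))
  half1-x>0 to∞ {z} (p , _) = pos-cancel 0<2 (pos-by 0<1 (≋-trans (≋-sym p) (ring! 1 (λ x → x :+ x := # 2 :* x) (x z))))

  halfLine⊆△ : ∀ κ h → halfLine κ h ⊑ △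
  halfLine⊆△ type0 to0 z (p , _) = line⊆△ z p
  halfLine⊆△ type0 to∞ z (p , _) = line⊆△ z p
  halfLine⊆△ type1 to0 z z∈@(p , q) = pos⇒nonneg (half1-x>0 to0 {z} z∈) , q , ≤-reflexive (≋-sym p)
  halfLine⊆△ type1 to∞ z z∈@(p , q) = pos⇒nonneg (half1-x>0 to∞ {z} z∈) , ≤-reflexive p , ≤-trans (≤-reflexive p) q

  half0⊆line : ∀ h → halfLine type0 h ⊑ ⟨0,∞⟩
  half0⊆line to0 _ = proj₁
  half0⊆line to∞ _ = proj₁

  √¾ : Scalar
  √¾ = proj₁ (sqrt {numeral 3 * (½ * ½)} (*-nonneg (numeral-nonneg 3) (square-nonneg ½)))

  √¾² : √¾ * √¾ ≋ numeral 3 * (½ * ½)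
  √¾² = proj₂ (proj₂ (sqrt {numeral 3 * (½ * ½)} (*-nonneg (numeral-nonneg 3) (square-nonneg ½))))

  √¾>0 : 0# < √¾
  √¾>0 = nonneg∧≉0⇒pos (proj₁ (proj₂ (sqrt {numeral 3 * (½ * ½)} (*-nonneg (numeral-nonneg 3) (square-nonneg ½)))))
    λ p → pos⇒≉0 (*-pos (numeral-pos 2) (*-pos 0<half 0<half)) (≋-trans (≋-sym √¾²) (≋-trans (*-congʳ p) (zeroˡ √¾)))

  apex : Kind → ℍ
  apex type0 = 0# +i 1# ⟨ 0<1 ⟩
  apex type1 = ½ +i √¾ ⟨ √¾>0 ⟩

  half+half : ½ + ½ ≋ 1#
  half+half = ≋-trans (ring! 1 (λ h → h :+ h := # 2 :* h) ½) 2*half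

  apex-n : ∀ κ → normSq (apex κ) ≋ 1#
  apex-n type0 = ring! 0 (# 0 :* # 0 :+ # 1 :* # 1 := # 1)
  apex-n type1 = ≋-trans (+-congˡ √¾²) (≋-trans (ring! 1 (λ h → h :* h :+ # 3 :* (h :* h) := # 2 :* # 2 :* (h :* h)) ½) quarter)

  apex∈ : ∀ κ h → halfLine κ h (apex κ)
  apex∈ type0 to0 = ≋-refl , ≤-reflexive (apex-n type0)
  apex∈ type0 to∞ = ≋-refl , ≤-reflexive (≋-sym (apex-n type0))
  apex∈ type1 to0 = ≋-trans (apex-n type1) (≋-sym half+half) , ≤-reflexive half+half
  apex∈ type1 to∞ = half+half , ≤-reflexive (≋-sym (apex-n type1))

  -- The form that cuts the half-line out of its geodesic. It is ≥ 0 there and vanishes only at the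
  -- apex, which exhibits the apex as an extreme point.
  extremal : Kind → Half → Form
  extremal type0 to0 = ℓ-1-n
  extremal type0 to∞ = ℓ-n-1
  extremal type1 to0 = ℓ-1-2x
  extremal type1 to∞ = ℓ-n-1

  extremal∈ : ∀ κ h → extremal κ h ∈ Polyhedral.forms (halfLine-polyhedral κ h)
  extremal∈ type0 to0 = there (there (here refl))
  extremal∈ type0 to∞ = there (there (here refl))
  extremal∈ type1 to0 = there (there (here refl))
  extremal∈ type1 to∞ = there (there (here refl))

  halve : ∀ {x y} → x + x ≋ y + y → x ≋ y
  halve {x} {y} p = *-cancel 0<2 (≋-trans (ring! 1 (λ x → # 2 :* x := x :+ x) x) (≋-trans p (ring! 1 (λ y → y :+ y := # 2 :* y) y)))

  apex-by : ∀ κ {z} → x z ≋ x (apex κ) → normSq z ≋ 1# → z ≃ apex κ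
  apex-by κ p q = ≃-from-normSq p (≋-trans q (≋-sym (apex-n κ)))

  extremal-apex : ∀ κ h {z} → halfLine κ h z → value (extremal κ h) z ≋ 0# → z ≃ apex κ
  extremal-apex type0 to0 {z} (p , _) q = apex-by type0 p (≋-sym (difference-zero (≋-trans (≋-sym (value-1-n z)) q)))
  extremal-apex type0 to∞ {z} (p , _) q = apex-by type0 p (difference-zero (≋-trans (≋-sym (value-n-1 z)) q))
  extremal-apex type1 to0 {z} (p , _) q = apex-by type1 (halve (≋-trans (≋-sym 1≋2x) (≋-sym half+half))) (≋-trans p (≋-sym 1≋2x))
    where
    1≋2x : 1# ≋ x z + x z
    1≋2x = difference-zero (≋-trans (≋-sym (value-1-2x z)) q)
  extremal-apex type1 to∞ {z} (p , _) q = apex-by type1 (halve (≋-trans p (≋-sym half+half))) (difference-zero (≋-trans (≋-sym (value-n-1 z)) q))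

  apex-extremal : ∀ κ h → value (extremal κ h) (apex κ) ≋ 0#
  apex-extremal type0 to0 = ≋-trans (value-1-n (apex type0)) (zero-difference (≋-sym (apex-n type0)))
  apex-extremal type0 to∞ = ≋-trans (value-n-1 (apex type0)) (zero-difference (apex-n type0))
  apex-extremal type1 to0 = ≋-trans (value-1-2x (apex type1)) (zero-difference (≋-sym half+half))
  apex-extremal type1 to∞ = ≋-trans (value-n-1 (apex type1)) (zero-difference (apex-n type1))

  halves-meet : ∀ κ {z} → halfLine κ to0 z → halfLine κ to∞ z → z ≃ apex κ
  halves-meet type0 {z} (p , q) (_ , r) = apex-by type0 p (≤-antisym q r)
  halves-meet type1 {z} (p , q) (r , t) = apex-by type1 (halve (≋-trans r (≋-sym half+half))) (≋-trans p r)

-- Translated edges as geodesic intervals: endpoints and angles.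

module Sides (em : ExcludedMiddle 0ℓ) (ℝ : CompleteOrderedField) where
  open Edges em ℝ public
  open ModularGroup hiding (_⁻¹; module Γ; s; u; left; right; last; next; done)
  private module Γ = Group PSL₂ℤ
  open Γ using (_⁻¹)

  same-column : ∀ {p q z} → x p ≋ x q → x p ≋ x z → orient p q z ≋ 0#
  same-column {p} {q} {z} = identity (x p) (normSq p) (x q) (normSq q) (x z) (normSq z)
    where
    identity : ∀ a n b m c l → a ≋ b → a ≋ c → (b - a) * (l - n) - (m - n) * (c - a) ≋ 0#
    identity a n b m c l p q = combine₂ (- (l - n)) (m - n) p q (ring! 6 (λ a n b m c l →
      (b :- a) :* (l :- n) :- (m :- n) :* (c :- a) :- # 0 := (:- (l :- n)) :* (a :- b) :+ (m :- n) :* (a :- c)) a n b m c l)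

  line-collinear : ∀ {p q z} → ⟨0,∞⟩ p → ⟨0,∞⟩ q → ⟨0,∞⟩ z → orient p q z ≋ 0#
  line-collinear {p} {q} {z} a b c = same-column {p} {q} {z} (≋-trans a (≋-sym b)) (≋-trans a (≋-sym c))

  halfLine-collinear : ∀ κ h {p q z} → halfLine κ h p → halfLine κ h q → halfLine κ h z → orient p q z ≋ 0#
  halfLine-collinear type0 to0 {p} {q} {z} (a , _) (b , _) (c , _) = line-collinear {p} {q} {z} a b c
  halfLine-collinear type0 to∞ {p} {q} {z} (a , _) (b , _) (c , _) = line-collinear {p} {q} {z} a b c
  halfLine-collinear type1 to∞ {p} {q} {z} (a , _) (b , _) (c , _) =
    same-column {p} {q} {z} (halve (≋-trans a (≋-sym b))) (halve (≋-trans a (≋-sym c)))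
  halfLine-collinear type1 to0 {p} {q} {z} (a , _) (b , _) (c , _) =
    identity (x p) (normSq p) (x q) (normSq q) (x z) (normSq z) a b c
    where
    identity : ∀ a n b m c l → n ≋ a + a → m ≋ b + b → l ≋ c + c → (b - a) * (l - n) - (m - n) * (c - a) ≋ 0#
    identity a n b m c l p q r = combine₃ (c - b) (- (c - a)) (b - a) p q r (ring! 6 (λ a n b m c l →
      (b :- a) :* (l :- n) :- (m :- n) :* (c :- a) :- # 0
      := (c :- b) :* (n :- (a :+ a)) :+ (:- (c :- a)) :* (m :- (b :+ b)) :+ (b :- a) :* (l :- (c :+ c))) a n b m c l)

  column : Kind → Scalar
  column type0 = 0#
  column type1 = ½

  -- Test points on Re z = 0 and Re z = 1/2 with |z| ≥ 1, hence on the half-lines towards ∞. The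
  -- images of two points control that of the whole geodesic.
  low high : Kind → ℍ
  low  κ = column κ +i 1# ⟨ 0<1 ⟩
  high κ = column κ +i 2# ⟨ 0<2 ⟩

  low≄high : ∀ κ → ¬ (low κ ≃ high κ)
  low≄high κ (by (_ , p)) = 0≉1 (combine₁ 1# p (ring! 0 (# 0 :- # 1 := # 1 :* (# 1 :- # 2))))

  low-n : ∀ κ → 1# ≤ normSq (low κ)
  low-n κ = nonneg⇒≤ (nonneg-by (square-nonneg (column κ)) (ring! 1 (λ c → c :* c := c :* c :+ # 1 :* # 1 :- # 1) (column κ)))

  high-n : ∀ κ → 1# ≤ normSq (high κ)
  high-n κ = nonneg⇒≤ (nonneg-by (+-nonneg (square-nonneg (column κ)) (numeral-nonneg 3))
    (ring! 1 (λ c → c :* c :+ # 3 := c :* c :+ # 2 :* # 2 :- # 1) (column κ)))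

  low∈ : ∀ κ → halfLine κ to∞ (low κ)
  low∈ type0 = ≋-refl , low-n type0
  low∈ type1 = half+half , low-n type1

  high∈ : ∀ κ → halfLine κ to∞ (high κ)
  high∈ type0 = ≋-refl , high-n type0
  high∈ type1 = half+half , high-n type1

  TwoPoints : Region → Set
  TwoPoints A = ∃₂ λ p q → A p × A q × ¬ (p ≃ q)

  ▸-injective : ∀ g {z w} → g ▸ z ≃ g ▸ w → z ≃ w
  ▸-injective g {z} {w} p = ≃-trans (≃-sym (▸-inverseˡ g z)) (≃-trans (▸-congʳ (g ⁻¹) p) (▸-inverseˡ g w))

  two-points-⊙ : ∀ {A B : Region} g → (∀ z → A z → B (g ▸ z)) → TwoPoints A → TwoPoints B
  two-points-⊙ g f (p , q , p∈ , q∈ , p≄q) = g ▸ p , g ▸ q , f p p∈ , f q q∈ , λ e → p≄q (▸-injective g e)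

  line-two-points : TwoPoints ⟨0,∞⟩
  line-two-points = low type0 , high type0 , ≋-refl , ≋-refl , low≄high type0

  halfLine-two-points : ∀ κ h → TwoPoints (halfLine κ h)
  halfLine-two-points κ to∞ = low κ , high κ , low∈ κ , high∈ κ , low≄high κ
  halfLine-two-points type0 to0 = two-points-⊙ S (half0-S to∞) (halfLine-two-points type0 to∞)
  halfLine-two-points type1 to0 = two-points-⊙ U half1-U (halfLine-two-points type1 to∞)

  geodesic-⊙ : ∀ {A : Region} → Polyhedral A → (∀ {p q z} → A p → A q → A z → orient p q z ≋ 0#) → TwoPoints A →
               ∀ g → IsGeodesicInterval (g ⊙ A)
  geodesic-⊙ {A} poly col two g = record
    { closed = λ {z} → ⊙-closed poly g {z}
    ; convex = λ {p} {q} {z} → ⊙-convex poly g {p} {q} {z}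
    ; collinear = λ {p} {q} {z} p∈ q∈ z∈ → ≋-trans (≋-sym (orient-invariant (g ⁻¹) p q z))
        (≋-trans (*-congˡ (col {g ⁻¹ ▸ p} {g ⁻¹ ▸ q} {g ⁻¹ ▸ z} (⊙-to resp′ g p∈) (⊙-to resp′ g q∈) (⊙-to resp′ g z∈))) (zeroʳ _))
    ; nondegenerate = let p , q , p∈ , q∈ , p≄q = two-points-⊙ {A} {g ⊙ A} g (λ z → ⊙-in g {z}) two in
        p , q , p∈ , q∈ , λ e → p≄q (by e)
    }
    where
    resp′ : Resp A
    resp′ = Polyhedral.respects poly

  line-geodesic : ∀ g → IsGeodesicInterval (g ⊙ ⟨0,∞⟩)
  line-geodesic = geodesic-⊙ line-polyhedral (λ {p} {q} {z} → line-collinear {p} {q} {z}) line-two-points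

  halfLine-geodesic : ∀ κ h g → IsGeodesicInterval (g ⊙ halfLine κ h)
  halfLine-geodesic κ h = geodesic-⊙ (halfLine-polyhedral κ h) (λ {p} {q} {z} → halfLine-collinear κ h {p} {q} {z}) (halfLine-two-points κ h)

  module EndpointOf (κ : Kind) (h : Half) (g : Γ) where
    A : Region
    A = g ⊙ halfLine κ h

    ℓ : Form
    ℓ = pull (g ⁻¹) (extremal κ h)

    nonneg : ∀ z → A z → 0# ≤ value ℓ z
    nonneg z z∈ = pull-nonneg (g ⁻¹) (extremal κ h) z (value-⊙ (halfLine-polyhedral κ h) g (extremal∈ κ h) z∈)

    at-apex : ∀ z → A z → value ℓ z ≋ 0# → z ≃ g ▸ apex κ
    at-apex z z∈ p = ≃-trans (≃-sym (▸-inverseʳ g z)) (▸-congʳ g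
      (extremal-apex κ h (⊙-to (halfLine-resp κ h) g z∈) (*-≋0 (pos⇒≉0 (den-pos (g ⁻¹) z)) (≋-trans (value-pull (g ⁻¹) (extremal κ h) z) p))))

    vanishes : ∀ {z} → z ≃ g ▸ apex κ → value ℓ z ≋ 0#
    vanishes {z} p = ≋-trans (≋-sym (value-pull (g ⁻¹) (extremal κ h) z)) (≋-trans (*-congˡ
      (≋-trans (value-cong (extremal κ h) (≃-trans (▸-congʳ (g ⁻¹) p) (▸-inverseˡ g (apex κ)))) (apex-extremal κ h))) (zeroʳ _))

    member : ∀ {z} → z ≃ g ▸ apex κ → A z
    member p = ⊙-resp g (≃-sym p) (⊙-in g (apex∈ κ h))

    -- The form vanishes at z and is there the weighted sum of two nonnegative values, at p and at
    -- q. A point with nonzero weight must therefore be the apex too.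
    endpoint : ∀ {z} → z ≃ g ▸ apex κ → Endpoint A z
    endpoint {z} z≃ = member z≃ , λ {p} {q} → extreme {p} {q}
      where
      extreme : ∀ {p q} → A p → A q → Between p q z → z ≈ʰ p ⊎ z ≈ʰ q
      extreme {p} {q} p∈ q∈ b@(t , t≥0 , t≤1 , _) with (1# - t) ≋? 0#
      ... | yes t≋1 = inj₂ (coordinates (≃-trans z≃ (≃-sym (at-apex q q∈ (*-≋0 t≉0 Q≋0)))))
        where
        sum≋0 : (1# - t) * value ℓ p + t * value ℓ q ≋ 0#
        sum≋0 = ≋-trans (≋-sym (Between-value (Form.α ℓ) (Form.β ℓ) (Form.γ ℓ) {p} {q} {z} b)) (vanishes z≃)
        Q≋0 : t * value ℓ q ≋ 0#
        Q≋0 = sum-zeroʳ (*-nonneg (≤⇒nonneg t≤1) (nonneg p p∈)) (*-nonneg t≥0 (nonneg q q∈)) sum≋0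
        t≉0 : ¬ (t ≋ 0#)
        t≉0 t≋0 = 0≉1 (≋-trans (≋-sym t≋0) (≋-sym (difference-zero t≋1)))
      ... | no t≉1 = inj₁ (coordinates (≃-trans z≃ (≃-sym (at-apex p p∈ (*-≋0 t≉1 P≋0)))))
        where
        P≋0 : (1# - t) * value ℓ p ≋ 0#
        P≋0 = sum-zeroˡ (*-nonneg (≤⇒nonneg t≤1) (nonneg p p∈)) (*-nonneg t≥0 (nonneg q q∈))
          (≋-trans (≋-sym (Between-value (Form.α ℓ) (Form.β ℓ) (Form.γ ℓ) {p} {q} {z} b)) (vanishes z≃))

  halves-meet-⊙ : ∀ κ g {z} → (g ⊙ halfLine κ to0) z → (g ⊙ halfLine κ to∞) z → z ≃ g ▸ apex κ
  halves-meet-⊙ κ g {z} p q = ≃-trans (≃-sym (▸-inverseʳ g z)) (▸-congʳ g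
    (halves-meet κ (⊙-to (halfLine-resp κ to0) g p) (⊙-to (halfLine-resp κ to∞) g q)))

  module Angle (p q r : ℍ) where
    -- For j = -1/c, where c < 0 is the intended cosine, this says u·v = c|u||v| without square
    -- roots: the sign of u·v together with the squared equation.
    Obtuse : Scalar → Set
    Obtuse j = 0# ≤ - (j * inner p q r) × j * j * (inner p q r * inner p q r) ≋ inner p q q * inner p r r

    inner-nonneg : ∀ q → 0# ≤ inner p q q
    inner-nonneg q = +-nonneg (square-nonneg _) (square-nonneg _)

    cosAngle : ∀ j c → j * c ≋ - 1# → Obtuse j → CosAngle p q r c
    cosAngle j c jc (obtuse , squares) =
      let m , m≥0 , m² = sqrt (inner-nonneg q)
          l , l≥0 , l² = sqrt (inner-nonneg r)
      in m , l , m≥0 , l≥0 , m² , l² , conclusion c j (inner p q r) (m * l)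
           (square-injective (*-nonneg m≥0 l≥0) obtuse (product m l (inner p q q) (inner p r r) j (inner p q r) m² l² squares)) jc
      where
      product : ∀ m l M L j K → m * m ≋ M → l * l ≋ L → j * j * (K * K) ≋ M * L → (m * l) * (m * l) ≋ (- (j * K)) * (- (j * K))
      product m l M L j K p q r = combine₃ (l * l) M (- 1#) p q r (ring! 6 (λ m l M L j K →
        (m :* l) :* (m :* l) :- (:- (j :* K)) :* (:- (j :* K))
        := (l :* l) :* (m :* m :- M) :+ M :* (l :* l :- L) :+ (:- # 1) :* (j :* j :* (K :* K) :- M :* L)) m l M L j K)
      conclusion : ∀ c j K m → m ≋ - (j * K) → j * c ≋ - 1# → K ≋ c * m
      conclusion c j K m p q = combine₂ (- c) K p q (ring! 4 (λ c j K m →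
        K :- c :* m := (:- c) :* (m :- (:- (j :* K))) :+ K :* (j :* c :- (:- # 1))) c j K m)

  -- Under g each inner product changes by a positive factor built from `den`, and the two sides of
  -- the squared equation by the same one.
  obtuse-▸ : ∀ g p q r j → Angle.Obtuse (g ▸ p) (g ▸ q) (g ▸ r) j → Angle.Obtuse p q r j
  obtuse-▸ g p q r j (a , b) =
    nonneg-by (*-nonneg (pos⇒nonneg F>0) a) (≋-trans (ring! 3 (λ F j K → F :* (:- (j :* K)) := :- (j :* (F :* K))) F j K)
      (-‿cong (*-congˡ (inner-invariant g p q r)))) ,
    ≋-trans (*-congˡ (*-cong (≋-sym (inner-invariant g p q r)) (≋-sym (inner-invariant g p q r))))
      (≋-trans (identity (den g p) (den g q) (den g r) j K (inner (g ▸ p) (g ▸ q) (g ▸ q)) (inner (g ▸ p) (g ▸ r) (g ▸ r)) b)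
        (*-cong (inner-invariant g p q q) (inner-invariant g p r r)))
    where
    F K : Scalar
    F = den g p * den g p * (den g q * den g r)
    K = inner (g ▸ p) (g ▸ q) (g ▸ r)
    F>0 : 0# < F
    F>0 = *-pos (*-pos (den-pos g p) (den-pos g p)) (*-pos (den-pos g q) (den-pos g r))
    identity : ∀ P Q R j K M L → j * j * (K * K) ≋ M * L →
      j * j * ((P * P * (Q * R) * K) * (P * P * (Q * R) * K)) ≋ (P * P * (Q * Q) * M) * (P * P * (R * R) * L)
    identity P Q R j K M L p = combine₁ (P * P * P * P * (Q * Q) * (R * R)) p (ring! 7 (λ P Q R j K M L →
      j :* j :* ((P :* P :* (Q :* R) :* K) :* (P :* P :* (Q :* R) :* K)) :- (P :* P :* (Q :* Q) :* M) :* (P :* P :* (R :* R) :* L)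
      := (P :* P :* P :* P :* (Q :* Q) :* (R :* R)) :* (j :* j :* (K :* K) :- M :* L)) P Q R j K M L)

  dir₁ dir₂ : ℍ → ℍ → Scalar
  dir₁ p q = proj₁ (direction p q)
  dir₂ p q = proj₂ (direction p q)

  vertical-dir : ∀ {p q} → x q ≋ x p → normSq p ≋ 1# → dir₁ p q ≋ 0# × dir₂ p q ≋ normSq q - 1#
  vertical-dir {p} {q} a b = identity₁ (x p) (y p) (x q) a , identity₂ (x p) (normSq p) (x q) (normSq q) a b
    where
    identity₁ : ∀ x y x′ → x′ ≋ x → 2# * y * (x′ - x) ≋ 0#
    identity₁ x y x′ p = combine₁ (2# * y) p (ring! 3 (λ x y x′ → # 2 :* y :* (x′ :- x) :- # 0 := # 2 :* y :* (x′ :- x)) x y x′)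
    identity₂ : ∀ x n x′ n′ → x′ ≋ x → n ≋ 1# → (n′ - n) - 2# * x * (x′ - x) ≋ n′ - 1#
    identity₂ x n x′ n′ p q = combine₂ (- (2# * x)) (- 1#) p q (ring! 4 (λ x n x′ n′ →
      (n′ :- n) :- # 2 :* x :* (x′ :- x) :- (n′ :- # 1) := (:- (# 2 :* x)) :* (x′ :- x) :+ (:- # 1) :* (n :- # 1)) x n x′ n′)

  circle-dir₂ : ∀ {p q} → x p + x p ≋ 1# → normSq p ≋ 1# → normSq q ≋ x q + x q → dir₂ p q ≋ x q - x p
  circle-dir₂ {p} {q} = identity (x p) (normSq p) (x q) (normSq q)
    where
    identity : ∀ x n x′ n′ → x + x ≋ 1# → n ≋ 1# → n′ ≋ x′ + x′ → (n′ - n) - 2# * x * (x′ - x) ≋ x′ - x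
    identity x n x′ n′ p q r = combine₃ (1# - (x′ - x)) (- 1#) 1# p q r (ring! 4 (λ x n x′ n′ →
      (n′ :- n) :- # 2 :* x :* (x′ :- x) :- (x′ :- x)
      := (# 1 :- (x′ :- x)) :* (x :+ x :- # 1) :+ (:- # 1) :* (n :- # 1) :+ # 1 :* (n′ :- (x′ :+ x′))) x n x′ n′)

  inner-by : ∀ {p q r a b c d} → dir₁ p q ≋ a × dir₂ p q ≋ b → dir₁ p r ≋ c × dir₂ p r ≋ d → inner p q r ≋ a * c + b * d
  inner-by (a , b) (c , d) = +-cong (*-cong a c) (*-cong b d)

  -- -1/cos π and -1/cos(2π/3).
  angleFactor : Kind → Scalar
  angleFactor type0 = 1#
  angleFactor type1 = 2#

  obtuse-swap : ∀ p q r j → Angle.Obtuse p q r j → Angle.Obtuse p r q j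
  obtuse-swap p q r j (a , b) = nonneg-by a (-‿cong (*-congˡ swap)) , ≋-trans (*-congˡ (*-cong (≋-sym swap) (≋-sym swap))) (≋-trans b (*-comm _ _))
    where
    swap : inner p q r ≋ inner p r q
    swap = +-cong (*-comm _ _) (*-comm _ _)

  -- At i both directions are vertical and opposed. At ρ they are δ(2y , 1) with δ = Re q - Re p ≤
  -- 0, and (0 , |r|² - 1); as 4y² + 1 = 4 there, the cosine is -1/2.
  obtuse-apex : ∀ κ {p q r} → p ≃ apex κ → halfLine κ to0 q → halfLine κ to∞ r → Angle.Obtuse p q r (angleFactor κ)
  obtuse-apex type0 {p} {q} {r} p≃@(by (px , _)) (qx , qn) (rx , rn) =
    nonneg-by (*-nonneg (≤⇒nonneg qn) (≤⇒nonneg rn)) (≋-sym (≋-trans (-‿cong (*-congˡ (inner-by {p} {q} {r} dq dr)))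
      (ring! 2 (λ n m → :- (# 1 :* (# 0 :* # 0 :+ (n :- # 1) :* (m :- # 1))) := (# 1 :- n) :* (m :- # 1)) (normSq q) (normSq r)))) ,
    ≋-trans (*-congˡ (*-cong (inner-by {p} {q} {r} dq dr) (inner-by {p} {q} {r} dq dr)))
      (≋-trans (ring! 2 (λ n m → let K = # 0 :* # 0 :+ (n :- # 1) :* (m :- # 1) in
         # 1 :* # 1 :* (K :* K) := (# 0 :* # 0 :+ (n :- # 1) :* (n :- # 1)) :* (# 0 :* # 0 :+ (m :- # 1) :* (m :- # 1))) (normSq q) (normSq r))
       (≋-sym (*-cong (inner-by {p} {q} {q} dq dq) (inner-by {p} {r} {r} dr dr))))
    where
    pn : normSq p ≋ 1#
    pn = ≋-trans (normSq-cong p≃) (apex-n type0)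
    dq : dir₁ p q ≋ 0# × dir₂ p q ≋ normSq q - 1#
    dq = vertical-dir {p} {q} (≋-trans qx (≋-sym px)) pn
    dr : dir₁ p r ≋ 0# × dir₂ p r ≋ normSq r - 1#
    dr = vertical-dir {p} {r} (≋-trans rx (≋-sym px)) pn
  obtuse-apex type1 {p} {q} {r} p≃@(by (px , _)) (qn , qx) (rx , rn) =
    nonneg-by (*-nonneg (*-nonneg (pos⇒nonneg 0<2) δ≤0) (≤⇒nonneg rn)) (≋-sym (≋-trans (-‿cong (*-congˡ (inner-by {p} {q} {r} dq dr)))
      (ring! 3 (λ e δ m → :- (# 2 :* (e :* # 0 :+ δ :* (m :- # 1))) := # 2 :* (:- δ) :* (m :- # 1)) (dir₁ p q) δ (normSq r)))) ,
    ≋-trans (*-congˡ (*-cong (inner-by {p} {q} {r} dq dr) (inner-by {p} {q} {r} dq dr)))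
      (≋-trans (identity (y p) (x p) δ (normSq p) (normSq r) 2px pn)
       (≋-sym (*-cong (inner-by {p} {q} {q} dq dq) (inner-by {p} {r} {r} dr dr))))
    where
    δ : Scalar
    δ = x q - x p
    pn : normSq p ≋ 1#
    pn = ≋-trans (normSq-cong p≃) (apex-n type1)
    2px : x p + x p ≋ 1#
    2px = ≋-trans (+-cong px px) half+half
    dq : dir₁ p q ≋ 2# * y p * (x q - x p) × dir₂ p q ≋ x q - x p
    dq = ≋-refl , circle-dir₂ {p} {q} 2px pn qn
    dr : dir₁ p r ≋ 0# × dir₂ p r ≋ normSq r - 1#
    dr = vertical-dir {p} {r} (halve (≋-trans rx (≋-sym 2px))) pn
    δ≤0 : 0# ≤ - δ
    δ≤0 = nonneg-cancel 0<2 (nonneg-by (≤⇒nonneg qx) (bound (x p) (x q) 2px))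
      where
      bound : ∀ a b → a + a ≋ 1# → 1# - (b + b) ≋ 2# * (- (b - a))
      bound a b p = combine₁ (- 1#) p (ring! 2 (λ a b → # 1 :- (b :+ b) :- # 2 :* (:- (b :- a)) := (:- # 1) :* (a :+ a :- # 1)) a b)
    identity : ∀ y x δ n m → x + x ≋ 1# → x * x + y * y ≋ 1# →
      let e = 2# * y * δ; K = e * 0# + δ * (m - 1#) in
      2# * 2# * (K * K) ≋ (e * e + δ * δ) * (0# * 0# + (m - 1#) * (m - 1#))
    identity y x δ n m p q = combine₂ (δ * δ * (m - 1#) * (m - 1#) * (x + x + 1#)) (- (2# * 2# * (δ * δ) * ((m - 1#) * (m - 1#)))) p q
      (ring! 4 (λ y x δ m → let e = # 2 :* y :* δ; K = e :* # 0 :+ δ :* (m :- # 1) in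
        # 2 :* # 2 :* (K :* K) :- (e :* e :+ δ :* δ) :* (# 0 :* # 0 :+ (m :- # 1) :* (m :- # 1))
        := (δ :* δ :* (m :- # 1) :* (m :- # 1) :* (x :+ x :+ # 1)) :* (x :+ x :- # 1)
           :+ (:- (# 2 :* # 2 :* (δ :* δ) :* ((m :- # 1) :* (m :- # 1)))) :* (x :* x :+ y :* y :- # 1)) y x δ m)

  angleCosine : Kind → Pred Scalar 0ℓ
  angleCosine type0 = cosπ
  angleCosine type1 = cos2π/3

  cosine : ∀ κ → ∃ λ c → angleCosine κ c × angleFactor κ * c ≋ - 1#
  cosine type0 = - 1# , ≋-refl , *-identityˡ (- 1#)
  cosine type1 = - ½ , combine₁ (- 1#) 2*half (ring! 1 (λ h → (:- h) :+ (:- h) :- (:- # 1) := (:- # 1) :* (# 2 :* h :- # 1)) ½) ,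
    combine₁ (- 1#) 2*half (ring! 1 (λ h → # 2 :* (:- h) :- (:- # 1) := (:- # 1) :* (# 2 :* h :- # 1)) ½)

  halves-adjacent : ∀ κ h g → Adjacent-at-angle-with-cosine (angleCosine κ) (g ⊙ halfLine κ h) (g ⊙ halfLine κ (flip h))
  halves-adjacent κ h g = g ▸ apex κ , EndpointOf.endpoint κ h g ≃-refl , EndpointOf.endpoint κ (flip h) g ≃-refl ,
    λ {q} {r} q∈ r∈ _ _ → let c , κc , jc = cosine κ in
      c , κc , Angle.cosAngle (g ▸ apex κ) q r (angleFactor κ) c jc
        (obtuse-▸ (g ⁻¹) (g ▸ apex κ) q r (angleFactor κ)
          (base h (⊙-to (halfLine-resp κ h) g q∈) (⊙-to (halfLine-resp κ (flip h)) g r∈)))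
    where
    base : ∀ h {q r} → halfLine κ h q → halfLine κ (flip h) r → Angle.Obtuse (g ⁻¹ ▸ g ▸ apex κ) q r (angleFactor κ)
    base to0 {q} {r} q∈ r∈ = obtuse-apex κ {g ⁻¹ ▸ g ▸ apex κ} {q} {r} (▸-inverseˡ g (apex κ)) q∈ r∈
    base to∞ {q} {r} q∈ r∈ = obtuse-swap (g ⁻¹ ▸ g ▸ apex κ) r q (angleFactor κ) (obtuse-apex κ {g ⁻¹ ▸ g ▸ apex κ} {r} {q} (▸-inverseˡ g (apex κ)) r∈ q∈)

-- Stabilisers of the model edges, and their inequivalence under Γ.

module Stabilisers (em : ExcludedMiddle 0ℓ) (ℝ : CompleteOrderedField) where
  open Sides em ℝ public
  open ModularGroup hiding (_⁻¹; module Γ; s; u; left; right; last; next; done)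
  private module Γ = Group PSL₂ℤ
  open Γ using (_⁻¹)

  -- On a vertical line a form is affine in y², and its values at y = 1 and y = 2 differ by 3γ.
  two-values : ∀ κ ℓ → value ℓ (low κ) ≋ 0# → value ℓ (high κ) ≋ 0# →
               Form.γ ℓ ≋ 0# × Form.α ℓ + Form.β ℓ * column κ ≋ 0#
  two-values κ (form α β γ) p q = γ≋0 , combine₂ 1# (- (c * c + 1# * 1#)) p γ≋0 (ring! 4 (λ α β γ c →
      α :+ β :* c :- # 0 := # 1 :* (α :+ β :* c :+ γ :* (c :* c :+ # 1 :* # 1) :- # 0) :+ (:- (c :* c :+ # 1 :* # 1)) :* (γ :- # 0)) α β γ c)
    where
    c : Scalar
    c = column κ
    γ≋0 : γ ≋ 0#
    γ≋0 = *-≋0 (pos⇒≉0 (numeral-pos 2)) (combine₂ 1# (- 1#) q p (ring! 4 (λ α β γ c →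
      # 3 :* γ :- # 0 := # 1 :* (α :+ β :* c :+ γ :* (c :* c :+ # 2 :* # 2) :- # 0)
        :+ (:- # 1) :* (α :+ β :* c :+ γ :* (c :* c :+ # 1 :* # 1) :- # 0)) α β γ c))

  pull-zero : ∀ g ℓ z → value ℓ (g ▸ z) ≋ 0# → value (pull g ℓ) z ≋ 0#
  pull-zero g ℓ z p = ≋-trans (≋-sym (value-pull g ℓ z)) (≋-trans (*-congˡ p) (zeroʳ _))

  fromℤ-product : ∀ i j → fromℤ i * fromℤ j ≋ 0# → i ℤ.* j ≡ 0ℤ
  fromℤ-product i j p = fromℤ-zero (i ℤ.* j) (≋-trans (fromℤ-* i j) p)

  -- The pullback of Re has constant term bd and leading coefficient ac. Both vanish, so with
  -- determinant 1 the integer matrix is diagonal or antidiagonal with entries ±1.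
  preserves-line : ∀ g → ⟨0,∞⟩ (g ▸ low type0) → ⟨0,∞⟩ (g ▸ high type0) → g Γ.≈ one ⊎ g Γ.≈ S
  preserves-line g@(sl (mat a b c d) det) p q =
    classify (fromℤ-product a c ac≋0) (fromℤ-product b d bd≋0)
    where
    coefficients : Form.γ (pull g ℓ-x) ≋ 0# × Form.α (pull g ℓ-x) + Form.β (pull g ℓ-x) * column type0 ≋ 0#
    coefficients = two-values type0 (pull g ℓ-x)
      (pull-zero g ℓ-x (low type0) (≋-trans (value-x (g ▸ low type0)) p))
      (pull-zero g ℓ-x (high type0) (≋-trans (value-x (g ▸ high type0)) q))
    ac≋0 : fromℤ a * fromℤ c ≋ 0#
    ac≋0 = ≋-trans (ring! 2 (λ a c → a :* c := # 0 :* (c :* c) :+ # 1 :* (a :* c) :+ # 0 :* (a :* a)) (fromℤ a) (fromℤ c)) (proj₁ coefficients)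
    bd≋0 : fromℤ b * fromℤ d ≋ 0#
    bd≋0 = ≋-trans (ring! 3 (λ b d e → b :* d := # 0 :* (d :* d) :+ # 1 :* (b :* d) :+ # 0 :* (b :* b) :+ e :* # 0)
      (fromℤ b) (fromℤ d) (Form.β (pull g ℓ-x))) (proj₂ coefficients)
    det-a≡0 : ∀ b c d → 0ℤ ℤ.* d ℤ.- b ℤ.* c ≡ b ℤ.* (ℤ.- c)
    det-a≡0 = solve-∀
    det-c≡0 : ∀ a b d → a ℤ.* d ℤ.- b ℤ.* 0ℤ ≡ a ℤ.* d
    det-c≡0 = solve-∀
    neg-≡ : ∀ {i j} → ℤ.- i ≡ j → i ≡ ℤ.- j
    neg-≡ {i} p = ≡.trans (≡.sym (ℤ.neg-involutive i)) (≡.cong ℤ.-_ p)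
    unit≢0 : ∀ {i j k} → i ℤ.* j ≡ 1ℤ → i ℤ.* k ≡ 0ℤ → k ≡ 0ℤ
    unit≢0 {i} {j} {k} p q = [ (λ { refl → ⊥-elim (0≢1 (≡.trans (≡.sym (ℤ.*-zeroˡ j)) p)) }) , (λ r → r) ]′ (ℤ.i*j≡0⇒i≡0∨j≡0 i {k} q)
      where
      0≢1 : ¬ (0ℤ ≡ 1ℤ)
      0≢1 ()
    classify : a ℤ.* c ≡ 0ℤ → b ℤ.* d ≡ 0ℤ → g Γ.≈ one ⊎ g Γ.≈ S
    classify ac bd with ℤ.i*j≡0⇒i≡0∨j≡0 a {c} ac
    ... | inj₁ refl = inj₂ (antidiagonal (unit-product b (ℤ.- c) b-c≡1) (unit≢0 {b} {ℤ.- c} {d} b-c≡1 bd))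
      where
      b-c≡1 : b ℤ.* (ℤ.- c) ≡ 1ℤ
      b-c≡1 = ≡.trans (≡.sym (det-a≡0 b c d)) det
      antidiagonal : (b ≡ 1ℤ × ℤ.- c ≡ 1ℤ) ⊎ (b ≡ ℤ.- 1ℤ × ℤ.- c ≡ ℤ.- 1ℤ) → d ≡ 0ℤ → g Γ.≈ S
      antidiagonal (inj₁ (b≡ , c≡)) d≡ = minus (mat-≡ refl b≡ (neg-≡ c≡) d≡)
      antidiagonal (inj₂ (b≡ , c≡)) d≡ = plus (mat-≡ refl b≡ (neg-≡ c≡) d≡)
    ... | inj₂ refl = inj₁ (diagonal (unit-product a d ad≡1) (unit≢0 {d} {a} {b} (≡.trans (ℤ.*-comm d a) ad≡1) (≡.trans (ℤ.*-comm d b) bd)))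
      where
      ad≡1 : a ℤ.* d ≡ 1ℤ
      ad≡1 = ≡.trans (≡.sym (det-c≡0 a b d)) det
      diagonal : (a ≡ 1ℤ × d ≡ 1ℤ) ⊎ (a ≡ ℤ.- 1ℤ × d ≡ ℤ.- 1ℤ) → b ≡ 0ℤ → g Γ.≈ one
      diagonal (inj₁ (a≡ , d≡)) b≡ = plus (mat-≡ a≡ b≡ refl d≡)
      diagonal (inj₂ (a≡ , d≡)) b≡ = minus (mat-≡ a≡ b≡ refl d≡)

  odd : ∀ m → ¬ (+ 2 ℤ.* m ≡ 1ℤ)
  odd m p with () ← ℕ.m*n≡1⇒m≡1 2 ℤ.∣ m ∣ (≡.trans (≡.sym (ℤ.abs-* (+ 2) m)) (≡.cong ℤ.∣_∣ p))

  zero-or-double : ∀ {i j} → i ℤ.* (+ 2 ℤ.* j ℤ.- i) ≡ 0ℤ → i ≡ 0ℤ ⊎ i ≡ + 2 ℤ.* j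
  zero-or-double {i} {j} p with ℤ.i*j≡0⇒i≡0∨j≡0 i p
  ... | inj₁ q = inj₁ q
  ... | inj₂ q = inj₂ (≡.sym (ℤ.i-j≡0⇒i≡j (+ 2 ℤ.* j) i q))

  even : ∀ {i j} → i ≡ 0ℤ ⊎ i ≡ + 2 ℤ.* j → ∃ λ k → i ≡ + 2 ℤ.* k
  even (inj₁ p) = 0ℤ , p
  even (inj₂ p) = _ , p

  fromℤ-double : ∀ i j → fromℤ i * (2# * fromℤ j - fromℤ i) ≋ 0# → i ℤ.* (+ 2 ℤ.* j ℤ.- i) ≡ 0ℤ
  fromℤ-double i j p = fromℤ-zero _ (≋-trans (fromℤ-* i _) (≋-trans (*-congˡ (≋-trans (fromℤ-+ (+ 2 ℤ.* j) (ℤ.- i))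
    (+-cong (≋-trans (fromℤ-* (+ 2) j) (*-congʳ (+-congˡ (+-identityʳ 1#)))) (fromℤ-neg i)))) p))

  2x-1-zero : ∀ g z → x (g ▸ z) + x (g ▸ z) ≋ 1# → value (pull g ℓ-2x-1) z ≋ 0#
  2x-1-zero g z p = pull-zero g ℓ-2x-1 z (≋-trans (value-2x-1 (g ▸ z)) (zero-difference p))

  leading : ∀ a c → - 1# * (c * c) + 2# * (a * c) + 0# * (a * a) ≋ 0# → c * (2# * a - c) ≋ 0#
  leading a c p = ≋-trans (ring! 2 (λ a c → c :* (# 2 :* a :- c) := (:- # 1) :* (c :* c) :+ # 2 :* (a :* c) :+ # 0 :* (a :* a)) a c) p

  -- The orbits of i and ρ differ: otherwise the bottom row of g would be even.
  line-not-half1 : ∀ g → x (g ▸ low type0) + x (g ▸ low type0) ≋ 1# → x (g ▸ high type0) + x (g ▸ high type0) ≋ 1# → ⊥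
  line-not-half1 g@(sl (mat a b c d) det) p q = contradict (even (zero-or-double {c} {a} c-even)) (even (zero-or-double {d} {b} d-even))
    where
    ℓ : Form
    ℓ = pull g ℓ-2x-1
    coefficients : Form.γ ℓ ≋ 0# × Form.α ℓ + Form.β ℓ * column type0 ≋ 0#
    coefficients = two-values type0 ℓ (2x-1-zero g (low type0) p) (2x-1-zero g (high type0) q)
    c-even : c ℤ.* (+ 2 ℤ.* a ℤ.- c) ≡ 0ℤ
    c-even = fromℤ-double c a (leading (fromℤ a) (fromℤ c) (proj₁ coefficients))
    d-even : d ℤ.* (+ 2 ℤ.* b ℤ.- d) ≡ 0ℤ
    d-even = fromℤ-double d b (≋-trans (ring! 3 (λ b d e →
      d :* (# 2 :* b :- d) := (:- # 1) :* (d :* d) :+ # 2 :* (b :* d) :+ # 0 :* (b :* b) :+ e :* # 0) (fromℤ b) (fromℤ d) (Form.β ℓ)) (proj₂ coefficients))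
    factor : ∀ a b k l → a ℤ.* (+ 2 ℤ.* l) ℤ.- b ℤ.* (+ 2 ℤ.* k) ≡ + 2 ℤ.* (a ℤ.* l ℤ.- b ℤ.* k)
    factor = solve-∀
    contradict : (∃ λ k → c ≡ + 2 ℤ.* k) → (∃ λ l → d ≡ + 2 ℤ.* l) → ⊥
    contradict (k , refl) (l , refl) = odd (a ℤ.* l ℤ.- b ℤ.* k) (≡.trans (≡.sym (factor a b k l)) det)

  -- The involution fixing (1 + i)/2, which exchanges the ends of the line Re z = 1/2.
  reflection : Γ
  reflection = sl (mat 1ℤ (ℤ.- 1ℤ) (+ 2) (ℤ.- 1ℤ)) refl

  -- The point 1/2 + 2i goes to (-1/2 + 2i)/4i = 1/2 + i/8. Numerator and denominator have squared
  -- absolute values 17/4 and 16, and 4(17/4 - 16) = -47.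
  reflection-high : ¬ (1# ≤ normSq (reflection ▸ high type1))
  reflection-high p = pos-not-nonpos (numeral-pos 46) (nonneg-by
    (*-nonneg (*-nonneg (pos⇒nonneg 0<2) (pos⇒nonneg 0<2)) (*-nonneg (pos⇒nonneg (den-pos reflection (high type1))) (≤⇒nonneg p)))
    (≋-trans (*-congˡ (≋-trans (ring! 2 (λ D n → D :* (n :- # 1) := D :* n :- D) (den reflection (high type1)) (normSq (reflection ▸ high type1)))
        (+-congʳ (Maps-n reflection {high type1} {reflection ▸ high type1} (Maps-▸ reflection (high type1))))))
      (identity ½ 2*half)))
    where
    identity : ∀ h → 2# * h ≋ 1# →
      let l = 1# + 0#; t = 1# + (1# + 0#); D = (t * h + - l) * (t * h + - l) + (t * 2#) * (t * 2#) in
      2# * 2# * ((l * l) * (h * h + 2# * 2#) + 2# * (l * - l) * h + - l * - l - D) ≋ - numeral 47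
    identity h p = combine₁ (1# + 2# * h + 2# * 2# * - (2# * h - 1#) - 2# * 2#) p (ring! 1 (λ h →
      let l = # 1 :+ # 0; t = # 1 :+ (# 1 :+ # 0); D = (t :* h :+ :- l) :* (t :* h :+ :- l) :+ (t :* # 2) :* (t :* # 2) in
      # 2 :* # 2 :* ((l :* l) :* (h :* h :+ # 2 :* # 2) :+ # 2 :* (l :* :- l) :* h :+ :- l :* :- l :- D) :- (:- # 47)
      := (# 1 :+ # 2 :* h :+ # 2 :* # 2 :* :- (# 2 :* h :- # 1) :- # 2 :* # 2) :* (# 2 :* h :- # 1)) h)

  -- 2α + β, for the pullback of 2x - 1.
  half1-relation : ∀ a b c d → c ℤ.* (+ 2 ℤ.* a ℤ.- c) ≡ 0ℤ → a ℤ.* d ℤ.- b ℤ.* c ≡ 1ℤ →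
    + 2 ℤ.* (b ℤ.* d) ℤ.- d ℤ.* d ℤ.- c ℤ.* d ℤ.+ (a ℤ.* d ℤ.+ b ℤ.* c) ≡ 0ℤ →
    (a ≡ d × b ≡ 0ℤ × c ≡ 0ℤ × (a ≡ 1ℤ ⊎ a ≡ ℤ.- 1ℤ)) ⊎ ((a ≡ 1ℤ ⊎ a ≡ ℤ.- 1ℤ) × b ≡ ℤ.- a × c ≡ + 2 ℤ.* a × d ≡ ℤ.- a)
  half1-relation a b c d c-even det rel with zero-or-double {c} {a} c-even
  ... | inj₁ refl with unit-product a d (≡.trans (≡.sym (det-c≡0 a b d)) det)
    where
    det-c≡0 : ∀ a b d → a ℤ.* d ℤ.- b ℤ.* 0ℤ ≡ a ℤ.* d
    det-c≡0 = solve-∀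
  ...   | inj₁ (refl , refl) = inj₁ (refl , double-zero b (≡.trans (≡.sym (identity b)) rel) , refl , inj₁ refl)
    where
    identity : ∀ b → + 2 ℤ.* (b ℤ.* 1ℤ) ℤ.- 1ℤ ℤ.* 1ℤ ℤ.- 0ℤ ℤ.* 1ℤ ℤ.+ (1ℤ ℤ.* 1ℤ ℤ.+ b ℤ.* 0ℤ) ≡ + 2 ℤ.* b
    identity = solve-∀
    double-zero : ∀ b → + 2 ℤ.* b ≡ 0ℤ → b ≡ 0ℤ
    double-zero b p with ℤ.i*j≡0⇒i≡0∨j≡0 (+ 2) p
    ... | inj₂ q = q
  ...   | inj₂ (refl , refl) = inj₁ (refl , double-zero b (≡.trans (≡.sym (identity b)) rel) , refl , inj₂ refl)
    where
    identity : ∀ b → + 2 ℤ.* (b ℤ.* (ℤ.- 1ℤ)) ℤ.- (ℤ.- 1ℤ) ℤ.* (ℤ.- 1ℤ) ℤ.- 0ℤ ℤ.* (ℤ.- 1ℤ) ℤ.+ ((ℤ.- 1ℤ) ℤ.* (ℤ.- 1ℤ) ℤ.+ b ℤ.* 0ℤ) ≡ (ℤ.- + 2) ℤ.* b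
    identity = solve-∀
    double-zero : ∀ b → (ℤ.- + 2) ℤ.* b ≡ 0ℤ → b ≡ 0ℤ
    double-zero b p with ℤ.i*j≡0⇒i≡0∨j≡0 (ℤ.- + 2) p
    ... | inj₂ q = q
  -- Here the determinant is a(d - 2b), so d - 2b = a = ±1. The relation factors as -(d - 2b)(a + d)
  -- = 0, whence d = -a and b = -a: the matrix is ± that of `reflection`.
  half1-relation a b c d c-even det rel | inj₂ refl =
    inj₂ (sign , b≡ , refl , d≡)
    where
    det-factor : ∀ a b d → a ℤ.* d ℤ.- b ℤ.* (+ 2 ℤ.* a) ≡ a ℤ.* (d ℤ.- + 2 ℤ.* b)
    det-factor = solve-∀
    units : (a ≡ 1ℤ × d ℤ.- + 2 ℤ.* b ≡ 1ℤ) ⊎ (a ≡ ℤ.- 1ℤ × d ℤ.- + 2 ℤ.* b ≡ ℤ.- 1ℤ)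
    units = unit-product a (d ℤ.- + 2 ℤ.* b) (≡.trans (≡.sym (det-factor a b d)) det)
    sign : a ≡ 1ℤ ⊎ a ≡ ℤ.- 1ℤ
    sign = [ (λ p → inj₁ (proj₁ p)) , (λ p → inj₂ (proj₁ p)) ]′ units
    difference : d ℤ.- + 2 ℤ.* b ≡ a
    difference = [ (λ { (p , q) → ≡.trans q (≡.sym p) }) , (λ { (p , q) → ≡.trans q (≡.sym p) }) ]′ units
    factored : ∀ a b d → + 2 ℤ.* (b ℤ.* d) ℤ.- d ℤ.* d ℤ.- + 2 ℤ.* a ℤ.* d ℤ.+ (a ℤ.* d ℤ.+ b ℤ.* (+ 2 ℤ.* a))
                         ≡ (d ℤ.- + 2 ℤ.* b) ℤ.* (ℤ.- (a ℤ.+ d))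
    factored = solve-∀
    1≢0 : ¬ (1ℤ ≡ 0ℤ)
    1≢0 ()
    -1≢0 : ¬ (ℤ.- 1ℤ ≡ 0ℤ)
    -1≢0 ()
    sum≡0 : ℤ.- (a ℤ.+ d) ≡ 0ℤ
    difference≢0 : ¬ (d ℤ.- + 2 ℤ.* b ≡ 0ℤ)
    difference≢0 p = [ (λ { (_ , q) → 1≢0 (≡.trans (≡.sym q) p) }) , (λ { (_ , q) → -1≢0 (≡.trans (≡.sym q) p) }) ]′ units
    sum≡0 = [ (λ p → ⊥-elim (difference≢0 p)) , (λ p → p) ]′
      (ℤ.i*j≡0⇒i≡0∨j≡0 (d ℤ.- + 2 ℤ.* b) (≡.trans (≡.sym (factored a b d)) rel))
    d≡ : d ≡ ℤ.- a
    d≡ = ≡.trans (identity a d) (≡.trans (≡.cong (λ k → ℤ.- a ℤ.- k) sum≡0) (ℤ.+-identityʳ (ℤ.- a)))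
      where
      identity : ∀ a d → d ≡ ℤ.- a ℤ.- ℤ.- (a ℤ.+ d)
      identity = solve-∀
    b≡ : b ≡ ℤ.- a
    b≡ = ℤ.*-cancelˡ-≡ (+ 2) b (ℤ.- a) (≡.trans (identity b d) (≡.trans (≡.cong₂ ℤ._-_ d≡ difference) (identity′ a)))
      where
      identity : ∀ b d → + 2 ℤ.* b ≡ d ℤ.- (d ℤ.- + 2 ℤ.* b)
      identity = solve-∀
      identity′ : ∀ a → ℤ.- a ℤ.- a ≡ + 2 ℤ.* (ℤ.- a)
      identity′ = solve-∀

  -- The line Re z = 1/2 is preserved by the identity and by `reflection`; the latter exchanges its
  -- ends and moves `high type1` off the half-line.
  preserves-half1 : ∀ g → halfLine type1 to∞ (g ▸ low type1) → halfLine type1 to∞ (g ▸ high type1) → g Γ.≈ one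
  preserves-half1 g@(sl (mat a b c d) det) (p , _) (q , q′) = conclude (half1-relation a b c d c-even det relation)
    where
    ℓ : Form
    ℓ = pull g ℓ-2x-1
    coefficients : Form.γ ℓ ≋ 0# × Form.α ℓ + Form.β ℓ * column type1 ≋ 0#
    coefficients = two-values type1 ℓ (2x-1-zero g (low type1) p) (2x-1-zero g (high type1) q)
    c-even : c ℤ.* (+ 2 ℤ.* a ℤ.- c) ≡ 0ℤ
    c-even = fromℤ-double c a (leading (fromℤ a) (fromℤ c) (proj₁ coefficients))
    doubled : ∀ a b c d h → 2# * h ≋ 1# →
      (- 1# * (d * d) + 2# * (b * d) + 0# * (b * b))
        + (- 1# * (2# * (c * d)) + 2# * (a * d + b * c) + 0# * (2# * (a * b))) * h ≋ 0# →
      (2# * (b * d) + - (d * d)) + - (c * d) + (a * d + b * c) ≋ 0#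
    doubled a b c d h p q = combine₂ (- ((a * d + b * c) - c * d)) 1# p q (ring! 5 (λ a b c d h →
      (# 2 :* (b :* d) :+ :- (d :* d)) :+ :- (c :* d) :+ (a :* d :+ b :* c) :- # 0
      := (:- ((a :* d :+ b :* c) :- c :* d)) :* (# 2 :* h :- # 1)
        :+ # 1 :* ((:- # 1 :* (d :* d) :+ # 2 :* (b :* d) :+ # 0 :* (b :* b))
          :+ (:- # 1 :* (# 2 :* (c :* d)) :+ # 2 :* (a :* d :+ b :* c) :+ # 0 :* (# 2 :* (a :* b))) :* h :- # 0)) a b c d h)
    relation : + 2 ℤ.* (b ℤ.* d) ℤ.- d ℤ.* d ℤ.- c ℤ.* d ℤ.+ (a ℤ.* d ℤ.+ b ℤ.* c) ≡ 0ℤ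
    relation = fromℤ-zero _ (≋-trans homomorphic (doubled (fromℤ a) (fromℤ b) (fromℤ c) (fromℤ d) ½ 2*half (proj₂ coefficients)))
      where
      homomorphic : fromℤ (+ 2 ℤ.* (b ℤ.* d) ℤ.- d ℤ.* d ℤ.- c ℤ.* d ℤ.+ (a ℤ.* d ℤ.+ b ℤ.* c)) ≋
        (2# * (fromℤ b * fromℤ d) + - (fromℤ d * fromℤ d)) + - (fromℤ c * fromℤ d) + (fromℤ a * fromℤ d + fromℤ b * fromℤ c)
      homomorphic = ≋-trans (fromℤ-+ (+ 2 ℤ.* (b ℤ.* d) ℤ.- d ℤ.* d ℤ.- c ℤ.* d) (a ℤ.* d ℤ.+ b ℤ.* c)) (+-cong
        (≋-trans (fromℤ-+ (+ 2 ℤ.* (b ℤ.* d) ℤ.- d ℤ.* d) (ℤ.- (c ℤ.* d))) (+-cong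
          (≋-trans (fromℤ-+ (+ 2 ℤ.* (b ℤ.* d)) (ℤ.- (d ℤ.* d))) (+-cong
            (≋-trans (fromℤ-* (+ 2) (b ℤ.* d)) (*-cong (+-congˡ (+-identityʳ 1#)) (fromℤ-* b d)))
            (≋-trans (fromℤ-neg (d ℤ.* d)) (-‿cong (fromℤ-* d d)))))
          (≋-trans (fromℤ-neg (c ℤ.* d)) (-‿cong (fromℤ-* c d)))))
        (≋-trans (fromℤ-+ (a ℤ.* d) (b ℤ.* c)) (+-cong (fromℤ-* a d) (fromℤ-* b c))))
    excluded : ¬ (g Γ.≈ reflection)
    excluded e = reflection-high (≤-respʳ (normSq-cong (▸-congˡ {g} {reflection} (high type1) e)) q′)
    conclude : (a ≡ d × b ≡ 0ℤ × c ≡ 0ℤ × (a ≡ 1ℤ ⊎ a ≡ ℤ.- 1ℤ)) ⊎ ((a ≡ 1ℤ ⊎ a ≡ ℤ.- 1ℤ) × b ≡ ℤ.- a × c ≡ + 2 ℤ.* a × d ≡ ℤ.- a) → g Γ.≈ one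
    conclude (inj₁ (a≡d , b≡ , c≡ , inj₁ a≡)) = plus (mat-≡ a≡ b≡ c≡ (≡.trans (≡.sym a≡d) a≡))
    conclude (inj₁ (a≡d , b≡ , c≡ , inj₂ a≡)) = minus (mat-≡ a≡ b≡ c≡ (≡.trans (≡.sym a≡d) a≡))
    conclude (inj₂ (inj₁ refl , b≡ , c≡ , d≡)) = ⊥-elim (excluded (plus (mat-≡ refl b≡ c≡ d≡)))
    conclude (inj₂ (inj₂ refl , b≡ , c≡ , d≡)) = ⊥-elim (excluded (minus (mat-≡ refl b≡ c≡ d≡)))

  S-high : ¬ (1# ≤ normSq (S ▸ high type0))
  S-high p = pos-not-nonpos (numeral-pos 2) (nonneg-by (*-nonneg (pos⇒nonneg (n>0 (high type0))) (≤⇒nonneg p))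
    (identity (normSq (S ▸ high type0)) (S-n (high type0))))
    where
    identity : ∀ m → (0# * 0# + 2# * 2#) * m ≋ 1# → (0# * 0# + 2# * 2#) * (m - 1#) ≋ - numeral 3
    identity m p = combine₁ 1# p (ring! 1 (λ m → (# 0 :* # 0 :+ # 2 :* # 2) :* (m :- # 1) :- (:- # 3) := # 1 :* ((# 0 :* # 0 :+ # 2 :* # 2) :* m :- # 1)) m)

  preserves-half0 : ∀ g → (∀ z → halfLine type0 to∞ z → halfLine type0 to∞ (g ▸ z)) → g Γ.≈ one
  preserves-half0 g f = [ (λ p → p) , (λ p → ⊥-elim (S-high (high-S p))) ]′
    (preserves-line g (proj₁ (f (low type0) (low∈ type0))) (proj₁ (f (high type0) (high∈ type0))))
    where
    high-S : g Γ.≈ S → 1# ≤ normSq (S ▸ high type0)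
    high-S p = ≤-respʳ (normSq-cong (▸-congˡ {g} {S} (high type0) p)) (proj₂ (f (high type0) (high∈ type0)))

  -- For the half-line to ∞, g would preserve it and hence be 1; but the line contains i/2 = S(2i).
  -- The other half-line reduces to this one through S.
  line-not-half0 : ∀ g h → ¬ (∀ z → ⟨0,∞⟩ z → halfLine type0 h (g ▸ z))
  line-not-half0 g to∞ f = S-high (≤-respʳ
    (normSq-cong (≃-trans (▸-congˡ {g} {one} (S ▸ high type0) (preserves-half0 g λ z z∈ → f z (proj₁ z∈))) (▸-one (S ▸ high type0))))
    (proj₂ (f (S ▸ high type0) (line-S (high type0) ≋-refl))))
  line-not-half0 g to0 f = line-not-half0 (S · g) to∞ λ z z∈ →
    halfLine-resp type0 to∞ (≃-sym (▸-· S g z)) (half0-S to0 (g ▸ z) (f z z∈))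

  half0∞-not-half1 : ∀ g h → ¬ (∀ z → halfLine type0 to∞ z → halfLine type1 h (g ▸ z))
  half0∞-not-half1 g h f = avoid (to-∞ h f)
    where
    Sends : Γ → Set
    Sends k = ∀ z → halfLine type0 to∞ z → halfLine type1 to∞ (k ▸ z)
    to-∞ : ∀ h → (∀ z → halfLine type0 to∞ z → halfLine type1 h (g ▸ z)) → ∃ Sends
    to-∞ to∞ f = g , f
    to-∞ to0 f = U · U · g , λ z z∈ → halfLine-resp type1 to∞ (≃-sym (▸-· (U · U) g z)) (half1-UU (g ▸ z) (f z z∈))
    avoid : ¬ ∃ Sends
    avoid (k , f) = line-not-half1 k (proj₁ (f (low type0) (low∈ type0))) (proj₁ (f (high type0) (high∈ type0)))

  half0-not-half1 : ∀ g h h′ → ¬ (∀ z → halfLine type0 h z → halfLine type1 h′ (g ▸ z))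
  half0-not-half1 g to∞ h′ f = half0∞-not-half1 g h′ f
  half0-not-half1 g to0 h′ f = half0∞-not-half1 (g · S) h′ λ z z∈ →
    halfLine-resp type1 h′ (≃-sym (▸-· g S z)) (f (S ▸ z) (half0-S to∞ z z∈))

  flips-half0 : ∀ g h → (∀ z → halfLine type0 h z → halfLine type0 (flip h) (g ▸ z)) → g Γ.≈ S
  flips-half0 g to∞ f = begin
    g             ≈⟨ cancelˡ g S·S ⟨
    S · (S · g)   ≈⟨ ·-congˡ {S} (preserves-half0 (S · g) λ z z∈ → halfLine-resp type0 to∞ (≃-sym (▸-· S g z)) (half0-S to0 (g ▸ z) (f z z∈))) ⟩
    S · one       ≈⟨ Γ.identityʳ S ⟩
    S             ∎
  flips-half0 g to0 f = begin
    g             ≈⟨ Γ.identityʳ g ⟨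
    g · one       ≈⟨ ·-congˡ {g} S·S ⟨
    g · (S · S)   ≈⟨ ·-assoc g S S ⟨
    g · S · S     ≈⟨ ·-congʳ {S} (preserves-half0 (g · S) λ z z∈ → halfLine-resp type0 to∞ (≃-sym (▸-· g S z)) (f (S ▸ z) (half0-S to∞ z z∈))) ⟩
    one · S       ≈⟨ Γ.identityˡ S ⟩
    S             ∎

  rotates-half1 : ∀ g → (∀ z → halfLine type1 to0 z → halfLine type1 to∞ (g ▸ z)) → g Γ.≈ U · U
  rotates-half1 g f = begin
    g                   ≈⟨ Γ.identityʳ g ⟨
    g · one             ≈⟨ ·-congˡ {g} (spin-opp ModularGroup.left) ⟨
    g · (U · (U · U))   ≈⟨ ·-assoc g U (U · U) ⟨
    g · U · (U · U)     ≈⟨ ·-congʳ {U · U} (preserves-half1 (g · U) (at (low type1) (low∈ type1)) (at (high type1) (high∈ type1))) ⟩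
    one · (U · U)       ≈⟨ Γ.identityˡ (U · U) ⟩
    U · U               ∎
    where
    at : ∀ z → halfLine type1 to∞ z → halfLine type1 to∞ (g · U ▸ z)
    at z z∈ = halfLine-resp type1 to∞ (≃-sym (▸-· g U z)) (f (U ▸ z) (half1-U z z∈))

  transported : ∀ (A B : Region) → Resp B → ∀ g f f′ → g ⊙ (f ⊙ A) ⊑ f′ ⊙ B → ∀ z → A z → B (f′ ⁻¹ · g · f ▸ z)
  transported A B B-resp g f f′ sub z z∈ = B-resp
    (≃-trans (▸-congʳ (f′ ⁻¹) (▸▸ g f z)) (≃-trans (▸▸ (f′ ⁻¹) (g · f) z) (▸-congˡ {f′ ⁻¹ · (g · f)} {f′ ⁻¹ · g · f} z (Γ.sym (·-assoc (f′ ⁻¹) g f)))))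
    (⊙-to B-resp f′ (sub (g ▸ f ▸ z) (⊙-in g (⊙-in f z∈))))

  transported′ : ∀ (A B : Region) → Resp B → ∀ f f′ → f ⊙ A ⊑ f′ ⊙ B → ∀ z → A z → B (f′ ⁻¹ · f ▸ z)
  transported′ A B B-resp f f′ sub z z∈ = B-resp (▸▸ (f′ ⁻¹) f z) (⊙-to B-resp f′ (sub (f ▸ z) (⊙-in f z∈)))

  untransport : ∀ {g f f′ k} → f′ ⁻¹ · g · f Γ.≈ k → g Γ.≈ f′ · k · f ⁻¹
  untransport {g} {f} {f′} {k} p = begin
    g                                   ≈⟨ //-rightDividesʳ f g ⟨
    g · f · f ⁻¹                        ≈⟨ ·-congʳ {f ⁻¹} (\\-leftDividesˡ f′ (g · f)) ⟨
    f′ · (f′ ⁻¹ · (g · f)) · f ⁻¹       ≈⟨ ·-congʳ {f ⁻¹} (·-congˡ {f′} (Γ.trans (Γ.sym (·-assoc (f′ ⁻¹) g f)) p)) ⟩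
    f′ · k · f ⁻¹                       ∎

-- The elements of ⟨S⟩ and ⟨U⟩.

module CyclicStabilisers (𝒢 : Group 0ℓ 0ℓ) (generator : Kind → Group.Carrier 𝒢)
    (S² : Group._≈_ 𝒢 (Group._∙_ 𝒢 (generator type0) (generator type0)) (Group.ε 𝒢))
    (U³ : Group._≈_ 𝒢 (Group._∙_ 𝒢 (generator type1) (Group._∙_ 𝒢 (generator type1) (generator type1))) (Group.ε 𝒢)) where
  open TwoGenerators 𝒢 generator S² U³
  private module T = GroupTheory 𝒢

  ⟨S⟩ : ∀ {k} → T.⟨_⟩ S k → k ≈ ε ⊎ k ≈ S
  ⟨S⟩ T.gen  = inj₂ ≈-refl
  ⟨S⟩ T.unit = inj₁ ≈-refl
  ⟨S⟩ (T.prod {y} {z} p q) = product (⟨S⟩ p) (⟨S⟩ q)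
    where
    product : y ≈ ε ⊎ y ≈ S → z ≈ ε ⊎ z ≈ S → y ∙ z ≈ ε ⊎ y ∙ z ≈ S
    product (inj₁ a) (inj₁ b) = inj₁ (≈-trans (∙-cong a b) (identityˡ ε))
    product (inj₁ a) (inj₂ b) = inj₂ (≈-trans (∙-cong a b) (identityˡ S))
    product (inj₂ a) (inj₁ b) = inj₂ (≈-trans (∙-cong a b) (identityʳ S))
    product (inj₂ a) (inj₂ b) = inj₁ (≈-trans (∙-cong a b) S∙S)
  ⟨S⟩ (T.inv {y} p) = inverse (⟨S⟩ p)
    where
    inverse : y ≈ ε ⊎ y ≈ S → y ⁻¹ ≈ ε ⊎ y ⁻¹ ≈ S
    inverse (inj₁ a) = inj₁ (≈-trans (⁻¹-cong a) ε⁻¹≈ε)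
    inverse (inj₂ a) = inj₂ (≈-trans (⁻¹-cong a) S⁻¹)
  ⟨S⟩ (T.⟨⟩-resp e p) = [ (λ a → inj₁ (≈-trans (≈-sym e) a)) , (λ a → inj₂ (≈-trans (≈-sym e) a)) ]′ (⟨S⟩ p)

  ⟨U⟩ : ∀ {k} → T.⟨_⟩ U k → ∃ λ j → k ≈ rotate j
  ⟨U⟩ T.gen  = turn left , ≈-refl
  ⟨U⟩ T.unit = still , ≈-refl
  ⟨U⟩ (T.prod {y} {z} p q) = product (⟨U⟩ p) (⟨U⟩ q)
    where
    product : (∃ λ j → y ≈ rotate j) → (∃ λ j → z ≈ rotate j) → ∃ λ j → y ∙ z ≈ rotate j
    product (j , a) (still , b)  = j , ≈-trans (∙-cong a b) (identityʳ (rotate j))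
    product (j , a) (turn t , b) = let k , c = rotate-spin j t in k , ≈-trans (∙-cong a b) c
  ⟨U⟩ (T.inv {y} p) = inverse (⟨U⟩ p)
    where
    inverse : (∃ λ j → y ≈ rotate j) → ∃ λ j → y ⁻¹ ≈ rotate j
    inverse (still , a)  = still , ≈-trans (⁻¹-cong a) ε⁻¹≈ε
    inverse (turn t , a) = turn (opp t) , ≈-trans (⁻¹-cong a) (≈-sym (inverseˡ-unique (spin (opp t)) (spin t) (opp-spin t)))
  ⟨U⟩ (T.⟨⟩-resp e p) = let j , a = ⟨U⟩ p in j , ≈-trans (≈-sym e) a

  U∈ : ∀ t → T.⟨_⟩ U (spin t)
  U∈ left  = T.gen
  U∈ right = T.prod T.gen T.gen

-- Combinatorics of the cut graph and of its lift.

module Lifted (em : ExcludedMiddle 0ℓ) (𝒢 : Group 0ℓ 0ℓ) (generator : Kind → Group.Carrier 𝒢)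
    (S² : Group._≈_ 𝒢 (Group._∙_ 𝒢 (generator type0) (generator type0)) (Group.ε 𝒢))
    (U³ : Group._≈_ 𝒢 (Group._∙_ 𝒢 (generator type1) (Group._∙_ 𝒢 (generator type1) (generator type1))) (Group.ε 𝒢))
    (G : GroupTheory.Subgroup 𝒢)
    (C : CutSet (CosetGraph.Y-comb 𝒢 generator G))
    (tree : Graph.IsTree (Cutting.cutGraph (CosetGraph.Y-comb 𝒢 generator G) C))
    (ȷ : GraphMap (Cutting.cutGraph (CosetGraph.Y-comb 𝒢 generator G) C) (CosetGraph.Y-comb 𝒢 generator (GroupTheory.trivial 𝒢)))
    (overV : ∀ v → Graph.V._≈_ (CosetGraph.Y-comb 𝒢 generator G) (GraphMap.vertex ȷ v) (Cutting.glueVertex (CosetGraph.Y-comb 𝒢 generator G) C v))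
    (overE : ∀ e → Graph.E._≈_ (CosetGraph.Y-comb 𝒢 generator G) (GraphMap.edge ȷ e) e) where
  open TwoGenerators 𝒢 generator S² U³
  open CyclicStabilisers 𝒢 generator S² U³
  private
    module T = GroupTheory 𝒢
    module K = CosetGraph 𝒢 generator
  open Cutting (K.Y-comb G) C
  module Y = Graph (K.Y-comb G)
  module Y′ = Graph cutGraph
  open CutSet C using (Cut; cut-resp; bivalent)

  r : Carrier → Carrier
  r = GraphMap.edge ȷ

  infix 4 _~_

  _~_ : Carrier → Carrier → Set
  _~_ = Y.E._≈_

  ~-refl : ∀ {x} → x ~ x
  ~-refl = Y.E.refl

  ~-sym : ∀ {x y} → x ~ y → y ~ x
  ~-sym = Y.E.sym

  ~-trans : ∀ {x y z} → x ~ y → y ~ z → x ~ z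
  ~-trans = Y.E.trans

  ≈⇒~ : ∀ {x y} → x ≈ y → x ~ y
  ≈⇒~ {x} p = ε , T.ε-closed G , ≈-trans (≈-sym p) (≈-sym (identityˡ x))

  ~-∙ : ∀ {x y} k → x ~ y → x ∙ k ~ y ∙ k
  ~-∙ {x} k (h , h∈ , p) = h , h∈ , ≈-trans (∙-congʳ {k} p) (∙-assoc h x k)

  ~-cancel : ∀ {x y} k → x ∙ k ~ y ∙ k → x ~ y
  ~-cancel {x} {y} k p = ~-trans (≈⇒~ (≈-sym (//-rightDividesʳ k x))) (~-trans (~-∙ (k ⁻¹) p) (≈⇒~ (//-rightDividesʳ k y)))

  r-cong : ∀ {x y} → x ~ y → r x ≈ r y
  r-cong {x} p = let h , h≈ , q = Func.cong (GraphMap.onE ȷ) p in ≈-sym (≈-trans q (≈-trans (∙-congʳ {r x} h≈) (identityˡ (r x))))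

  r~ : ∀ x → r x ~ x
  r~ = overE

  r-injective : ∀ {x y} → r x ≈ r y → x ~ y
  r-injective {x} {y} p = ~-trans (~-sym (r~ x)) (~-trans (≈⇒~ p) (r~ y))

  inc-refl : ∀ κ e → Y.Inc e (κ , e)
  inc-refl κ e = ε , ε , T.ε-closed G , T.unit , ≈-sym (≈-trans (identityʳ (ε ∙ e)) (identityˡ e))

  inc-same : ∀ {κ e y} → Y.Inc e (κ , y) → (κ , e) Y.V.≈ (κ , y)
  inc-same p = K.same p

  inc-~ : ∀ {κ e y} → Y.Inc e (κ , y) → ∃ λ k → T.⟨_⟩ (generator κ) k × y ~ e ∙ k
  inc-~ {e = e} (h , k , h∈ , k∈ , p) = k , k∈ , h ⁻¹ , T.⁻¹-closed G h∈ ,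
    ≈-trans (≈-sym (\\-leftDividesʳ h (e ∙ k))) (∙-congˡ {h ⁻¹} (≈-trans (≈-sym (∙-assoc h e k)) (≈-sym p)))

  inc-∙ : ∀ {κ e y k} → T.⟨_⟩ (generator κ) k → Y.Inc e (κ , y) → Y.Inc (e ∙ k) (κ , y)
  inc-∙ {κ} {e} {y} {k} k∈ (h , l , h∈ , l∈ , p) = h , k ⁻¹ ∙ l , h∈ , T.prod (T.inv k∈) l∈ , (begin
    y                             ≈⟨ p ⟩
    h ∙ e ∙ l                     ≈⟨ ∙-congʳ {l} (//-rightDividesʳ k (h ∙ e)) ⟨
    h ∙ e ∙ k ∙ k ⁻¹ ∙ l          ≈⟨ ∙-congʳ {l} (∙-congʳ {k ⁻¹} (∙-assoc h e k)) ⟩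
    h ∙ (e ∙ k) ∙ k ⁻¹ ∙ l        ≈⟨ ∙-assoc (h ∙ (e ∙ k)) (k ⁻¹) l ⟩
    h ∙ (e ∙ k) ∙ (k ⁻¹ ∙ l)      ∎)

  same-kind : ∀ {κ κ′ x y} → (κ′ , x) Y.V.≈ (κ , y) → κ′ ≡ κ
  same-kind (K.same _) = refl

  -- An uncut vertex has a single image in 𝐓, of the same kind by `overV`, and the edges of 𝐓 at
  -- that image form one left coset of the cyclic group of this kind.
  share : ∀ {κ y nc e₁ e₂} → Y.Inc e₁ (κ , y) → Y.Inc e₂ (κ , y) →
          ∃ λ k → T.⟨_⟩ (generator κ) k × r e₂ ≈ r e₁ ∙ k
  share {κ} {y} {nc} {e₁} {e₂} i₁ i₂ = through (GraphMap.vertex ȷ v) (same-kind (overV v)) (GraphMap.inc ȷ {e₁} {v} i₁) (GraphMap.inc ȷ {e₂} {v} i₂)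
    where
    v : CutVertex
    v = inj₁ ((κ , y) , nc)
    through : ∀ w → proj₁ w ≡ κ → Graph.Inc (K.Y-comb T.trivial) (r e₁) w → Graph.Inc (K.Y-comb T.trivial) (r e₂) w → ∃ λ k → T.⟨_⟩ (generator κ) k × r e₂ ≈ r e₁ ∙ k
    through (_ , w) refl (h , k , h≈ , k∈ , p) (h′ , k′ , h′≈ , k′∈ , p′) = k ∙ k′ ⁻¹ , T.prod k∈ (T.inv k′∈) , (begin
      r e₂                        ≈⟨ //-rightDividesʳ k′ (r e₂) ⟨
      r e₂ ∙ k′ ∙ k′ ⁻¹           ≈⟨ ∙-congʳ {k′ ⁻¹} (∙-congʳ {k′} (≈-trans (∙-congʳ {r e₂} h′≈) (identityˡ (r e₂)))) ⟨
      h′ ∙ r e₂ ∙ k′ ∙ k′ ⁻¹      ≈⟨ ∙-congʳ {k′ ⁻¹} (≈-trans (≈-sym p′) p) ⟩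
      h ∙ r e₁ ∙ k ∙ k′ ⁻¹        ≈⟨ ∙-congʳ {k′ ⁻¹} (∙-congʳ {k} (≈-trans (∙-congʳ {r e₁} h≈) (identityˡ (r e₁)))) ⟩
      r e₁ ∙ k ∙ k′ ⁻¹            ≈⟨ ∙-assoc (r e₁) k (k′ ⁻¹) ⟩
      r e₁ ∙ (k ∙ k′ ⁻¹)          ∎)

  univalent⇒ : ∀ {κ y e k} → Y.Univalent (κ , y) → Y.Inc e (κ , y) → T.⟨_⟩ (generator κ) k → e ∙ k ~ e
  univalent⇒ {κ} {y} {e} {k} (f , _ , all) i k∈ = ~-trans (all (e ∙ k) (inc-∙ k∈ i)) (~-sym (all e i))

  univalent0 : ∀ {e} → e ∙ S ~ e → Y.Univalent (type0 , e)
  univalent0 {e} p = e , inc-refl type0 e , λ f i → let k , k∈ , q = inc-~ i in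
    [ (λ k≈1 → ~-sym (~-trans q (≈⇒~ (≈-trans (∙-congˡ {f} k≈1) (identityʳ f)))))
    , (λ k≈S → ~-trans (~-cancel S (~-trans (≈⇒~ (≈-sym (∙-congˡ {f} k≈S))) (~-trans (~-sym q) (~-sym p)))) ~-refl)
    ]′ (⟨S⟩ k∈)

  spin~ : ∀ {e} t → e ∙ U ~ e → e ∙ spin t ~ e
  spin~ left p = p
  spin~ {e} right p = ~-trans (≈⇒~ (≈-sym (∙-assoc e U U))) (~-trans (~-∙ U p) p)

  rotate~ : ∀ {e} j → e ∙ U ~ e → e ∙ rotate j ~ e
  rotate~ {e} still p    = ≈⇒~ (identityʳ e)
  rotate~ {e} (turn t) p = spin~ t p

  univalent1 : ∀ {e} → e ∙ U ~ e → Y.Univalent (type1 , e)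
  univalent1 {e} p = e , inc-refl type1 e , λ f i → let k , k∈ , q = inc-~ i
                                                        j , k≈ = ⟨U⟩ k∈
    in ~-cancel (rotate j) (~-trans (≈⇒~ (≈-sym (∙-congˡ {f} k≈))) (~-trans (~-sym q) (~-sym (rotate~ j p))))

  spin-fixed : ∀ {e} t → e ∙ spin t ~ e → e ∙ U ~ e
  spin-fixed left p = p
  spin-fixed {e} right p = ~-trans (~-sym (~-∙ U p)) (≈⇒~ (≈-trans (∙-assoc e (U ∙ U) U) (≈-trans (∙-congˡ {e} (spin-opp right)) (identityʳ e))))

  spins-equal : ∀ {e} → e ∙ U ~ e ∙ (U ∙ U) → e ∙ U ~ e
  spins-equal {e} p = ~-sym (~-cancel U (~-trans p (≈⇒~ (≈-sym (∙-assoc e U U)))))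

  -- If the vertex were bivalent, two of the three edges e, eU, eU² would coincide. Any such
  -- coincidence gives eU ~ e, and then the vertex is univalent.
  type1-uncut : ∀ {e} → ¬ Cut (type1 , e)
  type1-uncut {e} c = impossible (bivalent c)
    where
    impossible : ¬ Y.Bivalent (type1 , e)
    impossible (e₁ , e₂ , i₁ , i₂ , e₁≁e₂ , all) = contradict
        (all e (inc-refl type1 e)) (all (e ∙ U) (inc-∙ T.gen (inc-refl type1 e))) (all (e ∙ (U ∙ U)) (inc-∙ (T.prod T.gen T.gen) (inc-refl type1 e)))
      where
      fixed : ¬ (e ∙ U ~ e)
      fixed p = let f , _ , unique = univalent1 p in e₁≁e₂ (~-trans (unique e₁ i₁) (~-sym (unique e₂ i₂)))
      contradict : e ~ e₁ ⊎ e ~ e₂ → e ∙ U ~ e₁ ⊎ e ∙ U ~ e₂ → e ∙ (U ∙ U) ~ e₁ ⊎ e ∙ (U ∙ U) ~ e₂ → ⊥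
      contradict (inj₁ a) (inj₁ b) _        = fixed (~-trans b (~-sym a))
      contradict (inj₂ a) (inj₂ b) _        = fixed (~-trans b (~-sym a))
      contradict (inj₁ a) (inj₂ b) (inj₁ c) = fixed (spin-fixed right (~-trans c (~-sym a)))
      contradict (inj₂ a) (inj₁ b) (inj₂ c) = fixed (spin-fixed right (~-trans c (~-sym a)))
      contradict (inj₁ a) (inj₂ b) (inj₂ c) = fixed (spins-equal (~-trans b (~-sym c)))
      contradict (inj₂ a) (inj₁ b) (inj₁ c) = fixed (spins-equal (~-trans b (~-sym c)))

  -- In the first two cases the line r(e)(0,∞) carries sides of P; in the third the neighbouring
  -- tile r(e)S△ belongs to P as well.
  data Type0 (e : Carrier) : Set where
    cut       : Cut (type0 , e) → Type0 e
    univalent : ¬ Cut (type0 , e) → e ∙ S ~ e → Type0 e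
    crossing  : ¬ Cut (type0 , e) → r (e ∙ S) ≈ r e ∙ S → Type0 e

  type0-cases : ∀ e → Type0 e
  type0-cases e = decide em
    where
    decide : Dec (Cut (type0 , e)) → Type0 e
    decide (yes c) = cut c
    decide (no ¬c) = let k , k∈ , p = share {nc = ¬c} (inc-refl type0 e) (inc-∙ T.gen (inc-refl type0 e)) in
      [ (λ k≈1 → univalent ¬c (r-injective (≈-trans p (≈-trans (∙-congˡ {r e} k≈1) (identityʳ (r e))))))
      , (λ k≈S → crossing ¬c (≈-trans p (∙-congˡ {r e} k≈S))) ]′ (⟨S⟩ k∈)

  data Type1 (e : Carrier) : Set where
    univalent : e ∙ U ~ e → Type1 e
    trivalent : (∀ j → r (e ∙ rotate j) ≈ r e ∙ rotate j) → Type1 e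

  r∙~ : ∀ e k → r e ∙ k ~ e ∙ k
  r∙~ e k = ~-∙ k (r~ e)

  -- The lift turns a rotation t at the vertex into some rotation j. Unless the vertex is univalent,
  -- the cosets of e, eU and eU² are distinct, so j must be t.
  type1-cases : ∀ e → Type1 e
  type1-cases e = decide em
    where
    to : ∀ t → ∃ λ j → r (e ∙ spin t) ≈ r e ∙ rotate j
    to t = let k , k∈ , p = share {nc = type1-uncut} (inc-refl type1 e) (inc-∙ (U∈ t) (inc-refl type1 e))
               j , q = ⟨U⟩ k∈ in j , ≈-trans p (∙-congˡ {r e} q)
    same-coset : ∀ t j → r (e ∙ spin t) ≈ r e ∙ rotate j → e ∙ spin t ~ e ∙ rotate j
    same-coset t j p = ~-trans (~-sym (r~ (e ∙ spin t))) (~-trans (≈⇒~ p) (r∙~ e (rotate j)))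
    decide : Dec (e ∙ U ~ e) → Type1 e
    decide (yes p) = univalent p
    decide (no ¬p) = trivalent λ { still → ≈-trans (r-cong (≈⇒~ (identityʳ e))) (≈-sym (identityʳ (r e)))
                                 ; (turn t) → check t (to t) }
      where
      check : ∀ t → (∃ λ j → r (e ∙ spin t) ≈ r e ∙ rotate j) → r (e ∙ spin t) ≈ r e ∙ spin t
      check t (still , p) = ⊥-elim (¬p (spin-fixed t (~-trans (same-coset t still p) (≈⇒~ (identityʳ e)))))
      check left  (turn left , p)  = p
      check right (turn right , p) = p
      check left  (turn right , p) = ⊥-elim (¬p (spins-equal (same-coset left (turn right) p)))
      check right (turn left , p)  = ⊥-elim (¬p (spins-equal (~-sym (same-coset right (turn left) p))))

  -- Connectedness as an induction principle on the edges of Y′. A cut end is a vertex with one edge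
  -- up to ~, so no property is carried across a cut; the walks run between type (1) vertices, which
  -- are never cut.
  connect : (Inv : Carrier → Set) → (∀ {e₁ e₂} v → Y′.Inc e₁ v → Y′.Inc e₂ v → Inv e₁ → Inv e₂) →
            ∀ {e₀} → Inv e₀ → ∀ e → Inv e
  connect Inv transfer {e₀} inv₀ e =
    along (Y′.IsTree.connected tree (origin e₀) (origin e)) (λ e′ i → transfer (origin e₀) (inc-refl type1 e₀) i inv₀) e (inc-refl type1 e)
    where
    origin : Carrier → CutVertex
    origin e = inj₁ ((type1 , e) , type1-uncut)
    along : ∀ {u v} → Y′.Walk u v → (∀ e → Y′.Inc e u → Inv e) → ∀ e → Y′.Inc e v → Inv e
    along {p₁} {p₂} (Y′.stay p) have e i = have e (Y′.Inc-resp {e} {e} {p₂} {p₁} ~-refl (Y′.V.sym {p₁} {p₂} p) i)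
    along (Y′.step f w i i′ _ rest) have = along rest λ e i″ → transfer w i′ i″ (have f i)

  -- All tiles lie on one side of a type (0) side: the walk cannot cross it.
  Closed0 : Carrier → Set
  Closed0 e = Cut (type0 , e) ⊎ e ∙ S ~ e

  -- The position of the tile of e′ in the frame in which the tile of e is △.
  relative : Carrier → Carrier → Carrier
  relative e e′ = r e ⁻¹ ∙ r e′

  relative-one : ∀ {e e′} → r e′ ≈ r e → relative e e′ ≈ ε
  relative-one {e} p = ≈-trans (∙-congˡ {r e ⁻¹} p) (inverseˡ (r e))

  one-relative : ∀ {e e′} → relative e e′ ≈ ε → r e ≈ r e′
  one-relative {e} {e′} p = ≈-sym (≈-trans (≈-sym (\\-leftDividesˡ (r e) (r e′))) (≈-trans (∙-congˡ {r e} p) (identityʳ (r e))))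

  relative-∙ : ∀ {e e₁ e₂ k} → r e₂ ≈ r e₁ ∙ k → relative e e₂ ≈ relative e e₁ ∙ k
  relative-∙ {e} {e₁} {e₂} {k} p = ≈-trans (∙-congˡ {r e ⁻¹} p) (≈-sym (∙-assoc (r e ⁻¹) (r e₁) k))

  -- Only a step by S from relative position 1 could leave `Pos`. Such a step starts at e itself,
  -- where the vertex is cut, or eS ~ e and the step does not move.
  side0-invariant : ∀ {e} → Closed0 e → ∀ e′ → Pos (relative e e′)
  side0-invariant {e} closed = connect (λ e′ → Pos (relative e e′)) transfer {e} (pos-rotate still (relative-one {e} {e} ≈-refl))
    where
    rotated : ∀ {e₁ e₂} → (∃ λ j → r e₂ ≈ r e₁ ∙ rotate j) → Pos (relative e e₁) → Pos (relative e e₂)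
    rotated {e₁} {e₂} (still , p)  q = Pos-resp (≈-sym (≈-trans (relative-∙ {e} {e₁} {e₂} p) (identityʳ (relative e e₁)))) q
    rotated {e₁} {e₂} (turn t , p) q = Pos-resp (≈-sym (relative-∙ {e} {e₁} {e₂} p)) (Pos-∙spin t q)
    returned : ∀ {e₁ e₂ y} → ¬ Cut (type0 , y) → Y.Inc e₁ (type0 , y) → r e₂ ≈ r e₁ ∙ S → relative e e₁ ≈ ε → r e₂ ≈ r e
    returned {e₁} {e₂} nc i p q = [ (λ c → ⊥-elim (nc (cut-resp (Y.V.trans (K.same (e~ c)) (inc-same i)) c))) , (λ fixed → r-cong (~-trans (~-sym (r~ e₂))
        (~-trans (≈⇒~ p) (~-trans (r∙~ e₁ S) (~-trans (~-∙ S (~-sym e~e₁)) fixed))))) ]′ closed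
      where
      e~e₁ : e ~ e₁
      e~e₁ = r-injective (one-relative {e} {e₁} q)
      e~ : Cut (type0 , e) → _
      e~ _ = let h , h∈ , t = e~e₁ in h , ε , h∈ , T.unit , ≈-trans t (≈-sym (identityʳ (h ∙ e)))
    crossed : ∀ {e₁ e₂ y} → ¬ Cut (type0 , y) → Y.Inc e₁ (type0 , y) → r e₂ ≈ r e₁ ∙ S → Pos (relative e e₁) → Pos (relative e e₂)
    crossed {e₁} {e₂} nc i p q = [ (λ t → pos-rotate still (relative-one {e} {e₂} (returned {e₁} {e₂} nc i p t)))
                                 , (λ t → Pos-resp (≈-sym (relative-∙ {e} {e₁} {e₂} p)) t) ]′ (Pos-∙S q)
    transfer : ∀ {e₁ e₂} v → Y′.Inc e₁ v → Y′.Inc e₂ v → Pos (relative e e₁) → Pos (relative e e₂)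
    transfer {e₁} {e₂} (inj₂ V) i₁ i₂ q = Pos-resp (∙-congˡ {r e ⁻¹} (r-cong (~-trans i₁ (~-sym i₂)))) q
    transfer {e₁} {e₂} (inj₁ ((type1 , y) , nc)) i₁ i₂ q = let k , k∈ , p = share {nc = nc} i₁ i₂
                                                               j , t = ⟨U⟩ k∈
      in rotated {e₁} {e₂} (j , ≈-trans p (∙-congˡ {r e₁} t)) q
    transfer {e₁} {e₂} (inj₁ ((type0 , y) , nc)) i₁ i₂ q = let k , k∈ , p = share {nc = nc} i₁ i₂ in
      [ (λ t → rotated {e₁} {e₂} (still , ≈-trans p (∙-congˡ {r e₁} t)) q)
      , (λ t → crossed {e₁} {e₂} nc i₁ (≈-trans p (∙-congˡ {r e₁} t)) q) ]′ (⟨S⟩ k∈)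

  Neg : Carrier → Set
  Neg γ = ∃ λ δ → Pos δ × γ ≈ S ∙ δ

  -- At the type (1) end of e the rotations do not move, so e is left only through its other end:
  -- the word of any other tile begins with S.
  side1-invariant : ∀ {e} → e ∙ U ~ e → ∀ e′ → r e′ ≈ r e ⊎ Neg (relative e e′)
  side1-invariant {e} fixed = connect Inv transfer {e} (inj₁ ≈-refl)
    where
    Inv : Carrier → Set
    Inv e′ = r e′ ≈ r e ⊎ Neg (relative e e′)
    rotated : ∀ {e₁ e₂} → (∃ λ j → r e₂ ≈ r e₁ ∙ rotate j) → Inv e₁ → Inv e₂
    rotated {e₁} {e₂} (j , p) (inj₁ q) = inj₁ (r-cong (~-trans (~-sym (r~ e₂)) (~-trans (≈⇒~ p)
      (~-trans (r∙~ e₁ (rotate j)) (~-trans (~-∙ (rotate j) (r-injective q)) (rotate~ j fixed))))))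
    rotated {e₁} {e₂} (still , p) (inj₂ (δ , δ∈ , q)) = inj₂ (δ , δ∈ ,
      ≈-trans (relative-∙ {e} {e₁} {e₂} p) (≈-trans (identityʳ (relative e e₁)) q))
    rotated {e₁} {e₂} (turn t , p) (inj₂ (δ , δ∈ , q)) = inj₂ (δ ∙ spin t , Pos-∙spin t δ∈ ,
      ≈-trans (relative-∙ {e} {e₁} {e₂} p) (≈-trans (∙-congʳ {spin t} q) (∙-assoc S δ (spin t))))
    crossed : ∀ {e₁ e₂} → r e₂ ≈ r e₁ ∙ S → Inv e₁ → Inv e₂
    crossed {e₁} {e₂} p (inj₁ q) = inj₂ (ε , pos-rotate still ≈-refl ,
      ≈-trans (relative-∙ {e} {e₁} {e₂} p) (≈-trans (∙-congʳ {S} (relative-one {e} {e₁} q)) (≈-trans (identityˡ S) (≈-sym (identityʳ S)))))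
    crossed {e₁} {e₂} p (inj₂ (δ , δ∈ , q)) = [ (λ t → inj₁ (≈-sym (one-relative {e} {e₂} (≈-trans rel (≈-trans (∙-congˡ {S} (≈-trans (∙-congʳ {S} t) (identityˡ S))) S∙S)))))
                                              , (λ t → inj₂ (δ ∙ S , t , rel)) ]′ (Pos-∙S δ∈)
      where
      rel : relative e e₂ ≈ S ∙ (δ ∙ S)
      rel = ≈-trans (relative-∙ {e} {e₁} {e₂} p) (≈-trans (∙-congʳ {S} q) (∙-assoc S δ S))
    transfer : ∀ {e₁ e₂} v → Y′.Inc e₁ v → Y′.Inc e₂ v → Inv e₁ → Inv e₂
    transfer {e₁} {e₂} (inj₂ V) i₁ i₂ q = rotated {e₁} {e₂} (still , ≈-trans (r-cong (~-trans i₂ (~-sym i₁))) (≈-sym (identityʳ (r e₁)))) q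
    transfer {e₁} {e₂} (inj₁ ((type1 , y) , nc)) i₁ i₂ q = let k , k∈ , p = share {nc = nc} i₁ i₂
                                                               j , t = ⟨U⟩ k∈
      in rotated {e₁} {e₂} (j , ≈-trans p (∙-congˡ {r e₁} t)) q
    transfer {e₁} {e₂} (inj₁ ((type0 , y) , nc)) i₁ i₂ q = let k , k∈ , p = share {nc = nc} i₁ i₂ in
      [ (λ t → rotated {e₁} {e₂} (still , ≈-trans p (∙-congˡ {r e₁} t)) q)
      , (λ t → crossed {e₁} {e₂} (≈-trans p (∙-congˡ {r e₁} t)) q) ]′ (⟨S⟩ k∈)


  cutEnd-vertex : ∀ V → proj₁ (W V) ≡ type0 → W V Y.V.≈ (type0 , e V)
  cutEnd-vertex V@(cutEnd (type0 , y) _ f i) refl = Y.V.sym {type0 , f} {type0 , y} (K.same i)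

  cutEnd-cut : ∀ V → proj₁ (W V) ≡ type0 → Cut (type0 , e V)
  cutEnd-cut V p = cut-resp (cutEnd-vertex V p) (W∈ V)

  edge-vertex : ∀ κ e e′ → e ~ e′ → (κ , e) Y.V.≈ (κ , e′)
  edge-vertex κ e e′ (h , h∈ , p) = K.same (h , ε , h∈ , T.unit , ≈-trans p (≈-sym (identityʳ (h ∙ e))))

  cutEnd-≈ : ∀ V V′ → proj₁ (W V) ≡ type0 → proj₁ (W V′) ≡ type0 → e V ~ e V′ → V ≈ᵉ V′
  cutEnd-≈ V V′ p p′ q = Y.V.trans {W V} {type0 , e V} {W V′} (cutEnd-vertex V p)
    (Y.V.trans {type0 , e V} {type0 , e V′} {W V′} (edge-vertex type0 (e V) (e V′) q) (Y.V.sym {W V′} {type0 , e V′} (cutEnd-vertex V′ p′))) , q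

  opposite-W : ∀ V → W (opposite V) ≡ W V
  opposite-W (cutEnd W W∈ e e∋W) with bivalent W∈
  ... | _ , _ , _ , _ , _ , all with all e e∋W
  ...   | inj₁ _ = refl
  ...   | inj₂ _ = refl

  opposite≁ : ∀ V → ¬ (e (opposite V) ~ e V)
  opposite≁ (cutEnd W W∈ e e∋W) with bivalent W∈
  ... | e₁ , e₂ , _ , _ , e₁≁e₂ , all with all e e∋W
  ...   | inj₁ q = λ p → e₁≁e₂ (~-sym (~-trans p q))
  ...   | inj₂ q = λ p → e₁≁e₂ (~-trans p q)

  opposite-unique : ∀ V {f} → Y.Inc f (W V) → ¬ (f ~ e V) → f ~ e (opposite V)
  opposite-unique (cutEnd W W∈ e e∋W) {f} i f≁e with bivalent W∈
  ... | e₁ , e₂ , _ , _ , _ , all with all e e∋W | all f i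
  ...   | inj₁ q | inj₁ p = ⊥-elim (f≁e (~-trans p (~-sym q)))
  ...   | inj₁ q | inj₂ p = p
  ...   | inj₂ q | inj₁ p = p
  ...   | inj₂ q | inj₂ p = ⊥-elim (f≁e (~-trans p (~-sym q)))

  opposite-inc : ∀ V → Y.Inc (e (opposite V)) (W V)
  opposite-inc V = ≡.subst (Y.Inc (e (opposite V))) (opposite-W V) (e∋W (opposite V))

  W-≡ : ∀ {V V′ : CutEnd} → W V ≡ W V′ → W V Y.V.≈ W V′
  W-≡ {V} p = ≡.subst (W V Y.V.≈_) p (Y.V.refl {W V})

  opposite-cong : ∀ V V′ → V ≈ᵉ V′ → opposite V ≈ᵉ opposite V′
  opposite-cong V V′ (p , q) = Y.V.trans {W (opposite V)} {W V} {W (opposite V′)} (W-≡ {opposite V} {V} (opposite-W V))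
      (Y.V.trans {W V} {W V′} {W (opposite V′)} p (Y.V.sym {W (opposite V′)} {W V′} (W-≡ {opposite V′} {V′} (opposite-W V′)))) ,
    opposite-unique V′ (Y.Inc-resp {e (opposite V)} {e (opposite V)} {W V} {W V′} ~-refl p (opposite-inc V)) λ t → opposite≁ V (~-trans t (~-sym q))

  opposite-involutive : ∀ V → opposite (opposite V) ≈ᵉ V
  opposite-involutive V = W-≡ {opposite (opposite V)} {V} (≡.trans (opposite-W (opposite V)) (opposite-W V)) ,
    ~-sym (opposite-unique (opposite V) (≡.subst (Y.Inc (e V)) (≡.sym (opposite-W V)) (e∋W V)) λ t → opposite≁ V (~-sym t))

  -- All edges at a type (0) vertex are e or eS up to ~, so two distinct ones differ by S.
  opposite-S : ∀ V → proj₁ (W V) ≡ type0 → e (opposite V) ~ e V ∙ S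
  opposite-S V@(cutEnd (type0 , y) _ f i) refl = let k , k∈ , q = inc-~ i
                                                     k′ , k′∈ , q′ = inc-~ (opposite-inc V)
    in cases (⟨S⟩ k∈) (⟨S⟩ k′∈) q q′
    where
    g : Carrier
    g = e (opposite V)
    fixed : ∀ {x k} → k ≈ ε → y ~ x ∙ k → y ~ x
    fixed {x} p q = ~-trans q (≈⇒~ (≈-trans (∙-congˡ p) (identityʳ x)))
    moved : ∀ {x k} → k ≈ S → y ~ x ∙ k → y ~ x ∙ S
    moved {x} p q = ~-trans q (≈⇒~ (∙-congˡ p))
    unS : ∀ {x} → y ~ x ∙ S → x ~ y ∙ S
    unS {x} p = ~-sym (~-trans (~-∙ S p) (≈⇒~ (≈-trans (∙-assoc x S S) (≈-trans (∙-congˡ S∙S) (identityʳ x)))))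
    cases : ∀ {k k′} → k ≈ ε ⊎ k ≈ S → k′ ≈ ε ⊎ k′ ≈ S → y ~ f ∙ k → y ~ g ∙ k′ → g ~ f ∙ S
    cases (inj₁ a) (inj₁ b) q q′ = ⊥-elim (opposite≁ V (~-trans (~-sym (fixed b q′)) (fixed a q)))
    cases (inj₁ a) (inj₂ b) q q′ = ~-trans (unS (moved b q′)) (~-∙ S (fixed a q))
    cases (inj₂ a) (inj₁ b) q q′ = ~-trans (~-sym (fixed b q′)) (moved a q)
    cases (inj₂ a) (inj₂ b) q q′ = ⊥-elim (opposite≁ V (~-cancel S (~-trans (~-sym (moved b q′)) (moved a q))))

  incident-vertex : ∀ κ e e′ y y′ → Y.Inc e (κ , y) → Y.Inc e′ (κ , y′) → e ~ e′ → (κ , y) Y.V.≈ (κ , y′)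
  incident-vertex κ e e′ y y′ i i′ p = Y.V.trans {κ , y} {κ , e} {κ , y′} (Y.V.sym {κ , e} {κ , y} (K.same i))
    (Y.V.trans {κ , e} {κ , e′} {κ , y′} (edge-vertex κ e e′ p) (K.same i′))

  univalent-edge : ∀ v v′ (uni : Y.Univalent v) (uni′ : Y.Univalent v′) → v Y.V.≈ v′ → proj₁ uni ~ proj₁ uni′
  univalent-edge v v′ (e , _ , all) (e′ , i′ , _) p = ~-sym (all e′ (Y.Inc-resp {e′} {e′} {v′} {v} ~-refl (Y.V.sym {v} {v′} p) i′))

  univalent-inc : ∀ v (uni : Y.Univalent v) → Y.Inc (proj₁ uni) v
  univalent-inc v uni = proj₁ (proj₂ uni)

  univalent-S : ∀ y (uni : Y.Univalent (type0 , y)) → proj₁ uni ∙ S ~ proj₁ uni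
  univalent-S y uni = univalent⇒ uni (univalent-inc (type0 , y) uni) T.gen

  univalent-U : ∀ y (uni : Y.Univalent (type1 , y)) → proj₁ uni ∙ U ~ proj₁ uni
  univalent-U y uni = univalent⇒ uni (univalent-inc (type1 , y) uni) T.gen

  uncut-vertex : ∀ y e → ¬ Cut (type0 , y) → Y.Inc e (type0 , y) → ¬ Cut (type0 , e)
  uncut-vertex y e nc i c = nc (cut-resp (K.same i) c)

  -- The pairing element of a type (0) side: back to the model line by r(e)⁻¹, turned round by S,
  -- and out along the lift of the other edge at the vertex. If eS ~ e it is the half-turn about
  -- r(e)i.
  pair0 : Carrier → Carrier
  pair0 e = r (e ∙ S) ∙ S ∙ r e ⁻¹

  S∙S-edge : ∀ e → e ∙ S ∙ S ≈ e
  S∙S-edge e = ≈-trans (∙-assoc e S S) (≈-trans (∙-congˡ S∙S) (identityʳ e))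

  conj-⁻¹ : ∀ x k y → (x ∙ k ∙ y ⁻¹) ⁻¹ ≈ y ∙ k ⁻¹ ∙ x ⁻¹
  conj-⁻¹ x k y = begin
    (x ∙ k ∙ y ⁻¹) ⁻¹           ≈⟨ ⁻¹-anti-homo-∙ (x ∙ k) (y ⁻¹) ⟩
    y ⁻¹ ⁻¹ ∙ (x ∙ k) ⁻¹        ≈⟨ ∙-cong (⁻¹-involutive y) (⁻¹-anti-homo-∙ x k) ⟩
    y ∙ (k ⁻¹ ∙ x ⁻¹)           ≈⟨ ∙-assoc y (k ⁻¹) (x ⁻¹) ⟨
    y ∙ k ⁻¹ ∙ x ⁻¹             ∎

  -- The selected side may sit on either of the two edges at the vertex; this decides between the
  -- transition along e and its inverse.
  pair0-transition : ∀ {e f} → f ~ e ⊎ f ~ e ∙ S → pair0 f ≈ r e ∙ S ∙ r (e ∙ S) ⁻¹ ⊎ pair0 f ≈ (r e ∙ S ∙ r (e ∙ S) ⁻¹) ⁻¹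
  pair0-transition {e} {f} (inj₁ p) = inj₂ (≈-sym (≈-trans (conj-⁻¹ (r e) S (r (e ∙ S)))
    (∙-cong (∙-cong (r-cong (~-∙ S (~-sym p))) S⁻¹) (⁻¹-cong (r-cong (~-sym p))))))
  pair0-transition {e} {f} (inj₂ p) = inj₁ (∙-cong (∙-congʳ (r-cong (~-trans (~-∙ S p) (≈⇒~ (S∙S-edge e))))) (⁻¹-cong (r-cong p)))

  pair0-cong : ∀ {e e′} → e ~ e′ → pair0 e ≈ pair0 e′
  pair0-cong p = ∙-cong (∙-congʳ (r-cong (~-∙ S p))) (⁻¹-cong (r-cong p))

  -- A rotation of order 3 about r(e)ρ.
  pair1 : Turn → Carrier → Carrier
  pair1 t e = r e ∙ spin t ∙ r e ⁻¹

  pair1-cong : ∀ t {e e′} → e ~ e′ → pair1 t e ≈ pair1 t e′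
  pair1-cong t p = ∙-cong (∙-congʳ (r-cong p)) (⁻¹-cong (r-cong p))

  pair1-transition : ∀ t {e f} → f ∙ U ~ f → f ~ e → pair1 t f ≈ r e ∙ U ∙ r (e ∙ U) ⁻¹ ⊎ pair1 t f ≈ (r e ∙ U ∙ r (e ∙ U) ⁻¹) ⁻¹
  pair1-transition left {e} {f} q p = inj₁ (∙-cong (∙-congʳ (r-cong p)) (⁻¹-cong (r-cong (~-trans (~-sym q) (~-∙ U p)))))
  pair1-transition right {e} {f} q p = inj₂ (≈-sym (≈-trans (conj-⁻¹ (r e) U (r (e ∙ U)))
    (∙-cong (∙-cong (r-cong (~-trans (~-∙ U (~-sym p)) q)) (≈-sym (inverseˡ-unique (U ∙ U) U (spin-opp right)))) (⁻¹-cong (r-cong (~-sym p))))))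

  related-S : ∀ {e e′ f f′} → f ~ e ⊎ f ~ e ∙ S → f′ ~ e′ ⊎ f′ ~ e′ ∙ S → e′ ~ e ⊎ e′ ~ e ∙ S → f′ ~ f ⊎ f′ ~ f ∙ S
  related-S {e} {e′} {f} {f′} p p′ q = compose p′ (compose q (invert p))
    where
    invert : ∀ {x y} → x ~ y ⊎ x ~ y ∙ S → y ~ x ⊎ y ~ x ∙ S
    invert (inj₁ p) = inj₁ (~-sym p)
    invert {x} {y} (inj₂ p) = inj₂ (~-trans (≈⇒~ (≈-sym (S∙S-edge y))) (~-∙ S (~-sym p)))
    compose : ∀ {x y z} → x ~ y ⊎ x ~ y ∙ S → y ~ z ⊎ y ~ z ∙ S → x ~ z ⊎ x ~ z ∙ S
    compose (inj₁ p) (inj₁ q) = inj₁ (~-trans p q)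
    compose (inj₁ p) (inj₂ q) = inj₂ (~-trans p q)
    compose (inj₂ p) (inj₁ q) = inj₂ (~-trans p (~-∙ S q))
    compose {z = z} (inj₂ p) (inj₂ q) = inj₁ (~-trans p (~-trans (~-∙ S q) (≈⇒~ (S∙S-edge z))))

-- The congruence on words that defines the free product.

module Words (𝒢 : Group 0ℓ 0ℓ) (X : Pred (Group.Carrier 𝒢) 0ℓ) where
  open Group 𝒢 using (Carrier; _∙_; _≈_; ∙-congˡ; ∙-congʳ; ∙-cong; identityˡ; identityʳ; assoc)
    renaming (ε to 1ᴳ; refl to ≈-refl; sym to ≈-sym; trans to ≈-trans)
  private module T = GroupTheory 𝒢
  open T.Letter

  Word′ : Set
  Word′ = T.Word X

  infix 4 _≈ʷ_

  _≈ʷ_ : Word′ → Word′ → Set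
  _≈ʷ_ = EqClosure (T.Reduction X)

  ≈ʷ-refl : ∀ {u} → u ≈ʷ u
  ≈ʷ-refl = ε★

  ≈ʷ-reflexive : ∀ {u v} → u ≡ v → u ≈ʷ v
  ≈ʷ-reflexive refl = ε★

  ≈ʷ-sym : ∀ {u v} → u ≈ʷ v → v ≈ʷ u
  ≈ʷ-sym = Closure.symmetric (T.Reduction X)

  ≈ʷ-trans : ∀ {u v w} → u ≈ʷ v → v ≈ʷ w → u ≈ʷ w
  ≈ʷ-trans = _◅◅_

  step : ∀ {u v} → T.Reduction X u v → u ≈ʷ v
  step p = fwd p ◅ ε★

  ++-congˡ : ∀ w {u v} → u ≈ʷ v → w ++ u ≈ʷ w ++ v
  ++-congˡ w = Closure.gmap (w ++_) prefixed
    where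
    prefixed : ∀ {u v} → T.Reduction X u v → T.Reduction X (w ++ u) (w ++ v)
    prefixed (T.delete u {k} v p) = ≡.subst₂ (T.Reduction X) (++-assoc w u (k ∷ v)) (++-assoc w u v) (T.delete (w ++ u) v p)
    prefixed (T.merge u {k} {l} {m} v p q r) = ≡.subst₂ (T.Reduction X) (++-assoc w u (k ∷ l ∷ v)) (++-assoc w u (m ∷ v)) (T.merge (w ++ u) v p q r)

  ++-congʳ : ∀ w {u v} → u ≈ʷ v → u ++ w ≈ʷ v ++ w
  ++-congʳ w = Closure.gmap (_++ w) suffixed
    where
    suffixed : ∀ {u v} → T.Reduction X u v → T.Reduction X (u ++ w) (v ++ w)
    suffixed (T.delete u {k} v p) = ≡.subst₂ (T.Reduction X) (≡.sym (++-assoc u (k ∷ v) w)) (≡.sym (++-assoc u v w)) (T.delete u (v ++ w) p)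
    suffixed (T.merge u {k} {l} {m} v p q r) = ≡.subst₂ (T.Reduction X) (≡.sym (++-assoc u (k ∷ l ∷ v) w)) (≡.sym (++-assoc u (m ∷ v) w)) (T.merge u (v ++ w) p q r)

  ++-cong : ∀ {u u′ v v′} → u ≈ʷ u′ → v ≈ʷ v′ → u ++ v ≈ʷ u′ ++ v′
  ++-cong {u} {u′} {v} {v′} p q = ≈ʷ-trans (++-congˡ u q) (++-congʳ v′ p)

  [_∣_∣_∣_] : ∀ x → X x → ∀ y → T.⟨_⟩ x y → Word′
  [ x ∣ x∈ ∣ y ∣ y∈ ] = record { factor = x ; inX = x∈ ; value = y ; value∈ = y∈ } ∷ []

  erase : ∀ {k} → value k ≈ 1ᴳ → k ∷ [] ≈ʷ []
  erase p = step (T.delete [] [] p)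

  fuse : ∀ {k l m} → factor k ≈ factor m → factor l ≈ factor m → value k ∙ value l ≈ value m → k ∷ l ∷ [] ≈ʷ m ∷ []
  fuse p q r = step (T.merge [] [] p q r)

  -- A trivial letter of the target factor is inserted and then merged, so that letters may change
  -- their representatives and their membership proofs.
  replace : ∀ {k m} → factor k ≈ factor m → value k ≈ value m → k ∷ [] ≈ʷ m ∷ []
  replace {k} {m} p q = ≈ʷ-trans (≈ʷ-sym (++-congˡ (k ∷ []) (erase {identity} ≈-refl)))
    (fuse p ≈-refl (≈-trans (identityʳ (value k)) q))
    where
    identity : T.Letter X
    identity = record { factor = factor m ; inX = inX m ; value = 1ᴳ ; value∈ = T.unit }

  cancel : ∀ {k l} → factor k ≈ factor l → value k ∙ value l ≈ 1ᴳ → k ∷ l ∷ [] ≈ʷ []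
  cancel {k} {l} p q = ≈ʷ-trans (fuse {m = identity} p ≈-refl q) (erase {identity} ≈-refl)
    where
    identity : T.Letter X
    identity = record { factor = factor l ; inX = inX l ; value = 1ᴳ ; value∈ = T.unit }

  evaluate′ : Word′ → Carrier
  evaluate′ = T.evaluate X

  evaluate-++ : ∀ u v → evaluate′ (u ++ v) ≈ evaluate′ u ∙ evaluate′ v
  evaluate-++ []      v = ≈-sym (identityˡ (evaluate′ v))
  evaluate-++ (k ∷ u) v = ≈-trans (∙-congˡ (evaluate-++ u v)) (≈-sym (assoc (value k) (evaluate′ u) (evaluate′ v)))

-- Reidemeister-Schreier rewriting and the inverse of evaluation.

module Generators (em : ExcludedMiddle 0ℓ) (𝒢 : Group 0ℓ 0ℓ) (generator : Kind → Group.Carrier 𝒢)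
    (S² : Group._≈_ 𝒢 (Group._∙_ 𝒢 (generator type0) (generator type0)) (Group.ε 𝒢))
    (U³ : Group._≈_ 𝒢 (Group._∙_ 𝒢 (generator type1) (Group._∙_ 𝒢 (generator type1) (generator type1))) (Group.ε 𝒢))
    (G : GroupTheory.Subgroup 𝒢)
    (C : CutSet (CosetGraph.Y-comb 𝒢 generator G))
    (tree : Graph.IsTree (Cutting.cutGraph (CosetGraph.Y-comb 𝒢 generator G) C))
    (ȷ : GraphMap (Cutting.cutGraph (CosetGraph.Y-comb 𝒢 generator G) C) (CosetGraph.Y-comb 𝒢 generator (GroupTheory.trivial 𝒢)))
    (overV : ∀ v → Graph.V._≈_ (CosetGraph.Y-comb 𝒢 generator G) (GraphMap.vertex ȷ v) (Cutting.glueVertex (CosetGraph.Y-comb 𝒢 generator G) C v))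
    (overE : ∀ e → Graph.E._≈_ (CosetGraph.Y-comb 𝒢 generator G) (GraphMap.edge ȷ e) e)
    (generated : ∀ g → TwoGenerators.Generated 𝒢 generator S² U³ g)
    (trivial-word : ∀ w → Group._≈_ 𝒢 (TwoGenerators.eval 𝒢 generator S² U³ w) (Group.ε 𝒢) → TwoGenerators._↠_ 𝒢 generator S² U³ w [])
    (X : Pred (Group.Carrier 𝒢) 0ℓ) where
  open TwoGenerators 𝒢 generator S² U³ hiding (ε; cancelˡ; generated-⁻¹)
  open Group 𝒢 using () renaming (ε to 1ᴳ)
  open CyclicStabilisers 𝒢 generator S² U³
  open Lifted em 𝒢 generator S² U³ G C tree ȷ overV overE
  open Words 𝒢 X
  private
    module T = GroupTheory 𝒢
    module W = TwoGenerators 𝒢 generator S² U³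

  Leaving : Gen → Carrier → Set
  Leaving s e = Closed0 e
  Leaving u e = e ∙ U ~ e

  closed-or-open : ∀ a e → Leaving a e ⊎ r (e ∙ ⟦ a ⟧) ≈ r e ∙ ⟦ a ⟧
  closed-or-open s e = cases (type0-cases e)
    where
    cases : Type0 e → Closed0 e ⊎ r (e ∙ S) ≈ r e ∙ S
    cases (cut c)         = inj₁ (inj₁ c)
    cases (univalent _ p) = inj₁ (inj₂ p)
    cases (crossing _ p)  = inj₂ p
  closed-or-open u e = cases (type1-cases e)
    where
    cases : Type1 e → e ∙ U ~ e ⊎ r (e ∙ U) ≈ r e ∙ U
    cases (univalent p) = inj₁ p
    cases (trivalent f) = inj₂ (f (turn left))

  -- The element of G by which the step from e to e ∙ ⟦ a ⟧ leaves the lifted tree.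
  transition : Gen → Carrier → Carrier
  transition a e = r e ∙ ⟦ a ⟧ ∙ r (e ∙ ⟦ a ⟧) ⁻¹

  transition-cong : ∀ a {e e′} → e ~ e′ → transition a e ≈ transition a e′
  transition-cong a {e} {e′} p = ∙-cong (∙-congʳ (r-cong p)) (⁻¹-cong (r-cong (~-∙ ⟦ a ⟧ p)))

  transition-open : ∀ a {e} → r (e ∙ ⟦ a ⟧) ≈ r e ∙ ⟦ a ⟧ → transition a e ≈ 1ᴳ
  transition-open a {e} p = ≈-trans (∙-congˡ (⁻¹-cong p)) (inverseʳ (r e ∙ ⟦ a ⟧))

  -- r(ea) and r(e)a both represent the coset of ea.
  transition∈ : ∀ a e → T.Mem G (transition a e)
  transition∈ a e = let h , h∈ , p = ~-trans (r~ (e ∙ ⟦ a ⟧)) (~-sym (r∙~ e ⟦ a ⟧)) in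
    T.resp G (≈-sym (≈-trans (∙-congʳ p) (//-rightDividesʳ (r (e ∙ ⟦ a ⟧)) h))) h∈

  pair0-value : ∀ {e f x} → f ~ e ⊎ f ~ e ∙ S → x ≈ pair0 f → x ≈ transition s e ⊎ x ≈ transition s e ⁻¹
  pair0-value {e} {f} q p = [ (λ v → inj₁ (≈-trans p v)) , (λ v → inj₂ (≈-trans p v)) ]′ (pair0-transition {e} {f} q)

  pair1-value : ∀ t {e f x} → f ∙ U ~ f → f ~ e → x ≈ pair1 t f → x ≈ transition u e ⊎ x ≈ transition u e ⁻¹
  pair1-value t {e} {f} c q p = [ (λ v → inj₁ (≈-trans p v)) , (λ v → inj₂ (≈-trans p v)) ]′ (pair1-transition t {e} {f} c q)

  -- `A a e x` says that x is the generator attached to the step a out of e. Uniqueness also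
  -- compares e with ea, since crossing a side forwards and backwards must use the same factor.
  module Attached (A : Gen → Carrier → Carrier → Set)
      (A-exists   : ∀ a e → Leaving a e → ∃ (A a e))
      (A-unique   : ∀ a {e e′ x x′} → A a e x → A a e′ x′ → e′ ~ e ⊎ e′ ~ e ∙ ⟦ a ⟧ → x ≈ x′)
      (A-member   : ∀ a {e x} → A a e x → X x)
      (A-value    : ∀ a {e x} → A a e x → x ≈ transition a e ⊎ x ≈ transition a e ⁻¹)
      (A-complete : ∀ {x} → X x → ∃₂ λ a e → A a e x) where

    A-power : ∀ a {e x} → A a e x → T.⟨_⟩ x (transition a e)
    A-power a {e} {x} α = [ (λ p → T.⟨⟩-resp p T.gen)
      , (λ p → T.⟨⟩-resp (≈-trans (⁻¹-cong p) (⁻¹-involutive (transition a e))) (T.inv T.gen)) ]′ (A-value a α)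

    letter : ∀ a {e x} → A a e x → Word′
    letter a {e} {x} α = [ x ∣ A-member a α ∣ transition a e ∣ A-power a α ]

    -- The value of the letter is the transition itself and its factor the attached generator, which
    -- is the transition or its inverse. Steps inside the lifted tree contribute nothing.
    τ : Gen → Carrier → Word′
    τ a e = [ (λ c → letter a (proj₂ (A-exists a e c))) , (λ _ → []) ]′ (closed-or-open a e)

    letter-open : ∀ a {e x} (α : A a e x) → transition a e ≈ 1ᴳ → letter a α ≈ʷ []
    letter-open a α p = erase p

    τ-trivial : ∀ a {e} → transition a e ≈ 1ᴳ → τ a e ≈ʷ []
    τ-trivial a {e} p = cases (closed-or-open a e)
      where
      cases : (q : Leaving a e ⊎ r (e ∙ ⟦ a ⟧) ≈ r e ∙ ⟦ a ⟧) → [ (λ c → letter a (proj₂ (A-exists a e c))) , (λ _ → []) ]′ q ≈ʷ []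
      cases (inj₁ c) = letter-open a (proj₂ (A-exists a e c)) p
      cases (inj₂ _) = ≈ʷ-refl

    -- Holds for either outcome of `closed-or-open`: in the open case the letter has value 1 and is
    -- erased, in the other the two generators agree by `A-unique`.
    τ-letter : ∀ a {e e′ x} (α : A a e′ x) (y∈ : T.⟨_⟩ x (transition a e)) → e′ ~ e ⊎ e′ ~ e ∙ ⟦ a ⟧ →
               τ a e ≈ʷ [ x ∣ A-member a α ∣ transition a e ∣ y∈ ]
    τ-letter a {e} {e′} {x} α y∈ p = cases (closed-or-open a e)
      where
      cases : (q : Leaving a e ⊎ r (e ∙ ⟦ a ⟧) ≈ r e ∙ ⟦ a ⟧) → [ (λ c → letter a (proj₂ (A-exists a e c))) , (λ _ → []) ]′ q
              ≈ʷ [ x ∣ A-member a α ∣ transition a e ∣ y∈ ]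
      cases (inj₁ c) = replace (A-unique a (proj₂ (A-exists a e c)) α p) ≈-refl
      cases (inj₂ q) = ≈ʷ-sym (erase (transition-open a q))

    τ-cong : ∀ a {e e′} → e ~ e′ → τ a e ≈ʷ τ a e′
    τ-cong a {e} {e′} p = cases (closed-or-open a e)
      where
      cases : Leaving a e ⊎ r (e ∙ ⟦ a ⟧) ≈ r e ∙ ⟦ a ⟧ → τ a e ≈ʷ τ a e′
      cases (inj₁ c) = let x , α = A-exists a e c
                           y∈ = T.⟨⟩-resp (transition-cong a p) (A-power a α)
        in ≈ʷ-trans (τ-letter a α (A-power a α) (inj₁ ~-refl)) (≈ʷ-trans (replace ≈-refl (transition-cong a p)) (≈ʷ-sym (τ-letter a α y∈ (inj₁ p))))
      cases (inj₂ q) = ≈ʷ-trans (τ-trivial a (transition-open a q)) (≈ʷ-sym (τ-trivial a (≈-trans (≈-sym (transition-cong a p)) (transition-open a q))))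

    τ-evaluate : ∀ a e → evaluate′ (τ a e) ≈ transition a e
    τ-evaluate a e = cases (closed-or-open a e)
      where
      cases : (q : Leaving a e ⊎ r (e ∙ ⟦ a ⟧) ≈ r e ∙ ⟦ a ⟧) → evaluate′ ([ (λ c → letter a (proj₂ (A-exists a e c))) , (λ _ → []) ]′ q) ≈ transition a e
      cases (inj₁ c) = identityʳ (transition a e)
      cases (inj₂ q) = ≈-sym (transition-open a q)

    path : Carrier → List Gen → Word′
    path e []      = []
    path e (a ∷ w) = τ a e ++ path (e ∙ ⟦ a ⟧) w

    path-cong : ∀ {e e′} w → e ~ e′ → path e w ≈ʷ path e′ w
    path-cong []      p = ≈ʷ-refl
    path-cong (a ∷ w) p = ++-cong (τ-cong a p) (path-cong w (~-∙ ⟦ a ⟧ p))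

    path-++ : ∀ e v w → path e (v ++ w) ≈ʷ path e v ++ path (e ∙ eval v) w
    path-++ e []      w = path-cong w (≈⇒~ (≈-sym (identityʳ e)))
    path-++ e (a ∷ v) w = ≈ʷ-trans (++-congˡ (τ a e) (≈ʷ-trans (path-++ (e ∙ ⟦ a ⟧) v w)
        (++-congˡ (path (e ∙ ⟦ a ⟧) v) (path-cong w (≈⇒~ (∙-assoc e ⟦ a ⟧ (eval v)))))))
      (≈ʷ-reflexive (≡.sym (++-assoc (τ a e) (path (e ∙ ⟦ a ⟧) v) (path (e ∙ (⟦ a ⟧ ∙ eval v)) w))))

    telescope : ∀ x k y l z → x ∙ k ∙ y ⁻¹ ∙ (y ∙ l ∙ z ⁻¹) ≈ x ∙ (k ∙ l) ∙ z ⁻¹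
    telescope x k y l z = begin
      x ∙ k ∙ y ⁻¹ ∙ (y ∙ l ∙ z ⁻¹)       ≈⟨ ∙-congˡ (∙-assoc y l (z ⁻¹)) ⟩
      x ∙ k ∙ y ⁻¹ ∙ (y ∙ (l ∙ z ⁻¹))     ≈⟨ ∙-assoc (x ∙ k) (y ⁻¹) _ ⟩
      x ∙ k ∙ (y ⁻¹ ∙ (y ∙ (l ∙ z ⁻¹)))   ≈⟨ ∙-congˡ (\\-leftDividesʳ y (l ∙ z ⁻¹)) ⟩
      x ∙ k ∙ (l ∙ z ⁻¹)                  ≈⟨ ∙-assoc (x ∙ k) l (z ⁻¹) ⟨
      x ∙ k ∙ l ∙ z ⁻¹                    ≈⟨ ∙-congʳ (∙-assoc x k l) ⟩
      x ∙ (k ∙ l) ∙ z ⁻¹                  ∎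

    path-evaluate : ∀ e w → evaluate′ (path e w) ≈ r e ∙ eval w ∙ r (e ∙ eval w) ⁻¹
    path-evaluate e [] = ≈-sym (≈-trans (∙-cong (identityʳ (r e)) (⁻¹-cong (r-cong (≈⇒~ (identityʳ e))))) (inverseʳ (r e)))
    path-evaluate e (a ∷ w) = begin
      evaluate′ (τ a e ++ path (e ∙ ⟦ a ⟧) w)                ≈⟨ evaluate-++ (τ a e) (path (e ∙ ⟦ a ⟧) w) ⟩
      evaluate′ (τ a e) ∙ evaluate′ (path (e ∙ ⟦ a ⟧) w)      ≈⟨ ∙-cong (τ-evaluate a e) (path-evaluate (e ∙ ⟦ a ⟧) w) ⟩
      transition a e ∙ (r (e ∙ ⟦ a ⟧) ∙ eval w ∙ r (e ∙ ⟦ a ⟧ ∙ eval w) ⁻¹) ≈⟨ telescope (r e) ⟦ a ⟧ (r (e ∙ ⟦ a ⟧)) (eval w) (r (e ∙ ⟦ a ⟧ ∙ eval w)) ⟩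
      r e ∙ (⟦ a ⟧ ∙ eval w) ∙ r (e ∙ ⟦ a ⟧ ∙ eval w) ⁻¹    ≈⟨ ∙-congˡ (⁻¹-cong (r-cong (≈⇒~ (∙-assoc e ⟦ a ⟧ (eval w))))) ⟩
      r e ∙ (⟦ a ⟧ ∙ eval w) ∙ r (e ∙ (⟦ a ⟧ ∙ eval w)) ⁻¹  ∎

    loop-transition : ∀ {e k} → k ≈ 1ᴳ → r e ∙ k ∙ r (e ∙ k) ⁻¹ ≈ 1ᴳ
    loop-transition {e} {k} p = ≈-trans (∙-cong (≈-trans (∙-congˡ p) (identityʳ (r e)))
      (⁻¹-cong (r-cong (≈⇒~ (≈-trans (∙-congˡ p) (identityʳ e)))))) (inverseʳ (r e))

    -- Crossing a side and coming back yields two letters of one factor with inverse values; that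
    -- the factors agree is `A-unique` for e and eS.
    path-ss : ∀ e → τ s e ++ τ s (e ∙ S) ≈ʷ []
    path-ss e = cases (closed-or-open s e)
      where
      product : transition s e ∙ transition s (e ∙ S) ≈ 1ᴳ
      product = ≈-trans (telescope (r e) S (r (e ∙ S)) S (r (e ∙ S ∙ S)))
        (≈-trans (∙-congˡ (⁻¹-cong (r-cong (≈⇒~ (∙-assoc e S S))))) (loop-transition {e} S∙S))
      cases : Leaving s e ⊎ r (e ∙ S) ≈ r e ∙ S → τ s e ++ τ s (e ∙ S) ≈ʷ []
      cases (inj₁ c) = let x , α = A-exists s e c
                           y∈ = T.⟨⟩-resp (inverse-of product) (T.inv (A-power s α))
        in ≈ʷ-trans (++-cong (τ-letter s α (A-power s α) (inj₁ ~-refl))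
             (τ-letter s α y∈ (inj₂ (≈⇒~ (≈-trans (≈-sym (identityʳ e)) (≈-trans (∙-congˡ (≈-sym S∙S)) (≈-sym (∙-assoc e S S))))))))
             (cancel ≈-refl product)
        where
        inverse-of : ∀ {x y} → x ∙ y ≈ 1ᴳ → x ⁻¹ ≈ y
        inverse-of {x} {y} p = ≈-sym (inverseʳ-unique x y p)
      cases (inj₂ q) = ++-cong (τ-trivial s (transition-open s q))
        (τ-trivial s (≈-trans (≈-trans (≈-sym (identityˡ _)) (∙-congʳ (≈-sym (transition-open s q)))) product))

    U³-reassociated : ∀ e → e ∙ U ∙ U ∙ U ≈ e
    U³-reassociated e = ≈-trans (∙-assoc (e ∙ U) U U) (≈-trans (∙-assoc e U (U ∙ U)) (≈-trans (∙-congˡ U³) (identityʳ e)))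

    -- If eU ~ e, all three letters have the factor attached to e and the product of their values
    -- telescopes to 1. Otherwise none of e, eU, eU² is fixed by U up to ~, and all three steps are
    -- trivial.
    path-uuu : ∀ e → τ u e ++ (τ u (e ∙ U) ++ τ u (e ∙ U ∙ U)) ≈ʷ []
    path-uuu e = cases em
      where
      product : transition u e ∙ (transition u (e ∙ U) ∙ transition u (e ∙ U ∙ U)) ≈ 1ᴳ
      product = ≈-trans (∙-congˡ (telescope (r (e ∙ U)) U (r (e ∙ U ∙ U)) U (r (e ∙ U ∙ U ∙ U))))
        (≈-trans (telescope (r e) U (r (e ∙ U)) (U ∙ U) (r (e ∙ U ∙ U ∙ U)))
          (≈-trans (∙-congˡ (⁻¹-cong (r-cong (≈⇒~ (≈-trans (∙-assoc (e ∙ U) U U) (∙-assoc e U (U ∙ U))))))) (loop-transition {e} U³)))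
      opened : ∀ {e} → ¬ (e ∙ U ~ e) → τ u e ≈ʷ []
      opened {e} ¬p = τ-trivial u ([ (λ p → ⊥-elim (¬p p)) , transition-open u ]′ (closed-or-open u e))
      cases : Dec (e ∙ U ~ e) → τ u e ++ (τ u (e ∙ U) ++ τ u (e ∙ U ∙ U)) ≈ʷ []
      cases (no ¬p) = ++-cong (opened ¬p) (++-cong (opened (λ q → ¬p (~-cancel U q))) (opened (λ q → ¬p (~-cancel U (~-cancel U q)))))
      cases (yes p) = let x , α = A-exists u e p
                          e~₁ = ~-sym p
                          e~₂ = ~-trans e~₁ (~-∙ U e~₁)
                          y∈ = A-power u α
                          y∈₁ = T.⟨⟩-resp (transition-cong u e~₁) y∈
                          y∈₂ = T.⟨⟩-resp (transition-cong u e~₂) y∈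
        in ≈ʷ-trans (++-cong (τ-letter u α y∈ (inj₁ ~-refl)) (≈ʷ-trans (++-cong (τ-letter u α y∈₁ (inj₁ e~₁)) (τ-letter u α y∈₂ (inj₁ e~₂)))
             (fuse {m = record { factor = x ; inX = A-member u α ; value = transition u (e ∙ U) ∙ transition u (e ∙ U ∙ U) ; value∈ = T.prod y∈₁ y∈₂ }}
               ≈-refl ≈-refl ≈-refl)))
             (cancel ≈-refl product)

    path-↠ : ∀ {v w} → v ↠ w → ∀ e → path e v ≈ʷ path e w
    path-↠ ↠-refl        e = ≈ʷ-refl
    path-↠ (↠-trans p q) e = ≈ʷ-trans (path-↠ p e) (path-↠ q e)
    path-↠ (↠-cons a p)  e = ++-congˡ (τ a e) (path-↠ p (e ∙ ⟦ a ⟧))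
    path-↠ (ss {w})      e = ≈ʷ-trans (≈ʷ-reflexive (≡.sym (++-assoc (τ s e) (τ s (e ∙ S)) (path (e ∙ S ∙ S) w))))
      (++-cong (path-ss e) (path-cong w (≈⇒~ (≈-trans (∙-assoc e S S) (≈-trans (∙-congˡ S∙S) (identityʳ e))))))
    path-↠ (uuu {w})     e = ≈ʷ-trans (≈ʷ-reflexive (≡.trans (≡.cong (τ u e ++_) (≡.sym (++-assoc (τ u (e ∙ U)) (τ u (e ∙ U ∙ U)) (path (e ∙ U ∙ U ∙ U) w))))
        (≡.sym (++-assoc (τ u e) (τ u (e ∙ U) ++ τ u (e ∙ U ∙ U)) (path (e ∙ U ∙ U ∙ U) w)))))
      (++-cong (path-uuu e) (path-cong w (≈⇒~ (U³-reassociated e))))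

    path-trivial : ∀ e w → eval w ≈ 1ᴳ → path e w ≈ʷ []
    path-trivial e w p = path-↠ (trivial-word w p) e

    -- Let v⁻ be a word for the inverse of v. In the path along v v⁻ w both v v⁻ and v⁻ w evaluate
    -- to 1, so this path gives the word of w and also that of v.
    path-eval : ∀ e {v w} → eval v ≈ eval w → path e v ≈ʷ path e w
    path-eval e {v} {w} p = let v⁻ , q = W.generated-⁻¹ (v , ≈-refl)
                                v⁻v = ≈-trans (eval-++ v⁻ v) (≈-trans (∙-congʳ q) (inverseˡ (eval v)))
                                v⁻w = ≈-trans (eval-++ v⁻ w) (≈-trans (∙-cong q (≈-sym p)) (inverseˡ (eval v)))
                                vv⁻ = ≈-trans (eval-++ v v⁻) (≈-trans (∙-congˡ q) (inverseʳ (eval v)))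
      in ≈ʷ-sym (≈ʷ-trans (≈ʷ-sym (≈ʷ-trans (path-++ e (v ++ v⁻) w)
             (++-cong (path-trivial e (v ++ v⁻) vv⁻) (path-cong w (≈⇒~ (≈-trans (∙-congˡ vv⁻) (identityʳ e)))))))
           (≈ʷ-trans (≈ʷ-reflexive (≡.cong (path e) (++-assoc v v⁻ w)))
             (≈ʷ-trans (path-++ e v (v⁻ ++ w)) (≈ʷ-trans (++-congˡ (path e v) (path-trivial (e ∙ eval v) (v⁻ ++ w) v⁻w))
               (≈ʷ-reflexive (++-identityʳ (path e v)))))))

    -- By `path-eval` every word for g gives the same result; `generated` merely supplies one.
    Φ : Carrier → Carrier → Word′
    Φ e g = path e (proj₁ (generated g))

    Φ-eval : ∀ e w {g} → eval w ≈ g → Φ e g ≈ʷ path e w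
    Φ-eval e w {g} p = path-eval e {proj₁ (generated g)} {w} (≈-trans (proj₂ (generated g)) (≈-sym p))

    Φ-cong : ∀ {e e′ g g′} → e ~ e′ → g ≈ g′ → Φ e g ≈ʷ Φ e′ g′
    Φ-cong {e} {e′} {g} {g′} p q = ≈ʷ-trans (path-cong (proj₁ (generated g)) p)
      (≈ʷ-sym (Φ-eval e′ (proj₁ (generated g)) (≈-trans (proj₂ (generated g)) q)))

    Φ-∙ : ∀ e g h → Φ e (g ∙ h) ≈ʷ Φ e g ++ Φ (e ∙ g) h
    Φ-∙ e g h = let v , p = generated g
                    w , q = generated h
      in ≈ʷ-trans (Φ-eval e (v ++ w) (≈-trans (eval-++ v w) (∙-cong p q)))
        (≈ʷ-trans (path-++ e v w) (++-congˡ (path e v) (path-cong w (≈⇒~ (∙-congˡ p)))))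

    Φ-one : ∀ e {g} → g ≈ 1ᴳ → Φ e g ≈ʷ []
    Φ-one e {g} p = path-trivial e (proj₁ (generated g)) (≈-trans (proj₂ (generated g)) p)

    Φ-letter : ∀ a e → Φ e ⟦ a ⟧ ≈ʷ τ a e
    Φ-letter a e = ≈ʷ-trans (Φ-eval e (a ∷ []) (identityʳ ⟦ a ⟧)) (≈ʷ-reflexive (++-identityʳ (τ a e)))

    r-idem : ∀ e → r (r e) ≈ r e
    r-idem e = r-cong (r~ e)

    Φ-inside : ∀ a {e e′} → r e′ ≈ r e ∙ ⟦ a ⟧ → Φ (r e) ⟦ a ⟧ ≈ʷ []
    Φ-inside a {e} {e′} p = ≈ʷ-trans (Φ-letter a (r e)) (τ-trivial a (transition-open a
      (≈-trans (r-cong (≈⇒~ (≈-sym p))) (≈-trans (r-idem e′) (≈-trans p (∙-congʳ (≈-sym (r-idem e))))))))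

    Inside : Carrier → Carrier → Set
    Inside e e′ = Φ (r e) (relative e e′) ≈ʷ []

    inside : ∀ e e′ → Inside e e′
    inside e = connect (Inside e) transfer {e} (Φ-one (r e) (relative-one {e} {e} ≈-refl))
      where
      extend : ∀ {e₁ e₂ k} → r e₂ ≈ r e₁ ∙ k → Φ (r e₁) k ≈ʷ [] → Inside e e₁ → Inside e e₂
      extend {e₁} {e₂} {k} p q i = ≈ʷ-trans (Φ-cong ~-refl (relative-∙ {e} {e₁} {e₂} p))
        (≈ʷ-trans (Φ-∙ (r e) (relative e e₁) k) (++-cong i (≈ʷ-trans (Φ-cong (≈⇒~ (\\-leftDividesˡ (r e) (r e₁))) ≈-refl) q)))
      stay : ∀ {e₁ e₂} → r e₂ ≈ r e₁ → Inside e e₁ → Inside e e₂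
      stay {e₁} {e₂} p = extend {e₁} {e₂} (≈-trans p (≈-sym (identityʳ (r e₁)))) (Φ-one (r e₁) ≈-refl)
      spun : ∀ {e₁ e₂} t → Type1 e₁ → r e₂ ≈ r e₁ ∙ spin t → Inside e e₁ → Inside e e₂
      spun {e₁} {e₂} t (univalent f) p = stay (r-cong (~-trans (~-sym (r~ e₂)) (~-trans (≈⇒~ p) (~-trans (r∙~ e₁ (spin t)) (spin~ t f)))))
      spun {e₁} {e₂} left (trivalent f) p = extend p (Φ-inside u {e₁} {e₂} p)
      -- U² is taken as two steps of U; the tile r(e₁)U△ between them belongs to the lift because
      -- the vertex is trivalent.
      spun {e₁} {e₂} right (trivalent f) p = extend p
        (≈ʷ-trans (Φ-∙ (r e₁) U U) (++-cong (Φ-inside u {e₁} {e₁ ∙ U} (f (turn left)))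
          (≈ʷ-trans (Φ-cong (≈⇒~ (≈-sym (f (turn left)))) ≈-refl)
            (Φ-inside u {e₁ ∙ U} {e₂} (≈-trans p (≈-trans (≈-sym (∙-assoc (r e₁) U U)) (∙-congʳ (≈-sym (f (turn left))))))))))
      transfer : ∀ {e₁ e₂} v → Y′.Inc e₁ v → Y′.Inc e₂ v → Inside e e₁ → Inside e e₂
      transfer {e₁} {e₂} (inj₂ V) i₁ i₂ = stay (r-cong (~-trans i₂ (~-sym i₁)))
      transfer {e₁} {e₂} (inj₁ ((type0 , y) , nc)) i₁ i₂ = let k , k∈ , p = share {nc = nc} i₁ i₂ in
        [ (λ q → stay (≈-trans p (≈-trans (∙-congˡ q) (identityʳ (r e₁)))))
        , (λ q → let p′ = ≈-trans p (∙-congˡ q) in extend p′ (Φ-inside s {e₁} {e₂} p′)) ]′ (⟨S⟩ k∈)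
      transfer {e₁} {e₂} (inj₁ ((type1 , y) , nc)) i₁ i₂ = let k , k∈ , p = share {nc = nc} i₁ i₂
                                                               j , q = ⟨U⟩ k∈
        in rotated j (≈-trans p (∙-congˡ q))
        where
        rotated : ∀ j → r e₂ ≈ r e₁ ∙ rotate j → Inside e e₁ → Inside e e₂
        rotated still    p = stay (≈-trans p (identityʳ (r e₁)))
        rotated (turn t) p = spun t (type1-cases e₁) p

    x₀ : Carrier
    x₀ = r 1ᴳ

    -- gx₀ = x₀ · `conj g`: the left translate of the base tile is read as the end of a path, which
    -- multiplies on the right.
    conj : Carrier → Carrier
    conj g = x₀ ⁻¹ ∙ g ∙ x₀

    conj-∙ : ∀ g h → conj (g ∙ h) ≈ conj g ∙ conj h
    conj-∙ g h = ≈-sym (begin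
      x₀ ⁻¹ ∙ g ∙ x₀ ∙ (x₀ ⁻¹ ∙ h ∙ x₀)     ≈⟨ ∙-congˡ (∙-assoc (x₀ ⁻¹) h x₀) ⟩
      x₀ ⁻¹ ∙ g ∙ x₀ ∙ (x₀ ⁻¹ ∙ (h ∙ x₀))   ≈⟨ ∙-assoc (x₀ ⁻¹ ∙ g) x₀ _ ⟩
      x₀ ⁻¹ ∙ g ∙ (x₀ ∙ (x₀ ⁻¹ ∙ (h ∙ x₀))) ≈⟨ ∙-congˡ (\\-leftDividesˡ x₀ (h ∙ x₀)) ⟩
      x₀ ⁻¹ ∙ g ∙ (h ∙ x₀)                  ≈⟨ ∙-assoc (x₀ ⁻¹ ∙ g) h x₀ ⟨
      x₀ ⁻¹ ∙ g ∙ h ∙ x₀                    ≈⟨ ∙-congʳ (∙-assoc (x₀ ⁻¹) g h) ⟩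
      x₀ ⁻¹ ∙ (g ∙ h) ∙ x₀                  ∎)

    x₀-conj : ∀ g → x₀ ∙ conj g ≈ g ∙ x₀
    x₀-conj g = ≈-trans (∙-congˡ (∙-assoc (x₀ ⁻¹) g x₀)) (\\-leftDividesˡ x₀ (g ∙ x₀))

    Ψ : Carrier → Word′
    Ψ g = Φ x₀ (conj g)

    Ψ-cong : ∀ {g h} → g ≈ h → Ψ g ≈ʷ Ψ h
    Ψ-cong p = Φ-cong ~-refl (∙-congʳ (∙-congˡ p))

    -- The second half of the path starts at gx₀. Words of paths depend only on the coset of the
    -- start, and g ∈ G keeps it in that of x₀.
    Ψ-∙ : ∀ {g h} → T.Mem G g → Ψ (g ∙ h) ≈ʷ Ψ g ++ Ψ h
    Ψ-∙ {g} {h} g∈ = ≈ʷ-trans (Φ-cong ~-refl (conj-∙ g h)) (≈ʷ-trans (Φ-∙ x₀ (conj g) (conj h))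
      (++-congˡ (Ψ g) (Φ-cong (~-trans (≈⇒~ (x₀-conj g)) (~-sym (g , g∈ , ≈-refl))) ≈-refl)))

    Ψ-one : ∀ {g} → g ≈ 1ᴳ → Ψ g ≈ʷ []
    Ψ-one p = Φ-one x₀ (≈-trans (∙-congʳ (≈-trans (∙-congˡ p) (identityʳ (x₀ ⁻¹)))) (inverseˡ x₀))

    Ψ-evaluate : ∀ {g} → T.Mem G g → evaluate′ (Ψ g) ≈ g
    Ψ-evaluate {g} g∈ = let w , p = generated (conj g)
                            x₀w = ≈-trans (∙-congˡ p) (x₀-conj g) in begin
      evaluate′ (path x₀ w)                     ≈⟨ path-evaluate x₀ w ⟩
      r x₀ ∙ eval w ∙ r (x₀ ∙ eval w) ⁻¹       ≈⟨ ∙-cong (≈-trans (∙-congʳ (r-idem 1ᴳ)) x₀w)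
                                                    (⁻¹-cong (≈-trans (r-cong (~-trans (≈⇒~ x₀w) (~-sym (g , g∈ , ≈-refl)))) (r-idem 1ᴳ))) ⟩
      g ∙ x₀ ∙ x₀ ⁻¹                           ≈⟨ //-rightDividesʳ x₀ g ⟩
      g                                        ∎

    -- The path from x₀ to its image under the transition runs through the tree to e, takes one step, and returns.
    Ψ-transition : ∀ a e → Ψ (transition a e) ≈ʷ τ a e
    Ψ-transition a e = ≈ʷ-trans (Φ-cong ~-refl decompose) (≈ʷ-trans (Φ-∙ x₀ (relative 1ᴳ e) (⟦ a ⟧ ∙ relative e′ 1ᴳ))
      (≈ʷ-trans (++-cong (inside 1ᴳ e) (Φ-cong (≈⇒~ (\\-leftDividesˡ x₀ (r e))) ≈-refl))
        (≈ʷ-trans (Φ-∙ (r e) ⟦ a ⟧ (relative e′ 1ᴳ))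
          (≈ʷ-trans (++-cong (≈ʷ-trans (Φ-letter a (r e)) (τ-cong a (r~ e)))
              (≈ʷ-trans (Φ-cong (~-trans (r∙~ e ⟦ a ⟧) (~-sym (r~ e′))) ≈-refl) (inside e′ 1ᴳ)))
            (≈ʷ-reflexive (++-identityʳ (τ a e)))))))
      where
      e′ : Carrier
      e′ = e ∙ ⟦ a ⟧
      decompose : conj (transition a e) ≈ relative 1ᴳ e ∙ (⟦ a ⟧ ∙ relative e′ 1ᴳ)
      decompose = begin
        x₀ ⁻¹ ∙ (r e ∙ ⟦ a ⟧ ∙ r e′ ⁻¹) ∙ x₀      ≈⟨ ∙-assoc (x₀ ⁻¹) _ x₀ ⟩
        x₀ ⁻¹ ∙ (r e ∙ ⟦ a ⟧ ∙ r e′ ⁻¹ ∙ x₀)      ≈⟨ ∙-congˡ (≈-trans (∙-assoc (r e ∙ ⟦ a ⟧) (r e′ ⁻¹) x₀) (∙-assoc (r e) ⟦ a ⟧ _)) ⟩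
        x₀ ⁻¹ ∙ (r e ∙ (⟦ a ⟧ ∙ (r e′ ⁻¹ ∙ x₀)))  ≈⟨ ∙-assoc (x₀ ⁻¹) (r e) _ ⟨
        x₀ ⁻¹ ∙ r e ∙ (⟦ a ⟧ ∙ (r e′ ⁻¹ ∙ x₀))    ∎

    module _ {x : Carrier} (x∈ : X x) where
      private
        a : Gen
        a = proj₁ (A-complete x∈)
        e : Carrier
        e = proj₁ (proj₂ (A-complete x∈))
        α : A a e x
        α = proj₂ (proj₂ (A-complete x∈))

      contained : T.Mem G x
      contained = [ (λ p → T.resp G (≈-sym p) (transition∈ a e)) , (λ p → T.resp G (≈-sym p) (T.⁻¹-closed G (transition∈ a e))) ]′ (A-value a α)

      power∈ : ∀ {y} → T.⟨_⟩ x y → T.Mem G y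
      power∈ T.gen           = contained
      power∈ T.unit          = T.ε-closed G
      power∈ (T.prod p q)    = T.∙-closed G (power∈ p) (power∈ q)
      power∈ (T.inv p)       = T.⁻¹-closed G (power∈ p)
      power∈ (T.⟨⟩-resp e p) = T.resp G e (power∈ p)

      Fixed : ∀ {y} → T.⟨_⟩ x y → Set
      Fixed {y} y∈ = Ψ y ≈ʷ [ x ∣ x∈ ∣ y ∣ y∈ ]

      -- Uniqueness of inverses: with y′ and z′ the letters of y and z, Ψ z = z′ y′ Ψ z = z′ Ψ(yz) =
      -- z′.
      Ψ-inverse : ∀ {y z} (y∈ : T.⟨_⟩ x y) (z∈ : T.⟨_⟩ x z) → z ∙ y ≈ 1ᴳ → Fixed y∈ → Fixed z∈
      Ψ-inverse {y} {z} y∈ z∈ p f = ≈ʷ-trans (≈ʷ-sym (++-congʳ (Ψ z) (cancel {k = z′} {l = y′} ≈-refl p)))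
        (≈ʷ-trans (++-congˡ (z′ ∷ []) (≈ʷ-trans (++-congʳ (Ψ z) (≈ʷ-sym f)) (≈ʷ-trans (≈ʷ-sym (Ψ-∙ (power∈ y∈))) (Ψ-one yz))))
          ≈ʷ-refl)
        where
        y′ z′ : T.Letter X
        y′ = record { factor = x ; inX = x∈ ; value = y ; value∈ = y∈ }
        z′ = record { factor = x ; inX = x∈ ; value = z ; value∈ = z∈ }
        yz : y ∙ z ≈ 1ᴳ
        yz = ≈-trans (∙-congˡ (inverseˡ-unique z y p)) (inverseʳ y)

      Ψ-generator : Fixed T.gen
      Ψ-generator = [ (λ p → ≈ʷ-trans (Ψ-cong p) (≈ʷ-trans fixed (replace ≈-refl (≈-sym p))))
                    , (λ p → Ψ-inverse (A-power a α) T.gen (≈-trans (∙-congʳ p) (inverseˡ (transition a e))) fixed) ]′ (A-value a α)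
        where
        fixed : Fixed (A-power a α)
        fixed = ≈ʷ-trans (Ψ-transition a e) (≈ʷ-trans (τ-letter a α (A-power a α) (inj₁ ~-refl)) (replace ≈-refl ≈-refl))

      Ψ-power : ∀ {y} (y∈ : T.⟨_⟩ x y) → Fixed y∈
      Ψ-power T.gen           = Ψ-generator
      Ψ-power T.unit          = ≈ʷ-trans (Ψ-one ≈-refl) (≈ʷ-sym (erase ≈-refl))
      Ψ-power (T.prod p q)    = ≈ʷ-trans (Ψ-∙ (power∈ p)) (≈ʷ-trans (++-cong (Ψ-power p) (Ψ-power q)) (fuse ≈-refl ≈-refl ≈-refl))
      Ψ-power (T.inv {y} p)   = Ψ-inverse p (T.inv p) (inverseˡ y) (Ψ-power p)
      Ψ-power (T.⟨⟩-resp e p) = ≈ʷ-trans (Ψ-cong (≈-sym e)) (≈ʷ-trans (Ψ-power p) (replace ≈-refl e))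

    Ψ-word : ∀ w → Ψ (evaluate′ w) ≈ʷ w
    Ψ-word []      = Ψ-one ≈-refl
    Ψ-word (l ∷ w) = ≈ʷ-trans (Ψ-∙ (power∈ (T.Letter.inX l) (T.Letter.value∈ l)))
      (++-cong (Ψ-power (T.Letter.inX l) (T.Letter.value∈ l)) (Ψ-word w))

    independent : T.IndependentGenerators X G
    independent = record
      { contained  = contained
      ; surjective = λ {h} h∈ → Ψ h , Ψ-evaluate h∈
      ; injective  = λ {w} {w′} p → ≈ʷ-trans (≈ʷ-sym (Ψ-word w)) (≈ʷ-trans (Ψ-cong p) (Ψ-word w′))
      }

-- P as an intersection of half-planes, and its local structure.

module Polygon (em : ExcludedMiddle 0ℓ) (ℝ : CompleteOrderedField) (G : Subgroup) (C : CutSet (Y-comb G))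
               (tree : Graph.IsTree (Cutting.cutGraph (Y-comb G) C)) (ȷ : Lift G C) where
  open Stabilisers em ℝ public
  open ModularGroup hiding (_⁻¹; module Γ; s; u; left; right; last; next; done)
  private module Γ = Group PSL₂ℤ
  open Γ using (_⁻¹)
  open Lifted em PSL₂ℤ generator (minus refl) (minus refl) G C tree (Lift.toTree ȷ) (Lift.overV ȷ) (Lift.overE ȷ) public
  open LiftedPolygon G C ȷ public
  open CutSet C using (Cut)

  -- The point z in the frame in which the tile of f is △.
  at : Γ → ℍ → ℍ
  at f z = r f ⁻¹ ▸ z

  Tile : Γ → Region
  Tile f z = △ (at f z)

  P⇒Tile : ∀ {z} → P z → ∃ λ f → Tile f z
  P⇒Tile (f , z∈) = f , ⊙-to △-resp (r f) z∈

  Tile⇒P : ∀ f {z} → Tile f z → P z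
  Tile⇒P f z∈ = f , ⊙-from (r f) z∈

  at-relative : ∀ f f′ z → at f z ≃ relative f f′ ▸ at f′ z
  at-relative f f′ z = ≃-trans (▸-congʳ (r f ⁻¹) (≃-sym (▸-inverseʳ (r f′) z))) (▸▸ (r f ⁻¹) (r f′) (at f′ z))

  at-cong : ∀ {f f′} z → r f Γ.≈ r f′ → at f z ≃ at f′ z
  at-cong {f} {f′} z p = ▸-congˡ {r f ⁻¹} {r f′ ⁻¹} z (Γ.⁻¹-cong p)

  at-step : ∀ {f f′} k {z v} → r f′ Γ.≈ r f · k → at f z ≃ k ▸ v → at f′ z ≃ v
  at-step {f} {f′} k {z} {v} p q = ≃-trans (▸-congˡ {r f′ ⁻¹} {k ⁻¹ · r f ⁻¹} z (Γ.trans (Γ.⁻¹-cong p) (⁻¹-anti-homo-∙ (r f) k)))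
    (≃-trans (▸-· (k ⁻¹) (r f ⁻¹) z) (≃-trans (▸-congʳ (k ⁻¹) q) (▸-inverseˡ k v)))

  at-r : ∀ f v → at f (r f ▸ v) ≃ v
  at-r f v = ▸-inverseˡ (r f) v

  x-cong : ∀ {z w} → z ≃ w → x z ≋ x w
  x-cong (by (p , _)) = p

  Tile-Pos : ∀ {f f′ z} → Pos (relative f f′) → Tile f′ z → 0# < x (at f z) ⊎ r f Γ.≈ r f′
  Tile-Pos {f} {f′} {z} p z∈ = [ (λ q → inj₁ (pos-by q (≋-sym (x-cong (at-relative f f′ z))))) , (λ q → inj₂ (one-relative {f} {f′} q)) ]′ (Pos-x>0 p z∈)

  closed0-nonneg : ∀ {f} → Closed0 f → ∀ {z} → P z → 0# ≤ x (at f z)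
  closed0-nonneg {f} c {z} z∈P = let f′ , z∈ = P⇒Tile z∈P in
    nonneg-by (Pos-x≥0 (side0-invariant c f′) z∈) (≋-sym (x-cong (at-relative f f′ z)))

  -- By ping-pong every other tile of P lies strictly to the right of the line.
  closed0-tile : ∀ {f} → Closed0 f → ∀ {f′ z} → Tile f′ z → x (at f z) ≋ 0# → r f Γ.≈ r f′
  closed0-tile {f} c {f′} {z} z∈ p = [ (λ q → ⊥-elim (pos⇒≉0 q p)) , (λ q → q) ]′ (Tile-Pos (side0-invariant c f′) z∈)

  Neg-x≤0 : ∀ {γ z} → Neg γ → △ z → 0# ≤ - x (γ ▸ z)
  Neg-x≤0 {γ} {z} (δ , δ∈ , p) z∈ = nonneg-by (S-x≤0 (δ ▸ z) (Pos-x≥0 δ∈ z∈))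
    (-‿cong (≋-sym (x-cong (≃-trans (▸-congˡ {γ} {S · δ} z p) (▸-· S δ z)))))

  closed1-tile : ∀ {f} → f · U ~ f → ∀ {f′ z} → Tile f′ z → r f′ Γ.≈ r f ⊎ 0# ≤ - x (at f z)
  closed1-tile {f} c {f′} {z} z∈ = [ inj₁ , (λ q → inj₂ (nonneg-by (Neg-x≤0 q z∈) (-‿cong (≋-sym (x-cong (at-relative f f′ z)))))) ]′ (side1-invariant c f′)

  closed1-P : ∀ {f} → f · U ~ f → ∀ {z} → P z → Tile f z ⊎ 0# ≤ - x (at f z)
  closed1-P {f} c {z} z∈P = let f′ , z∈ = P⇒Tile z∈P in
    [ (λ p → inj₁ (△-resp (at-cong {f′} {f} z p) z∈)) , inj₂ ]′ (closed1-tile c {f′} z∈)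

  -- The intersection of the half-planes bounded by the geodesics through [ρ,∞) and [ρ,0). It
  -- contains Re z ≤ 0, hence all tiles across the line (0,∞).
  Corner : Region
  Corner z = x z + x z ≤ 1# × x z + x z ≤ normSq z

  nonpos-corner : ∀ z → 0# ≤ - x z → Corner z
  nonpos-corner z p = nonneg⇒≤ (nonneg-by (+-nonneg 0≤1 (+-nonneg p p)) (ring! 1 (λ x → # 1 :+ ((:- x) :+ (:- x)) := # 1 :- (x :+ x)) (x z))) ,
    nonneg⇒≤ (nonneg-by (+-nonneg (pos⇒nonneg (n>0 z)) (+-nonneg p p)) (ring! 2 (λ x n → n :+ ((:- x) :+ (:- x)) := n :- (x :+ x)) (x z) (normSq z)))

  -- The half-planes bounded by the sides, indexed by the edges of Y′; P is their intersection.
  record Hull (z : ℍ) : Set where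
    field
      hull0 : ∀ {f} → Closed0 f → 0# ≤ x (at f z)
      hull1 : ∀ {f} → f · U ~ f → Corner (at f z)

  P⇒Hull : ∀ {z} → P z → Hull z
  P⇒Hull {z} z∈ = record
    { hull0 = λ c → closed0-nonneg c z∈
    ; hull1 = λ {f} c → [ proj₂ , nonpos-corner (at f z) ]′ (closed1-P c z∈)
    }

  module _ {z : ℍ} (hull : Hull z) where
    open Hull hull

    mutual
      -- Follows the reduced word from the tile of f towards z. If the type (1) vertex is univalent
      -- the walk stops: the word gives Re ≥ 0 and `hull1` the two other inequalities of △, so z is
      -- in this tile already.
      Pos⇒P : ∀ {δ} → Pos δ → ∀ f v → △ v → at f z ≃ δ ▸ v → P z
      Pos⇒P {δ} δ∈ f v v∈ p = rotation (type1-cases f) δ∈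
        where
        rotation : Type1 f → Pos δ → P z
        rotation (univalent c) δ∈ = Tile⇒P f (nonneg-by (Pos-x≥0 δ∈ v∈) (≋-sym (x-cong p)) , hull1 c)
        rotation (trivalent g) (pos-rotate j q) = Tile⇒P (f · rotate j)
          (△-resp (≃-sym (at-step {f} {f · rotate j} (rotate j) (g j) (≃-trans p (▸-congˡ {δ} {rotate j} v q)))) v∈)
        rotation (trivalent g) (pos-turn {δ = δ′} t δ′∈ q) = Neg⇒P δ′∈ (f · spin t) v v∈
          (at-step {f} {f · spin t} (spin t) (g (turn t)) (≃-trans p (≃-trans (▸-congˡ {δ} {spin t · (S · δ′)} v q)
            (≃-trans (▸-· (spin t) (S · δ′) v) (▸-congʳ (spin t) (▸-· S δ′ v))))))

      -- If the line is closed, the word gives Re ≤ 0 and `hull0` gives Re ≥ 0; then z lies on the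
      -- line, which is part of the tile of f.
      Neg⇒P : ∀ {δ} → Pos δ → ∀ f v → △ v → at f z ≃ S ▸ (δ ▸ v) → P z
      Neg⇒P {δ} δ∈ f v v∈ p = across (type0-cases f)
        where
        halt : Closed0 f → P z
        halt c = Tile⇒P f (line⊆△ (at f z) (both-signs (hull0 c)
          (nonneg-by (S-x≤0 (δ ▸ v) (Pos-x≥0 δ∈ v∈)) (-‿cong (≋-sym (x-cong p))))))
        across : Type0 f → P z
        across (cut c)         = halt (inj₁ c)
        across (univalent _ c) = halt (inj₂ c)
        across (crossing _ q)  = Pos⇒P δ∈ (f · S) v v∈ (at-step {f} {f · S} S q p)

    Hull⇒P : P z
    Hull⇒P = let γ , v∈ = tessellation z in
      [ (λ δ∈ → Pos⇒P δ∈ one (γ ▸ z) v∈ (p γ))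
      , (λ { (δ , δ∈ , q) → Neg⇒P δ∈ one (γ ▸ z) v∈ (≃-trans (p γ) (≃-trans (▸-congˡ {r one ⁻¹ · γ ⁻¹} {S · δ} (γ ▸ z) q) (▸-· S δ (γ ▸ z)))) })
      ]′ (Pos-or-S·Pos (r one ⁻¹ · γ ⁻¹))
      where
      p : ∀ γ → at one z ≃ r one ⁻¹ · γ ⁻¹ ▸ γ ▸ z
      p γ = ≃-sym (≃-trans (▸-· (r one ⁻¹) (γ ⁻¹) (γ ▸ z)) (▸-congʳ (r one ⁻¹) (▸-inverseˡ γ z)))

  P-convex : Convex P
  P-convex {p} {q} {z} p∈ q∈ b = Hull⇒P record
    { hull0 = λ {f} c → nonneg-by (between f ℓ-x (λ {w} H → by-value (value-x (at f w)) (Hull.hull0 H c))) (value-x (at f z))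
    ; hull1 = λ {f} c → nonneg⇒≤ (nonneg-by (between f ℓ-1-2x (λ {w} H → by-value (value-1-2x (at f w)) (≤⇒nonneg (proj₁ (Hull.hull1 H c))))) (value-1-2x (at f z)))
                      , nonneg⇒≤ (nonneg-by (between f ℓ-n-2x (λ {w} H → by-value (value-n-2x (at f w)) (≤⇒nonneg (proj₂ (Hull.hull1 H c))))) (value-n-2x (at f z)))
    }
    where
    between : ∀ f ℓ → (∀ {w} → Hull w → 0# ≤ value ℓ (at f w)) → 0# ≤ value ℓ (at f z)
    between f ℓ k = Between-▸-nonneg (r f ⁻¹) ℓ {p} {q} {z} (k (P⇒Hull p∈)) (k (P⇒Hull q∈)) b

  P-closed : Closed P
  P-closed {z} z∈ = Hull⇒P record
    { hull0 = λ {f} c → nonneg-by (limit f ℓ-x (λ {w} H → by-value (value-x (at f w)) (Hull.hull0 H c))) (value-x (at f z))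
    ; hull1 = λ {f} c → nonneg⇒≤ (nonneg-by (limit f ℓ-1-2x (λ {w} H → by-value (value-1-2x (at f w)) (≤⇒nonneg (proj₁ (Hull.hull1 H c))))) (value-1-2x (at f z)))
                      , nonneg⇒≤ (nonneg-by (limit f ℓ-n-2x (λ {w} H → by-value (value-n-2x (at f w)) (≤⇒nonneg (proj₂ (Hull.hull1 H c))))) (value-n-2x (at f z)))
    }
    where
    limit : ∀ f ℓ → (∀ {w} → Hull w → 0# ≤ value ℓ (at f w)) → 0# ≤ value ℓ (at f z)
    limit f ℓ k = closure-nonneg {P} (r f ⁻¹) ℓ {z} (λ w∈ → k (P⇒Hull w∈)) z∈

  open-at : ∀ f ℓ {z} → 0# < value ℓ (at f z) → Interior (λ w → 0# < value ℓ (at f w)) z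
  open-at f ℓ {z} = value-▸-open (r f ⁻¹) ℓ z

  near-x : ∀ f {z} → 0# < x (at f z) → Interior (λ w → 0# < x (at f w)) z
  near-x f {z} p = Interior-⊆ {z = z} (λ {w} q → pos-by q (value-x (at f w))) (open-at f ℓ-x {z} (pos-by p (≋-sym (value-x (at f z)))))

  near-1-2x : ∀ f {z} → 0# < 1# - (x (at f z) + x (at f z)) → Interior (λ w → 0# < 1# - (x (at f w) + x (at f w))) z
  near-1-2x f {z} p = Interior-⊆ {z = z} (λ {w} q → pos-by q (value-1-2x (at f w))) (open-at f ℓ-1-2x {z} (pos-by p (≋-sym (value-1-2x (at f z)))))

  near-n-2x : ∀ f {z} → 0# < normSq (at f z) - (x (at f z) + x (at f z)) → Interior (λ w → 0# < normSq (at f w) - (x (at f w) + x (at f w))) z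
  near-n-2x f {z} p = Interior-⊆ {z = z} (λ {w} q → pos-by q (value-n-2x (at f w))) (open-at f ℓ-n-2x {z} (pos-by p (≋-sym (value-n-2x (at f z)))))

  ℓ-1+2x ℓ-n+2x ℓ-1-x ℓ-n-x : Form
  ℓ-1+2x = form 1# 2# 0#
  ℓ-n+2x = form 0# 2# 1#
  ℓ-1-x  = form 1# (- 1#) 0#
  ℓ-n-x  = form 0# (- 1#) 1#

  value-1+2x : ∀ z → value ℓ-1+2x z ≋ 1# + (x z + x z)
  value-1+2x z = ring! 2 (λ x n → # 1 :+ # 2 :* x :+ # 0 :* n := # 1 :+ (x :+ x)) (x z) (normSq z)
  value-n+2x : ∀ z → value ℓ-n+2x z ≋ normSq z + (x z + x z)
  value-n+2x z = ring! 2 (λ x n → # 0 :+ # 2 :* x :+ # 1 :* n := n :+ (x :+ x)) (x z) (normSq z)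
  value-1-x : ∀ z → value ℓ-1-x z ≋ 1# - x z
  value-1-x z = ring! 2 (λ x n → # 1 :+ (:- # 1) :* x :+ # 0 :* n := # 1 :- x) (x z) (normSq z)
  value-n-x : ∀ z → value ℓ-n-x z ≋ normSq z - x z
  value-n-x z = ring! 2 (λ x n → # 0 :+ (:- # 1) :* x :+ # 1 :* n := n :- x) (x z) (normSq z)

  near-1+2x : ∀ f {z} → 0# < 1# + (x (at f z) + x (at f z)) → Interior (λ w → 0# < 1# + (x (at f w) + x (at f w))) z
  near-1+2x f {z} p = Interior-⊆ {z = z} (λ {w} q → pos-by q (value-1+2x (at f w))) (open-at f ℓ-1+2x {z} (pos-by p (≋-sym (value-1+2x (at f z)))))

  near-n+2x : ∀ f {z} → 0# < normSq (at f z) + (x (at f z) + x (at f z)) → Interior (λ w → 0# < normSq (at f w) + (x (at f w) + x (at f w))) z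
  near-n+2x f {z} p = Interior-⊆ {z = z} (λ {w} q → pos-by q (value-n+2x (at f w))) (open-at f ℓ-n+2x {z} (pos-by p (≋-sym (value-n+2x (at f z)))))

  near-1-x : ∀ f {z} → 0# < 1# - x (at f z) → Interior (λ w → 0# < 1# - x (at f w)) z
  near-1-x f {z} p = Interior-⊆ {z = z} (λ {w} q → pos-by q (value-1-x (at f w))) (open-at f ℓ-1-x {z} (pos-by p (≋-sym (value-1-x (at f z)))))

  near-n-x : ∀ f {z} → 0# < normSq (at f z) - x (at f z) → Interior (λ w → 0# < normSq (at f w) - x (at f w)) z
  near-n-x f {z} p = Interior-⊆ {z = z} (λ {w} q → pos-by q (value-n-x (at f w))) (open-at f ℓ-n-x {z} (pos-by p (≋-sym (value-n-x (at f z)))))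

  interior-△ : ∀ f {z} → 0# < x (at f z) → 0# < 1# - (x (at f z) + x (at f z)) → 0# < normSq (at f z) - (x (at f z) + x (at f z)) →
               Interior (Tile f) z
  interior-△ f {z} p q t = Interior-⊆ {z = z} (λ { (a , b , c) → pos⇒nonneg a , nonneg⇒≤ (pos⇒nonneg b) , nonneg⇒≤ (pos⇒nonneg c) })
    (Interior-∩ {z = z} (near-x f {z} p) (Interior-∩ {z = z} (near-1-2x f {z} q) (near-n-2x f {z} t)))

  P-hasInterior : ∃ (Interior P)
  P-hasInterior = r one ▸ centre , Interior-⊆ {z = r one ▸ centre} (Tile⇒P one)
    (interior-△ one {r one ▸ centre} (pos-by centre-x>0 (≋-sym (x-cong c)))
      (pos-by centre-2x<1 (+-congˡ (-‿cong (+-cong (≋-sym (x-cong c)) (≋-sym (x-cong c))))))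
      (pos-by centre-2x<n (+-cong (≋-sym (normSq-cong c)) (-‿cong (+-cong (≋-sym (x-cong c)) (≋-sym (x-cong c)))))))
    where
    c : at one (r one ▸ centre) ≃ centre
    c = at-r one centre

  S∈△ : ∀ w → 0# ≤ - x w → 0# < 1# + (x w + x w) → 0# < normSq w + (x w + x w) → △ (S ▸ w)
  S∈△ w p q t = nonneg-cancel (n>0 w) (nonneg-by p (≋-sym (S-x w))) ,
    nonneg⇒≤ (nonneg-cancel (n>0 w) (nonneg-by (pos⇒nonneg t) (identity₁ (x w) (normSq w) (x (S ▸ w)) (S-x w)))) ,
    nonneg⇒≤ (nonneg-cancel (n>0 w) (nonneg-by (pos⇒nonneg q) (identity₂ (x w) (normSq w) (x (S ▸ w)) (normSq (S ▸ w)) (S-x w) (S-n w))))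
    where
    identity₁ : ∀ x n u → n * u ≋ - x → n + (x + x) ≋ n * (1# - (u + u))
    identity₁ x n u p = combine₁ 2# p (ring! 3 (λ x n u → n :+ (x :+ x) :- n :* (# 1 :- (u :+ u)) := # 2 :* (n :* u :- (:- x))) x n u)
    identity₂ : ∀ x n u m → n * u ≋ - x → n * m ≋ 1# → 1# + (x + x) ≋ n * (m - (u + u))
    identity₂ x n u m p q = combine₂ 2# (- 1#) p q (ring! 4 (λ x n u m →
      # 1 :+ (x :+ x) :- n :* (m :- (u :+ u)) := # 2 :* (n :* u :- (:- x)) :+ (:- # 1) :* (n :* m :- # 1)) x n u m)

  -- Near the line the remaining inequalities of △ and of S△ are strict, so the sign of the real
  -- part alone decides between the two tiles.
  near-line : ∀ f {z} → x (at f z) ≋ 0# → Interior (λ w →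
      (0# < 1# - (x (at f w) + x (at f w)) × 0# < normSq (at f w) - (x (at f w) + x (at f w)))
    × (0# < 1# + (x (at f w) + x (at f w)) × 0# < normSq (at f w) + (x (at f w) + x (at f w)))) z
  near-line f {z} p = Interior-∩ {z = z}
    (Interior-∩ {z = z} (near-1-2x f {z} (pos-by 0<1 (≋-sym (≋-trans (+-congˡ (≋-trans (-‿cong 2x≋0) -0#≈0#)) (+-identityʳ 1#)))))
                (near-n-2x f {z} (pos-by (n>0 (at f z)) (≋-sym (≋-trans (+-congˡ (≋-trans (-‿cong 2x≋0) -0#≈0#)) (+-identityʳ _))))))
    (Interior-∩ {z = z} (near-1+2x f {z} (pos-by 0<1 (≋-sym (≋-trans (+-congˡ 2x≋0) (+-identityʳ 1#)))))
                (near-n+2x f {z} (pos-by (n>0 (at f z)) (≋-sym (≋-trans (+-congˡ 2x≋0) (+-identityʳ _))))))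
    where
    2x≋0 : x (at f z) + x (at f z) ≋ 0#
    2x≋0 = ≋-trans (+-cong p p) (+-identityˡ 0#)

  near-crossing : ∀ f {z} → r (f · S) Γ.≈ r f · S → x (at f z) ≋ 0# → Interior (λ w → Tile f w ⊎ Tile (f · S) w) z
  near-crossing f {z} q p = Interior-⊆ {z = z} (λ {w} → split w) (near-line f {z} p)
    where
    split : ∀ w → _ → Tile f w ⊎ Tile (f · S) w
    split w ((a , b) , (c , d)) = [ (λ x≥0 → inj₁ (x≥0 , nonneg⇒≤ (pos⇒nonneg a) , nonneg⇒≤ (pos⇒nonneg b)))
      , (λ x≤0 → inj₂ (△-resp (≃-sym (at-step {f} {f · S} S q (≃-trans (≃-sym (▸-one (at f w)))
          (≃-trans (▸-congˡ {one} {S · S} (at f w) (Γ.sym S·S)) (▸-· S S (at f w)))))) (S∈△ (at f w) (neg-nonneg x≤0) c d))) ]′ (total 0# (x (at f w)))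

  -- Off the line Re = 0 a point of △ is interior to the ideal triangle 0, 1, ∞, which the three
  -- tiles around ρ fill.
  near-trivalent : ∀ f {z} → (∀ j → r (f · rotate j) Γ.≈ r f · rotate j) → Tile f z → 0# < x (at f z) →
                   Interior (λ w → ∃ λ j → Tile (f · rotate j) w) z
  near-trivalent f {z} g (_ , a , b) p = Interior-⊆ {z = z} (λ {w} → split w)
    (Interior-∩ {z = z} (near-x f {z} p) (Interior-∩ {z = z} (near-1-x f {z} (0<1-x {at f z} a)) (near-n-x f {z} (0<n-x {at f z} b))))
    where
    undo : ∀ j → ∃ λ k → rotate k · rotate j Γ.≈ one
    undo still    = still , Γ.identityˡ one
    undo (turn t) = turn (opp t) , opp-spin t
    split : ∀ w → _ → ∃ λ j → Tile (f · rotate j) w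
    split w (a , b , c) = let j , w∈ = ideal-covered (at f w) (pos⇒nonneg a) (pos⇒nonneg b) (pos⇒nonneg c)
                              k , q = undo j in
      k , △-resp (≃-sym (at-step {f} {f · rotate k} (rotate k) (g k) (≃-trans (≃-sym (▸-one (at f w)))
            (≃-trans (▸-congˡ {one} {rotate k · rotate j} (at f w) (Γ.sym q)) (▸-· (rotate k) (rotate j) (at f w)))))) w∈

  near-univalent : ∀ f {z} → f · U ~ f → 0# < x (at f z) → Interior (λ w → P w → Tile f w) z
  near-univalent f {z} c p = Interior-⊆ {λ w → 0# < x (at f w)} {λ w → P w → Tile f w} {z} (λ {w} → inside-tile w) (near-x f {z} p)
    where
    inside-tile : ∀ w → 0# < x (at f w) → P w → Tile f w
    inside-tile w a w∈P = [ (λ t → t) , (λ t → ⊥-elim (pos-not-nonpos a t)) ]′ (closed1-P c {w} w∈P)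

  near-closed0 : ∀ f {z} → Closed0 f → x (at f z) ≋ 0# → Interior (λ w → P w → Tile f w) z
  near-closed0 f {z} c p = Interior-⊆ {A = Near} {B = λ w → P w → Tile f w} {z = z} (λ {w} → inside-tile w) (near-line f {z} p)
    where
    Near : Region
    Near w = (0# < 1# - (x (at f w) + x (at f w)) × 0# < normSq (at f w) - (x (at f w) + x (at f w)))
      × (0# < 1# + (x (at f w) + x (at f w)) × 0# < normSq (at f w) + (x (at f w) + x (at f w)))
    inside-tile : ∀ w → Near w → P w → Tile f w
    inside-tile w ((a , b) , _) w∈P = closed0-nonneg c {w} w∈P , nonneg⇒≤ (pos⇒nonneg a) , nonneg⇒≤ (pos⇒nonneg b)

  -- A finite list of tiles suffices for local finiteness: a side determines its tile, and a tile
  -- carries at most four sides.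
  CoveredBy : List Γ → Region
  CoveredBy l w = P w → ∃ λ f → f ∈ l × Tile f w

  Covered : ℍ → Set
  Covered z = ∃ λ l → Interior (CoveredBy l) z

  covered-alone : ∀ f {z} → Interior (λ w → P w → Tile f w) z → Covered z
  covered-alone f {z} i = f ∷ [] , Interior-⊆ {λ w → P w → Tile f w} {CoveredBy (f ∷ [])} {z} (λ {w} → listed w) i
    where
    listed : ∀ w → (P w → Tile f w) → CoveredBy (f ∷ []) w
    listed w k w∈P = f , here refl , k w∈P

  covered-line : ∀ f {z} → x (at f z) ≋ 0# → Type0 f → Covered z
  covered-line f {z} p (cut c)         = covered-alone f {z} (near-closed0 f {z} (inj₁ c) p)
  covered-line f {z} p (univalent _ c) = covered-alone f {z} (near-closed0 f {z} (inj₂ c) p)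
  covered-line f {z} p (crossing _ q)  = l , Interior-⊆ {λ w → Tile f w ⊎ Tile (f · S) w} {CoveredBy l} {z} (λ {w} → listed w) (near-crossing f {z} q p)
    where
    l : List Γ
    l = f ∷ f · S ∷ []
    listed : ∀ w → Tile f w ⊎ Tile (f · S) w → CoveredBy l w
    listed w (inj₁ t) _ = f , here refl , t
    listed w (inj₂ t) _ = f · S , there (here refl) , t

  covered-inside : ∀ f {z} → Tile f z → 0# < x (at f z) → Type1 f → Covered z
  covered-inside f {z} z∈ p (univalent c) = covered-alone f {z} (near-univalent f {z} c p)
  covered-inside f {z} z∈ p (trivalent g) = l , Interior-⊆ {λ w → ∃ λ j → Tile (f · rotate j) w} {CoveredBy l} {z} (λ {w} → listed w) (near-trivalent f {z} g z∈ p)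
    where
    l : List Γ
    l = f · rotate still ∷ f · rotate (turn ModularGroup.left) ∷ f · rotate (turn ModularGroup.right) ∷ []
    listed : ∀ w → (∃ λ j → Tile (f · rotate j) w) → CoveredBy l w
    listed w (still , t) _                     = f · rotate still , here refl , t
    listed w (turn ModularGroup.left , t) _    = f · rotate (turn ModularGroup.left) , there (here refl) , t
    listed w (turn ModularGroup.right , t) _   = f · rotate (turn ModularGroup.right) , there (there (here refl)) , t

  covered : ∀ {z} → P z → Covered z
  covered {z} z∈P = let f , z∈ = P⇒Tile {z} z∈P in cases f z∈ em
    where
    cases : ∀ f → Tile f z → Dec (x (at f z) ≋ 0#) → Covered z
    cases f z∈ (yes p) = covered-line f {z} p (type0-cases f)
    cases f z∈ (no ¬p) = covered-inside f {z} z∈ (nonneg∧≉0⇒pos (proj₁ z∈) ¬p) (type1-cases f)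

-- The sides of P: incidence, local finiteness, boundary.

module SpecialPolygon (em : ExcludedMiddle 0ℓ) (ℝ : CompleteOrderedField) (G : Subgroup) (C : CutSet (Y-comb G))
               (tree : Graph.IsTree (Cutting.cutGraph (Y-comb G) C)) (ȷ : Lift G C) where
  open Polygon em ℝ G C tree ȷ public
  open ModularGroup hiding (_⁻¹; module Γ; s; u; left; right; last; next; done)
  private module Γ = Group PSL₂ℤ
  open Γ using (_⁻¹)
  open CutSet C using (Cut; cut-resp)

  full-line : ∀ V p {z} → side (full V p) z → ⟨0,∞⟩ (at (e V) z)
  full-line V p z∈ = ⊙-to line-resp (r (e V)) z∈

  half-line : ∀ V uni h {z} → side (half V uni h) z → halfLine (proj₁ (proj₁ V)) h (at (proj₁ uni) z)
  half-line V uni h z∈ = ⊙-to (halfLine-resp (proj₁ (proj₁ V)) h) (r (proj₁ uni)) z∈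

  side⊆Tile : ∀ t {z} → side t z → Tile (edgeAt t) z
  side⊆Tile (full V p) {z} z∈     = line⊆△ (at (e V) z) (full-line V p z∈)
  side⊆Tile (half V uni h) {z} z∈ = halfLine⊆△ (proj₁ (proj₁ V)) h (at (proj₁ uni) z) (half-line V uni h z∈)

  side⊆P : ∀ t {z} → side t z → P z
  side⊆P t {z} z∈ = Tile⇒P (edgeAt t) {z} (side⊆Tile t z∈)

  full-closed : ∀ V → proj₁ (W V) ≡ type0 → Closed0 (e V)
  full-closed V p = inj₁ (cutEnd-cut V p)

  -- Any other tile of P is strictly to the right of a type (0) side; for a type (1) side it has Re
  -- ≤ 0 in the frame of the side, where the side itself has Re > 0.
  side-tile : ∀ t {f z} → side t z → Tile f z → r (edgeAt t) Γ.≈ r f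
  side-tile (full V p) {f} {z} z∈ z∈f = closed0-tile (full-closed V p) {f} {z} z∈f (full-line V p z∈)
  side-tile (half V@((type0 , y) , _) uni h) {f} {z} z∈ z∈f =
    closed0-tile {proj₁ uni} (inj₂ (univalent-S y uni)) {f} {z} z∈f (half0⊆line h (at (proj₁ uni) z) (half-line V uni h z∈))
  side-tile (half V@((type1 , y) , _) uni h) {f} {z} z∈ z∈f =
    [ Γ.sym , (λ p → ⊥-elim (pos-not-nonpos (half1-x>0 h {at (proj₁ uni) z} (half-line V uni h z∈)) p)) ]′
      (closed1-tile {proj₁ uni} (univalent-U y uni) {f} {z} z∈f)

  side-sides : ∀ t t′ {z} → side t z → side t′ z → r (edgeAt t) Γ.≈ r (edgeAt t′)
  side-sides t t′ {z} z∈ z∈′ = side-tile t {edgeAt t′} {z} z∈ (side⊆Tile t′ z∈′)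

  half-endpoint : ∀ V uni h {z} → z ≃ r (proj₁ uni) ▸ apex (proj₁ (proj₁ V)) → Endpoint (side (half V uni h)) z
  half-endpoint V uni h = EndpointOf.endpoint (proj₁ (proj₁ V)) h (r (proj₁ uni))

  uncut-univalent : ∀ y → ¬ Cut (type0 , y) → (uni : Y.Univalent (type0 , y)) → ¬ Cut (type0 , proj₁ uni)
  uncut-univalent y nc uni = uncut-vertex y (proj₁ uni) nc (univalent-inc (type0 , y) uni)

  cut-uncut : ∀ V → proj₁ (W V) ≡ type0 → ∀ y → ¬ Cut (type0 , y) → (uni : Y.Univalent (type0 , y)) → ¬ (e V ~ proj₁ uni)
  cut-uncut V p y nc uni q = uncut-univalent y nc uni
    (cut-resp {type0 , e V} {type0 , proj₁ uni} (edge-vertex type0 (e V) (proj₁ uni) q) (cutEnd-cut V p))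

  line-half1 : ∀ {f f′} h {z} → r f Γ.≈ r f′ → ⟨0,∞⟩ (at f z) → ¬ halfLine type1 h (at f′ z)
  line-half1 {f} {f′} h {z} q a b = pos⇒≉0 (half1-x>0 h {at f′ z} b) (≋-trans (≋-sym (x-cong (at-cong {f} {f′} z q))) a)

  distinct-halves : ∀ V uni V′ uni′ h h′ {z} → proj₁ (proj₁ V) ≡ proj₁ (proj₁ V′) → r (proj₁ uni) Γ.≈ r (proj₁ uni′) → ¬ (h ≡ h′) →
    side (half V uni h) z → side (half V′ uni′ h′) z → Endpoint (side (half V uni h)) z × Endpoint (side (half V′ uni′ h′)) z
  distinct-halves V@((κ , _) , _) uni V′@((.κ , _) , _) uni′ h h′ {z} refl q h≢h′ z∈ z∈′ =
    half-endpoint V uni h {z} (apex-point h h′ h≢h′ z∈ z∈″) ,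
    half-endpoint V′ uni′ h′ {z} (≃-trans (apex-point h h′ h≢h′ z∈ z∈″) (▸-congˡ {r (proj₁ uni)} {r (proj₁ uni′)} (apex κ) q))
    where
    f : Γ
    f = proj₁ uni
    z∈″ : (r f ⊙ halfLine κ h′) z
    z∈″ = ⊙-cong (halfLine κ h′) {r (proj₁ uni′)} {r f} (Γ.sym q) z z∈′
    apex-point : ∀ h h′ → ¬ (h ≡ h′) → (r f ⊙ halfLine κ h) z → (r f ⊙ halfLine κ h′) z → z ≃ r f ▸ apex κ
    apex-point to0 to0 n _ _ = ⊥-elim (n refl)
    apex-point to∞ to∞ n _ _ = ⊥-elim (n refl)
    apex-point to0 to∞ _ a b = halves-meet-⊙ κ (r f) a b
    apex-point to∞ to0 _ a b = halves-meet-⊙ κ (r f) b a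

  same-vertex : ∀ κ y y′ (uni : Y.Univalent (κ , y)) (uni′ : Y.Univalent (κ , y′)) → proj₁ uni ~ proj₁ uni′ → (κ , y) Y.V.≈ (κ , y′)
  same-vertex κ y y′ uni uni′ = incident-vertex κ (proj₁ uni) (proj₁ uni′) y y′ (univalent-inc (κ , y) uni) (univalent-inc (κ , y′) uni′)

  -- Sides with a common point belong to one tile. There the two kinds of half-sides are disjoint
  -- and a vertex is not both cut and uncut, which leaves the two halves at one vertex, meeting at
  -- the apex.
  sides-meet : ∀ t t′ {z} → ¬ (t ≈ˢ t′) → side t z → side t′ z → Endpoint (side t) z × Endpoint (side t′) z
  sides-meet t t′ {z} t≉t′ z∈ z∈′ = cases t t′ t≉t′ z∈ z∈′ (side-sides t t′ {z} z∈ z∈′)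
    where
    cases : ∀ t t′ → ¬ (t ≈ˢ t′) → side t z → side t′ z → r (edgeAt t) Γ.≈ r (edgeAt t′) → Endpoint (side t) z × Endpoint (side t′) z
    cases (full V p) (full V′ p′) n _ _ q = ⊥-elim (n (cutEnd-≈ V V′ p p′ (r-injective {e V} {e V′} q)))
    cases (full V p) (half ((type0 , y) , nc) uni _) n _ _ q = ⊥-elim (cut-uncut V p y nc uni (r-injective {e V} {proj₁ uni} q))
    cases (half ((type0 , y) , nc) uni _) (full V p) n _ _ q = ⊥-elim (cut-uncut V p y nc uni (r-injective {e V} {proj₁ uni} (Γ.sym q)))
    cases (full V p) (half V′@((type1 , _) , nc) uni h) n a b q = ⊥-elim (line-half1 {e V} {proj₁ uni} h {z} q (full-line V p a) (half-line V′ uni h b))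
    cases (half V′@((type1 , _) , nc) uni h) (full V p) n b a q = ⊥-elim (line-half1 {e V} {proj₁ uni} h {z} (Γ.sym q) (full-line V p a) (half-line V′ uni h b))
    cases (half V@((type0 , _) , _) uni h) (half V′@((type1 , _) , _) uni′ h′) n a b q =
      ⊥-elim (line-half1 {proj₁ uni} {proj₁ uni′} h′ {z} q (half0⊆line h (at (proj₁ uni) z) (half-line V uni h a)) (half-line V′ uni′ h′ b))
    cases (half V@((type1 , _) , _) uni h) (half V′@((type0 , _) , _) uni′ h′) n a b q =
      ⊥-elim (line-half1 {proj₁ uni′} {proj₁ uni} h {z} (Γ.sym q) (half0⊆line h′ (at (proj₁ uni′) z) (half-line V′ uni′ h′ b)) (half-line V uni h a))
    cases (half V@((type0 , y) , _) uni h) (half V′@((type0 , y′) , _) uni′ h′) n a b q =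
      distinct-halves V uni V′ uni′ h h′ {z} refl q (λ { refl → n (same-vertex type0 y y′ uni uni′ (r-injective {proj₁ uni} {proj₁ uni′} q) , refl) }) a b
    cases (half V@((type1 , y) , _) uni h) (half V′@((type1 , y′) , _) uni′ h′) n a b q =
      distinct-halves V uni V′ uni′ h h′ {z} refl q (λ { refl → n (same-vertex type1 y y′ uni uni′ (r-injective {proj₁ uni} {proj₁ uni′} q) , refl) }) a b

  cutSide : ∀ f → Cut (type0 , f) → Side
  cutSide f c = full (cutEnd (type0 , f) c f (inc-refl type0 f)) refl

  univalentSide0 : ∀ f → ¬ Cut (type0 , f) → f · S ~ f → Half → Side
  univalentSide0 f nc p h = half ((type0 , f) , nc) (univalent0 {f} p) h

  univalentSide1 : ∀ f → f · U ~ f → Half → Side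
  univalentSide1 f p h = half ((type1 , f) , type1-uncut {f}) (univalent1 {f} p) h

  sides0 : ∀ f → Type0 f → List Side
  sides0 f (cut c)          = cutSide f c ∷ []
  sides0 f (univalent nc p) = univalentSide0 f nc p to0 ∷ univalentSide0 f nc p to∞ ∷ []
  sides0 f (crossing _ _)   = []

  sides1 : ∀ f → Type1 f → List Side
  sides1 f (univalent p) = univalentSide1 f p to0 ∷ univalentSide1 f p to∞ ∷ []
  sides1 f (trivalent _) = []

  sidesAt : Γ → List Side
  sidesAt f = sides0 f (type0-cases f) ++ sides1 f (type1-cases f)

  S≉one : ¬ (S Γ.≈ one)
  S≉one (plus ())
  S≉one (minus ())

  ·-fixed : ∀ {g k} → g · k Γ.≈ g → k Γ.≈ one
  ·-fixed {g} {k} p = ∙-cancelˡ g k one (Γ.trans p (Γ.sym (Γ.identityʳ g)))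

  crossing-not-fixed : ∀ {f} → r (f · S) Γ.≈ r f · S → ¬ (f · S ~ f)
  crossing-not-fixed {f} q p = S≉one (·-fixed {r f} {S} (Γ.trans (Γ.sym q) (r-cong {f · S} {f} p)))

  trivalent-not-fixed : ∀ {f} → (∀ j → r (f · rotate j) Γ.≈ r f · rotate j) → ¬ (f · U ~ f)
  trivalent-not-fixed {f} g p = spin≉one ModularGroup.left (·-fixed {r f} {U} (Γ.trans (Γ.sym (g (turn ModularGroup.left))) (r-cong {f · U} {f} p)))

  ~-fixed : ∀ {f f′} k → f′ ~ f → f′ · k ~ f′ → f · k ~ f
  ~-fixed {f} {f′} k p q = ~-trans {f · k} {f′ · k} {f} (~-sym {f′ · k} {f · k} (~-∙ {f′} {f} k p)) (~-trans {f′ · k} {f′} {f} q p)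

  sidesAt-complete : ∀ t {f} → edgeAt t ~ f → Any (t ≈ˢ_) (sidesAt f)
  sidesAt-complete t@(full V p) {f} q = Any.++⁺ˡ (cases (type0-cases f))
    where
    c : Cut (type0 , f)
    c = cut-resp {type0 , e V} {type0 , f} (edge-vertex type0 (e V) f q) (cutEnd-cut V p)
    cases : (k : Type0 f) → Any (t ≈ˢ_) (sides0 f k)
    cases (cut c′)         = here (cutEnd-≈ V (cutEnd (type0 , f) c′ f (inc-refl type0 f)) p refl q)
    cases (univalent nc _) = ⊥-elim (nc c)
    cases (crossing nc _)  = ⊥-elim (nc c)
  sidesAt-complete t@(half ((type0 , y) , nc) uni h) {f} q = Any.++⁺ˡ (cases (type0-cases f))
    where
    vertex : (type0 , y) Y.V.≈ (type0 , f)
    vertex = incident-vertex type0 (proj₁ uni) f y f (univalent-inc (type0 , y) uni) (inc-refl type0 f) q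
    cases : (k : Type0 f) → Any (t ≈ˢ_) (sides0 f k)
    cases (cut c) = ⊥-elim (nc (cut-resp {type0 , f} {type0 , y} (Y.V.sym {type0 , y} {type0 , f} vertex) c))
    cases (univalent _ _) = pick h
      where
      pick : ∀ h → Any (half ((type0 , y) , nc) uni h ≈ˢ_) _
      pick to0 = here (vertex , refl)
      pick to∞ = there (here (vertex , refl))
    cases (crossing _ g) = ⊥-elim (crossing-not-fixed {f} g (~-fixed {f} {proj₁ uni} S q (univalent-S y uni)))
  sidesAt-complete t@(half ((type1 , y) , nc) uni h) {f} q = Any.++⁺ʳ (sides0 f (type0-cases f)) (cases (type1-cases f))
    where
    vertex : (type1 , y) Y.V.≈ (type1 , f)
    vertex = incident-vertex type1 (proj₁ uni) f y f (univalent-inc (type1 , y) uni) (inc-refl type1 f) q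
    cases : (k : Type1 f) → Any (t ≈ˢ_) (sides1 f k)
    cases (univalent _) = pick h
      where
      pick : ∀ h → Any (half ((type1 , y) , nc) uni h ≈ˢ_) _
      pick to0 = here (vertex , refl)
      pick to∞ = there (here (vertex , refl))
    cases (trivalent g) = ⊥-elim (trivalent-not-fixed {f} g (~-fixed {f} {proj₁ uni} U q (univalent-U y uni)))

  sidesAtAll : List Γ → List Side
  sidesAtAll []      = []
  sidesAtAll (f ∷ l) = sidesAt f ++ sidesAtAll l

  sidesAtAll-complete : ∀ t {f l} → f ∈ l → edgeAt t ~ f → Any (t ≈ˢ_) (sidesAtAll l)
  sidesAtAll-complete t {f} (here refl) q = Any.++⁺ˡ (sidesAt-complete t {f} q)
  sidesAtAll-complete t {f} {f′ ∷ _} (there i) q = Any.++⁺ʳ (sidesAt f′) (sidesAtAll-complete t {f} i q)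

  LocallyFinite : ℍ → Set
  LocallyFinite z = ∃ λ ε → 0# < ε × ∃ λ (l : List Side) → ∀ t → Meets (Ball z ε) (side t) → Any (t ≈ˢ_) l

  tile-side-listed : ∀ t l w → side t w → (∃ λ f → f ∈ l × Tile f w) → Any (t ≈ˢ_) (sidesAtAll l)
  tile-side-listed t l w w∈t (f , f∈l , w∈f) = sidesAtAll-complete t {f} {l} f∈l (r-injective {edgeAt t} {f} (side-tile t {f} {w} w∈t w∈f))

  -- A side meeting the ball does so in a listed tile, and by `side-tile` it is a side of that tile.
  covered-locallyFinite : ∀ z → Covered z → LocallyFinite z
  covered-locallyFinite z (l , ε , ε>0 , ball) = ε , ε>0 , sidesAtAll l , listed
    where
    listed : ∀ t → Meets (Ball z ε) (side t) → Any (t ≈ˢ_) (sidesAtAll l)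
    listed t (w , w∈ball , w∈t) = tile-side-listed t l w w∈t (ball {w} w∈ball (side⊆P t {w} w∈t))

  apart-locallyFinite : ∀ z → (∃ λ ε → 0# < ε × ¬ Meets (Ball z ε) P) → LocallyFinite z
  apart-locallyFinite z (ε , ε>0 , apart) = ε , ε>0 , [] , none
    where
    none : ∀ t → Meets (Ball z ε) (side t) → Any (t ≈ˢ_) []
    none t (w , w∈ball , w∈t) = ⊥-elim (apart (w , w∈ball , side⊆P t {w} w∈t))

  separated : ∀ z → ¬ P z → ∃ λ ε → 0# < ε × ¬ Meets (Ball z ε) P
  separated z z∉ = stable λ close → z∉ (P-closed {z} λ ε ε>0 → stable λ apart → close (ε , ε>0 , apart))

  P-locallyFinite : ∀ z → LocallyFinite z
  P-locallyFinite z = decide em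
    where
    decide : Dec (P z) → LocallyFinite z
    decide (yes z∈) = covered-locallyFinite z (covered {z} z∈)
    decide (no z∉)  = apart-locallyFinite z (separated z z∉)

  -- The centre of the tile of f is the point at which the form is positive, so that it is not
  -- identically zero.
  P-not-interior : ∀ f ℓ {z} → (∀ {w} → P w → 0# ≤ value ℓ (at f w)) → 0# < value ℓ centre → value ℓ (at f z) ≋ 0# → ¬ Interior P z
  P-not-interior f ℓ {z} P≥0 c>0 p i = zero-▸-not-interior (r f ⁻¹) ℓ {z} {r f ▸ centre} p
    (pos-by c>0 (≋-sym (value-cong ℓ (at-r f centre)))) (Interior-⊆ {P} {λ w → 0# ≤ value ℓ (at f w)} {z} (λ {w} → P≥0 {w}) i)

  side-not-interior : ∀ t {z} → side t z → ¬ Interior P z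
  side-not-interior (full V p) {z} z∈ = P-not-interior (e V) ℓ-x {z}
    (λ {w} w∈ → by-value (value-x (at (e V) w)) (closed0-nonneg {e V} (full-closed V p) {w} w∈))
    (pos-by centre-x>0 (≋-sym (value-x centre))) (≋-trans (value-x (at (e V) z)) (full-line V p z∈))
  side-not-interior (half V@((type0 , y) , _) uni h) {z} z∈ = P-not-interior (proj₁ uni) ℓ-x {z}
    (λ {w} w∈ → by-value (value-x (at (proj₁ uni) w)) (closed0-nonneg {proj₁ uni} (inj₂ (univalent-S y uni)) {w} w∈))
    (pos-by centre-x>0 (≋-sym (value-x centre)))
    (≋-trans (value-x (at (proj₁ uni) z)) (half0⊆line h (at (proj₁ uni) z) (half-line V uni h z∈)))
  side-not-interior (half V@((type1 , y) , _) uni to0) {z} z∈ = P-not-interior (proj₁ uni) ℓ-n-2x {z}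
    (λ {w} w∈ → by-value (value-n-2x (at (proj₁ uni) w)) (≤⇒nonneg (proj₂ (Hull.hull1 (P⇒Hull {w} w∈) {proj₁ uni} (univalent-U y uni)))))
    (pos-by centre-2x<n (≋-sym (value-n-2x centre)))
    (≋-trans (value-n-2x (at (proj₁ uni) z)) (zero-difference (proj₁ (half-line V uni to0 z∈))))
  side-not-interior (half V@((type1 , y) , _) uni to∞) {z} z∈ = P-not-interior (proj₁ uni) ℓ-1-2x {z}
    (λ {w} w∈ → by-value (value-1-2x (at (proj₁ uni) w)) (≤⇒nonneg (proj₁ (Hull.hull1 (P⇒Hull {w} w∈) {proj₁ uni} (univalent-U y uni)))))
    (pos-by centre-2x<1 (≋-sym (value-1-2x centre)))
    (≋-trans (value-1-2x (at (proj₁ uni) z)) (zero-difference (≋-sym (proj₁ (half-line V uni to∞ z∈)))))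

  complement-closure : ∀ {A : Region} {z} → ¬ Interior A z → Closure (Complement A) z
  complement-closure {A} {z} ni ε ε>0 = stable λ apart → ni (ε , ε>0 , λ {w} w∈ → stable λ w∉ → apart (w , w∈ , w∉))

  OnSide : Region
  OnSide z = ∃ λ t → side t z

  side-boundary : ∀ {z} → OnSide z → Boundary P z
  side-boundary {z} (t , z∈) = (λ ε ε>0 → z , Ball-centre z ε>0 , side⊆P t {z} z∈) , complement-closure {P} {z} (side-not-interior t {z} z∈)

  on-cut : ∀ {f z} (c : Cut (type0 , f)) → ⟨0,∞⟩ (at f z) → OnSide z
  on-cut {f} c z∈ = cutSide f c , ⊙-from (r f) z∈

  on-univalent0 : ∀ {f z} → ¬ Cut (type0 , f) → f · S ~ f → ⟨0,∞⟩ (at f z) → OnSide z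
  on-univalent0 {f} {z} nc p z∈ = [ (λ n≤1 → univalentSide0 f nc p to0 , ⊙-from (r f) (z∈ , n≤1))
    , (λ 1≤n → univalentSide0 f nc p to∞ , ⊙-from (r f) (z∈ , 1≤n)) ]′ (total (normSq (at f z)) 1#)

  on-univalent1 : ∀ {f z} → f · U ~ f → Tile f z → ¬ (0# < 1# - (x (at f z) + x (at f z)) × 0# < normSq (at f z) - (x (at f z) + x (at f z))) → OnSide z
  on-univalent1 {f} {z} p (a , b , c) q = cases em em
    where
    w = at f z
    cases : Dec (x w + x w ≋ 1#) → Dec (normSq w ≋ x w + x w) → OnSide z
    cases (yes d) _ = univalentSide1 f p to∞ , ⊙-from (r f) (d , ≤-respˡ d c)
    cases (no _) (yes d) = univalentSide1 f p to0 , ⊙-from (r f) (d , b)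
    cases (no d) (no d′) = ⊥-elim (q (nonneg∧≉0⇒pos (≤⇒nonneg b) (λ t → d (≋-sym (difference-zero t))) , nonneg∧≉0⇒pos (≤⇒nonneg c) (λ t → d′ (difference-zero t))))

  -- On the line of the tile the type (0) vertex decides, off it the type (1) vertex: either tiles
  -- of P fill a neighbourhood, or a side passes through z, or z is interior to the tile.
  inner-or-side : ∀ f {z} → Tile f z → Interior P z ⊎ OnSide z
  inner-or-side f {z} z∈ = decide em
    where
    at-line : x (at f z) ≋ 0# → Type0 f → Interior P z ⊎ OnSide z
    at-line p (cut c) = inj₂ (on-cut {f} {z} c p)
    at-line p (univalent nc q) = inj₂ (on-univalent0 {f} {z} nc q p)
    at-line p (crossing _ q) = inj₁ (Interior-⊆ {λ w → Tile f w ⊎ Tile (f · S) w} {P} {z} (λ {w} → [ Tile⇒P f {w} , Tile⇒P (f · S) {w} ]′) (near-crossing f {z} q p))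
    off-line : 0# < x (at f z) → Type1 f → Interior P z ⊎ OnSide z
    off-line p (trivalent g) = inj₁ (Interior-⊆ {λ w → ∃ λ j → Tile (f · rotate j) w} {P} {z} (λ {w} (j , t) → Tile⇒P (f · rotate j) {w} t) (near-trivalent f {z} g z∈ p))
    off-line p (univalent c) = strict em
      where
      strict : Dec (0# < 1# - (x (at f z) + x (at f z)) × 0# < normSq (at f z) - (x (at f z) + x (at f z))) → Interior P z ⊎ OnSide z
      strict (yes (q , t)) = inj₁ (Interior-⊆ {Tile f} {P} {z} (λ {w} → Tile⇒P f {w}) (interior-△ f {z} p q t))
      strict (no ¬q) = inj₂ (on-univalent1 {f} {z} c z∈ ¬q)
    decide : Dec (x (at f z) ≋ 0#) → Interior P z ⊎ OnSide z
    decide (yes p) = at-line p (type0-cases f)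
    decide (no ¬p) = off-line (nonneg∧≉0⇒pos (proj₁ z∈) ¬p) (type1-cases f)

  boundary-side : ∀ {z} → Boundary P z → OnSide z
  boundary-side {z} (z∈ , z∉) = let f , z∈f = P⇒Tile {z} (P-closed {z} z∈) in
    [ (λ (ε , ε>0 , ball) → let w , w∈ , w∉ = z∉ ε ε>0 in ⊥-elim (w∉ (ball {w} w∈))) , (λ t → t) ]′ (inner-or-side f {z} z∈f)

  edge≈ : ∀ t t′ → t ≈ˢ t′ → r (edgeAt t) Γ.≈ r (edgeAt t′)
  edge≈ (full V _) (full V′ _) (_ , q) = r-cong {e V} {e V′} q
  edge≈ (half V uni _) (half V′ uni′ _) (p , _) = r-cong {proj₁ uni} {proj₁ uni′} (univalent-edge (proj₁ V) (proj₁ V′) uni uni′ p)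

  side-≐ : ∀ t t′ → t ≈ˢ t′ → side t ≐ side t′
  side-≐ t@(full V _) t′@(full V′ _) q = ≗⇒≐ (side t) (side t′) (⊙-≈ ⟨0,∞⟩ {r (e V)} {r (e V′)} (edge≈ t t′ q))
  side-≐ t@(half ((κ , _) , _) uni h) t′@(half ((.κ , _) , _) uni′ .h) q@(same _ , refl) =
    ≗⇒≐ (side t) (side t′) (⊙-≈ (halfLine κ h) {r (proj₁ uni)} {r (proj₁ uni′)} (edge≈ t t′ q))

  side-geodesic : ∀ t → IsGeodesicInterval (side t)
  side-geodesic (full V _)     = line-geodesic (r (e V))
  side-geodesic (half V uni h) = halfLine-geodesic (proj₁ (proj₁ V)) h (r (proj₁ uni))

  P-isConvexPolygon : IsConvexPolygon P sides side
  P-isConvexPolygon = record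
    { convex        = λ {p} {q} {z} → P-convex {p} {q} {z}
    ; closed        = λ {z} → P-closed {z}
    ; hasInterior   = P-hasInterior
    ; edge-resp     = λ {t} {t′} → side-≐ t t′
    ; edge-geodesic = side-geodesic
    ; boundary      = λ z → mk⇔ (boundary-side {z}) (side-boundary {z})
    ; edges-meet    = λ {t} {t′} {z} → sides-meet t t′ {z}
    ; locallyFinite = P-locallyFinite
    }

-- The involution, the pairing elements, and the two claims.

module MainTheorem (em : ExcludedMiddle 0ℓ) (ℝ : CompleteOrderedField) (G : Subgroup) (C : CutSet (Y-comb G))
               (tree : Graph.IsTree (Cutting.cutGraph (Y-comb G) C)) (ȷ : Lift G C) where
  open SpecialPolygon em ℝ G C tree ȷ public
  open ModularGroup hiding (_⁻¹; module Γ; left; right; last; next; done)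
  private module Γ = Group PSL₂ℤ
  open Γ using (_⁻¹)
  open CutSet C using (Cut; cut-resp)

  σ-cong : ∀ t t′ → t ≈ˢ t′ → σ t ≈ˢ σ t′
  σ-cong (full V _) (full V′ _) q = opposite-cong V V′ q
  σ-cong (half _ _ h) (half _ _ .h) (p , refl) = p , refl

  σ-involutive : ∀ t → σ (σ t) ≈ˢ t
  σ-involutive (full V _)          = opposite-involutive V
  σ-involutive (half (v , _) _ to0) = Y.V.refl {v} , refl
  σ-involutive (half (v , _) _ to∞) = Y.V.refl {v} , refl

  flip≢ : ∀ h → ¬ (flip h ≡ h)
  flip≢ to0 ()
  flip≢ to∞ ()

  σ-fixpoint-free : ∀ t → ¬ (σ t ≈ˢ t)
  σ-fixpoint-free (full V _) (_ , q)     = opposite≁ V q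
  σ-fixpoint-free (half _ _ h) (_ , q) = flip≢ h q

  ≐-refl : ∀ (A : Region) → A ≐ A
  ≐-refl A = (λ z → z) , (λ z → z)

  translate-copy : ∀ (A B : Region) f k → k ⊙ A ≗ B → f ⊙ B ≐ (f · k) ⊙ A
  translate-copy A B f k p = ≗⇒≐ (f ⊙ B) ((f · k) ⊙ A) (≗-trans (f ⊙ B) (f ⊙ (k ⊙ A)) ((f · k) ⊙ A)
    (⊙-≗ B (k ⊙ A) f (≗-sym (k ⊙ A) B p)) (⊙-assoc A f k))

  Copyˢ : Region → Side → Set
  Copyˢ A t = Copy P sides side A t

  full-copy : ∀ V p → Copyˢ ⟨0,∞⟩ (full V p)
  full-copy V p = r (e V) , ≐-refl (side (full V p))

  half0-copy : ∀ y nc uni h → Copyˢ (halfLine type0 to∞) (half ((type0 , y) , nc) uni h)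
  half0-copy y nc uni to∞ = r (proj₁ uni) , ≐-refl (side (half ((type0 , y) , nc) uni to∞))
  half0-copy y nc uni to0 = r (proj₁ uni) · S , translate-copy (halfLine type0 to∞) (halfLine type0 to0) (r (proj₁ uni)) S (S⊙half0 to∞)

  half1-copy : ∀ y nc uni h → Copyˢ (halfLine type1 to∞) (half ((type1 , y) , nc) uni h)
  half1-copy y nc uni to∞ = r (proj₁ uni) , ≐-refl (side (half ((type1 , y) , nc) uni to∞))
  half1-copy y nc uni to0 = r (proj₁ uni) · U , translate-copy (halfLine type1 to∞) (halfLine type1 to0) (r (proj₁ uni)) U U⊙half1

  kinds : ∀ t → Copyˢ ⟨0,∞⟩ t ⊎ Copyˢ (halfLine type0 to∞) t ⊎ Copyˢ (halfLine type1 to∞) t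
  kinds (full V p)                    = inj₁ (full-copy V p)
  kinds (half ((type0 , y) , nc) uni h) = inj₂ (inj₁ (half0-copy y nc uni h))
  kinds (half ((type1 , y) , nc) uni h) = inj₂ (inj₂ (half1-copy y nc uni h))

  -- The conditions on an edge of a special polygon refer to its shape as a point set. Hence the
  -- three model edges must be pairwise inequivalent under Γ, which this and the next five lemmas
  -- record.
  half0-not-line : ∀ f h → ¬ (∃ λ g → f ⊙ halfLine type0 h ≐ g ⊙ ⟨0,∞⟩)
  half0-not-line f h (g , q) = line-not-half0 (f ⁻¹ · g) h
    (transported′ ⟨0,∞⟩ (halfLine type0 h) (halfLine-resp type0 h) g f (proj₂ (≐⇒≗ (f ⊙ halfLine type0 h) (g ⊙ ⟨0,∞⟩) q)))

  half1-not-line : ∀ f h → ¬ (∃ λ g → f ⊙ halfLine type1 h ≐ g ⊙ ⟨0,∞⟩)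
  half1-not-line f h (g , q) = half0-not-half1 (f ⁻¹ · g) to∞ h λ z z∈ →
    transported′ ⟨0,∞⟩ (halfLine type1 h) (halfLine-resp type1 h) g f (proj₂ (≐⇒≗ (f ⊙ halfLine type1 h) (g ⊙ ⟨0,∞⟩) q)) z (proj₁ z∈)

  line-not-half0∞ : ∀ f → ¬ (∃ λ g → f ⊙ ⟨0,∞⟩ ≐ g ⊙ halfLine type0 to∞)
  line-not-half0∞ f (g , q) = line-not-half0 (g ⁻¹ · f) to∞
    (transported′ ⟨0,∞⟩ (halfLine type0 to∞) (halfLine-resp type0 to∞) f g (proj₁ (≐⇒≗ (f ⊙ ⟨0,∞⟩) (g ⊙ halfLine type0 to∞) q)))

  half1-not-half0∞ : ∀ f h → ¬ (∃ λ g → f ⊙ halfLine type1 h ≐ g ⊙ halfLine type0 to∞)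
  half1-not-half0∞ f h (g , q) = half0-not-half1 (f ⁻¹ · g) to∞ h
    (transported′ (halfLine type0 to∞) (halfLine type1 h) (halfLine-resp type1 h) g f (proj₂ (≐⇒≗ (f ⊙ halfLine type1 h) (g ⊙ halfLine type0 to∞) q)))

  line-not-half1∞ : ∀ f → ¬ (∃ λ g → f ⊙ ⟨0,∞⟩ ≐ g ⊙ halfLine type1 to∞)
  line-not-half1∞ f (g , q) = half0-not-half1 (g ⁻¹ · f) to∞ to∞ λ z z∈ →
    transported′ ⟨0,∞⟩ (halfLine type1 to∞) (halfLine-resp type1 to∞) f g (proj₁ (≐⇒≗ (f ⊙ ⟨0,∞⟩) (g ⊙ halfLine type1 to∞) q)) z (proj₁ z∈)

  half0-not-half1∞ : ∀ f h → ¬ (∃ λ g → f ⊙ halfLine type0 h ≐ g ⊙ halfLine type1 to∞)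
  half0-not-half1∞ f h (g , q) = half0-not-half1 (g ⁻¹ · f) h to∞
    (transported′ (halfLine type0 h) (halfLine type1 to∞) (halfLine-resp type1 to∞) f g (proj₁ (≐⇒≗ (f ⊙ halfLine type0 h) (g ⊙ halfLine type1 to∞) q)))

  full-sides : ∀ t → Copyˢ ⟨0,∞⟩ t → ¬ (σ t ≈ˢ t) × Copyˢ ⟨0,∞⟩ (σ t)
  full-sides (full V p) _ = σ-fixpoint-free (full V p) , full-copy (opposite V) (≡.trans (≡.cong proj₁ (opposite-kind V)) p)
  full-sides (half ((type0 , _) , _) uni h) c = ⊥-elim (half0-not-line (r (proj₁ uni)) h c)
  full-sides (half ((type1 , _) , _) uni h) c = ⊥-elim (half1-not-line (r (proj₁ uni)) h c)

  i-sides : ∀ t → Copyˢ (halfLine type0 to∞) t → ¬ (σ t ≈ˢ t) × Copyˢ (halfLine type0 to∞) (σ t) ×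
            Adjacent-at-angle-with-cosine cosπ (side t) (side (σ t))
  i-sides (full V p) c = ⊥-elim (line-not-half0∞ (r (e V)) c)
  i-sides (half ((type1 , _) , _) uni h) c = ⊥-elim (half1-not-half0∞ (r (proj₁ uni)) h c)
  i-sides t@(half ((type0 , y) , nc) uni h) _ =
    σ-fixpoint-free t , half0-copy y nc uni (flip h) , halves-adjacent type0 h (r (proj₁ uni))

  ρ-sides : ∀ t → Copyˢ (halfLine type1 to∞) t → ¬ (σ t ≈ˢ t) × Copyˢ (halfLine type1 to∞) (σ t) ×
            Adjacent-at-angle-with-cosine cos2π/3 (side t) (side (σ t))
  ρ-sides (full V p) c = ⊥-elim (line-not-half1∞ (r (e V)) c)
  ρ-sides (half ((type0 , _) , _) uni h) c = ⊥-elim (half0-not-half1∞ (r (proj₁ uni)) h c)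
  ρ-sides t@(half ((type1 , y) , nc) uni h) _ =
    σ-fixpoint-free t , half1-copy y nc uni (flip h) , halves-adjacent type1 h (r (proj₁ uni))

  special : IsSpecialPolygon P sides side σ
  special = record
    { isConvexPolygon = P-isConvexPolygon
    ; σ-cong          = λ {t} {t′} → σ-cong t t′
    ; σ-involutive    = σ-involutive
    ; edge-kinds      = kinds
    ; full-edges      = full-sides
    ; i-edges         = i-sides
    ; ρ-edges         = ρ-sides
    }

  -- The explicit g_s. `isPairing` and `pairing-unique` identify it with the element characterised
  -- by its action; U² takes [ρ,0) to [ρ,∞), which fixes the choice of turns.
  pairing : Side → Γ
  pairing (full V _)                          = pair0 (e V)
  pairing (half ((type0 , _) , _) uni _)      = pair0 (proj₁ uni)
  pairing (half ((type1 , _) , _) uni to0)    = pair1 ModularGroup.right (proj₁ uni)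
  pairing (half ((type1 , _) , _) uni to∞)    = pair1 ModularGroup.left (proj₁ uni)

  line-orient : ∀ {p q w} → ⟨0,∞⟩ p → ⟨0,∞⟩ q → orient p q w ≋ (normSq p - normSq q) * x w
  line-orient {p} {q} {w} a b = identity (x p) (normSq p) (x q) (normSq q) (x w) (normSq w) a b
    where
    identity : ∀ a n b m c l → a ≋ 0# → b ≋ 0# → (b - a) * (l - n) - (m - n) * (c - a) ≋ (n - m) * c
    identity a n b m c l p q = combine₂ (- (l - n) + (m - n)) (l - n) p q (ring! 6 (λ a n b m c l →
      (b :- a) :* (l :- n) :- (m :- n) :* (c :- a) :- (n :- m) :* c
      := (:- (l :- n) :+ (m :- n)) :* (a :- # 0) :+ (l :- n) :* (b :- # 0)) a n b m c l)

  -- P lies to the left of a type (0) side directed from the image of ∞ to that of 0.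
  directed⇒ : ∀ f p q → ⟨0,∞⟩ (at f p) → ⟨0,∞⟩ (at f q) → Directed p q → 0# ≤ normSq (at f p) - normSq (at f q)
  directed⇒ f p q a b dir = nonneg-cancel (centre-x>0) (nonneg-by
    (nonneg-cancel (*-pos (*-pos (den-pos (r f ⁻¹) p) (den-pos (r f ⁻¹) q)) (den-pos (r f ⁻¹) c))
      (nonneg-by (dir {c} (Tile⇒P f {c} (△-resp (≃-sym (at-r f centre)) centre∈△))) (≋-sym (orient-invariant (r f ⁻¹) p q c))))
    (≋-trans (line-orient {at f p} {at f q} {at f c} a b) (≋-trans (*-congˡ (x-cong (at-r f centre))) (*-comm _ _))))
    where
    c : ℍ
    c = r f ▸ centre

  ⇒directed : ∀ f p q → Closed0 f → ⟨0,∞⟩ (at f p) → ⟨0,∞⟩ (at f q) → 0# ≤ normSq (at f p) - normSq (at f q) → Directed p q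
  ⇒directed f p q c a b n {z} z∈ = nonneg-by (*-nonneg (pos⇒nonneg (*-pos (*-pos (den-pos (r f ⁻¹) p) (den-pos (r f ⁻¹) q)) (den-pos (r f ⁻¹) z)))
      (nonneg-by (*-nonneg n (closed0-nonneg {f} c {z} z∈)) (≋-sym (line-orient {at f p} {at f q} {at f z} a b))))
    (orient-invariant (r f ⁻¹) p q z)

  -- |Sz|² = 1/|z|².
  S-antitone : ∀ p q → 0# ≤ normSq p - normSq q → 0# ≤ normSq (S ▸ q) - normSq (S ▸ p)
  S-antitone p q n = nonneg-cancel (*-pos (n>0 p) (n>0 q)) (nonneg-by n (identity (normSq p) (normSq q) (normSq (S ▸ p)) (normSq (S ▸ q)) (S-n p) (S-n q)))
    where
    identity : ∀ n m n′ m′ → n * n′ ≋ 1# → m * m′ ≋ 1# → n - m ≋ (n * m) * (m′ - n′)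
    identity n m n′ m′ p q = combine₂ m (- n) p q (ring! 4 (λ n m n′ m′ →
      n :- m :- (n :* m) :* (m′ :- n′) := m :* (n :* n′ :- # 1) :+ (:- n) :* (m :* m′ :- # 1)) n m n′ m′)

  image-at : ∀ f f′ k g {p p′} → g Γ.≈ r f′ · k · r f ⁻¹ → Maps g p p′ → at f′ p′ ≃ k ▸ at f p
  image-at f f′ k g {p} {p′} q m = ≃-trans (▸-congʳ (r f′ ⁻¹) (≃-trans (Maps⇒≈ g {p} {p′} m)
      (≃-trans (▸-congˡ {g} {r f′ · k · r f ⁻¹} p q) (≃-trans (▸-· (r f′ · k) (r f ⁻¹) p) (▸-· (r f′) k (at f p))))))
    (▸-inverseˡ (r f′) (k ▸ at f p))

  opposite-edge : ∀ V → proj₁ (W V) ≡ type0 → r (e (opposite V)) Γ.≈ r (e V · S)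
  opposite-edge V p = r-cong {e (opposite V)} {e V · S} (opposite-S V p)

  pair0-full : ∀ V → proj₁ (W V) ≡ type0 → pair0 (e V) Γ.≈ r (e (opposite V)) · S · r (e V) ⁻¹
  pair0-full V p = ·-congʳ {r (e V) ⁻¹} (·-congʳ {S} (Γ.sym (opposite-edge V p)))

  pair0-half : ∀ {f} → f · S ~ f → pair0 f Γ.≈ r f · S · r f ⁻¹
  pair0-half {f} p = ·-congʳ {r f ⁻¹} (·-congʳ {S} (r-cong {f · S} {f} p))

  conjugate-≐ : ∀ (A B : Region) g f′ f k → g Γ.≈ f′ · k · f ⁻¹ → k ⊙ A ≗ B → g ⊙ (f ⊙ A) ≐ f′ ⊙ B
  conjugate-≐ A B g f′ f k p q = ≗⇒≐ (g ⊙ (f ⊙ A)) (f′ ⊙ B)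
    (≗-trans (g ⊙ (f ⊙ A)) ((f′ · k · f ⁻¹) ⊙ (f ⊙ A)) (f′ ⊙ B) (⊙-≈ (f ⊙ A) {g} {f′ · k · f ⁻¹} p) (conjugate A B f′ f k q))

  pair1-inverse : ∀ f → pair1 ModularGroup.left f ⁻¹ Γ.≈ pair1 ModularGroup.right f
  pair1-inverse f = Γ.trans (conj-⁻¹ (r f) U (r f)) (·-congʳ {r f ⁻¹} (·-congˡ {r f} (Γ.sym (inverseˡ-unique (U · U) U (spin-opp ModularGroup.right)))))

  S⊙half0′ : ∀ h → S ⊙ halfLine type0 (flip h) ≗ halfLine type0 h
  S⊙half0′ to0 = S⊙half0 to∞
  S⊙half0′ to∞ = S⊙half0 to0

  -- In the frames of the two edges a full pairing acts as S. It reverses the order along the line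
  -- while P lies in Re ≥ 0 in both frames, so the boundary orientations are reversed.
  isPairing : ∀ t {g} → g Γ.≈ pairing t → IsPairing t g
  isPairing t@(full V p) {g} q = conjugate-≐ ⟨0,∞⟩ ⟨0,∞⟩ g (r f′) (r f) S q′ S⊙line , (λ {a} {b} {a′} {b′} → reverses {a} {b} {a′} {b′})
    where
    f f′ : Γ
    f  = e V
    f′ = e (opposite V)
    q′ : g Γ.≈ r f′ · S · r f ⁻¹
    q′ = Γ.trans q (pair0-full V p)
    reverses : ReversesOrientation g (side t)
    reverses {a} {b} {a′} {b′} a∈ b∈ m m′ dir {z} = ⇒directed f′ b′ a′ (full-closed (opposite V) (≡.trans (≡.cong proj₁ (opposite-W V)) p))
        (line-resp (≃-sym mb) (line-S (at f b) (full-line V p {b} b∈))) (line-resp (≃-sym ma) (line-S (at f a) (full-line V p {a} a∈)))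
        (nonneg-by (S-antitone (at f a) (at f b) (directed⇒ f a b (full-line V p {a} a∈) (full-line V p {b} b∈) (λ {z} → dir {z})))
          (+-cong (≋-sym (normSq-cong mb)) (-‿cong (≋-sym (normSq-cong ma))))) {z}
      where
      ma : at f′ a′ ≃ S ▸ at f a
      ma = image-at f f′ S g {a} {a′} q′ m
      mb : at f′ b′ ≃ S ▸ at f b
      mb = image-at f f′ S g {b} {b′} q′ m′
  isPairing (half ((type0 , y) , _) uni h) {g} q =
    conjugate-≐ (halfLine type0 h) (halfLine type0 (flip h)) g (r f) (r f) S q′ (S⊙half0 h) ,
    conjugate-≐ (halfLine type0 (flip h)) (halfLine type0 h) g (r f) (r f) S q′ (S⊙half0′ h)
    where
    f : Γ
    f = proj₁ uni
    q′ : g Γ.≈ r f · S · r f ⁻¹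
    q′ = Γ.trans q (pair0-half {f} (univalent-S y uni))
  isPairing (half ((type1 , y) , _) uni to0) {g} q =
    conjugate-≐ (halfLine type1 to0) (halfLine type1 to∞) g (r (proj₁ uni)) (r (proj₁ uni)) (U · U) q UU⊙half1
  isPairing (half ((type1 , y) , _) uni to∞) {g} q =
    conjugate-≐ (halfLine type1 to0) (halfLine type1 to∞) (g ⁻¹) (r (proj₁ uni)) (r (proj₁ uni)) (U · U)
      (Γ.trans (Γ.⁻¹-cong q) (pair1-inverse (proj₁ uni))) UU⊙half1

  preserves-translate : ∀ (A B : Region) → Resp B → ∀ g f f′ → g ⊙ (f ⊙ A) ≐ f′ ⊙ B → ∀ z → A z → B (f′ ⁻¹ · g · f ▸ z)
  preserves-translate A B B-resp g f f′ q = transported A B B-resp g f f′ (proj₁ (≐⇒≗ (g ⊙ (f ⊙ A)) (f′ ⊙ B) q))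

  -- The translate by the identity in place of S would put P on both sides of the side.
  not-reversing : ∀ V p g → g Γ.≈ r (e (opposite V)) · one · r (e V) ⁻¹ → ¬ ReversesOrientation g (side (full V p))
  -- Tested on the points 2i and i of the model line: |i|² - |2i|² = -3 would have to be
  -- nonnegative.
  not-reversing V p g q reverses = pos-not-nonpos (numeral-pos 2) (nonneg-by
      (directed⇒ f′ b′ a′ (line-resp (≃-sym mb) ≋-refl) (line-resp (≃-sym ma) ≋-refl)
        (λ {z} → reverses {a} {b} {a′} {b′} (⊙-in (r f) ≋-refl) (⊙-in (r f) ≋-refl) (Maps-▸ g a) (Maps-▸ g b) (λ {w} → forwards {w}) {z}))
      (≋-trans (+-cong (normSq-cong mb) (-‿cong (normSq-cong ma))) (ring! 0 ((# 0 :* # 0 :+ # 1 :* # 1) :- (# 0 :* # 0 :+ # 2 :* # 2) := :- # 3))))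
    where
    f f′ : Γ
    f  = e V
    f′ = e (opposite V)
    a b a′ b′ : ℍ
    a  = r f ▸ high type0
    b  = r f ▸ low type0
    a′ = g ▸ a
    b′ = g ▸ b
    ma : at f′ a′ ≃ high type0
    ma = ≃-trans (image-at f f′ one g {a} {a′} q (Maps-▸ g a)) (≃-trans (▸-one (at f a)) (at-r f (high type0)))
    mb : at f′ b′ ≃ low type0
    mb = ≃-trans (image-at f f′ one g {b} {b′} q (Maps-▸ g b)) (≃-trans (▸-one (at f b)) (at-r f (low type0)))
    forwards : Directed a b
    forwards {z} = ⇒directed f a b (full-closed V p) (line-resp (≃-sym (at-r f (high type0))) ≋-refl) (line-resp (≃-sym (at-r f (low type0))) ≋-refl)
      (nonneg-by (numeral-nonneg 3) (≋-trans (ring! 0 (# 3 := (# 0 :* # 0 :+ # 2 :* # 2) :- (# 0 :* # 0 :+ # 1 :* # 1)))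
        (+-cong (≋-sym (normSq-cong (at-r f (high type0)))) (-‿cong (≋-sym (normSq-cong (at-r f (low type0)))))))) {z}

  -- Conjugation to the model edge leaves the candidates 1 and S for a full side, of which
  -- orientation excludes 1; for half-sides the stabiliser computations leave a single element.
  pairing-unique : ∀ t {g} → IsPairing t g → g Γ.≈ pairing t
  pairing-unique (full V p) {g} (q , reverses) =
    [ (λ k≈1 → ⊥-elim (not-reversing V p g (untransport {g} {r (e V)} {r (e (opposite V))} {one} k≈1) (λ {a} {b} {a′} {b′} → reverses {a} {b} {a′} {b′})))
    , (λ k≈S → Γ.trans (untransport {g} {r (e V)} {r (e (opposite V))} {S} k≈S) (Γ.sym (pair0-full V p))) ]′
    (preserves-line (r (e (opposite V)) ⁻¹ · g · r (e V)) (k (low type0) ≋-refl) (k (high type0) ≋-refl))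
    where
    k : ∀ z → ⟨0,∞⟩ z → ⟨0,∞⟩ (r (e (opposite V)) ⁻¹ · g · r (e V) ▸ z)
    k = preserves-translate ⟨0,∞⟩ ⟨0,∞⟩ line-resp g (r (e V)) (r (e (opposite V))) q
  pairing-unique (half ((type0 , y) , _) uni h) {g} (q , _) = Γ.trans
    (untransport {g} {r (proj₁ uni)} {r (proj₁ uni)} {S} (flips-half0 (r (proj₁ uni) ⁻¹ · g · r (proj₁ uni)) h
      (preserves-translate (halfLine type0 h) (halfLine type0 (flip h)) (halfLine-resp type0 (flip h)) g (r (proj₁ uni)) (r (proj₁ uni)) q)))
    (Γ.sym (pair0-half {proj₁ uni} (univalent-S y uni)))
  pairing-unique (half ((type1 , _) , _) uni to0) {g} q = untransport {g} {r (proj₁ uni)} {r (proj₁ uni)} {U · U}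
    (rotates-half1 (r (proj₁ uni) ⁻¹ · g · r (proj₁ uni))
      (preserves-translate (halfLine type1 to0) (halfLine type1 to∞) (halfLine-resp type1 to∞) g (r (proj₁ uni)) (r (proj₁ uni)) q))
  pairing-unique (half ((type1 , _) , _) uni to∞) {g} q = Γ.trans (Γ.sym (⁻¹-involutive g)) (Γ.trans (Γ.⁻¹-cong g⁻¹≈)
      (Γ.trans (Γ.⁻¹-cong (Γ.sym (pair1-inverse (proj₁ uni)))) (⁻¹-involutive (pair1 ModularGroup.left (proj₁ uni)))))
    where
    g⁻¹≈ : g ⁻¹ Γ.≈ pair1 ModularGroup.right (proj₁ uni)
    g⁻¹≈ = untransport {g ⁻¹} {r (proj₁ uni)} {r (proj₁ uni)} {U · U}
      (rotates-half1 (r (proj₁ uni) ⁻¹ · g ⁻¹ · r (proj₁ uni))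
        (preserves-translate (halfLine type1 to0) (halfLine type1 to∞) (halfLine-resp type1 to∞) (g ⁻¹) (r (proj₁ uni)) (r (proj₁ uni)) q))

  pairing-cong : ∀ t t′ → t ≈ˢ t′ → pairing t Γ.≈ pairing t′
  pairing-cong (full V _) (full V′ _) (_ , q) = pair0-cong {e V} {e V′} q
  pairing-cong (half v@((type0 , _) , _) uni _) (half v′@((type0 , _) , _) uni′ _) (q , _) =
    pair0-cong {proj₁ uni} {proj₁ uni′} (univalent-edge (proj₁ v) (proj₁ v′) uni uni′ q)
  pairing-cong (half v@((type1 , _) , _) uni to0) (half v′@((type1 , _) , _) uni′ .to0) (q , refl) =
    pair1-cong ModularGroup.right {proj₁ uni} {proj₁ uni′} (univalent-edge (proj₁ v) (proj₁ v′) uni uni′ q)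
  pairing-cong (half v@((type1 , _) , _) uni to∞) (half v′@((type1 , _) , _) uni′ .to∞) (q , refl) =
    pair1-cong ModularGroup.left {proj₁ uni} {proj₁ uni′} (univalent-edge (proj₁ v) (proj₁ v′) uni uni′ q)
  pairing-cong (half ((type0 , _) , _) _ _) (half ((type1 , _) , _) _ _) (() , _)
  pairing-cong (half ((type1 , _) , _) _ _) (half ((type0 , _) , _) _ _) (() , _)

  sideKind : Side → Kind
  sideKind (full _ _)            = type0
  sideKind (half ((κ , _) , _) _ _) = κ

  σ-kind : ∀ t → sideKind (σ t) ≡ sideKind t
  σ-kind (full _ _)   = refl
  σ-kind (half _ _ _) = refl

  Related0 : Γ → Γ → Set
  Related0 f f′ = f′ ~ f ⊎ f′ ~ f · S

  halves-related : ∀ V (uni : Y.Univalent (proj₁ V)) V′ (uni′ : Y.Univalent (proj₁ V′)) h h′ → proj₁ V Y.V.≈ proj₁ V′ → half V uni h ≈ˢ half V′ uni′ h′ ⊎ half V uni h ≈ˢ σ (half V′ uni′ h′)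
  halves-related V uni V′ uni′ to0 to0 q = inj₁ (q , refl)
  halves-related V uni V′ uni′ to∞ to∞ q = inj₁ (q , refl)
  halves-related V uni V′ uni′ to0 to∞ q = inj₂ (q , refl)
  halves-related V uni V′ uni′ to∞ to0 q = inj₂ (q , refl)

  -- A type (0) vertex carrying sides is either cut or univalent and uncut, so its sides form one
  -- σ-orbit; `once` then identifies the selected ones.
  related0 : ∀ t t′ → sideKind t ≡ type0 → sideKind t′ ≡ type0 → Related0 (edgeAt t) (edgeAt t′) → t′ ≈ˢ t ⊎ t′ ≈ˢ σ t
  related0 (full V p) (full V′ p′) _ _ (inj₁ q) = inj₁ (cutEnd-≈ V′ V p′ p q)
  related0 (full V p) (full V′ p′) _ _ (inj₂ q) = inj₂ (cutEnd-≈ V′ (opposite V) p′ (≡.trans (≡.cong proj₁ (opposite-kind V)) p)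
    (~-trans {e V′} {e V · S} {e (opposite V)} q (~-sym {e (opposite V)} {e V · S} (opposite-S V p))))
  related0 (full V p) (half ((type0 , y) , nc) uni _) _ _ (inj₁ q) = ⊥-elim (cut-uncut V p y nc uni (~-sym {proj₁ uni} {e V} q))
  related0 (full V p) (half ((type0 , y) , nc) uni _) _ _ (inj₂ q) = ⊥-elim (cut-uncut V p y nc uni (~-cancel {e V} {proj₁ uni} S
    (~-trans {e V · S} {proj₁ uni} {proj₁ uni · S} (~-sym {proj₁ uni} {e V · S} q) (~-sym {proj₁ uni · S} {proj₁ uni} (univalent-S y uni)))))
  related0 (half ((type0 , y) , nc) uni _) (full V p) _ _ (inj₁ q) = ⊥-elim (cut-uncut V p y nc uni q)
  related0 (half ((type0 , y) , nc) uni _) (full V p) _ _ (inj₂ q) = ⊥-elim (cut-uncut V p y nc uni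
    (~-trans {e V} {proj₁ uni · S} {proj₁ uni} q (univalent-S y uni)))
  related0 (half V@((type0 , y) , _) uni h) (half V′@((type0 , y′) , _) uni′ h′) _ _ (inj₁ q) =
    halves-related V′ uni′ V uni h′ h (same-vertex type0 y′ y uni′ uni q)
  related0 (half V@((type0 , y) , _) uni h) (half V′@((type0 , y′) , _) uni′ h′) _ _ (inj₂ q) =
    halves-related V′ uni′ V uni h′ h (same-vertex type0 y′ y uni′ uni (~-trans {proj₁ uni′} {proj₁ uni · S} {proj₁ uni} q (univalent-S y uni)))

  related1 : ∀ t t′ → sideKind t ≡ type1 → sideKind t′ ≡ type1 → edgeAt t′ ~ edgeAt t → t′ ≈ˢ t ⊎ t′ ≈ˢ σ t
  related1 (half V@((type1 , y) , _) uni h) (half V′@((type1 , y′) , _) uni′ h′) _ _ q =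
    halves-related V′ uni′ V uni h′ h (same-vertex type1 y′ y uni′ uni q)

  pairing0 : ∀ t → sideKind t ≡ type0 → pairing t Γ.≈ pair0 (edgeAt t)
  pairing0 (full V _) _                      = Γ.refl
  pairing0 (half ((type0 , _) , _) uni _) _  = Γ.refl

  pairing1 : ∀ t → sideKind t ≡ type1 → edgeAt t · U ~ edgeAt t × ∃ λ k → pairing t Γ.≈ pair1 k (edgeAt t)
  pairing1 (half ((type1 , y) , _) uni to0) _ = univalent-U y uni , ModularGroup.right , Γ.refl
  pairing1 (half ((type1 , y) , _) uni to∞) _ = univalent-U y uni , ModularGroup.left , Γ.refl

  kind-cases : ∀ t → sideKind t ≡ type0 ⊎ sideKind t ≡ type1
  kind-cases (full _ _)                 = inj₁ refl
  kind-cases (half ((type0 , _) , _) _ _) = inj₁ refl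
  kind-cases (half ((type1 , _) , _) _ _) = inj₂ refl

  open Generators em PSL₂ℤ generator (minus refl) (minus refl) G C tree (Lift.toTree ȷ) (Lift.overV ȷ) (Lift.overE ȷ) generated trivial-word
    using (Leaving; transition; pair0-value; pair1-value; module Attached)

  module _ (Sel : Pred Side 0ℓ) (transversal : IsTransversal Sel) where
    open IsTransversal transversal

    -- x is the generator of the selected side at the vertex crossed by the step a from the edge f.
    Chosen : Gen → Γ → Γ → Set
    Chosen s f x = ∃ λ t → Sel t × sideKind t ≡ type0 × Related0 f (edgeAt t) × x Γ.≈ pairing t
    Chosen u f x = ∃ λ t → Sel t × sideKind t ≡ type1 × edgeAt t ~ f × x Γ.≈ pairing t

    -- The transversal may contain σ t instead of t. Its edge is then f · S at a cut vertex, which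
    -- is why `Chosen` allows `Related0`.
    selected0 : ∀ f t → sideKind t ≡ type0 → edgeAt t ~ f → Related0 f (edgeAt (σ t)) → ∃ (Chosen s f)
    selected0 f t k q q′ = [ (λ t∈ → pairing t , t , t∈ , k , inj₁ q , Γ.refl)
      , (λ σt∈ → pairing (σ t) , σ t , σt∈ , ≡.trans (σ-kind t) k , q′ , Γ.refl) ]′ (meets t)

    exists0 : ∀ f → Closed0 f → Dec (Cut (type0 , f)) → ∃ (Chosen s f)
    exists0 f _ (yes c) = selected0 f (cutSide f c) refl (~-refl {f}) (inj₂ (opposite-S (cutEnd (type0 , f) c f (inc-refl type0 f)) refl))
    exists0 f (inj₁ c) (no nc) = ⊥-elim (nc c)
    exists0 f (inj₂ p) (no nc) = selected0 f (univalentSide0 f nc p to0) refl (~-refl {f}) (inj₁ (~-refl {f}))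

    selected1 : ∀ f t → sideKind t ≡ type1 → edgeAt t ~ f → edgeAt (σ t) ~ f → ∃ (Chosen u f)
    selected1 f t k q q′ = [ (λ t∈ → pairing t , t , t∈ , k , q , Γ.refl)
      , (λ σt∈ → pairing (σ t) , σ t , σt∈ , ≡.trans (σ-kind t) k , q′ , Γ.refl) ]′ (meets t)

    exists1 : ∀ f → f · U ~ f → ∃ (Chosen u f)
    exists1 f p = selected1 f (univalentSide1 f p to0) refl (~-refl {f}) (~-refl {f})

    exists : ∀ X a f → Leaving X a f → ∃ (Chosen a f)
    exists _ s f c = exists0 f c em
    exists _ u f p = exists1 f p

    once-pairing : ∀ {t t′ x x′} → Sel t → Sel t′ → x Γ.≈ pairing t → x′ Γ.≈ pairing t′ → t′ ≈ˢ t ⊎ t′ ≈ˢ σ t → x Γ.≈ x′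
    once-pairing {t} {t′} t∈ t′∈ p p′ q = Γ.trans p (Γ.trans (Γ.sym (pairing-cong t′ t (once {t} {t′} t∈ t′∈ q))) (Γ.sym p′))

    unique : ∀ a {f f′ x x′} → Chosen a f x → Chosen a f′ x′ → f′ ~ f ⊎ f′ ~ f · ⟦ a ⟧ → x Γ.≈ x′
    unique s {f} {f′} (t , t∈ , k , q , p) (t′ , t′∈ , k′ , q′ , p′) l =
      once-pairing {t} {t′} t∈ t′∈ p p′ (related0 t t′ k k′ (related-S {f} {f′} {edgeAt t} {edgeAt t′} q q′ l))
    unique u {f} {f′} (t , t∈ , k , q , p) (t′ , t′∈ , k′ , q′ , p′) l =
      once-pairing {t} {t′} t∈ t′∈ p p′ (related1 t t′ k k′ (~-trans {edgeAt t′} {f} {edgeAt t} (~-trans {edgeAt t′} {f′} {f} q′ (towards l)) (~-sym {edgeAt t} {f} q)))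
      where
      fixed : f · U ~ f
      fixed = ~-fixed {f} {edgeAt t} U q (proj₁ (pairing1 t k))
      towards : f′ ~ f ⊎ f′ ~ f · U → f′ ~ f
      towards = [ (λ v → v) , (λ v → ~-trans {f′} {f · U} {f} v fixed) ]′

    member : ∀ a {f x} → Chosen a f x → pairings Sel x
    member s (t , t∈ , _ , _ , p) = t , t∈ , isPairing t p
    member u (t , t∈ , _ , _ , p) = t , t∈ , isPairing t p

    chosen-value : ∀ X a {f x} → Chosen a f x → x Γ.≈ transition X a f ⊎ x Γ.≈ transition X a f ⁻¹
    chosen-value X s {f} {x} (t , _ , k , q , p) = pair0-value X {f} {edgeAt t} {x} q (Γ.trans p (pairing0 t k))
    chosen-value X u {f} {x} (t , _ , k , q , p) = let c , l , v = pairing1 t k in pair1-value X l {f} {edgeAt t} {x} c q (Γ.trans p v)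

    complete : ∀ {x} → pairings Sel x → ∃₂ λ a f → Chosen a f x
    complete {x} (t , t∈ , p) = [ (λ k → s , edgeAt t , t , t∈ , k , inj₁ (~-refl {edgeAt t}) , pairing-unique t p)
                                , (λ k → u , edgeAt t , t , t∈ , k , ~-refl {edgeAt t} , pairing-unique t p) ]′ (kind-cases t)

    independentGenerators : IndependentGenerators (pairings Sel) G
    independentGenerators = Attached.independent (pairings Sel) Chosen (exists (pairings Sel)) (λ a {f} {f′} {x} {x′} → unique a {f} {f′} {x} {x′})
      (λ a {f} {x} → member a {f} {x}) (λ a {f} {x} → chosen-value (pairings Sel) a {f} {x}) complete

theorem3p1 : ExcludedMiddle 0ℓ →
    (ℝ : CompleteOrderedField) (G : Subgroup) (C : CutSet (Y-comb G)) →
    Graph.IsTree (Cutting.cutGraph (Y-comb G) C) →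
    (ȷ : Lift G C) →
    let open UpperHalfPlane ℝ
        open LiftedPolygon G C ȷ
    in IsSpecialPolygon P sides side σ
     × ((S : Pred Side 0ℓ) → IsTransversal S → IndependentGenerators (pairings S) G)
theorem3p1 em ℝ G C tree ȷ = special , independentGenerators
  where open MainTheorem em ℝ G C tree ȷ
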